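{- There exists $n_0 \in \mathbb{N}^+$ such that for every odd integer $n > n_0$ the following holds: if $G$ is a graph on $n$ vertices with minimum degree $\delta(G) \ge (n-1)/2$ and $G$ is Hamilton-connected, then $\mathcal{C}_n(G) = \mathcal{C}(G)$, i.e. $G$ is Hamilton-generated.
   Context: For a graph $G=(V,E)$, subsets of $E$ are identified with their indicator vectors in $\mathbb{F}_2^{|E|}$; the edge space is the $\mathbb{F}_2$-vector space of all subsets of $E$ with symmetric difference as addition. The cycle space $\mathcal{C}(G)$ is the subspace spanned by (the edge sets of) all cycles of $G$, and for an integer $k \ge 3$, $\mathcal{C}_k(G)$ is the subspace spanned by the cycles of length exactly $k$. A graph on $n$ vertices is Hamilton-generated if $\mathcal{C}_n(G)=\mathcal{C}(G)$. A graph is Hamilton-connected if every pair of distinct vertices is joined by a Hamilton path (a path visiting every vertex exactly once). -}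

module Defs where

open import Data.Nat using (ℕ; suc; _≤_; _*_; _∸_)
open import Data.Fin using (Fin; _≟_)
open import Data.Bool using (Bool; true; false; _∧_; _∨_; _xor_; T)
open import Data.List using (List; []; _∷_; _++_; [_]; length; filter; allFin)
open import Data.List.Relation.Unary.Unique.Propositional using (Unique)
open import Data.List.Relation.Unary.Linked using (Linked)
open import Data.List.Relation.Unary.All using (All)
open import Data.Product using (Σ; ∃; _×_; _,_)
open import Relation.Nullary using (¬_)
open import Relation.Nullary.Decidable using (⌊_⌋)
open import Relation.Binary.PropositionalEquality using (_≡_; _≢_)
open import Function.Bundles using (_⇔_)

record Graph (n : ℕ) : Set where
  field
    adj     : Fin n → Fin n → Bool
    sym     : ∀ u v → adj u v ≡ adj v u
    irrefl  : ∀ v → adj v v ≡ false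
open Graph public

Adj : ∀ {n} → Graph n → Fin n → Fin n → Set
Adj G u v = T (adj G u v)

degree : ∀ {n} → Graph n → Fin n → ℕ
degree {n} G v = length (filter (λ u → T? (adj G v u)) (allFin n))
  where
  open import Data.Bool.Properties using (T?)

-- minimum degree at least (n-1)/2, written without division: 2·deg(v) ≥ n-1
MinDegreeAtLeastHalf : ∀ {n} → Graph n → Set
MinDegreeAtLeastHalf {n} G = ∀ v → n ∸ 1 ≤ 2 * degree G v

HamPath : ∀ {n} → Graph n → Fin n → Fin n → Set
HamPath {n} G u v =
  Σ (List (Fin n)) λ mid →
    let p = u ∷ mid ++ [ v ] in
    Unique p × Linked (Adj G) p × length p ≡ n

HamiltonConnected : ∀ {n} → Graph n → Set
HamiltonConnected {n} G = ∀ (u v : Fin n) → u ≢ v → HamPath G u v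

-- Elements of the edge space: Fin n → Fin n → Bool read on unordered pairs.
EdgeVec : ℕ → Set
EdgeVec n = Fin n → Fin n → Bool

zeroV : ∀ {n} → EdgeVec n
zeroV _ _ = false

_⊕_ : ∀ {n} → EdgeVec n → EdgeVec n → EdgeVec n
(X ⊕ Y) a b = X a b xor Y a b

_≈E_ : ∀ {n} → EdgeVec n → EdgeVec n → Set
X ≈E Y = ∀ a b → X a b ≡ Y a b

pairInd : ∀ {n} → Fin n → Fin n → EdgeVec n
pairInd x y a b = (⌊ x ≟ a ⌋ ∧ ⌊ y ≟ b ⌋) ∨ (⌊ x ≟ b ⌋ ∧ ⌊ y ≟ a ⌋)

-- edge set of a walk given as its vertex sequence (symmetric difference of
-- its consecutive pairs; for a cycle these pairs are distinct, so this is
-- exactly the edge set)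
walkEdges : ∀ {n} → List (Fin n) → EdgeVec n
walkEdges []             = zeroV
walkEdges (x ∷ [])       = zeroV
walkEdges (x ∷ y ∷ rest) = pairInd x y ⊕ walkEdges (y ∷ rest)

record Cycle {n : ℕ} (G : Graph n) : Set where
  constructor mkCycle
  field
    start   : Fin n
    rest    : List (Fin n)
    long    : 2 ≤ length rest
    distinct : Unique (start ∷ rest)
    closed  : Linked (Adj G) (start ∷ rest ++ [ start ])
open Cycle public

cycLength : ∀ {n} {G : Graph n} → Cycle G → ℕ
cycLength C = suc (length (rest C))

cycEdges : ∀ {n} {G : Graph n} → Cycle G → EdgeVec n
cycEdges C = walkEdges (start C ∷ rest C ++ [ start C ])

sumE : ∀ {n} {G : Graph n} → List (Cycle G) → EdgeVec n
sumE []       = zeroV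
sumE (C ∷ Cs) = cycEdges C ⊕ sumE Cs

InSpan : ∀ {n} (G : Graph n) → (Cycle G → Set) → EdgeVec n → Set
InSpan G P X = Σ (List (Cycle G)) λ Cs → All P Cs × (X ≈E sumE Cs)

InCycleSpace : ∀ {n} (G : Graph n) → EdgeVec n → Set
InCycleSpace G = InSpan G (λ _ → ⊤)
  where open import Data.Unit using (⊤)

InCkSpace : ∀ {n} (G : Graph n) → ℕ → EdgeVec n → Set
InCkSpace G k = InSpan G (λ C → cycLength C ≡ k)

HamiltonGenerated : ∀ {n} → Graph n → Set
HamiltonGenerated {n} G = ∀ (X : EdgeVec n) → InCkSpace G n X ⇔ InCycleSpace G X

{-# OPTIONS --safe #-}
-- Write n = 2m + 1 and compute modulo the span of the Hamilton cycles.  It suffices to find a potential g : V → edge space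
-- with uv ≡ g u + g v for every edge uv, as such values telescope to 0 around a cycle.  If two paths with the same ends and
-- the same vertices are completed to Hamilton cycles by a common third path, they are congruent.  Applied to ladders, this
-- shows that the value of a short path from a fixed root depends only on its other end (and its parity), which yields g up
-- to an error on each edge that is constant on each part of the graph; counting the edges of suitable Hamilton cycles
-- shows that the error vanishes.  The Hamilton cycles needed for the switches come from one of three structures:
--  * any two vertex sets of size about m are joined by an edge: rotation and absorption make G robustly Hamilton-connected;
--  * two disjoint sets of size about m span no edge between them: G is two dense parts, joined through the few disjoint
--    cross edges that Hamilton-connectedness provides;
--  * two meeting such sets exist: their intersection is independent, so G is nearly complete bipartite.  Vertices are moved
--    between the sides until they differ by one, or until the larger side contains a large matching; Hamilton-connectedness
--    provides the edges inside the larger side that an odd Hamilton cycle must use.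
module Submission where

open import Defs hiding (sym; start; rest; long; distinct; closed)
import Defs
open import Data.Nat using (ℕ; zero; suc; _+_; _*_; _∸_; _%_; _/_; pred; _≤_; _<_; _≤ᵇ_; _≤?_; z≤n; s≤s)
open import Data.Nat.DivMod using (m≡m%n+[m/n]*n)
open import Data.Nat.Properties hiding (_≟_; suc-injective; 0≢1+n)
open import Data.Fin using (Fin; zero; suc; _≟_)
open import Data.Fin.Properties using (suc-injective)
open import Data.Bool using (Bool; true; false; _∧_; _∨_; not; T; if_then_else_; _xor_)
open import Data.Bool.Properties using (T?; T-∧; T-∨; xor-assoc; xor-comm; xor-identityʳ; xor-same; ∨-comm; ∧-comm)
open import Data.List using (List; []; _∷_; _++_; [_]; take; length; filter; allFin; map; reverse)
open import Data.List.Properties using (length-++; length-reverse; length-filter; length-take; unfold-reverse; ++-assoc; ++-identityʳ)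
open import Data.List.Relation.Unary.All as All using (All; []; _∷_)
import Data.List.Relation.Unary.All.Properties as Allₚ
open import Data.List.Relation.Unary.Any using (Any; here; there; any?)
open import Data.List.Relation.Unary.AllPairs using ([]; _∷_)
open import Data.List.Relation.Unary.Linked using (Linked; [-]; _∷_)
open import Data.List.Relation.Unary.Unique.Propositional using (Unique)
import Data.List.Relation.Unary.Unique.Propositional.Properties as Uniq
open import Data.List.Membership.Propositional using (_∈_; _∉_)
open import Data.List.Membership.Propositional.Properties using (∈-++⁺ˡ; ∈-++⁺ʳ; ∈-++⁻; ∈-∃++; ∈-filter⁺; ∈-filter⁻; ∈-allFin)
import Data.List.Membership.DecPropositional as DecMem
open import Data.List.Relation.Binary.Permutation.Propositional using (_↭_; ↭-refl; ↭-sym; ↭-trans; prep; ↭-reflexive; ↭⇒↭ₛ)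
open import Data.List.Relation.Binary.Permutation.Propositional.Properties using (shift; ++⁺; ++⁺ˡ; ++⁺ʳ; ++-comm; ↭-reverse; ∈-resp-↭; ↭-length; All-resp-↭; filter-↭)
import Data.List.Relation.Binary.Permutation.Setoid.Properties as PermSetoid
open import Data.Product using (Σ; ∃; _×_; _,_; proj₁; proj₂)
open import Data.Sum using (_⊎_; inj₁; inj₂; [_,_]′)
open import Data.Empty using (⊥; ⊥-elim)
open import Data.Unit using (⊤; tt)
open import Function using (_∘_; id)
open import Function.Bundles using (Equivalence)
open import Relation.Nullary using (¬_; Dec; yes; no; contradiction)
open import Relation.Nullary.Decidable using (⌊_⌋; toWitness; fromWitness)
open import Relation.Binary.PropositionalEquality using (_≡_; _≢_; refl; sym; trans; cong; cong₂; subst; subst₂; ≢-sym; setoid)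

-- A switch is only as free as its third path, which must span whatever a walk of at most 30
-- vertices leaves over. So each structure first has to yield spanning paths that survive the
-- deletion of a bounded set. Where a structure has few edges to spare (cross edges between two
-- dense parts, edges inside the larger side), the ends of such edges form an exceptional list `S`,
-- which a switched walk may touch only at prescribed places. In a part that is not bipartite, walks
-- of length three and of length four lead from the root to the same vertex, and the error is their
-- difference. One Hamilton cycle on an odd number of vertices kills it. With two parts, cycles with
-- two and with four cross edges are needed: one relation serves the part of even size, the other
-- the part of odd size. Between two sides the length of a walk is determined up to parity by its
-- end, so no such error arises. Instead every edge inside a side has an excess. As n is odd, the
-- sides differ by an odd number, and this parity makes the excesses vanish. Numerical constants are
-- round and far from optimal.

-- Reflective linear arithmetic over the natural numbers.

module LinearArithmetic where

  infixl 6 _:+_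
  infixl 7 _:*_
  infix 4 _≲_

  data Lin : Set where
    var  : ℕ → Lin
    con  : ℕ → Lin
    _:+_ : Lin → Lin → Lin
    _:*_ : ℕ → Lin → Lin

  record Ineq : Set where
    constructor _≲_
    field
      lower upper : Lin

  at : List ℕ → ℕ → ℕ
  at []       _       = 0
  at (x ∷ ρ) zero    = x
  at (x ∷ ρ) (suc i) = at ρ i

  ⟦_⟧ : Lin → List ℕ → ℕ
  ⟦ var i ⟧  ρ = at ρ i
  ⟦ con c ⟧  ρ = c
  ⟦ a :+ b ⟧ ρ = ⟦ a ⟧ ρ + ⟦ b ⟧ ρ
  ⟦ c :* a ⟧ ρ = c * ⟦ a ⟧ ρ

  Holds : List ℕ → Ineq → Set
  Holds ρ (a ≲ b) = ⟦ a ⟧ ρ ≤ ⟦ b ⟧ ρ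

  Entails : List ℕ → List Ineq → Ineq → Set
  Entails ρ []       g = Holds ρ g
  Entails ρ (h ∷ hs) g = Holds ρ h → Entails ρ hs g

  -- Linear forms as coefficient lists, the constant term first.
  dot : List ℕ → List ℕ → ℕ
  dot []       _       = 0
  dot (c ∷ cs) []      = 0
  dot (c ∷ cs) (x ∷ ρ) = c * x + dot cs ρ

  unit : ℕ → List ℕ
  unit zero    = 1 ∷ []
  unit (suc i) = 0 ∷ unit i

  plus : List ℕ → List ℕ → List ℕ
  plus []       ds       = ds
  plus (c ∷ cs) []       = c ∷ cs
  plus (c ∷ cs) (d ∷ ds) = (c + d) ∷ plus cs ds

  scale : ℕ → List ℕ → List ℕ
  scale c []       = []
  scale c (d ∷ ds) = (c * d) ∷ scale c ds

  coeffs : Lin → List ℕ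
  coeffs (var i)  = 0 ∷ unit i
  coeffs (con c)  = c ∷ []
  coeffs (a :+ b) = plus (coeffs a) (coeffs b)
  coeffs (c :* a) = scale c (coeffs a)

  dot-unit : ∀ i ρ → dot (unit i) ρ ≡ at ρ i
  dot-unit zero    []      = refl
  dot-unit (suc i) []      = refl
  dot-unit zero    (x ∷ ρ) = trans (+-identityʳ _) (+-identityʳ x)
  dot-unit (suc i) (x ∷ ρ) = dot-unit i ρ

  interchange : ∀ a b c d → (a + b) + (c + d) ≡ (a + c) + (b + d)
  interchange a b c d = trans (+-assoc a b (c + d)) (trans (cong (a +_) (trans (sym (+-assoc b c d))
    (trans (cong (_+ d) (+-comm b c)) (+-assoc c b d)))) (sym (+-assoc a c (b + d))))

  dot-plus : ∀ cs ds ρ → dot (plus cs ds) ρ ≡ dot cs ρ + dot ds ρ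
  dot-plus []       ds       ρ       = refl
  dot-plus (c ∷ cs) []       ρ       = sym (+-identityʳ _)
  dot-plus (c ∷ cs) (d ∷ ds) []      = refl
  dot-plus (c ∷ cs) (d ∷ ds) (x ∷ ρ) =
    trans (cong₂ _+_ (*-distribʳ-+ x c d) (dot-plus cs ds ρ)) (interchange (c * x) (d * x) _ _)

  dot-scale : ∀ c ds ρ → dot (scale c ds) ρ ≡ c * dot ds ρ
  dot-scale c []       ρ       = sym (*-zeroʳ c)
  dot-scale c (d ∷ ds) []      = sym (*-zeroʳ c)
  dot-scale c (d ∷ ds) (x ∷ ρ) =
    trans (cong₂ _+_ (*-assoc c d x) (dot-scale c ds ρ)) (sym (*-distribˡ-+ c (d * x) _))

  coeffs-sound : ∀ a ρ → dot (coeffs a) (1 ∷ ρ) ≡ ⟦ a ⟧ ρ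
  coeffs-sound (var i)  ρ = dot-unit i ρ
  coeffs-sound (con c)  ρ = trans (+-identityʳ _) (*-identityʳ c)
  coeffs-sound (a :+ b) ρ =
    trans (dot-plus (coeffs a) (coeffs b) (1 ∷ ρ)) (cong₂ _+_ (coeffs-sound a ρ) (coeffs-sound b ρ))
  coeffs-sound (c :* a) ρ = trans (dot-scale c (coeffs a) (1 ∷ ρ)) (cong (c *_) (coeffs-sound a ρ))

  below : List ℕ → List ℕ → Bool
  below []       ds       = true
  below (c ∷ cs) []       = (c ≤ᵇ 0) ∧ below cs []
  below (c ∷ cs) (d ∷ ds) = (c ≤ᵇ d) ∧ below cs ds

  ∧-T : ∀ {a b} → T (a ∧ b) → T a × T b
  ∧-T {true} {true} _ = tt , tt

  below-sound : ∀ cs ds ρ → T (below cs ds) → dot cs ρ ≤ dot ds ρ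
  below-sound []       ds       ρ       _ = z≤n
  below-sound (c ∷ cs) ds       []      _ = z≤n
  below-sound (c ∷ cs) []       (x ∷ ρ) t with ∧-T {c ≤ᵇ 0} t
  ... | t₁ , t₂ with n≤0⇒n≡0 (≤ᵇ⇒≤ c 0 t₁)
  ... | refl = below-sound cs [] ρ t₂
  below-sound (c ∷ cs) (d ∷ ds) (x ∷ ρ) t with ∧-T {c ≤ᵇ d} t
  ... | t₁ , t₂ = +-mono-≤ (*-monoˡ-≤ x (≤ᵇ⇒≤ c d t₁)) (below-sound cs ds ρ t₂)

  infixr 5 _⊹_
  _⊹_ : ∀ {a b c d} → a ≤ b → c ≤ d → a + c ≤ b + d
  _⊹_ = +-mono-≤

  total : List Ineq → Ineq
  total []             = con 0 ≲ con 0
  total ((a ≲ b) ∷ hs) = let (c ≲ d) = total hs in (a :+ c) ≲ (b :+ d)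

  -- If the summed hypotheses read p ≤ q, then the coefficientwise bound gives a + q ≤ b + p ≤ b +
  -- q, and q cancels. Adding crosswise avoids subtraction of coefficients. No multipliers are
  -- sought: a hypothesis needed twice has to be listed twice.
  follows : Ineq → Ineq → Bool
  follows (p ≲ q) (a ≲ b) = below (coeffs (a :+ q)) (coeffs (b :+ p))

  follows-sound : ∀ ρ h g → T (follows h g) → Holds ρ h → Holds ρ g
  follows-sound ρ (p ≲ q) (a ≲ b) t p≤q = +-cancelʳ-≤ (⟦ q ⟧ ρ) _ _ (≤-trans
    (subst₂ _≤_ (coeffs-sound (a :+ q) ρ) (coeffs-sound (b :+ p) ρ)
      (below-sound (coeffs (a :+ q)) (coeffs (b :+ p)) (1 ∷ ρ) t))
    (+-monoʳ-≤ (⟦ b ⟧ ρ) p≤q))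

  entail : ∀ ρ hs g → (Holds ρ (total hs) → Holds ρ g) → Entails ρ hs g
  entail ρ []             g f = f z≤n
  entail ρ ((a ≲ b) ∷ hs) g f h = entail ρ hs g (λ t → f (h ⊹ t))

  abstract
    -- Linear arithmetic over ℕ: an inequality follows if it is coefficientwise dominated by the sum of the hypotheses.
    lin : ∀ ρ hs g → {T (follows (total hs) g)} → Entails ρ hs g
    lin ρ hs g {t} = entail ρ hs g (follows-sound ρ (total hs) g t)

    le : ∀ m n → {T (m ≤ᵇ n)} → m ≤ n
    le m n {t} = ≤ᵇ⇒≤ m n t

  x₀ x₁ x₂ x₃ x₄ x₅ x₆ x₇ x₈ x₉ : Lin
  x₀ = var 0
  x₁ = var 1
  x₂ = var 2
  x₃ = var 3
  x₄ = var 4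
  x₅ = var 5
  x₆ = var 6
  x₇ = var 7
  x₈ = var 8
  x₉ = var 9

open LinearArithmetic

-- Counting in decidable subsets of a finite set.

module Counting where

  ∧-intro : ∀ {a b} → T a → T b → T (a ∧ b)
  ∧-intro ta tb = Equivalence.from T-∧ (ta , tb)

  ∨-T : ∀ {a b} → T (a ∨ b) → T a ⊎ T b
  ∨-T = Equivalence.to T-∨

  not-intro : ∀ {a} → ¬ T a → T (not a)
  not-intro {true}  f = f tt
  not-intro {false} f = tt

  not-T : ∀ {a} → T (not a) → ¬ T a
  not-T {true} ()

  module _ {n : ℕ} where

    Sub : Set
    Sub = Fin n → Bool

    open DecMem (_≟_ {n}) public using (_∈?_)

    infixr 7 _∩_ _∖_
    infixr 6 _∪_
    _∩_ _∪_ _∖_ : Sub → Sub → Sub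
    (p ∩ q) x = p x ∧ q x
    (p ∪ q) x = p x ∨ q x
    (p ∖ q) x = p x ∧ not (q x)

    ⟨_⟩ : List (Fin n) → Sub
    ⟨ xs ⟩ x = ⌊ x ∈? xs ⌋

    Full : Sub
    Full _ = true

    _⊑_ : Sub → Sub → Set
    p ⊑ q = ∀ x → T (p x) → T (q x)

    ∈⟨⟩ : ∀ {xs x} → x ∈ xs → T (⟨ xs ⟩ x)
    ∈⟨⟩ = fromWitness

    ⟨⟩∈ : ∀ {xs x} → T (⟨ xs ⟩ x) → x ∈ xs
    ⟨⟩∈ = toWitness

  # : ∀ {n} → (Fin n → Bool) → ℕ
  # {zero}  p = 0
  # {suc n} p = (if p zero then 1 else 0) + # (p ∘ suc)

  abstract
    #-mono : ∀ {n} {p q : Fin n → Bool} → p ⊑ q → # p ≤ # q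
    #-mono {zero}          f = z≤n
    #-mono {suc n} {p} {q} f with p zero in ep | q zero in eq
    ... | true  | true  = s≤s (#-mono (f ∘ suc))
    ... | true  | false = ⊥-elim (subst T eq (f zero (subst T (sym ep) tt)))
    ... | false | true  = m≤n⇒m≤1+n (#-mono (f ∘ suc))
    ... | false | false = #-mono (f ∘ suc)

    #-cong : ∀ {n} {p q : Fin n → Bool} → p ⊑ q → q ⊑ p → # p ≡ # q
    #-cong f g = ≤-antisym (#-mono f) (#-mono g)

    #-split : ∀ {n} (p q : Fin n → Bool) → # p ≡ # (p ∩ q) + # (p ∖ q)
    #-split {zero}  p q = refl
    #-split {suc n} p q with p zero | q zero
    ... | true  | true  = cong suc (#-split (p ∘ suc) (q ∘ suc))
    ... | true  | false = trans (cong suc (#-split (p ∘ suc) (q ∘ suc))) (sym (+-suc _ _))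
    ... | false | true  = #-split (p ∘ suc) (q ∘ suc)
    ... | false | false = #-split (p ∘ suc) (q ∘ suc)

    #-∪ : ∀ {n} (p q : Fin n → Bool) → # (p ∪ q) + # (p ∩ q) ≡ # p + # q
    #-∪ {zero}  p q = refl
    #-∪ {suc n} p q with p zero | q zero
    ... | true  | true  = cong suc (trans (+-suc _ _) (trans (cong suc (#-∪ (p ∘ suc) (q ∘ suc))) (sym (+-suc _ _))))
    ... | true  | false = cong suc (#-∪ (p ∘ suc) (q ∘ suc))
    ... | false | true  = trans (cong suc (#-∪ (p ∘ suc) (q ∘ suc))) (sym (+-suc _ _))
    ... | false | false = #-∪ (p ∘ suc) (q ∘ suc)

    #-Full : ∀ {n} → # {n} Full ≡ n
    #-Full {zero}  = refl
    #-Full {suc n} = cong suc #-Full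

    #-find : ∀ {n} {p : Fin n → Bool} → 1 ≤ # p → ∃ λ x → T (p x)
    #-find {suc n} {p} h with p zero in ep
    ... | true  = zero , subst T (sym ep) tt
    ... | false with #-find {n} {p ∘ suc} h
    ... | x , px = suc x , px

    ∖-mono : ∀ {n} (p : Fin n → Bool) q {r} → p ⊑ r → # (p ∖ q) ≤ # (r ∖ q)
    ∖-mono p q f = #-mono λ x t → let (a , b) = ∧-T {p x} t in ∧-intro (f x a) b

    #-empty : ∀ {n} (p : Fin n → Bool) → (∀ x → ¬ T (p x)) → # p ≤ 0
    #-empty {zero}  p f = z≤n
    #-empty {suc n} p f with p zero in e
    ... | true  = ⊥-elim (f zero (subst T (sym e) tt))
    ... | false = #-empty (p ∘ suc) (f ∘ suc)

    #-pos : ∀ {n} (p : Fin n → Bool) {x} → T (p x) → 1 ≤ # p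
    #-pos p {x} t with # p in e
    ... | suc c = s≤s z≤n
    ... | zero  = ⊥-elim (none p x t e)
      where
      none : ∀ {n} (p : Fin n → Bool) x → T (p x) → # p ≢ 0
      none p zero    t e with p zero
      none p zero    t () | true
      none p (suc x) t e with p zero
      none p (suc x) t () | true
      none p (suc x) t e  | false = none (p ∘ suc) x t e

    #-single : ∀ {n} (p : Fin n → Bool) x → # (p ∩ ⟨ x ∷ [] ⟩) ≤ 1
    #-single {suc n} p zero = +-mono-≤ (bit _) (#-empty _ (λ y t → absurd y (⟨⟩∈ {xs = zero ∷ []} (proj₂ (∧-T {p (suc y)} t)))))
      where
      bit : ∀ b → (if b then 1 else 0) ≤ 1
      bit true  = s≤s z≤n
      bit false = z≤n
      absurd : ∀ (y : Fin n) → suc y ∈ zero ∷ [] → ⊥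
      absurd _ (here ())
    #-single {suc n} p (suc x) = +-mono-≤ (bit _ (λ t → absurd (⟨⟩∈ {xs = suc x ∷ []} (proj₂ (∧-T {p zero} t)))))
      (≤-trans (#-mono (λ y t → let (a , b) = ∧-T {p (suc y)} t in ∧-intro a (∈⟨⟩ (down (⟨⟩∈ {xs = suc x ∷ []} b)))))
        (#-single (p ∘ suc) x))
      where
      bit : ∀ b → ¬ T b → (if b then 1 else 0) ≤ 0
      bit true  f = ⊥-elim (f tt)
      bit false f = z≤n
      absurd : Fin.zero ∈ suc x ∷ [] → ⊥
      absurd (here ())
      down : ∀ {y} → suc y ∈ suc x ∷ [] → y ∈ x ∷ []
      down (here e) = here (suc-injective e)

  module _ {n : ℕ} where

    private variable
      p q : Fin n → Bool
      xs ys : List (Fin n)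
      x y : Fin n

    abstract
      #-subadd : ∀ (r p q : Fin n → Bool) → (∀ x → T (r x) → T (p x) ⊎ T (q x)) → # r ≤ # p + # q
      #-subadd r p q f = ≤-trans (#-mono {q = p ∪ q} (λ x t → Equivalence.from T-∨ (f x t)))
        (≤-trans (m≤m+n _ _) (≤-reflexive (#-∪ p q)))

      #-disjoint : ∀ (r p q : Fin n → Bool) → p ⊑ r → q ⊑ r → (∀ x → T (p x) → T (q x) → ⊥) → # p + # q ≤ # r
      #-disjoint r p q f g d = ≤-trans (≤-reflexive (trans (sym (#-∪ p q)) (trans (cong (# (p ∪ q) +_) zero-meet) (+-identityʳ _))))
        (#-mono λ x t → h x (∨-T t))
        where
        h : ∀ x → T (p x) ⊎ T (q x) → T (r x)
        h x (inj₁ t) = f x t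
        h x (inj₂ t) = g x t
        zero-meet : # (p ∩ q) ≡ 0
        zero-meet with # (p ∩ q) in e
        ... | zero  = refl
        ... | suc c with #-find {p = p ∩ q} (≤-trans (s≤s z≤n) (≤-reflexive (sym e)))
        ... | x , t = ⊥-elim (let (a , b) = ∧-T {p x} t in d x a b)

      #-≤-length : ∀ xs → (∀ x → T (p x) → x ∈ xs) → # p ≤ length xs
      #-≤-length {p} []       f with # p in e
      ... | zero  = z≤n
      ... | suc c with #-find {p = p} (≤-trans (s≤s z≤n) (≤-reflexive (sym e)))
      ... | x , t with () ← f x t
      #-≤-length {p} (x ∷ xs) f = ≤-trans (≤-reflexive (#-split p ⟨ x ∷ [] ⟩))
        (+-mono-≤ (#-single p x) (#-≤-length xs rest))
        where
        rest : ∀ y → T ((p ∖ ⟨ x ∷ [] ⟩) y) → y ∈ xs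
        rest y t with ∧-T {p y} t
        ... | a , b with f y a
        ... | here e  = contradiction (∈⟨⟩ (here e)) (not-T b)
        ... | there i = i

      length-≤-# : Unique xs → All (λ x → T (p x)) xs → length xs ≤ # p
      length-≤-# []                  []         = z≤n
      length-≤-# {x ∷ xs} {p} (x∉ ∷ u) (t ∷ ts) = ≤-trans
        (+-mono-≤ (#-pos (p ∩ ⟨ x ∷ [] ⟩) (∧-intro t (∈⟨⟩ {xs = x ∷ []} (here refl))))
          (length-≤-# u (All.zipWith (λ (a , b) → ∧-intro a (not-intro (λ i → b (sym (only (⟨⟩∈ i)))))) (ts , x∉))))
        (≤-reflexive (sym (#-split p ⟨ x ∷ [] ⟩)))
        where
        only : ∀ {x y : Fin n} → y ∈ x ∷ [] → y ≡ x
        only (here e) = e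

      #-⟨⟩≤ : ∀ xs → # (⟨_⟩ {n} xs) ≤ length xs
      #-⟨⟩≤ xs = #-≤-length xs (λ _ → ⟨⟩∈)

      #-⟨⟩ : Unique xs → # (⟨_⟩ {n} xs) ≡ length xs
      #-⟨⟩ {xs} u = ≤-antisym (#-⟨⟩≤ xs) (length-≤-# u (All.tabulate ∈⟨⟩))

    cnt : (Fin n → Bool) → List (Fin n) → ℕ
    cnt p xs = length (filter (λ x → T? (p x)) xs)

    abstract
      cnt-≤ : Unique xs → All (λ x → T (q x)) xs → cnt p xs ≤ # (p ∩ q)
      cnt-≤ {xs} {q} {p} u a = length-≤-# (Uniq.filter⁺ (λ x → T? (p x)) u)
        (All.tabulate λ i → let (j , t) = ∈-filter⁻ (λ x → T? (p x)) {xs = xs} i in ∧-intro t (All.lookup a j))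

      #-≤-cnt : ∀ (p : Fin n → Bool) xs → # (p ∩ ⟨ xs ⟩) ≤ cnt p xs
      #-≤-cnt p xs = #-≤-length _ λ x t → let (a , b) = ∧-T {p x} t in ∈-filter⁺ (λ x → T? (p x)) (⟨⟩∈ b) a

      #-≤-cnt+ : ∀ (p : Fin n → Bool) xs → # p ≤ cnt p xs + # (p ∖ ⟨ xs ⟩)
      #-≤-cnt+ p xs = ≤-trans (≤-reflexive (#-split p ⟨ xs ⟩)) (+-monoˡ-≤ _ (#-≤-cnt p xs))

    elements : (Fin n → Bool) → List (Fin n)
    elements p = filter (λ x → T? (p x)) (allFin n)

    abstract
      elements-unique : ∀ (p : Fin n → Bool) → Unique (elements p)
      elements-unique p = Uniq.filter⁺ (λ x → T? (p x)) (Uniq.allFin⁺ n)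

      ∈-elements : ∀ {p : Fin n → Bool} {x} → T (p x) → x ∈ elements p
      ∈-elements {p} {x} t = ∈-filter⁺ (λ x → T? (p x)) (∈-allFin x) t

      elements-∈ : ∀ {p : Fin n → Bool} {x} → x ∈ elements p → T (p x)
      elements-∈ {p} i = proj₂ (∈-filter⁻ (λ x → T? (p x)) {xs = allFin n} i)

      #-elements : ∀ (p : Fin n → Bool) → length (elements p) ≡ # p
      #-elements p = ≤-antisym (length-≤-# (elements-unique p) (All.tabulate (elements-∈ {p}))) (#-≤-length _ (λ _ → ∈-elements {p}))

      pick : ∀ (p : Fin n → Bool) xs → length xs < # p → ∃ λ x → T (p x) × x ∉ xs
      pick p xs h with #-find {p = p ∖ ⟨ xs ⟩} (lin (# p ∷ # (p ∩ ⟨ xs ⟩) ∷ # (p ∖ ⟨ xs ⟩) ∷ length xs ∷ [])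
          ((con 1 :+ x₃ ≲ x₀) ∷ (x₀ ≲ x₁ :+ x₂) ∷ (x₁ ≲ x₃) ∷ []) (con 1 ≲ x₂)
          h (≤-reflexive (#-split p ⟨ xs ⟩)) (#-≤-length xs (λ x t → ⟨⟩∈ (proj₂ (∧-T {p x} t)))))
      ... | x , t = let (a , b) = ∧-T {p x} t in x , a , λ i → not-T b (∈⟨⟩ i)

      covering-length : Unique xs → (∀ x → x ∈ xs) → length xs ≡ n
      covering-length {xs} u c = trans (sym (#-⟨⟩ u)) (trans (#-cong {p = ⟨ xs ⟩} {q = Full} (λ _ _ → tt) (λ x _ → ∈⟨⟩ (c x))) #-Full)

      full-length : Unique xs → length xs ≡ n → ∀ x → x ∈ xs
      full-length {xs} u e x with x ∈? xs
      ... | yes i = i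
      ... | no ¬i = contradiction (≤-trans (length-≤-# {p = Full} (Allₚ.¬Any⇒All¬ xs ¬i ∷ u) (All.tabulate (λ _ → tt))) (≤-reflexive #-Full))
                      (<⇒≱ (s≤s (≤-reflexive (sym e))))

  abstract
    -- Brute force over the value at `zero`. Without function extensionality a set rebuilt from its
    -- values agrees with the original only pointwise, so P has to respect pointwise equality. This
    -- makes the distinction between the three structures decidable.
    anySub : ∀ {m} {P : (Fin m → Bool) → Set} → ((p : Fin m → Bool) → Dec (P p)) → (∀ {p q} → (∀ x → p x ≡ q x) → P p → P q) →
             Dec (∃ P)
    anySub {zero}  P? resp with P? (λ _ → true)
    ... | yes h = yes (_ , h)
    ... | no ¬h = no λ (p , h) → ¬h (resp (λ ()) h)
    anySub {suc m} {P} P? resp with anySub (λ p → P? (cons true p)) (λ e → resp (λ { zero → refl ; (suc x) → e x }))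
                                  | anySub (λ p → P? (cons false p)) (λ e → resp (λ { zero → refl ; (suc x) → e x }))
      where
      cons : Bool → (Fin m → Bool) → Fin (suc m) → Bool
      cons b p zero    = b
      cons b p (suc x) = p x
    ... | yes (p , h) | _ = yes (_ , h)
    ... | no _ | yes (p , h) = yes (_ , h)
    ... | no ¬t | no ¬f = no λ (p , h) → split p h (p zero) refl
      where
      split : ∀ p → P p → ∀ b → p zero ≡ b → ⊥
      split p h true  e = ¬t (p ∘ suc , resp (λ { zero → e ; (suc x) → refl }) h)
      split p h false e = ¬f (p ∘ suc , resp (λ { zero → e ; (suc x) → refl }) h)

open Counting

-- Walks, cuts and rotations.

module Walks where

  data Walk {A : Set} (R : A → A → Set) : A → A → List A → Set where
    end  : ∀ {x} → Walk R x x (x ∷ [])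
    step : ∀ {x y z xs} → R x y → Walk R y z xs → Walk R x z (x ∷ xs)

  -- With p the adjacency to a vertex w, this is the successor set of the neighbours of w in a
  -- rotation argument. A neighbour in last position has no successor, hence the loss of one in
  -- `succs-length`.
  succs : ∀ {A : Set} → (A → Bool) → List A → List A
  succs p []           = []
  succs p (x ∷ [])     = []
  succs p (x ∷ y ∷ ys) = if p x then y ∷ succs p (y ∷ ys) else succs p (y ∷ ys)

  module _ {A : Set} {R : A → A → Set} where

    private variable
      u v w x y z : A
      xs ys : List A

    join : Walk R u v xs → R v w → Walk R w z ys → Walk R u z (xs ++ ys)
    join end        r k = step r k
    join (step e h) r k = step e (join h r k)

    start-∈ : Walk R u v xs → u ∈ xs
    start-∈ end        = here refl
    start-∈ (step _ _) = here refl

    end-∈ : Walk R u v xs → v ∈ xs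
    end-∈ end        = here refl
    end-∈ (step _ h) = there (end-∈ h)

    walk-∷ : Walk R u v xs → ∃ λ ys → xs ≡ u ∷ ys
    walk-∷ end        = _ , refl
    walk-∷ (step _ _) = _ , refl

    rev : (∀ {x y} → R x y → R y x) → Walk R u v xs → Walk R v u (reverse xs)
    rev s end = end
    rev s (step {xs = xs} e h) = subst (Walk R _ _) (sym (unfold-reverse _ xs)) (join (rev s h) (s e) end)

    mapʷ : ∀ {S : A → A → Set} → (∀ {x y} → R x y → S x y) → Walk R u v xs → Walk S u v xs
    mapʷ f end        = end
    mapʷ f (step e h) = step (f e) (mapʷ f h)

    allʷ : ∀ {P : A → Set} → (∀ {x y} → R x y → P x × P y) → P u → Walk R u v xs → All P xs
    allʷ f pu end        = pu ∷ []
    allʷ f pu (step e h) = pu ∷ allʷ f (proj₂ (f e)) h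

    succs-∈ : ∀ (p : A → Bool) x {ys z} → z ∈ succs p (x ∷ ys) → z ∈ ys
    succs-∈ p x {y ∷ ys} i with p x
    succs-∈ p x {y ∷ ys} (here e)  | true  = here e
    succs-∈ p x {y ∷ ys} (there i) | true  = there (succs-∈ p y i)
    succs-∈ p x {y ∷ ys} i         | false = there (succs-∈ p y i)

    succs-unique : ∀ (p : A → Bool) {xs} → Unique xs → Unique (succs p xs)
    succs-unique p {[]}         u       = []
    succs-unique p {x ∷ []}     u       = []
    succs-unique p {x ∷ y ∷ ys} (_ ∷ u) with p x
    ... | true  = All.tabulate (λ i → All.lookup (hd u) (succs-∈ p y i)) ∷ succs-unique p u
      where
      hd : Unique (y ∷ ys) → All (y ≢_) ys
      hd (a ∷ _) = a
    ... | false = succs-unique p u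

    succs-length : ∀ (p : A → Bool) xs → length (filter (λ x → T? (p x)) xs) ≤ 1 + length (succs p xs)
    succs-length p [] = z≤n
    succs-length p (x ∷ []) with p x
    ... | true  = s≤s z≤n
    ... | false = z≤n
    succs-length p (x ∷ y ∷ ys) with p x | succs-length p (y ∷ ys)
    ... | true  | ih = s≤s ih
    ... | false | ih = ih

    record Cut (p : A → Bool) (u v : A) (xs : List A) (y : A) : Set where
      constructor mkCut
      field
        {m}     : A
        {ls rs} : List A
        split   : xs ≡ ls ++ rs
        left    : Walk R u m ls
        edge    : R m y
        right   : Walk R y v rs
        holds   : T (p m)

    succs-case : ∀ (p : A → Bool) {x y ys z} → z ∈ succs p (x ∷ y ∷ ys) → (T (p x) × z ≡ y) ⊎ z ∈ succs p (y ∷ ys)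
    succs-case p {x} i with p x
    succs-case p (here e)  | true  = inj₁ (tt , e)
    succs-case p (there i) | true  = inj₂ i
    succs-case p i         | false = inj₂ i

    abstract
      cut : ∀ {p} → Walk R u v xs → y ∈ succs p xs → Cut p u v xs y
      cut {p = p} (step e h) i with walk-∷ h
      ... | ys , refl with succs-case p {ys = ys} i
      ... | inj₁ (t , refl) = mkCut refl end e h t
      ... | inj₂ j with cut h j
      ... | mkCut eq l e′ r t = mkCut (cong (_ ∷_) eq) (step e l) e′ r t

    record Cut₂ (p q : A → Bool) (u v : A) (xs : List A) (y z : A) : Set where
      constructor mkCut₂
      field
        {m m′}     : A
        {ls ms rs} : List A
        split      : xs ≡ ls ++ ms ++ rs
        left       : Walk R u m ls
        middle     : Walk R y m′ ms
        right      : Walk R z v rs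
        holds      : T (p m)
        holds′     : T (q m′)

    abstract
      extend₂ : ∀ {p q} → R u w → Cut₂ p q w v xs y z → Cut₂ p q u v (u ∷ xs) y z
      extend₂ e (mkCut₂ eq l m r t t′) = mkCut₂ (cong (_ ∷_) eq) (step e l) m r t t′

      -- It is not known which of y and z comes first on the walk, hence the two outcomes.
      cut₂ : ∀ {p q} → Walk R u v xs → y ∈ succs p xs → z ∈ succs q xs → y ≢ z →
             Cut₂ p q u v xs y z ⊎ Cut₂ q p u v xs z y
      cut₂ {p = p} {q} (step e h) i j ne with walk-∷ h
      ... | ys , refl with succs-case p {ys = ys} i | succs-case q {ys = ys} j
      ... | inj₁ (_ , refl) | inj₁ (_ , refl) = contradiction refl ne
      ... | inj₁ (t , refl) | inj₂ j′ with cut h j′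
      ... | mkCut eq l e′ r t′ = inj₁ (mkCut₂ (cong (_ ∷_) eq) end l r t t′)
      cut₂ {p = p} {q} (step e h) i j ne | ys , refl | inj₂ i′ | inj₁ (t , refl) with cut h i′
      ... | mkCut eq l e′ r t′ = inj₂ (mkCut₂ (cong (_ ∷_) eq) end l r t t′)
      cut₂ {p = p} {q} (step e h) i j ne | ys , refl | inj₂ i′ | inj₂ j′ with cut₂ h i′ j′ ne
      ... | inj₁ c = inj₁ (extend₂ e c)
      ... | inj₂ c = inj₂ (extend₂ e c)

    module _ (symR : ∀ {x y} → R x y → R y x) where

      abstract
        -- Cut xs into l, m, r with m starting at y and r at z. The last vertices of l and m are
        -- neighbours of w, so l, w and the reversed m form a walk; it ends at y, from where the
        -- edge yz leads on to r.
        insert : ∀ {p} → Walk R u v xs → (∀ x → T (p x) → R x w) → y ∈ succs p xs → z ∈ succs p xs → y ≢ z → R y z →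
                 ∃ λ xs′ → Walk R u v xs′ × xs′ ↭ w ∷ xs
        insert {u} {v} {xs} {w} {p = p} h f i j ne r with cut₂ h i j ne
        ... | inj₁ c = go c r
          where
          go : ∀ {y z} → Cut₂ p p u v xs y z → R y z → ∃ λ xs′ → Walk R u v xs′ × xs′ ↭ w ∷ xs
          go (mkCut₂ {ls = ls} {ms} {rs} refl l m r t t′) e =
            _ , join l (f _ t) (step (symR (f _ t′)) (join (rev symR m) e r)) ,
            ↭-trans (shift w ls _) (prep w (++⁺ˡ ls (++⁺ʳ rs (↭-reverse ms))))
        ... | inj₂ c = go c (symR r)
          where
          go : ∀ {y z} → Cut₂ p p u v xs y z → R y z → ∃ λ xs′ → Walk R u v xs′ × xs′ ↭ w ∷ xs
          go (mkCut₂ {ls = ls} {ms} {rs} refl l m r t t′) e =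
            _ , join l (f _ t) (step (symR (f _ t′)) (join (rev symR m) e r)) ,
            ↭-trans (shift w ls _) (prep w (++⁺ˡ ls (++⁺ʳ rs (↭-reverse ms))))

        -- As for a single vertex, except that b is placed between y and z. Inserting two vertices
        -- at once keeps an alternating walk alternating: a enters on one side and b on the other.
        insert₂ : ∀ {p a b} → Walk R u v xs → (∀ x → T (p x) → R x a) → y ∈ succs p xs → z ∈ succs p xs → y ≢ z →
                  R y b → R z b → ∃ λ xs′ → Walk R u v xs′ × xs′ ↭ a ∷ b ∷ xs
        insert₂ {u} {v} {xs} {p = p} {a} {b} h f i j ne ry rz with cut₂ h i j ne
        ... | inj₁ c = go c ry rz
          where
          go : ∀ {y z} → Cut₂ p p u v xs y z → R y b → R z b → ∃ λ xs′ → Walk R u v xs′ × xs′ ↭ a ∷ b ∷ xs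
          go (mkCut₂ {ls = ls} {ms} {rs} refl l m r t t′) ry rz =
            _ , join l (f _ t) (step (symR (f _ t′)) (join (rev symR m) ry (step (symR rz) r))) ,
            ↭-trans (shift a ls _) (prep a (↭-trans (++⁺ˡ ls (shift b (reverse ms) rs)) (↭-trans (shift b ls _)
              (prep b (++⁺ˡ ls (++⁺ʳ rs (↭-reverse ms)))))))
        ... | inj₂ c = go c rz ry
          where
          go : ∀ {y z} → Cut₂ p p u v xs y z → R y b → R z b → ∃ λ xs′ → Walk R u v xs′ × xs′ ↭ a ∷ b ∷ xs
          go (mkCut₂ {ls = ls} {ms} {rs} refl l m r t t′) ry rz =
            _ , join l (f _ t) (step (symR (f _ t′)) (join (rev symR m) ry (step (symR rz) r))) ,
            ↭-trans (shift a ls _) (prep a (↭-trans (++⁺ˡ ls (shift b (reverse ms) rs)) (↭-trans (shift b ls _)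
              (prep b (++⁺ˡ ls (++⁺ʳ rs (↭-reverse ms)))))))

        -- A closed walk loses the two edges that enter y and z and gains yz. What remains runs from
        -- the predecessor of y to that of z.
        rotate : ∀ {p q} → Walk R u v xs → R v u → y ∈ succs p xs → z ∈ succs q xs → y ≢ z → R y z →
                 ∃ λ a → ∃ λ b → ∃ λ xs′ → T (p a) × T (q b) × Walk R a b xs′ × xs′ ↭ xs
        rotate {u} {v} {xs} {p = p} {q} h c i j ne r with cut₂ h i j ne
        ... | inj₁ (mkCut₂ {ls = ls} {ms} {rs} refl l m k t t′) =
          _ , _ , _ , t , t′ , join (rev symR l) (symR c) (join (rev symR k) (symR r) m) ,
          ++⁺ (↭-reverse ls) (↭-trans (++-comm (reverse rs) ms) (++⁺ˡ ms (↭-reverse rs)))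
        ... | inj₂ (mkCut₂ {ls = ls} {ms} {rs} refl l m k t t′) =
          _ , _ , _ , t′ , t , rev symR (join (rev symR l) (symR c) (join (rev symR k) r m)) ,
          ↭-trans (↭-reverse _) (++⁺ (↭-reverse ls) (↭-trans (++-comm (reverse rs) ms) (++⁺ˡ ms (↭-reverse rs))))

open Walks

Unique-resp-↭ : ∀ {A : Set} {xs ys : List A} → xs ↭ ys → Unique xs → Unique ys
Unique-resp-↭ {A} p = PermSetoid.Unique-resp-↭ (setoid A) (↭⇒↭ₛ p)

linked⇒walk : ∀ {A : Set} {R : A → A → Set} {u v} mid → Linked R (u ∷ mid ++ [ v ]) → Walk R u v (u ∷ mid ++ [ v ])
linked⇒walk []        (e ∷ [-]) = step e end
linked⇒walk (x ∷ mid) (e ∷ l)   = step e (linked⇒walk mid l)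

walk⇒linked : ∀ {A : Set} {R : A → A → Set} {u v xs} → Walk R u v xs → Linked R xs
walk⇒linked end                 = [-]
walk⇒linked (step e end)        = e ∷ [-]
walk⇒linked (step e (step f h)) = e ∷ walk⇒linked (step f h)

-- Formal sums of edge vectors over 𝔽₂.

toggle : ℕ → List Bool → List Bool
toggle zero    []       = true ∷ []
toggle zero    (b ∷ bs) = not b ∷ bs
toggle (suc i) []       = false ∷ toggle i []
toggle (suc i) (b ∷ bs) = b ∷ toggle i bs

-- Records for each index whether it occurs an odd number of times; missing trailing entries count
-- as `false`.
parity : List ℕ → List Bool
parity []       = []
parity (i ∷ is) = toggle i (parity is)

allFalse : List Bool → Bool
allFalse []           = true
allFalse (true ∷ bs)  = false
allFalse (false ∷ bs) = allFalse bs

module _ {n : ℕ} where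

  private
    V = Fin n
    E = EdgeVec n

  ∑ : List E → E
  ∑ []       = zeroV
  ∑ (X ∷ Xs) = X ⊕ ∑ Xs

  get : List E → ℕ → E
  get []      _       = zeroV
  get (X ∷ ρ) zero    = X
  get (X ∷ ρ) (suc i) = get ρ i

  ⟪_⟫ : List ℕ → List E → List E
  ⟪ is ⟫ ρ = map (get ρ) is

  private
    xor-swap : ∀ a b c → a xor (b xor c) ≡ b xor (a xor c)
    xor-swap a b c = trans (sym (xor-assoc a b c)) (trans (cong (_xor c) (xor-comm a b)) (xor-assoc b a c))

    select : List Bool → List E → E
    select []           ρ       = zeroV
    select (b ∷ bs)     []      = zeroV
    select (true ∷ bs)  (X ∷ ρ) = X ⊕ select bs ρ
    select (false ∷ bs) (X ∷ ρ) = select bs ρ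

    select-toggle : ∀ i bs ρ → select (toggle i bs) ρ ≈E (get ρ i ⊕ select bs ρ)
    select-toggle zero    []           []      a b = refl
    select-toggle (suc i) []           []      a b = refl
    select-toggle zero    (c ∷ bs)     []      a b = refl
    select-toggle (suc i) (c ∷ bs)     []      a b = refl
    select-toggle zero    []           (X ∷ ρ) a b = refl
    select-toggle (suc i) []           (X ∷ ρ) a b = select-toggle i [] ρ a b
    select-toggle zero    (true ∷ bs)  (X ∷ ρ) a b =
      trans (cong (_xor select bs ρ a b) (sym (xor-same (X a b)))) (xor-assoc (X a b) (X a b) (select bs ρ a b))
    select-toggle zero    (false ∷ bs) (X ∷ ρ) a b = refl
    select-toggle (suc i) (true ∷ bs)  (X ∷ ρ) a b =
      trans (cong (X a b xor_) (select-toggle i bs ρ a b)) (xor-swap (X a b) (get ρ i a b) (select bs ρ a b))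
    select-toggle (suc i) (false ∷ bs) (X ∷ ρ) a b = select-toggle i bs ρ a b

    select-parity : ∀ is ρ → select (parity is) ρ ≈E ∑ (⟪ is ⟫ ρ)
    select-parity []       ρ a b = refl
    select-parity (i ∷ is) ρ a b = trans (select-toggle i (parity is) ρ a b) (cong (get ρ i a b xor_) (select-parity is ρ a b))

    select-allFalse : ∀ bs ρ → T (allFalse bs) → select bs ρ ≈E zeroV
    select-allFalse []           ρ       t a b = refl
    select-allFalse (false ∷ bs) []      t a b = refl
    select-allFalse (false ∷ bs) (X ∷ ρ) t a b = select-allFalse bs ρ t a b

  ∑-++ : ∀ Xs Ys → ∑ (Xs ++ Ys) ≈E (∑ Xs ⊕ ∑ Ys)
  ∑-++ []       Ys a b = refl
  ∑-++ (X ∷ Xs) Ys a b = trans (cong (X a b xor_) (∑-++ Xs Ys a b)) (sym (xor-assoc (X a b) (∑ Xs a b) (∑ Ys a b)))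

  ⟪⟫-++ : ∀ is js ρ → ⟪ is ++ js ⟫ ρ ≡ ⟪ is ⟫ ρ ++ ⟪ js ⟫ ρ
  ⟪⟫-++ []       js ρ = refl
  ⟪⟫-++ (i ∷ is) js ρ = cong (_ ∷_) (⟪⟫-++ is js ρ)

  cancel : ∀ a b → a xor b ≡ false → a ≡ b
  cancel true  true  _ = refl
  cancel false false _ = refl

  parity-sound : ∀ is js ρ → T (allFalse (parity (is ++ js))) → ∑ (⟪ is ⟫ ρ) ≈E ∑ (⟪ js ⟫ ρ)
  parity-sound is js ρ t a b = cancel _ _ (trans (sym (∑-++ (⟪ is ⟫ ρ) (⟪ js ⟫ ρ) a b))
    (trans (cong (λ Xs → ∑ Xs a b) (sym (⟪⟫-++ is js ρ)))
      (trans (sym (select-parity (is ++ js) ρ a b)) (select-allFalse (parity (is ++ js)) ρ t a b))))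

  pairInd-sym : ∀ (x y : V) → pairInd x y ≈E pairInd y x
  pairInd-sym x y a b = trans (∨-comm (⌊ x ≟ a ⌋ ∧ ⌊ y ≟ b ⌋) (⌊ x ≟ b ⌋ ∧ ⌊ y ≟ a ⌋))
    (cong₂ _∨_ (∧-comm ⌊ x ≟ b ⌋ ⌊ y ≟ a ⌋) (∧-comm ⌊ x ≟ a ⌋ ⌊ y ≟ b ⌋))

-- The span of the Hamilton cycles and the values of walks.

module Space {n : ℕ} (G : Graph n) where

  private
    V = Fin n
    E = EdgeVec n

  H : E → Set
  H = InCkSpace G n

  H-zero : H zeroV
  H-zero = [] , [] , λ _ _ → refl

  H-resp : ∀ {X Y} → X ≈E Y → H Y → H X
  H-resp e (Cs , a , f) = Cs , a , λ x y → trans (e x y) (f x y)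

  H-⊕ : ∀ {X Y} → H X → H Y → H (X ⊕ Y)
  H-⊕ (Cs , a , f) (Ds , b , g) = Cs ++ Ds , Allₚ.++⁺ a b , λ x y →
    trans (cong₂ _xor_ (f x y) (g x y)) (sym (sum-++ Cs Ds x y))
    where
    sum-++ : ∀ (Cs Ds : List (Cycle G)) → sumE (Cs ++ Ds) ≈E (sumE Cs ⊕ sumE Ds)
    sum-++ []       Ds x y = refl
    sum-++ (C ∷ Cs) Ds x y = trans (cong (cycEdges C x y xor_) (sum-++ Cs Ds x y))
      (sym (xor-assoc (cycEdges C x y) (sumE Cs x y) (sumE Ds x y)))

  -- The sum of the listed vectors lies in the Hamilton space.
  record Z (Xs : List E) : Set where
    constructor mkZ
    field
      inSpan : H (∑ Xs)

  open Z public

  Implies : List E → List (List ℕ) → List ℕ → Set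
  Implies ρ []       g = Z (⟪ g ⟫ ρ)
  Implies ρ (h ∷ hs) g = Z (⟪ h ⟫ ρ) → Implies ρ hs g

  flatten : List (List ℕ) → List ℕ
  flatten []       = []
  flatten (h ∷ hs) = h ++ flatten hs

  abstract
    -- Linear algebra over 𝔽₂ modulo the Hamilton space: a sum vanishes if its terms cancel against those of vanishing sums.
    comb : ∀ ρ hs g → {T (allFalse (parity (g ++ flatten hs)))} → Implies ρ hs g
    comb ρ hs g {t} = go hs (λ h → mkZ (H-resp (parity-sound g (flatten hs) ρ t) h))
      where
      go : ∀ hs → (H (∑ (⟪ flatten hs ⟫ ρ)) → Z (⟪ g ⟫ ρ)) → Implies ρ hs g
      go []       f = f H-zero
      go (h ∷ hs) f z = go hs λ y → f (H-resp (λ a b → trans (cong (λ Xs → ∑ Xs a b) (⟪⟫-++ h (flatten hs) ρ))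
        (∑-++ (⟪ h ⟫ ρ) (⟪ flatten hs ⟫ ρ) a b)) (H-⊕ (inSpan z) y))

    ≈⇒Z : ∀ {X Y} → X ≈E Y → Z (X ∷ Y ∷ [])
    ≈⇒Z {X} {Y} e = mkZ (H-resp (λ a b → trans (cong₂ _xor_ (e a b) (xor-identityʳ (Y a b))) (xor-same (Y a b))) H-zero)

    Z-zero : Z (zeroV ∷ [])
    Z-zero = mkZ (H-resp (λ _ _ → refl) H-zero)

    Z-⊕ : ∀ X Y → Z ((X ⊕ Y) ∷ X ∷ Y ∷ [])
    Z-⊕ X Y = mkZ (H-resp (λ a b → trans (cong (λ c → (X a b xor Y a b) xor (X a b xor c)) (xor-identityʳ (Y a b)))
      (xor-same (X a b xor Y a b))) H-zero)

    Z-sym : ∀ x y → Z (pairInd x y ∷ pairInd y x ∷ [])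
    Z-sym x y = ≈⇒Z (pairInd-sym x y)

  private variable
    R : V → V → Set
    u v w z d e : V
    xs ys Λ Λ′ : List V

  abstract
    Z-step : Walk R v w xs → Z (walkEdges (u ∷ xs) ∷ pairInd u v ∷ walkEdges xs ∷ [])
    Z-step {v = v} {u = u} h with walk-∷ h
    ... | ys , refl = Z-⊕ (pairInd u v) (walkEdges (v ∷ ys))

    Z-join : Walk R u v xs → Walk R w z ys → Z (walkEdges (xs ++ ys) ∷ walkEdges xs ∷ pairInd v w ∷ walkEdges ys ∷ [])
    Z-join {v = v} {w = w} {ys = ys} end k = comb (pairInd v w ∷ walkEdges ys ∷ walkEdges (v ∷ ys) ∷ zeroV ∷ [])
      ((2 ∷ 0 ∷ 1 ∷ []) ∷ (3 ∷ []) ∷ []) (2 ∷ 3 ∷ 0 ∷ 1 ∷ []) (Z-step k) Z-zero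
    Z-join {u = u} {v} {w = w} {ys = ys} (step {y = y} {xs = xs} e h) k with walk-∷ h
    ... | ts , refl = comb
      (walkEdges (u ∷ xs ++ ys) ∷ pairInd u y ∷ walkEdges (xs ++ ys) ∷ walkEdges (u ∷ xs) ∷ walkEdges xs ∷ pairInd v w ∷ walkEdges ys ∷ [])
      ((0 ∷ 1 ∷ 2 ∷ []) ∷ (3 ∷ 1 ∷ 4 ∷ []) ∷ (2 ∷ 4 ∷ 5 ∷ 6 ∷ []) ∷ []) (0 ∷ 3 ∷ 5 ∷ 6 ∷ [])
      (Z-⊕ (pairInd u y) (walkEdges (y ∷ ts ++ ys))) (Z-⊕ (pairInd u y) (walkEdges (y ∷ ts))) (Z-join h k)

    Z-reverse : (∀ {x y} → R x y → R y x) → Walk R u v xs → Z (walkEdges (reverse xs) ∷ walkEdges xs ∷ [])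
    Z-reverse s end = ≈⇒Z (λ _ _ → refl)
    Z-reverse s (step {x = x} {y} {xs = xs} e h) rewrite unfold-reverse x xs = comb
      (walkEdges (reverse xs ++ x ∷ []) ∷ walkEdges (reverse xs) ∷ pairInd y x ∷ zeroV ∷ pairInd x y ∷ walkEdges (x ∷ xs) ∷ walkEdges xs ∷ [])
      ((0 ∷ 1 ∷ 2 ∷ 3 ∷ []) ∷ (3 ∷ []) ∷ (4 ∷ 2 ∷ []) ∷ (5 ∷ 4 ∷ 6 ∷ []) ∷ (1 ∷ 6 ∷ []) ∷ []) (0 ∷ 5 ∷ [])
      (Z-join {R = λ _ _ → ⊤} (mapʷ _ (rev s h)) end) Z-zero (Z-sym x y) (Z-step h) (Z-reverse s h)

    ham-cycle : 3 ≤ n → Walk (Adj G) u v xs → Adj G v u → Unique xs → (∀ x → x ∈ xs) → Z (walkEdges xs ∷ pairInd v u ∷ [])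
    ham-cycle {u} {v} 3≤n h e uq cov with walk-∷ h
    ... | rs , refl = comb (walkEdges (u ∷ rs ++ u ∷ []) ∷ walkEdges (u ∷ rs) ∷ pairInd v u ∷ zeroV ∷ [])
      ((0 ∷ []) ∷ (0 ∷ 1 ∷ 2 ∷ 3 ∷ []) ∷ (3 ∷ []) ∷ []) (1 ∷ 2 ∷ [])
      (mkZ (C ∷ [] , len ∷ [] , λ _ _ → refl)) (Z-join h (end {R = Adj G})) Z-zero
      where
      len : suc (length rs) ≡ n
      len = covering-length uq cov
      C : Cycle G
      C = mkCycle u rs (≤-pred (subst (3 ≤_) (sym len) 3≤n)) uq (walk⇒linked (join h e end))

    ham-switch : 3 ≤ n → Walk (Adj G) d z Λ → Walk (Adj G) d z Λ′ → Λ ↭ Λ′ → Walk (Adj G) w e ys → Adj G z w → Adj G e d →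
                 Unique (Λ ++ ys) → (∀ x → x ∈ Λ ++ ys) → Z (walkEdges Λ ∷ walkEdges Λ′ ∷ [])
    ham-switch {d} {z} {Λ} {Λ′} {w} {e} {ys} 3≤n h h′ p k zw ed uq cov = comb
      (walkEdges Λ ∷ walkEdges Λ′ ∷ walkEdges (Λ ++ ys) ∷ walkEdges (Λ′ ++ ys) ∷ pairInd e d ∷ pairInd z w ∷ walkEdges ys ∷ [])
      ((2 ∷ 4 ∷ []) ∷ (3 ∷ 4 ∷ []) ∷ (2 ∷ 0 ∷ 5 ∷ 6 ∷ []) ∷ (3 ∷ 1 ∷ 5 ∷ 6 ∷ []) ∷ []) (0 ∷ 1 ∷ [])
      (ham-cycle 3≤n (join h zw k) ed uq cov)
      (ham-cycle 3≤n (join h′ zw k) ed (Unique-resp-↭ p′ uq) (λ x → ∈-resp-↭ p′ (cov x)))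
      (Z-join h k) (Z-join h′ k)
      where
      p′ : Λ ++ ys ↭ Λ′ ++ ys
      p′ = ++⁺ʳ ys p

  rep : ℕ → E → E
  rep zero    ε = zeroV
  rep (suc j) ε = ε ⊕ rep j ε

  module _ (g : V → E) (ε : E) where

    -- A walk on l vertices has l - 1 edges. Over 𝔽₂ their errors amount to one ε plus l copies of
    -- it; in this form no subtraction occurs, and l can later be replaced by the size of the set
    -- that the walk spans.
    walk-value : (∀ {x y} → R x y → Z (pairInd x y ∷ g x ∷ g y ∷ ε ∷ [])) → Walk R u v xs →
                 Z (walkEdges xs ∷ g u ∷ g v ∷ ε ∷ rep (length xs) ε ∷ [])
    walk-value {u = u} f end = comb (zeroV ∷ g u ∷ ε ∷ (ε ⊕ zeroV) ∷ [])
      ((0 ∷ []) ∷ (0 ∷ []) ∷ (3 ∷ 2 ∷ 0 ∷ []) ∷ []) (0 ∷ 1 ∷ 1 ∷ 2 ∷ 3 ∷ []) Z-zero Z-zero (Z-⊕ ε zeroV)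
    walk-value {u = u} {v} f (step {y = y} {xs = xs} e h) = comb
      (walkEdges (u ∷ xs) ∷ pairInd u y ∷ walkEdges xs ∷ g u ∷ g v ∷ ε ∷ rep (length xs) ε ∷ (ε ⊕ rep (length xs) ε) ∷ g y ∷ [])
      ((0 ∷ 1 ∷ 2 ∷ []) ∷ (1 ∷ 3 ∷ 8 ∷ 5 ∷ []) ∷ (2 ∷ 8 ∷ 4 ∷ 5 ∷ 6 ∷ []) ∷ (7 ∷ 5 ∷ 6 ∷ []) ∷ []) (0 ∷ 3 ∷ 4 ∷ 5 ∷ 7 ∷ [])
      (Z-step h) (f e) (walk-value f h) (Z-⊕ ε (rep (length xs) ε))

  rep-zero : ∀ j → Z (rep j zeroV ∷ [])
  rep-zero zero    = Z-zero
  rep-zero (suc j) = comb ((zeroV ⊕ rep j zeroV) ∷ zeroV ∷ rep j zeroV ∷ []) ((0 ∷ 1 ∷ 2 ∷ []) ∷ (1 ∷ []) ∷ (2 ∷ []) ∷ []) (0 ∷ [])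
    (Z-⊕ zeroV (rep j zeroV)) Z-zero (rep-zero j)

  rep-suc-suc : ∀ j ε → Z (rep (suc (suc j)) ε ∷ rep j ε ∷ [])
  rep-suc-suc j ε = comb ((ε ⊕ (ε ⊕ rep j ε)) ∷ ε ∷ (ε ⊕ rep j ε) ∷ rep j ε ∷ []) ((0 ∷ 1 ∷ 2 ∷ []) ∷ (2 ∷ 1 ∷ 3 ∷ []) ∷ []) (0 ∷ 3 ∷ [])
    (Z-⊕ ε (ε ⊕ rep j ε)) (Z-⊕ ε (rep j ε))

  Coboundary : (V → E) → Set
  Coboundary g = ∀ {x y} → Adj G x y → Z (pairInd x y ∷ g x ∷ g y ∷ [])

  coboundary⇒generated : ∀ g → Coboundary g → HamiltonGenerated G
  coboundary⇒generated g cob X = record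
    { to        = λ (Cs , a , f) → Cs , All.map _ a , f
    ; from      = λ (Cs , _ , f) → H-resp f (go Cs)
    ; to-cong   = λ { refl → refl }
    ; from-cong = λ { refl → refl }
    }
    where
    cyc : ∀ C → H (cycEdges C)
    cyc (mkCycle s rs _ _ l) = H-resp (λ a b → sym (xor-identityʳ _)) (inSpan (comb
      (walkEdges (s ∷ rs ++ s ∷ []) ∷ g s ∷ zeroV ∷ rep (length (s ∷ rs ++ s ∷ [])) zeroV ∷ [])
      ((0 ∷ 1 ∷ 1 ∷ 2 ∷ 3 ∷ []) ∷ (2 ∷ []) ∷ (3 ∷ []) ∷ []) (0 ∷ [])
      (walk-value g zeroV (λ {x} {y} e → comb (pairInd x y ∷ g x ∷ g y ∷ zeroV ∷ []) ((0 ∷ 1 ∷ 2 ∷ []) ∷ (3 ∷ []) ∷ []) (0 ∷ 1 ∷ 2 ∷ 3 ∷ [])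
        (cob e) Z-zero) (linked⇒walk rs l))
      Z-zero (rep-zero (length (s ∷ rs ++ s ∷ [])))))
    go : ∀ Cs → H (sumE Cs)
    go []       = H-zero
    go (C ∷ Cs) = H-⊕ (cyc C) (go Cs)

-- Ladders: short even cycles vanish.

module Ladder {n : ℕ} (G : Graph n) where

  open Space G

  private
    V = Fin n
    E = EdgeVec n

  -- Only inner vertices have to avoid D. Seven vertices are what it takes to join two vertices on
  -- the side of the core in the bipartite structure.
  record Bridge (R : V → V → Set) (x y : V) (D : List V) : Set where
    field
      {list} : List V
      walk   : Walk R x y list
      unique : Unique list
      fresh  : All (λ v → v ≡ x ⊎ v ≡ y ⊎ v ∉ D) list
      short  : length list ≤ 7

  -- Two walks P, P′ from r with the same vertices, ending at y and at x, are prolonged in parallel: from y to y′ and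
  -- along a bridge to x′, respectively from x to x′ and back along the bridge to y′.  Their values differ by the rungs only.
  module Rungs (R : V → V → Set) (R-sym : ∀ {x y} → R x y → R y x) (r z : V) (Ok : V → Set)
    (switch : ∀ {Λ Λ′} → Walk R r z Λ → Walk R r z Λ′ → Λ ↭ Λ′ → Unique Λ → All Ok Λ → length Λ ≤ 30 →
              Z (walkEdges Λ ∷ walkEdges Λ′ ∷ []))
    where

    -- D holds the ladder vertices still to come, which the bridges must leave alone; X is the sum
    -- of the rungs used so far, and P ends at y while P′ ends at x.
    record State (x y : V) (X : E) (D : List V) (j : ℕ) : Set where
      field
        {P P′} : List V
        walk   : Walk R r y P
        walk′  : Walk R r x P′
        perm   : P ↭ P′
        unique : Unique P
        ok     : All Ok P
        avoids : All (_∉ D) P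
        short  : length P ≤ j
        value  : Z (walkEdges P ∷ walkEdges P′ ∷ X ∷ [])

    Linkable : V → V → Set
    Linkable x y = ∀ D → length D ≤ 40 → ∃ λ (b : Bridge R x y D) → All (λ v → v ≡ x ⊎ v ≡ y ⊎ Ok v) (Bridge.list b)

    init : ∀ {x y D} → R r x → R r y → Linkable x y → Unique (r ∷ x ∷ y ∷ []) → Ok r → Ok x → Ok y →
           All (_∉ D) (r ∷ x ∷ y ∷ []) → length D ≤ 39 → State x y (pairInd r x ⊕ pairInd r y) D 8
    init {x} {y} {D} rx ry l ((r≢x ∷ r≢y ∷ []) ∷ _) or ox oy (r∉ ∷ x∉ ∷ y∉ ∷ []) d with l (r ∷ D) (s≤s d)
    ... | b , oks = record
      { walk = step rx walk ; walk′ = step ry (rev R-sym walk) ; perm = prep r (↭-sym (↭-reverse list))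
      ; unique = All.map out fresh ∷ unique ; ok = or ∷ All.map okk oks ; avoids = r∉ ∷ All.map out′ fresh ; short = s≤s short
      ; value = comb (walkEdges (r ∷ list) ∷ walkEdges (r ∷ reverse list) ∷ (pairInd r x ⊕ pairInd r y) ∷ walkEdges list ∷ walkEdges (reverse list) ∷ pairInd r x ∷ pairInd r y ∷ [])
          ((0 ∷ 5 ∷ 3 ∷ []) ∷ (1 ∷ 6 ∷ 4 ∷ []) ∷ (4 ∷ 3 ∷ []) ∷ (2 ∷ 5 ∷ 6 ∷ []) ∷ []) (0 ∷ 1 ∷ 2 ∷ [])
          (Z-step walk) (Z-step (rev R-sym walk)) (Z-reverse R-sym walk) (Z-⊕ (pairInd r x) (pairInd r y)) }
      where
      open Bridge b
      out : ∀ {v} → v ≡ x ⊎ v ≡ y ⊎ v ∉ r ∷ D → r ≢ v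
      out (inj₁ refl)        = r≢x
      out (inj₂ (inj₁ refl)) = r≢y
      out (inj₂ (inj₂ v∉))   = λ e → v∉ (here (sym e))
      out′ : ∀ {v} → v ≡ x ⊎ v ≡ y ⊎ v ∉ r ∷ D → v ∉ D
      out′ (inj₁ refl)        = x∉
      out′ (inj₂ (inj₁ refl)) = y∉
      out′ (inj₂ (inj₂ v∉))   = v∉ ∘ there
      okk : ∀ {v} → v ≡ x ⊎ v ≡ y ⊎ Ok v → Ok v
      okk (inj₁ refl)        = ox
      okk (inj₂ (inj₁ refl)) = oy
      okk (inj₂ (inj₂ o))    = o

    rung-value : ∀ {x y x′ y′ P P′ L X} → Walk R r y P → Walk R r x P′ → Walk R y′ x′ L → Z (walkEdges P ∷ walkEdges P′ ∷ X ∷ []) →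
      Z (walkEdges (P ++ L) ∷ walkEdges (P′ ++ reverse L) ∷ (X ⊕ (pairInd x x′ ⊕ pairInd y y′)) ∷ [])
    rung-value {x} {y} {x′} {y′} {P} {P′} {L} {X} h h′ l z = comb (walkEdges (P ++ L) ∷ walkEdges (P′ ++ reverse L) ∷ walkEdges P ∷ walkEdges P′ ∷ walkEdges L ∷ walkEdges (reverse L) ∷ X ∷ pairInd x x′ ∷ pairInd y y′ ∷ (pairInd x x′ ⊕ pairInd y y′) ∷ (X ⊕ (pairInd x x′ ⊕ pairInd y y′)) ∷ [])
      ((0 ∷ 2 ∷ 8 ∷ 4 ∷ []) ∷ (1 ∷ 3 ∷ 7 ∷ 5 ∷ []) ∷ (5 ∷ 4 ∷ []) ∷ (2 ∷ 3 ∷ 6 ∷ []) ∷ (9 ∷ 7 ∷ 8 ∷ []) ∷ (10 ∷ 6 ∷ 9 ∷ []) ∷ []) (0 ∷ 1 ∷ 10 ∷ [])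
      (Z-join h l) (Z-join h′ (rev R-sym l)) (Z-reverse R-sym l) z (Z-⊕ (pairInd x x′) (pairInd y y′)) (Z-⊕ X (pairInd x x′ ⊕ pairInd y y′))

    -- The two walks change sides at each rung: P now ends at x′ and P′ at y′, hence the swapped
    -- indices of the new state.
    rung : ∀ {x y x′ y′ X D j} → State x y X (x′ ∷ y′ ∷ D) j → R x x′ → R y y′ → Linkable y′ x′ → Ok x′ → Ok y′ →
           x′ ∉ D → y′ ∉ D → length D + j ≤ 40 → State y′ x′ (X ⊕ (pairInd x x′ ⊕ pairInd y y′)) D (j + 7)
    rung {x} {y} {x′} {y′} {X} {D} {j} s xx yy l ox oy x∉ y∉ d = build (l (S.P ++ D) bound)
      where
      module S = State s
      bound : length (S.P ++ D) ≤ 40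
      bound = ≤-trans (≤-reflexive (length-++ S.P)) (lin (length S.P ∷ length D ∷ j ∷ [])
        ((x₀ ≲ x₂) ∷ (x₁ :+ x₂ ≲ con 40) ∷ []) (x₀ :+ x₁ ≲ con 40) S.short d)
      build : ∃ (λ (b : Bridge R y′ x′ (S.P ++ D)) → All (λ v → v ≡ y′ ⊎ v ≡ x′ ⊎ Ok v) (Bridge.list b)) →
              State y′ x′ (X ⊕ (pairInd x x′ ⊕ pairInd y y′)) D (j + 7)
      build (b , oks) = record
        { walk = join S.walk yy walk ; walk′ = join S.walk′ xx (rev R-sym walk) ; perm = ++⁺ S.perm (↭-sym (↭-reverse list))
        ; unique = Uniq.++⁺ S.unique unique disj
        ; ok = Allₚ.++⁺ S.ok (All.map okk oks)
        ; avoids = Allₚ.++⁺ (All.map (λ f → f ∘ there ∘ there) S.avoids) (All.map out fresh)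
        ; short = ≤-trans (≤-reflexive (length-++ S.P)) (S.short ⊹ short)
        ; value = rung-value S.walk S.walk′ walk S.value }
        where
        open Bridge b
        out : ∀ {v} → v ≡ y′ ⊎ v ≡ x′ ⊎ v ∉ S.P ++ D → v ∉ D
        out (inj₁ refl)        = y∉
        out (inj₂ (inj₁ refl)) = x∉
        out (inj₂ (inj₂ v∉))   = v∉ ∘ ∈-++⁺ʳ S.P
        disj : ∀ {v} → v ∈ S.P × v ∈ list → ⊥
        disj (i , k) with All.lookup fresh k
        ... | inj₁ refl        = All.lookup S.avoids i (there (here refl))
        ... | inj₂ (inj₁ refl) = All.lookup S.avoids i (here refl)
        ... | inj₂ (inj₂ v∉)   = v∉ (∈-++⁺ˡ i)
        okk : ∀ {v} → v ≡ y′ ⊎ v ≡ x′ ⊎ Ok v → Ok v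
        okk (inj₁ refl)        = oy
        okk (inj₂ (inj₁ refl)) = ox
        okk (inj₂ (inj₂ o))    = o

    close : ∀ {x y X j} → State x y X (z ∷ []) j → R x z → R y z → Ok z → j + 1 ≤ 30 → Z (X ∷ pairInd x z ∷ pairInd y z ∷ [])
    close {x} {y} {X} s xz yz oz d = comb
      (walkEdges (S.P ++ z ∷ []) ∷ walkEdges (S.P′ ++ z ∷ []) ∷ walkEdges S.P ∷ walkEdges S.P′ ∷ zeroV ∷ X ∷ pairInd x z ∷ pairInd y z ∷ [])
      ((0 ∷ 1 ∷ []) ∷ (0 ∷ 2 ∷ 7 ∷ 4 ∷ []) ∷ (1 ∷ 3 ∷ 6 ∷ 4 ∷ []) ∷ (2 ∷ 3 ∷ 5 ∷ []) ∷ []) (5 ∷ 6 ∷ 7 ∷ [])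
      (switch (join S.walk yz end) (join S.walk′ xz end) (++⁺ʳ _ S.perm)
        (Uniq.++⁺ S.unique ([] ∷ []) λ { (i , here refl) → All.lookup S.avoids i (here refl) })
        (Allₚ.++⁺ S.ok (oz ∷ [])) (≤-trans (≤-reflexive (length-++ S.P)) (≤-trans (+-monoˡ-≤ 1 S.short) d)))
      (Z-join S.walk (end {R = R})) (Z-join S.walk′ (end {R = R})) S.value
      where module S = State s

    private
      ∉₁ : ∀ {v a : V} → v ≢ a → v ∉ a ∷ []
      ∉₁ f (here e) = f e
      ∉₃ : ∀ {v a b c : V} → v ≢ a → v ≢ b → v ≢ c → v ∉ a ∷ b ∷ c ∷ []
      ∉₃ f g h = Allₚ.All¬⇒¬Any (f ∷ g ∷ h ∷ [])
      ∉₅ : ∀ {v a b c d e : V} → v ≢ a → v ≢ b → v ≢ c → v ≢ d → v ≢ e → v ∉ a ∷ b ∷ c ∷ d ∷ e ∷ []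
      ∉₅ f g h i j = Allₚ.All¬⇒¬Any (f ∷ g ∷ h ∷ i ∷ j ∷ [])

    -- The four edges of the cycle r x z y are exactly what distinguishes the two walks of a ladder
    -- whose sides meet at r and z. Each level adds a bridge of at most seven vertices, so cycles of
    -- length four, six and eight need walks of at most 9, 16 and 23 vertices.
    even₄ : ∀ {x y} → R r x → R x z → R r y → R y z → Linkable x y → Unique (r ∷ x ∷ y ∷ z ∷ []) →
            Ok r → Ok x → Ok y → Ok z → Z (pairInd r x ∷ pairInd x z ∷ pairInd r y ∷ pairInd y z ∷ [])
    even₄ {x} {y} rx xz ry yz l ((rx≢ ∷ ry≢ ∷ rz ∷ []) ∷ (xy ∷ xz≢ ∷ []) ∷ (yz≢ ∷ []) ∷ _) or ox oy oz = comb
      (pairInd r x ∷ pairInd x z ∷ pairInd r y ∷ pairInd y z ∷ (pairInd r x ⊕ pairInd r y) ∷ [])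
      ((4 ∷ 0 ∷ 2 ∷ []) ∷ (4 ∷ 1 ∷ 3 ∷ []) ∷ []) (0 ∷ 1 ∷ 2 ∷ 3 ∷ [])
      (Z-⊕ (pairInd r x) (pairInd r y))
      (close (init rx ry l ((rx≢ ∷ ry≢ ∷ []) ∷ (xy ∷ []) ∷ [] ∷ []) or ox oy (∉₁ rz ∷ ∉₁ xz≢ ∷ ∉₁ yz≢ ∷ []) (le 1 39))
        xz yz oz (le 9 30))

    even₆ : ∀ {x y x′ y′} → R r x → R x x′ → R x′ z → R r y → R y y′ → R y′ z → Linkable x y → Linkable y′ x′ →
            Unique (r ∷ x ∷ y ∷ x′ ∷ y′ ∷ z ∷ []) → All Ok (r ∷ x ∷ y ∷ x′ ∷ y′ ∷ z ∷ []) →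
            Z (pairInd r x ∷ pairInd x x′ ∷ pairInd x′ z ∷ pairInd r y ∷ pairInd y y′ ∷ pairInd y′ z ∷ [])
    even₆ {x} {y} {x′} {y′} rx xx xz ry yy yz l l′
      ((rx≢ ∷ ry≢ ∷ rx′ ∷ ry′ ∷ rz ∷ []) ∷ (xy ∷ xx′ ∷ xy′ ∷ xz≢ ∷ []) ∷ (yx′ ∷ yy′ ∷ yz≢ ∷ []) ∷ (x′y′ ∷ x′z ∷ []) ∷ (y′z ∷ []) ∷ _)
      (or ∷ ox ∷ oy ∷ ox′ ∷ oy′ ∷ oz ∷ []) = comb
      (pairInd r x ∷ pairInd x x′ ∷ pairInd x′ z ∷ pairInd r y ∷ pairInd y y′ ∷ pairInd y′ z ∷ (pairInd r x ⊕ pairInd r y) ∷ (pairInd x x′ ⊕ pairInd y y′) ∷ ((pairInd r x ⊕ pairInd r y) ⊕ (pairInd x x′ ⊕ pairInd y y′)) ∷ [])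
      ((6 ∷ 0 ∷ 3 ∷ []) ∷ (7 ∷ 1 ∷ 4 ∷ []) ∷ (8 ∷ 6 ∷ 7 ∷ []) ∷ (8 ∷ 5 ∷ 2 ∷ []) ∷ []) (0 ∷ 1 ∷ 2 ∷ 3 ∷ 4 ∷ 5 ∷ [])
      (Z-⊕ (pairInd r x) (pairInd r y)) (Z-⊕ (pairInd x x′) (pairInd y y′)) (Z-⊕ (pairInd r x ⊕ pairInd r y) (pairInd x x′ ⊕ pairInd y y′))
      (close (rung (init rx ry l ((rx≢ ∷ ry≢ ∷ []) ∷ (xy ∷ []) ∷ [] ∷ []) or ox oy
          (∉₃ rx′ ry′ rz ∷ ∉₃ xx′ xy′ xz≢ ∷ ∉₃ yx′ yy′ yz≢ ∷ []) (le 3 39))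
        xx yy l′ ox′ oy′ (∉₁ x′z) (∉₁ y′z) (le 9 40)) yz xz oz (le 16 30))

    even₈ : ∀ {x y x′ y′ x″ y″} → R r x → R x x′ → R x′ x″ → R x″ z → R r y → R y y′ → R y′ y″ → R y″ z →
            Linkable x y → Linkable y′ x′ → Linkable x″ y″ →
            Unique (r ∷ x ∷ y ∷ x′ ∷ y′ ∷ x″ ∷ y″ ∷ z ∷ []) → All Ok (r ∷ x ∷ y ∷ x′ ∷ y′ ∷ x″ ∷ y″ ∷ z ∷ []) →
            Z (pairInd r x ∷ pairInd x x′ ∷ pairInd x′ x″ ∷ pairInd x″ z ∷ pairInd r y ∷ pairInd y y′ ∷ pairInd y′ y″ ∷ pairInd y″ z ∷ [])
    even₈ {x} {y} {x′} {y′} {x″} {y″} rx xx xx″ xz ry yy yy″ yz l l′ l″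
      ((rx≢ ∷ ry≢ ∷ rx′ ∷ ry′ ∷ rx″ ∷ ry″ ∷ rz ∷ []) ∷ (xy ∷ xx′ ∷ xy′ ∷ xx″≢ ∷ xy″ ∷ xz≢ ∷ []) ∷ (yx′ ∷ yy′ ∷ yx″ ∷ yy″≢ ∷ yz≢ ∷ [])
       ∷ (x′y′ ∷ x′x″ ∷ x′y″ ∷ x′z ∷ []) ∷ (y′x″ ∷ y′y″ ∷ y′z ∷ []) ∷ (x″y″ ∷ x″z ∷ []) ∷ (y″z ∷ []) ∷ _)
      (or ∷ ox ∷ oy ∷ ox′ ∷ oy′ ∷ ox″ ∷ oy″ ∷ oz ∷ []) = comb
      (pairInd r x ∷ pairInd x x′ ∷ pairInd x′ x″ ∷ pairInd x″ z ∷ pairInd r y ∷ pairInd y y′ ∷ pairInd y′ y″ ∷ pairInd y″ z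
       ∷ A ∷ B ∷ (A ⊕ B) ∷ C ∷ ((A ⊕ B) ⊕ C) ∷ [])
      ((8 ∷ 0 ∷ 4 ∷ []) ∷ (9 ∷ 1 ∷ 5 ∷ []) ∷ (10 ∷ 8 ∷ 9 ∷ []) ∷ (11 ∷ 6 ∷ 2 ∷ []) ∷ (12 ∷ 10 ∷ 11 ∷ []) ∷ (12 ∷ 3 ∷ 7 ∷ []) ∷ [])
      (0 ∷ 1 ∷ 2 ∷ 3 ∷ 4 ∷ 5 ∷ 6 ∷ 7 ∷ [])
      (Z-⊕ (pairInd r x) (pairInd r y)) (Z-⊕ (pairInd x x′) (pairInd y y′)) (Z-⊕ A B) (Z-⊕ (pairInd y′ y″) (pairInd x′ x″)) (Z-⊕ (A ⊕ B) C)
      (close (rung (rung (init rx ry l ((rx≢ ∷ ry≢ ∷ []) ∷ (xy ∷ []) ∷ [] ∷ []) or ox oy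
          (∉₅ rx′ ry′ ry″ rx″ rz ∷ ∉₅ xx′ xy′ xy″ xx″≢ xz≢ ∷ ∉₅ yx′ yy′ yy″≢ yx″ yz≢ ∷ []) (le 5 39))
        xx yy l′ ox′ oy′ (∉₃ x′y″ x′x″ x′z) (∉₃ y′y″ y′x″ y′z) (le 11 40))
        yy″ xx″ l″ oy″ ox″ (∉₁ y″z) (∉₁ x″z) (le 16 40)) xz yz oz (le 23 30))
      where
      A = pairInd r x ⊕ pairInd r y
      B = pairInd x x′ ⊕ pairInd y y′
      C = pairInd y′ y″ ⊕ pairInd x′ x″

-- Values of short paths from a root.

module Rooted {n : ℕ} (G : Graph n) where

  open Space G
  open Ladder G

  private
    V = Fin n
    E = EdgeVec n

  Z₃ : ∀ (a b c d : V) → Z (walkEdges (a ∷ b ∷ c ∷ d ∷ []) ∷ pairInd a b ∷ pairInd b c ∷ pairInd c d ∷ [])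
  Z₃ a b c d = comb (walkEdges (a ∷ b ∷ c ∷ d ∷ []) ∷ pairInd a b ∷ pairInd b c ∷ pairInd c d ∷ walkEdges (b ∷ c ∷ d ∷ []) ∷ walkEdges (c ∷ d ∷ []) ∷ zeroV ∷ [])
    ((0 ∷ 1 ∷ 4 ∷ []) ∷ (4 ∷ 2 ∷ 5 ∷ []) ∷ (5 ∷ 3 ∷ 6 ∷ []) ∷ (6 ∷ []) ∷ []) (0 ∷ 1 ∷ 2 ∷ 3 ∷ [])
    (Z-⊕ (pairInd a b) (walkEdges (b ∷ c ∷ d ∷ []))) (Z-⊕ (pairInd b c) (walkEdges (c ∷ d ∷ []))) (Z-⊕ (pairInd c d) zeroV) Z-zero

  Z₄ : ∀ (a b c d e : V) → Z (walkEdges (a ∷ b ∷ c ∷ d ∷ e ∷ []) ∷ pairInd a b ∷ pairInd b c ∷ pairInd c d ∷ pairInd d e ∷ [])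
  Z₄ a b c d e = comb (walkEdges (a ∷ b ∷ c ∷ d ∷ e ∷ []) ∷ pairInd a b ∷ walkEdges (b ∷ c ∷ d ∷ e ∷ []) ∷ pairInd b c ∷ pairInd c d ∷ pairInd d e ∷ [])
    ((0 ∷ 1 ∷ 2 ∷ []) ∷ (2 ∷ 3 ∷ 4 ∷ 5 ∷ []) ∷ []) (0 ∷ 1 ∷ 3 ∷ 4 ∷ 5 ∷ [])
    (Z-⊕ (pairInd a b) (walkEdges (b ∷ c ∷ d ∷ e ∷ []))) (Z₃ b c d e)

  record Path₃ (R : V → V → Set) (S : List V) (r a : V) (D : List V) : Set where
    constructor path₃
    field
      {p q}  : V
      r-p    : R r p
      p-q    : R p q
      q-a    : R q a
      unique : Unique (r ∷ p ∷ q ∷ a ∷ [])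
      avoids : All (_∉ D) (p ∷ q ∷ [])
      free   : All (_∉ S) (p ∷ q ∷ [])
    value : E
    value = walkEdges (r ∷ p ∷ q ∷ a ∷ [])

  record Path₄ (R : V → V → Set) (S : List V) (r y : V) (D : List V) : Set where
    constructor path₄
    field
      {p q s} : V
      r-p    : R r p
      p-q    : R p q
      q-s    : R q s
      s-y    : R s y
      unique : Unique (r ∷ p ∷ q ∷ s ∷ y ∷ [])
      avoids : All (_∉ D) (p ∷ q ∷ s ∷ [])
      free   : All (_∉ S) (p ∷ q ∷ s ∷ [])
    value : E
    value = walkEdges (r ∷ p ∷ q ∷ s ∷ y ∷ [])

  ∉-head : ∀ {v x : V} {xs} → v ∉ x ∷ xs → v ≢ x
  ∉-head f e = f (here e)

  ∉-tail : ∀ {v x : V} {xs} → v ∉ x ∷ xs → v ∉ xs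
  ∉-tail f i = f (there i)

  ∉-cons : ∀ {v x : V} {xs} → v ≢ x → v ∉ xs → v ∉ x ∷ xs
  ∉-cons ne f (here e)  = ne e
  ∉-cons ne f (there i) = f i

  ∉-left : ∀ {v : V} xs {ys} → v ∉ xs ++ ys → v ∉ xs
  ∉-left xs f i = f (∈-++⁺ˡ i)

  ∉-right : ∀ {v : V} xs {ys} → v ∉ xs ++ ys → v ∉ ys
  ∉-right xs f i = f (∈-++⁺ʳ xs i)

  make₃ : ∀ {R S r a D p q} → R r p → R p q → R q a → r ≢ a → p ≢ q → p ∉ r ∷ a ∷ D ++ S → q ∉ r ∷ a ∷ D ++ S → Path₃ R S r a D
  make₃ {D = D} rp pq qa r≢a p≢q p∉ q∉ = path₃ rp pq qa
    ((≢-sym (∉-head p∉) ∷ ≢-sym (∉-head q∉) ∷ r≢a ∷ []) ∷ (p≢q ∷ ∉-head (∉-tail p∉) ∷ []) ∷ (∉-head (∉-tail q∉) ∷ []) ∷ [] ∷ [])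
    (∉-left D (∉-tail (∉-tail p∉)) ∷ ∉-left D (∉-tail (∉-tail q∉)) ∷ [])
    (∉-right D (∉-tail (∉-tail p∉)) ∷ ∉-right D (∉-tail (∉-tail q∉)) ∷ [])

  extend₄ : ∀ {R S r s y D} → R s y → r ≢ y → s ≢ y → s ∉ D ++ S → Path₃ R S r s (y ∷ D) → Path₄ R S r y D
  extend₄ {D = D} sy r≢y s≢y s∉ (path₃ rp pq qs ((r≢p ∷ r≢q ∷ r≢s ∷ []) ∷ (p≢q ∷ p≢s ∷ []) ∷ (q≢s ∷ []) ∷ _) (np ∷ nq ∷ []) (p∉ ∷ q∉ ∷ [])) =
    path₄ rp pq qs sy
      ((r≢p ∷ r≢q ∷ r≢s ∷ r≢y ∷ []) ∷ (p≢q ∷ p≢s ∷ ∉-head np ∷ []) ∷ (q≢s ∷ ∉-head nq ∷ []) ∷ (s≢y ∷ []) ∷ [] ∷ [])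
      (∉-tail np ∷ ∉-tail nq ∷ ∉-left D s∉ ∷ []) (p∉ ∷ q∉ ∷ ∉-right D s∉ ∷ [])

  -- `side false` holds at even, `side true` at odd distance from the root; in a non-bipartite setting both are everything.
  -- Vertices of S may occur on a switched walk only as its end z or as one prescribed interior vertex a.
  module At (R : V → V → Set) (R-sym : ∀ {x y} → R x y → R y x) (R-irr : ∀ {x y} → R x y → x ≢ y)
    (side : Bool → V → Set) (side-step : ∀ {b x y} → R x y → side b x → side (not b) y)
    (S : List V) (s : ℕ) (|S|≤s : length S ≤ s) (r : V) (r∉S : r ∉ S) (r-side : side false r)
    (bridge : ∀ {b x y} D → side b x → side b y → x ≢ y → length D ≤ 40 + s → Bridge R x y D)
    (switch : ∀ {a z Λ Λ′} → side true a → a ∉ S ⊎ z ∉ S → Walk R r z Λ → Walk R r z Λ′ → Λ ↭ Λ′ → Unique Λ →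
              All (λ v → v ≡ a ⊎ v ≡ z ⊎ v ∉ S) Λ → length Λ ≤ 30 → Z (walkEdges Λ ∷ walkEdges Λ′ ∷ []))
    where

    private
      Path₃′ Path₄′ : V → List V → Set
      Path₃′ = Path₃ R S r
      Path₄′ = Path₄ R S r

    module _ (third : ∀ {a} D → side true a → a ≢ r → length D ≤ 20 → Path₃′ a D)
             (fourth : ∀ {y} D → side false y → y ≢ r → length D ≤ 20 → Path₄′ y D) where

      private
        Allowed : V → V → V → Set
        Allowed a z v = v ≡ a ⊎ v ≡ z ⊎ v ∉ S

        link : ∀ {b x y} {Ok : V → Set} → (∀ {v} → v ∉ S → Ok v) → side b x → side b y → x ≢ y →
               ∀ D → length D ≤ 40 → ∃ λ (br : Bridge R x y D) → All (λ v → v ≡ x ⊎ v ≡ y ⊎ Ok v) (Bridge.list br)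
        link {x = x} {y} {Ok} f sx sy ne D d = record { walk = walk ; unique = unique ; fresh = All.map left fresh ; short = short } , All.map right fresh
          where
          open Bridge (bridge (D ++ S) sx sy ne (≤-trans (≤-reflexive (length-++ D)) (d ⊹ |S|≤s)))
          left : ∀ {v} → v ≡ x ⊎ v ≡ y ⊎ v ∉ D ++ S → v ≡ x ⊎ v ≡ y ⊎ v ∉ D
          left (inj₁ e)        = inj₁ e
          left (inj₂ (inj₁ e)) = inj₂ (inj₁ e)
          left (inj₂ (inj₂ k)) = inj₂ (inj₂ (k ∘ ∈-++⁺ˡ))
          right : ∀ {v} → v ≡ x ⊎ v ≡ y ⊎ v ∉ D ++ S → v ≡ x ⊎ v ≡ y ⊎ Ok v
          right (inj₁ e)        = inj₁ e
          right (inj₂ (inj₁ e)) = inj₂ (inj₁ e)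
          right (inj₂ (inj₂ k)) = inj₂ (inj₂ (f (k ∘ ∈-++⁺ʳ D)))

        module Rg {a z} (sa : side true a) (ok : a ∉ S ⊎ z ∉ S) =
          Rungs R R-sym r z (Allowed a z) (switch sa ok)

      -- Together the two paths form a six-cycle in which r and a are opposite.
      same₃ : ∀ {a D D′} (P : Path₃′ a D) (Q : Path₃′ a D′) → Path₃.p Q ∉ Path₃.p P ∷ Path₃.q P ∷ [] →
              Path₃.q Q ∉ Path₃.p P ∷ Path₃.q P ∷ [] → Z (Path₃.value P ∷ Path₃.value Q ∷ [])
      same₃ {a} (path₃ {p} {q} rp pq qa ((r≢p ∷ r≢q ∷ r≢a ∷ []) ∷ (p≢q ∷ p≢a ∷ []) ∷ (q≢a ∷ []) ∷ _) _ (p∉ ∷ q∉ ∷ []))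
            (path₃ {p′} {q′} rp′ pq′ qa′ ((r≢p′ ∷ r≢q′ ∷ _ ∷ []) ∷ (p′≢q′ ∷ p′≢a ∷ []) ∷ (q′≢a ∷ []) ∷ _) _ (p′∉ ∷ q′∉ ∷ [])) new new′ =
        comb (walkEdges (r ∷ p ∷ q ∷ a ∷ []) ∷ walkEdges (r ∷ p′ ∷ q′ ∷ a ∷ []) ∷ pairInd r p ∷ pairInd p q ∷ pairInd q a ∷ pairInd r p′ ∷ pairInd p′ q′ ∷ pairInd q′ a ∷ [])
          ((0 ∷ 2 ∷ 3 ∷ 4 ∷ []) ∷ (1 ∷ 5 ∷ 6 ∷ 7 ∷ []) ∷ (2 ∷ 3 ∷ 4 ∷ 5 ∷ 6 ∷ 7 ∷ []) ∷ []) (0 ∷ 1 ∷ [])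
          (Z₃ r p q a) (Z₃ r p′ q′ a)
          (Rg.even₆ sp (inj₁ p∉) rp pq qa rp′ pq′ qa′ (link free sp sp′ (λ e → new (here (sym e)))) (link free sq′ sq (λ e → new′ (there (here e))))
            ((r≢p ∷ r≢p′ ∷ r≢q ∷ r≢q′ ∷ r≢a ∷ []) ∷ ((λ e → new (here (sym e))) ∷ p≢q ∷ (λ e → new′ (here (sym e))) ∷ p≢a ∷ [])
              ∷ ((λ e → new (there (here e))) ∷ p′≢q′ ∷ p′≢a ∷ []) ∷ ((λ e → new′ (there (here (sym e)))) ∷ q≢a ∷ []) ∷ (q′≢a ∷ []) ∷ [] ∷ [])
            (free r∉S ∷ free p∉ ∷ free p′∉ ∷ free q∉ ∷ free q′∉ ∷ inj₂ (inj₁ refl) ∷ []))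
        where
        free : ∀ {v} → v ∉ S → Allowed p a v
        free f = inj₂ (inj₂ f)
        sp = side-step rp r-side
        sp′ = side-step rp′ r-side
        sq = side-step pq sp
        sq′ = side-step pq′ sp′

      -- The first path may pass through the exceptional vertex s.
      same₄ : ∀ {y p q s D} → R r p → R p q → R q s → R s y → Unique (r ∷ p ∷ q ∷ s ∷ y ∷ []) → p ∉ S → q ∉ S → s ∉ S ⊎ y ∉ S →
              (Q : Path₄′ y D) → All (_∉ p ∷ q ∷ s ∷ []) (Path₄.p Q ∷ Path₄.q Q ∷ Path₄.s Q ∷ []) →
              Z (walkEdges (r ∷ p ∷ q ∷ s ∷ y ∷ []) ∷ Path₄.value Q ∷ [])
      same₄ {y} {p} {q} {s} rp pq qs sy ((r≢p ∷ r≢q ∷ r≢s ∷ r≢y ∷ []) ∷ (p≢q ∷ p≢s ∷ p≢y ∷ []) ∷ (q≢s ∷ q≢y ∷ []) ∷ (s≢y ∷ []) ∷ _) p∉ q∉ ok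
            (path₄ {p′} {q′} {s′} rp′ pq′ qs′ sy′ ((r≢p′ ∷ r≢q′ ∷ r≢s′ ∷ _ ∷ []) ∷ (p′≢q′ ∷ p′≢s′ ∷ p′≢y ∷ []) ∷ (q′≢s′ ∷ q′≢y ∷ []) ∷ (s′≢y ∷ []) ∷ _) _ (p′∉ ∷ q′∉ ∷ s′∉ ∷ [])) (np ∷ nq ∷ ns ∷ []) =
        comb (walkEdges (r ∷ p ∷ q ∷ s ∷ y ∷ []) ∷ walkEdges (r ∷ p′ ∷ q′ ∷ s′ ∷ y ∷ []) ∷ pairInd r p ∷ pairInd p q ∷ pairInd q s ∷ pairInd s y ∷ pairInd r p′ ∷ pairInd p′ q′ ∷ pairInd q′ s′ ∷ pairInd s′ y ∷ [])
          ((0 ∷ 2 ∷ 3 ∷ 4 ∷ 5 ∷ []) ∷ (1 ∷ 6 ∷ 7 ∷ 8 ∷ 9 ∷ []) ∷ (2 ∷ 3 ∷ 4 ∷ 5 ∷ 6 ∷ 7 ∷ 8 ∷ 9 ∷ []) ∷ []) (0 ∷ 1 ∷ [])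
          (Z₄ r p q s y) (Z₄ r p′ q′ s′ y)
          (Rg.even₈ ss ok rp pq qs sy rp′ pq′ qs′ sy′
            (link free sp sp′ (λ e → np (here (sym e)))) (link free sq′ sq (λ e → nq (there (here e)))) (link free ss ss′ (λ e → ns (there (there (here (sym e))))))
            ((r≢p ∷ r≢p′ ∷ r≢q ∷ r≢q′ ∷ r≢s ∷ r≢s′ ∷ r≢y ∷ [])
              ∷ ((λ e → np (here (sym e))) ∷ p≢q ∷ (λ e → nq (here (sym e))) ∷ p≢s ∷ (λ e → ns (here (sym e))) ∷ p≢y ∷ [])
              ∷ ((λ e → np (there (here e))) ∷ p′≢q′ ∷ (λ e → np (there (there (here e)))) ∷ p′≢s′ ∷ p′≢y ∷ [])
              ∷ ((λ e → nq (there (here (sym e)))) ∷ q≢s ∷ (λ e → ns (there (here (sym e)))) ∷ q≢y ∷ [])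
              ∷ ((λ e → nq (there (there (here e)))) ∷ q′≢s′ ∷ q′≢y ∷ [])
              ∷ ((λ e → ns (there (there (here (sym e))))) ∷ s≢y ∷ []) ∷ (s′≢y ∷ []) ∷ [] ∷ [])
            (free r∉S ∷ free p∉ ∷ free p′∉ ∷ free q∉ ∷ free q′∉ ∷ inj₁ refl ∷ free s′∉ ∷ inj₂ (inj₁ refl) ∷ []))
        where
        free : ∀ {v} → v ∉ S → Allowed s y v
        free f = inj₂ (inj₂ f)
        sp = side-step rp r-side
        sp′ = side-step rp′ r-side
        sq = side-step pq sp
        sq′ = side-step pq′ sp′
        ss = side-step qs sq
        ss′ = side-step qs′ sq′

      -- A fresh path P′ of length three to a, prolonged by the edge ay, has length four and ends at
      -- y. Two paths can be compared only if their interiors are disjoint. So P′ is chosen off P,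
      -- and the prolonged path and Q are both compared with a further path Q′ that avoids them.
      edge-value : ∀ {a y} (P : Path₃′ a []) (Q : Path₄′ y []) → side true a → side false y → a ≢ r → y ≢ r → R a y → a ∉ S ⊎ y ∉ S →
                   Z (pairInd a y ∷ Path₃.value P ∷ Path₄.value Q ∷ [])
      edge-value {a} {y} P@(path₃ {p₀} {q₀} _ _ _ _ _ _) Q@(path₄ {p₁} {q₁} {s₁} rp₁ pq₁ qs₁ sy₁ u₁ _ (f₁ ∷ f₂ ∷ f₃ ∷ [])) sa sy a≢r y≢r ay ok
        with third (p₀ ∷ q₀ ∷ y ∷ []) sa a≢r (le 3 20)
      ... | P′@(path₃ {p} {q} rp pq qa ((r≢p ∷ r≢q ∷ r≢a ∷ []) ∷ (p≢q ∷ p≢a ∷ []) ∷ (q≢a ∷ []) ∷ _) (np ∷ nq ∷ []) (p∉ ∷ q∉ ∷ []))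
        with fourth (p ∷ q ∷ a ∷ p₁ ∷ q₁ ∷ s₁ ∷ []) sy y≢r (le 6 20)
      ... | Q′@(path₄ {p′} {q′} {s′} _ _ _ _ _ av _) = comb
        (pairInd a y ∷ Path₃.value P ∷ Path₄.value Q ∷ Path₃.value P′ ∷ Path₄.value Q′ ∷ walkEdges (r ∷ p ∷ q ∷ a ∷ y ∷ []) ∷ pairInd r p ∷ pairInd p q ∷ pairInd q a ∷ [])
        ((1 ∷ 3 ∷ []) ∷ (5 ∷ 4 ∷ []) ∷ (2 ∷ 4 ∷ []) ∷ (3 ∷ 6 ∷ 7 ∷ 8 ∷ []) ∷ (5 ∷ 6 ∷ 7 ∷ 8 ∷ 0 ∷ []) ∷ []) (0 ∷ 1 ∷ 2 ∷ [])
        (same₃ P P′ (np ∘ first) (nq ∘ first))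
        (same₄ rp pq qa ay ((r≢p ∷ r≢q ∷ r≢a ∷ (≢-sym y≢r) ∷ []) ∷ (p≢q ∷ p≢a ∷ (λ { refl → np (there (there (here refl))) }) ∷ [])
          ∷ (q≢a ∷ (λ { refl → nq (there (there (here refl))) }) ∷ []) ∷ (R-irr ay ∷ []) ∷ [] ∷ []) p∉ q∉ ok Q′ (All.map (λ k → k ∘ low) av))
        (same₄ rp₁ pq₁ qs₁ sy₁ u₁ f₁ f₂ (inj₁ f₃) Q′ (All.map (λ k → k ∘ there ∘ there ∘ there) av))
        (Z₃ r p q a) (Z₄ r p q a y)
        where
        first : ∀ {v} → v ∈ p₀ ∷ q₀ ∷ [] → v ∈ p₀ ∷ q₀ ∷ y ∷ []
        first (here e)         = here e
        first (there (here e)) = there (here e)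
        low : ∀ {v} → v ∈ p ∷ q ∷ a ∷ [] → v ∈ p ∷ q ∷ a ∷ p₁ ∷ q₁ ∷ s₁ ∷ []
        low = ∈-++⁺ˡ {xs = p ∷ q ∷ a ∷ []}

      root-value : ∀ {a} (P : Path₃′ a []) → side true a → R r a → Z (pairInd r a ∷ Path₃.value P ∷ [])
      root-value {a} (path₃ {p} {q} rp pq qa ((r≢p ∷ r≢q ∷ r≢a ∷ []) ∷ (p≢q ∷ p≢a ∷ []) ∷ (q≢a ∷ []) ∷ _) _ (p∉ ∷ q∉ ∷ [])) sa ra = comb
        (pairInd r a ∷ walkEdges (r ∷ p ∷ q ∷ a ∷ []) ∷ pairInd r p ∷ pairInd p q ∷ pairInd q a ∷ pairInd a q ∷ [])
        ((1 ∷ 2 ∷ 3 ∷ 4 ∷ []) ∷ (4 ∷ 5 ∷ []) ∷ (0 ∷ 5 ∷ 2 ∷ 3 ∷ []) ∷ []) (0 ∷ 1 ∷ [])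
        (Z₃ r p q a) (Z-sym q a)
        (Rg.even₄ sa (inj₂ q∉) ra (R-sym qa) rp pq (link free sa (side-step rp r-side) (≢-sym p≢a))
          ((r≢a ∷ r≢p ∷ r≢q ∷ []) ∷ ((≢-sym p≢a) ∷ (≢-sym q≢a) ∷ []) ∷ (p≢q ∷ []) ∷ [] ∷ [])
          (free r∉S) (inj₁ refl) (free p∉) (inj₂ (inj₁ refl)))
        where
        free : ∀ {v} → v ∉ S → Allowed a q v
        free f = inj₂ (inj₂ f)

-- Dense sets and the potential on them.

module Denseness {n : ℕ} (G : Graph n) where

  open Space G
  open Ladder G
  open Rooted G

  private
    V = Fin n
    E = EdgeVec n

  Adj-sym : ∀ {x y} → Adj G x y → Adj G y x
  Adj-sym {x} {y} = subst T (Defs.sym G x y)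

  Adj-irr : ∀ {x y} → Adj G x y → x ≢ y
  Adj-irr {x} a refl = subst T (irrefl G x) a

  #-avoid : ∀ (p : V → Bool) D {d} → d + length D ≤ # p → d ≤ # (p ∖ ⟨ D ⟩)
  #-avoid p D {d} h = lin (# p ∷ # (p ∩ ⟨ D ⟩) ∷ # (p ∖ ⟨ D ⟩) ∷ length D ∷ d ∷ [])
    ((x₄ :+ x₃ ≲ x₀) ∷ (x₀ ≲ x₁ :+ x₂) ∷ (x₁ ≲ x₃) ∷ []) (x₄ ≲ x₂)
    h (≤-reflexive (#-split p ⟨ D ⟩)) (#-≤-length D λ x t → ⟨⟩∈ (proj₂ (∧-T {p x} t)))

  -- The slack e is the number of vertices that may be deleted from a neighbourhood before it falls
  -- below the size d at which any two sets are joined by an edge.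
  record Dense (A : V → Bool) (d e : ℕ) : Set where
    field
      edge : ∀ p q → p ⊑ A → q ⊑ A → d ≤ # p → d ≤ # q → ∃ λ x → ∃ λ y → T (p x) × T (q y) × Adj G x y
      deg  : ∀ {x} → T (A x) → d + e ≤ # (adj G x ∩ A)

  module _ {A : V → Bool} {d e : ℕ} (dense : Dense A d e) where

    open Dense dense

    abstract
      neighbour : ∀ {x} D → T (A x) → length D < e → ∃ λ y → T (A y) × Adj G x y × y ∉ D
      neighbour {x} D ax h with pick (adj G x ∩ A) D (lin (length D ∷ d ∷ # (adj G x ∩ A) ∷ e ∷ [])
          ((con 1 :+ x₀ ≲ x₃) ∷ (x₁ :+ x₃ ≲ x₂) ∷ []) (con 1 :+ x₀ ≲ x₂) h (deg ax))
      ... | y , t , y∉ = let (a , b) = ∧-T {adj G x y} t in y , b , a , y∉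

      connect : ∀ {x y} D → T (A x) → T (A y) → length D < e →
                ∃ λ p → ∃ λ q → T (A p) × T (A q) × Adj G x p × Adj G p q × Adj G q y × p ∉ D × q ∉ D
      connect {x} {y} D ax ay h with edge ((adj G x ∩ A) ∖ ⟨ D ⟩) ((adj G y ∩ A) ∖ ⟨ D ⟩)
          (λ v t → proj₂ (∧-T {adj G x v} (proj₁ (∧-T {adj G x v ∧ A v} t))))
          (λ v t → proj₂ (∧-T {adj G y v} (proj₁ (∧-T {adj G y v ∧ A v} t)))) (room ax) (room ay)
        where
        room : ∀ {x} → T (A x) → d ≤ # ((adj G x ∩ A) ∖ ⟨ D ⟩)
        room {x} ax = #-avoid (adj G x ∩ A) D (lin (length D ∷ d ∷ # (adj G x ∩ A) ∷ e ∷ [])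
          ((con 1 :+ x₀ ≲ x₃) ∷ (x₁ :+ x₃ ≲ x₂) ∷ []) (x₁ :+ x₀ ≲ x₂) h (deg ax))
      ... | p , q , tp , tq , pq with ∧-T {adj G x p ∧ A p} tp | ∧-T {adj G y q ∧ A q} tq
      ... | t₁ , n₁ | t₂ , n₂ with ∧-T {adj G x p} t₁ | ∧-T {adj G y q} t₂
      ... | xp , ap | yq , aq = p , q , ap , aq , xp , pq , Adj-sym yq , (λ i → not-T n₁ (∈⟨⟩ i)) , (λ i → not-T n₂ (∈⟨⟩ i))

  Within : (V → Bool) → V → V → Set
  Within A x y = Adj G x y × T (A x) × T (A y)

  Within-sym : ∀ {A x y} → Within A x y → Within A y x
  Within-sym (e , a , b) = Adj-sym e , b , a

  module DenseRoot {A : V → Bool} {d e : ℕ} (dense : Dense A d e) (200≤e : 200 ≤ e) where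

    private
      ok : ∀ {l} → l ≤ 150 → l < e
      ok h = ≤-trans (s≤s h) (≤-trans (le 151 200) 200≤e)

    abstract
      bridge : ∀ {x y} D → T (A x) → T (A y) → x ≢ y → length D ≤ 50 → Bridge (Within A) x y D
      bridge {x} {y} D ax ay x≢y h with connect dense (x ∷ y ∷ D) ax ay (ok (≤-trans (s≤s (s≤s h)) (le 52 150)))
      ... | p , q , ap , aq , xp , pq , qy , p∉ , q∉ = record
        { walk = step (xp , ax , ap) (step (pq , ap , aq) (step (qy , aq , ay) end))
        ; unique = ((λ { refl → p∉ (here refl) }) ∷ (λ { refl → q∉ (here refl) }) ∷ x≢y ∷ [])
                 ∷ (Adj-irr pq ∷ (λ { refl → p∉ (there (here refl)) }) ∷ []) ∷ (Adj-irr qy ∷ []) ∷ [] ∷ []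
        ; fresh = inj₁ refl ∷ inj₂ (inj₂ (p∉ ∘ there ∘ there)) ∷ inj₂ (inj₂ (q∉ ∘ there ∘ there)) ∷ inj₂ (inj₁ refl) ∷ []
        ; short = le 4 7 }

    module _ (S : List V) (|S|≤10 : length S ≤ 10) (r : V) (ar : T (A r)) (r∉S : r ∉ S)
      (switch : ∀ {a z Λ Λ′} → T (A a) → a ∉ S ⊎ z ∉ S → Walk (Within A) r z Λ → Walk (Within A) r z Λ′ → Λ ↭ Λ′ → Unique Λ →
                All (λ v → v ≡ a ⊎ v ≡ z ⊎ v ∉ S) Λ → length Λ ≤ 30 → Z (walkEdges Λ ∷ walkEdges Λ′ ∷ []))
      where

      private
        module At′ = At (Within A) Within-sym (λ (e , _) → Adj-irr e) (λ _ v → T (A v)) (λ (_ , _ , b) _ → b) S 10 |S|≤10 r r∉S ar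
          (λ {b} → bridge) switch
        Path₃′ Path₄′ : V → List V → Set
        Path₃′ = Path₃ (Within A) S r
        Path₄′ = Path₄ (Within A) S r

        abstract
          third : ∀ {a} D → T (A a) → a ≢ r → length D ≤ 30 → Path₃′ a D
          third {a} D aa a≢r h = build (connect dense (r ∷ a ∷ D ++ S) ar aa
            (ok (≤-trans (s≤s (s≤s (≤-trans (≤-reflexive (length-++ D)) (h ⊹ |S|≤10)))) (le 42 150))))
            where
            build : (∃ λ p → ∃ λ q → T (A p) × T (A q) × Adj G r p × Adj G p q × Adj G q a × p ∉ r ∷ a ∷ D ++ S × q ∉ r ∷ a ∷ D ++ S) → Path₃′ a D
            build (p , q , ap , aq , rp , pq , qa , p∉ , q∉) =
              make₃ (rp , ar , ap) (pq , ap , aq) (qa , aq , aa) (≢-sym a≢r) (Adj-irr pq) p∉ q∉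

          fourth : ∀ {y} D → T (A y) → y ≢ r → length D ≤ 20 → Path₄′ y D
          fourth {y} D ay y≢r h = build (neighbour dense (r ∷ D ++ S) ay
            (ok (≤-trans (s≤s (≤-trans (≤-reflexive (length-++ D)) (h ⊹ |S|≤10))) (le 31 150))))
            where
            build : (∃ λ s → T (A s) × Adj G y s × s ∉ r ∷ D ++ S) → Path₄′ y D
            build (s , as , ys , s∉) = extend₄ (Adj-sym ys , as , ay) (≢-sym y≢r) (≢-sym (Adj-irr ys)) (∉-tail s∉)
              (third (y ∷ D) as (∉-head s∉) (≤-trans (s≤s h) (le 21 30)))

          third′ : ∀ {a} D → T (A a) → a ≢ r → length D ≤ 20 → Path₃′ a D
          third′ D aa ne h = third D aa ne (≤-trans h (le 20 30))

          -- Values of chosen paths of length three and four from the root; `zeroV` at the root and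
          -- outside A is a dummy.
          τ υ : V → E
          τ y with T? (A y) | y ≟ r
          ... | yes ay | no ne = Path₃.value (third {y} [] ay ne z≤n)
          ... | yes ay | yes _ = zeroV
          ... | no _   | _     = zeroV
          υ y with T? (A y) | y ≟ r
          ... | yes ay | no ne = Path₄.value (fourth {y} [] ay ne z≤n)
          ... | yes ay | yes _ = zeroV
          ... | no _   | _     = zeroV

          τ-spec : ∀ y → T (A y) → y ≢ r → ∃ λ (P : Path₃′ y []) → τ y ≡ Path₃.value P
          τ-spec y ay ne with T? (A y) | y ≟ r
          ... | yes ay′ | no ne′ = third [] ay′ ne′ z≤n , refl
          ... | yes ay′ | yes e  = contradiction e ne
          ... | no ¬a   | _      = contradiction ay ¬a

          υ-spec : ∀ y → T (A y) → y ≢ r → ∃ λ (P : Path₄′ y []) → υ y ≡ Path₄.value P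
          υ-spec y ay ne with T? (A y) | y ≟ r
          ... | yes ay′ | no ne′ = fourth [] ay′ ne′ z≤n , refl
          ... | yes ay′ | yes e  = contradiction e ne
          ... | no ¬a   | _      = contradiction ay ¬a

        τυ : ∀ {x y} → Within A x y → x ≢ r → y ≢ r → x ∉ S ⊎ y ∉ S → Z (pairInd x y ∷ τ x ∷ υ y ∷ [])
        τυ {x} {y} e@(_ , ax , ay) x≢r y≢r ok with τ-spec x ax x≢r | υ-spec y ay y≢r
        ... | P , e₁ | Q , e₂ = subst₂ (λ X Y → Z (pairInd x y ∷ X ∷ Y ∷ [])) (sym e₁) (sym e₂) (At′.edge-value third′ fourth P Q ax ay x≢r y≢r e ok)

        -- Reading the edge in both directions gives τ x + υ y = τ y + υ x. So τ + υ, which compares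
        -- the odd with the even path to a vertex, is the same at both ends.
        shift-ε : ∀ {x y} → Within A x y → x ≢ r → y ≢ r → x ∉ S ⊎ y ∉ S → Z (τ x ∷ υ x ∷ τ y ∷ υ y ∷ [])
        shift-ε {x} {y} e x≢r y≢r ok = comb (τ x ∷ υ x ∷ τ y ∷ υ y ∷ pairInd x y ∷ pairInd y x ∷ [])
          ((4 ∷ 0 ∷ 3 ∷ []) ∷ (5 ∷ 2 ∷ 1 ∷ []) ∷ (4 ∷ 5 ∷ []) ∷ []) (0 ∷ 1 ∷ 2 ∷ 3 ∷ [])
          (τυ e x≢r y≢r ok) (τυ (Within-sym e) y≢r x≢r (swp ok)) (Z-sym x y)
          where
          swp : x ∉ S ⊎ y ∉ S → y ∉ S ⊎ x ∉ S
          swp (inj₁ a) = inj₂ a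
          swp (inj₂ a) = inj₁ a

        y₀-data = neighbour dense (r ∷ S) ar (ok (≤-trans (s≤s |S|≤10) (le 11 150)))
        y₀ = proj₁ y₀-data

      ε : E
      ε = τ y₀ ⊕ υ y₀

      private
        -- The constant travels from `y₀` to y along a path whose inner vertices avoid S, so every
        -- edge of it has an end outside S even if y lies in S.
        ε-const : ∀ {y} → T (A y) → y ≢ r → Z (τ y ∷ υ y ∷ ε ∷ [])
        ε-const {y} ay y≢r with connect dense (r ∷ S) (proj₁ (proj₂ y₀-data)) ay (ok (≤-trans (s≤s |S|≤10) (le 11 150)))
        ... | p , q , ap , aq , yp , pq , qy , p∉ , q∉ = comb
          (τ y ∷ υ y ∷ ε ∷ τ y₀ ∷ υ y₀ ∷ τ p ∷ υ p ∷ τ q ∷ υ q ∷ [])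
          ((2 ∷ 3 ∷ 4 ∷ []) ∷ (3 ∷ 4 ∷ 5 ∷ 6 ∷ []) ∷ (5 ∷ 6 ∷ 7 ∷ 8 ∷ []) ∷ (7 ∷ 8 ∷ 0 ∷ 1 ∷ []) ∷ []) (0 ∷ 1 ∷ 2 ∷ [])
          (Z-⊕ (τ y₀) (υ y₀)) (shift-ε (yp , proj₁ (proj₂ y₀-data) , ap) (λ e → proj₂ (proj₂ (proj₂ y₀-data)) (here e)) p≢r (inj₂ (p∉ ∘ there)))
          (shift-ε (pq , ap , aq) p≢r q≢r (inj₁ (p∉ ∘ there))) (shift-ε (qy , aq , ay) q≢r y≢r (inj₁ (q∉ ∘ there)))
          where
          p≢r = λ (e : p ≡ r) → p∉ (here e)
          q≢r = λ (e : q ≡ r) → q∉ (here e)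

      -- An edge at the root has the value τ y alone; the entry ε at r makes it obey the same
      -- formula with error as all other edges.
      potential : V → E
      potential y with y ≟ r
      ... | yes _ = ε
      ... | no _  = τ y

      private
        at-root : potential r ≡ ε
        at-root with r ≟ r
        ... | yes _ = refl
        ... | no ne = contradiction refl ne

        off-root : ∀ {y} → y ≢ r → potential y ≡ τ y
        off-root {y} ne with y ≟ r
        ... | yes e = contradiction e ne
        ... | no _  = refl

        root-edge : ∀ {y} → Within A r y → Z (pairInd r y ∷ potential r ∷ potential y ∷ ε ∷ [])
        root-edge {y} e@(ry , _ , ay) with τ-spec y ay (≢-sym (Adj-irr ry))
        ... | P , e₁ = subst₂ (λ X Y → Z (pairInd r y ∷ X ∷ Y ∷ ε ∷ [])) (sym at-root) (sym (trans (off-root (≢-sym (Adj-irr ry))) e₁))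
          (comb (pairInd r y ∷ Path₃.value P ∷ ε ∷ []) ((0 ∷ 1 ∷ []) ∷ []) (0 ∷ 2 ∷ 1 ∷ 2 ∷ []) (At′.root-value third′ fourth P ay e))

      potential-edge : ∀ {x y} → Within A x y → x ∉ S ⊎ y ∉ S → Z (pairInd x y ∷ potential x ∷ potential y ∷ ε ∷ [])
      potential-edge {x} {y} e@(xy , ax , ay) ok = split (x ≟ r) (y ≟ r)
        where
        split : Dec (x ≡ r) → Dec (y ≡ r) → Z (pairInd x y ∷ potential x ∷ potential y ∷ ε ∷ [])
        split (yes refl) _          = root-edge e
        split (no x≢r)   (yes refl) = comb (pairInd x y ∷ potential x ∷ potential y ∷ ε ∷ pairInd y x ∷ [])
          ((4 ∷ 2 ∷ 1 ∷ 3 ∷ []) ∷ (0 ∷ 4 ∷ []) ∷ []) (0 ∷ 1 ∷ 2 ∷ 3 ∷ []) (root-edge (Within-sym e)) (Z-sym x y)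
        split (no x≢r)   (no y≢r) = subst₂ (λ X Y → Z (pairInd x y ∷ X ∷ Y ∷ ε ∷ [])) (sym (off-root x≢r)) (sym (off-root y≢r)) (comb
          (pairInd x y ∷ τ x ∷ τ y ∷ ε ∷ υ y ∷ []) ((0 ∷ 1 ∷ 4 ∷ []) ∷ (2 ∷ 4 ∷ 3 ∷ []) ∷ []) (0 ∷ 1 ∷ 2 ∷ 3 ∷ [])
          (τυ e x≢r y≢r ok) (ε-const ay y≢r))

-- Absorbing vertices into a path.

module Absorption {n : ℕ} (G : Graph n) where

  open Denseness G

  private
    V = Fin n

  record HamPathIn (A : V → Bool) (D : List V) (u v : V) : Set where
    constructor hamPathIn
    field
      {list}   : List V
      walk     : Walk (Adj G) u v list
      unique   : Unique list
      sound    : All (λ x → T (A x) × x ∉ D) list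
      complete : ∀ {x} → T (A x) → x ∉ D → x ∈ list

  record Outside (A : V → Bool) (D xs : List V) (w : V) : Set where
    constructor outside
    field
      in-A : T (A w)
      ∉D   : w ∉ D
      ∉xs  : w ∉ xs

  abstract
    outside? : ∀ A D xs → ∃ (Outside A D xs) ⊎ (∀ {x} → T (A x) → x ∉ D → x ∈ xs)
    outside? A D xs = decide (1 ≤? # ((A ∖ ⟨ D ⟩) ∖ ⟨ xs ⟩))
      where
      decide : Dec (1 ≤ # ((A ∖ ⟨ D ⟩) ∖ ⟨ xs ⟩)) → ∃ (Outside A D xs) ⊎ (∀ {x} → T (A x) → x ∉ D → x ∈ xs)
      decide (yes h) = inj₁ (conv (#-find h))
        where
        conv : ∃ (λ x → T (((A ∖ ⟨ D ⟩) ∖ ⟨ xs ⟩) x)) → ∃ (Outside A D xs)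
        conv (x , t) = let (t₁ , t₂) = ∧-T {A x ∧ not (⟨ D ⟩ x)} t ; (t₃ , t₄) = ∧-T {A x} t₁ in
          x , outside t₃ (λ i → not-T t₄ (∈⟨⟩ i)) (λ i → not-T t₂ (∈⟨⟩ i))
      decide (no h) = inj₂ member
        where
        member : ∀ {x} → T (A x) → x ∉ D → x ∈ xs
        member {x} a d = by (x ∈? xs)
          where
          by : Dec (x ∈ xs) → x ∈ xs
          by (yes i) = i
          by (no ¬i) = contradiction (#-pos ((A ∖ ⟨ D ⟩) ∖ ⟨ xs ⟩) {x} (∧-intro (∧-intro a (not-intro (λ t → d (⟨⟩∈ t)))) (not-intro (λ t → ¬i (⟨⟩∈ t))))) h

  module _ {A : V → Bool} {d e : ℕ} (dense : Dense A d e) where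

    abstract
      -- The neighbours of w on the path have at least d successors. Density, applied to the
      -- successor set twice, provides the edge between two successors that the insertion needs.
      insert-vertex : ∀ {u v w xs} → Walk (Adj G) u v xs → Unique xs → All (λ x → T (A x)) xs → d + 1 ≤ cnt (adj G w) xs →
                      ∃ λ xs′ → Walk (Adj G) u v xs′ × xs′ ↭ w ∷ xs
      insert-vertex {u} {v} {w} {xs} h uq ax big = go (Dense.edge dense ⟨ ss ⟩ ⟨ ss ⟩ inA inA size size)
        where
        ss : List V
        ss = succs (adj G w) xs
        sub : ∀ {x} → x ∈ ss → x ∈ xs
        sub i with walk-∷ h
        ... | ys , refl = there (succs-∈ {R = Adj G} (adj G w) u i)
        inA : ⟨ ss ⟩ ⊑ A
        inA x t = All.lookup ax (sub (⟨⟩∈ t))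
        size : d ≤ # ⟨ ss ⟩
        size = ≤-trans (lin (d ∷ cnt (adj G w) xs ∷ length ss ∷ []) ((x₀ :+ con 1 ≲ x₁) ∷ (x₁ ≲ con 1 :+ x₂) ∷ []) (x₀ ≲ x₂)
          big (succs-length {R = Adj G} (adj G w) xs)) (≤-reflexive (sym (#-⟨⟩ (succs-unique {R = Adj G} (adj G w) uq))))
        go : (∃ λ x → ∃ λ y → T (⟨ ss ⟩ x) × T (⟨ ss ⟩ y) × Adj G x y) → ∃ λ xs′ → Walk (Adj G) u v xs′ × xs′ ↭ w ∷ xs
        go (x , y , tx , ty , xy) = insert Adj-sym {p = adj G w} h (λ x t → Adj-sym t) (⟨⟩∈ tx) (⟨⟩∈ ty) (Adj-irr xy) xy

      -- The callback `rich` may choose which missing vertex comes next; of the current path it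
      -- learns that it still contains the initial one.
      absorb : ∀ D {u v} xs₀ → Walk (Adj G) u v xs₀ → Unique xs₀ → All (λ x → T (A x) × x ∉ D) xs₀ →
               (∀ xs → (∀ {x} → x ∈ xs₀ → x ∈ xs) → Unique xs → All (λ x → T (A x) × x ∉ D) xs →
                 ∃ (Outside A D xs) → ∃ λ w → Outside A D xs w × d + 1 ≤ cnt (adj G w) xs) →
               HamPathIn A D u v
      absorb D {u} {v} xs₀ h₀ u₀ a₀ rich = go n xs₀ (≤-trans (m≤m+n n _) (≤-reflexive (+-comm n _))) h₀ u₀ a₀ id
        where
        go : ∀ j xs → n ≤ length xs + j → Walk (Adj G) u v xs → Unique xs → All (λ x → T (A x) × x ∉ D) xs →
             (∀ {x} → x ∈ xs₀ → x ∈ xs) → HamPathIn A D u v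
        -- The fuel is n. Once it is used up, the path has n vertices and contains everything.
        go zero xs big h uq ax sub = hamPathIn h uq ax λ {x} _ _ → full-length uq
          (≤-antisym (≤-trans (length-≤-# {p = Full} uq (All.tabulate (λ _ → tt))) (≤-reflexive #-Full)) (≤-trans big (≤-reflexive (+-identityʳ _)))) x
        go (suc j) xs big h uq ax sub = decide (outside? A D xs)
          where
          grow : (∃ λ w → Outside A D xs w × d + 1 ≤ cnt (adj G w) xs) → HamPathIn A D u v
          grow (w , outside aw w∉D w∉ , cw) = next (insert-vertex h uq (All.map proj₁ ax) cw)
            where
            next : (∃ λ xs′ → Walk (Adj G) u v xs′ × xs′ ↭ w ∷ xs) → HamPathIn A D u v
            next (xs′ , h′ , p) = go j xs′ (≤-trans big (≤-trans (≤-reflexive (+-suc _ j)) (≤-reflexive (cong (_+ j) (sym (↭-length p))))))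
              h′ (Unique-resp-↭ (↭-sym p) (Allₚ.¬Any⇒All¬ xs w∉ ∷ uq)) (All-resp-↭ (↭-sym p) ((aw , w∉D) ∷ ax))
              (λ i → ∈-resp-↭ (↭-sym p) (there (sub i)))
          decide : ∃ (Outside A D xs) ⊎ (∀ {x} → T (A x) → x ∉ D → x ∈ xs) → HamPathIn A D u v
          decide (inj₁ o) = grow (rich xs sub uq ax o)
          decide (inj₂ c) = hamPathIn h uq ax c

-- Splitting walks and scanning for crossing pairs.

module _ {A : Set} {R : A → A → Set} where

  prefix : ∀ {u v y : A} ls {rs} → Walk R u v (ls ++ y ∷ rs) → Walk R u y (ls ++ y ∷ [])
  prefix []           end        = end
  prefix []           (step _ _) = end
  prefix (x ∷ [])     (step e h) = step e (prefix [] h)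
  prefix (x ∷ l ∷ ls) (step e h) = step e (prefix (l ∷ ls) h)

  suffix : ∀ {u v y : A} ls {rs} → Walk R u v (ls ++ y ∷ rs) → Walk R y v (y ∷ rs)
  suffix []           end        = end
  suffix []           (step e h) = step e h
  suffix (x ∷ [])     (step e h) = suffix [] h
  suffix (x ∷ l ∷ ls) (step e h) = suffix (l ∷ ls) h

  before : ∀ {u v y : A} l ls {rs} → Walk R u v (l ∷ ls ++ y ∷ rs) → ∃ λ x → Walk R u x (l ∷ ls) × R x y
  before l []        (step e h) with walk-∷ h
  ... | _ , refl = _ , end , e
  before l (k ∷ ls) (step e h) with before k ls h
  ... | x , h′ , e′ = x , step e h′ , e′

module Scanning {A : Set} (P Q : A → Bool) where

  private
    ¬P ¬Q : A → Set
    ¬P x = ¬ T (P x)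
    ¬Q x = ¬ T (Q x)

  count : (A → Bool) → List A → ℕ
  count p xs = length (filter (λ x → T? (p x)) xs)

  -- P and Q will be the neighbourhoods of the first and the last vertex of a path. Either some
  -- Q-vertex precedes a P-vertex with a gap free of both, or all P-vertices come before all
  -- Q-vertices, where a single pivot t may belong to both.
  data Scan : List A → Set where
    close : ∀ ls q gs p rs → T (Q q) → T (P p) → All ¬P gs → All ¬Q gs → Scan (ls ++ q ∷ gs ++ p ∷ rs)
    split : ∀ ls rs → All ¬Q ls → All ¬P rs → Scan (ls ++ rs)
    split₁ : ∀ ls t rs → All ¬Q ls → All ¬P rs → Scan (ls ++ t ∷ rs)

  first : ∀ xs → All ¬P xs ⊎ (∃ λ gs → ∃ λ p → ∃ λ rs → xs ≡ gs ++ p ∷ rs × T (P p) × All ¬P gs)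
  first []       = inj₁ []
  first (x ∷ xs) with T? (P x) | first xs
  ... | yes t | _      = inj₂ ([] , x , xs , refl , t , [])
  ... | no ¬t | inj₁ a = inj₁ (¬t ∷ a)
  ... | no ¬t | inj₂ (gs , p , rs , refl , t , a) = inj₂ (x ∷ gs , p , rs , refl , t , ¬t ∷ a)

  scan : ∀ xs → Scan xs
  scan []       = split [] [] [] []
  scan (y ∷ ys) with scan ys
  ... | close ls q gs p rs tq tp a b = close (y ∷ ls) q gs p rs tq tp a b
  ... | split ls rs a b with T? (Q y)
  ...   | no ¬t = split (y ∷ ls) rs (¬t ∷ a) b
  ...   | yes t with first ls
  ...     | inj₁ c = split₁ [] y (ls ++ rs) [] (Allₚ.++⁺ c b)
  ...     | inj₂ (gs , p , us , refl , tp , c) = subst Scan (cong (y ∷_) (sym (++-assoc gs (p ∷ us) rs)))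
              (close [] y gs p (us ++ rs) t tp c (Allₚ.++⁻ˡ gs a))
  scan (y ∷ ys) | split₁ ls t′ rs a b with T? (Q y)
  ...   | no ¬t = split₁ (y ∷ ls) t′ rs (¬t ∷ a) b
  ...   | yes t with first ls
  ...     | inj₂ (gs , p , us , refl , tp , c) = subst Scan (cong (y ∷_) (sym (++-assoc gs (p ∷ us) (t′ ∷ rs))))
              (close [] y gs p (us ++ t′ ∷ rs) t tp c (Allₚ.++⁻ˡ gs a))
  ...     | inj₁ c with T? (P t′)
  ...       | yes t″ = close [] y ls t′ rs t t″ c a
  ...       | no ¬t″ = split₁ [] y (ls ++ t′ ∷ rs) [] (Allₚ.++⁺ c (¬t″ ∷ b))

  count-++ : ∀ p xs ys → count p (xs ++ ys) ≡ count p xs + count p ys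
  count-++ p []       ys = refl
  count-++ p (x ∷ xs) ys with p x
  ... | true  = cong suc (count-++ p xs ys)
  ... | false = count-++ p xs ys

  count-none : ∀ p xs → All (λ x → ¬ T (p x)) xs → count p xs ≡ 0
  count-none p []       []       = refl
  count-none p (x ∷ xs) (n ∷ ns) with p x in e
  ... | true  = contradiction tt n
  ... | false = count-none p xs ns

  Pair : List A → Set
  Pair xs = ∃ λ ls → ∃ λ q → ∃ λ p → ∃ λ rs → xs ≡ ls ++ q ∷ p ∷ rs × T (Q q) × T (P p)

  private
    tail-count : ∀ x zs → Pair (x ∷ zs) ⊎ count P zs + count Q (x ∷ zs) ≤ suc (length zs)
    tail-count x [] with Q x
    ... | true  = inj₂ (le 1 1)
    ... | false = inj₂ z≤n
    tail-count x (y ∷ zs) = go (tail-count y zs) (T? (Q x)) (T? (P y))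
      where
      add : count P zs + count Q (y ∷ zs) ≤ suc (length zs) → ¬ (T (Q x) × T (P y)) →
            count P (y ∷ zs) + count Q (x ∷ y ∷ zs) ≤ suc (suc (length zs))
      add h no-pair with P y | Q x
      ... | true  | true  = contradiction (tt , tt) no-pair
      ... | true  | false = s≤s h
      ... | false | true  = ≤-trans (≤-reflexive (+-suc _ _)) (s≤s h)
      ... | false | false = m≤n⇒m≤1+n h
      go : Pair (y ∷ zs) ⊎ count P zs + count Q (y ∷ zs) ≤ suc (length zs) → Dec (T (Q x)) → Dec (T (P y)) →
           Pair (x ∷ y ∷ zs) ⊎ count P (y ∷ zs) + count Q (x ∷ y ∷ zs) ≤ suc (suc (length zs))
      go (inj₁ (ls , q , p , rs , e , tq , tp)) _ _ = inj₁ (x ∷ ls , q , p , rs , cong (x ∷_) e , tq , tp)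
      go (inj₂ h) (yes tq) (yes tp) = inj₁ ([] , x , y , zs , refl , tq , tp)
      go (inj₂ h) (no ¬q)  _        = inj₂ (add h (λ (q , _) → ¬q q))
      go (inj₂ h) (yes _)  (no ¬p)  = inj₂ (add h (λ (_ , p) → ¬p p))

  -- The count behind the theorems of Dirac and Ore: without a pair, every P-vertex except possibly
  -- the first entry has a predecessor outside Q, and these predecessors are distinct.
  pair-or-few : ∀ xs → Pair xs ⊎ count P xs + count Q xs ≤ length xs + 1
  pair-or-few []       = inj₂ z≤n
  pair-or-few (x ∷ zs) with tail-count x zs
  ... | inj₁ pr = inj₁ pr
  ... | inj₂ h  = inj₂ (≤-trans (+-monoˡ-≤ (count Q (x ∷ zs)) head-count) (≤-trans (s≤s h) (≤-reflexive (+-comm 1 _))))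
    where
    head-count : count P (x ∷ zs) ≤ suc (count P zs)
    head-count with P x
    ... | true  = ≤-refl
    ... | false = n≤1+n _

-- Long cycles from nearly spanning paths.

module Robust {n : ℕ} (G : Graph n) where

  open Denseness G
  open Absorption G

  private
    V = Fin n

  record LongCycle (xs : List V) (c : ℕ) : Set where
    constructor longCycle
    field
      {u v}  : V
      {list} : List V
      walk   : Walk (Adj G) u v list
      closed : Adj G v u
      unique : Unique list
      inside : ∀ {x} → x ∈ list → x ∈ xs
      long   : length xs ≤ length list + c

  record HamCycleIn (D : List V) : Set where
    constructor hamCycleIn
    field
      {u v}    : V
      path     : HamPathIn Full D u v
      closed   : Adj G v u

  module _ (m d : ℕ) (n≡ : n ≡ 1 + (m + m)) (deg : ∀ v → m ≤ # (adj G v)) (d≤ : d + 300 ≤ m) (dense : Dense Full d 200) where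

    module Closing {X Y : V} {xs : List V} (h : Walk (Adj G) X Y xs) (uq : Unique xs) (D : List V) (|D|≤60 : length D ≤ 60)
      (complete : ∀ {x} → x ∉ D → x ∈ xs) where

      open Scanning (adj G X) (adj G Y)

      private
        total-count : m + m ≤ count (adj G X) xs + count (adj G Y) xs + 120
        total-count = lin (m ∷ count (adj G X) xs ∷ count (adj G Y) xs ∷ # (adj G X ∖ ⟨ xs ⟩) ∷ # (adj G Y ∖ ⟨ xs ⟩) ∷ [])
          ((x₀ ≲ x₁ :+ x₃) ∷ (x₀ ≲ x₂ :+ x₄) ∷ (x₃ ≲ con 60) ∷ (x₄ ≲ con 60) ∷ []) (x₀ :+ x₀ ≲ x₁ :+ x₂ :+ con 120)
          (≤-trans (deg X) (#-≤-cnt+ (adj G X) xs)) (≤-trans (deg Y) (#-≤-cnt+ (adj G Y) xs)) (rest X) (rest Y)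
          where
          rest : ∀ W → # (adj G W ∖ ⟨ xs ⟩) ≤ 60
          rest W = ≤-trans (#-≤-length D (λ x t → by x (x ∈? D) (λ i → not-T (proj₂ (∧-T {adj G W x} t)) (∈⟨⟩ i)))) |D|≤60
            where
            by : ∀ x → Dec (x ∈ D) → x ∉ xs → x ∈ D
            by x (yes i) _  = i
            by x (no ¬i) ¬j = contradiction (complete ¬i) ¬j

        |xs|≤ : length xs ≤ 1 + (m + m)
        |xs|≤ = ≤-trans (length-≤-# {p = Full} uq (All.tabulate (λ _ → tt))) (≤-reflexive (trans #-Full n≡))

        -- The gap is dropped: from X to q, over to Y, backwards to p and home to X.
        around : ∀ {ls q gs p rs} → xs ≡ ls ++ q ∷ gs ++ p ∷ rs → T (adj G Y q) → T (adj G X p) → length gs ≤ 200 → LongCycle xs 200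
        around {ls} {q} {gs} {p} {rs} refl tq tp |gs| = longCycle
          (join (prefix ls h) (Adj-sym tq) (rev Adj-sym (suffix (ls ++ q ∷ gs) (subst (Walk (Adj G) X Y) (sym (++-assoc ls (q ∷ gs) (p ∷ rs))) h))))
          (Adj-sym tp)
          (Unique-resp-↭ (++⁺ˡ (ls ++ q ∷ []) (↭-sym (↭-reverse (p ∷ rs)))) (drop-middle (ls ++ q ∷ []) gs uq′))
          (λ i → back (∈-++⁻ (ls ++ q ∷ []) i))
          (≤-trans (≤-reflexive len) (≤-trans (+-monoʳ-≤ (length new) |gs|) ≤-refl))
          where
          new = (ls ++ q ∷ []) ++ reverse (p ∷ rs)
          regroup : ls ++ q ∷ gs ++ p ∷ rs ≡ (ls ++ q ∷ []) ++ gs ++ p ∷ rs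
          regroup = sym (++-assoc ls (q ∷ []) (gs ++ p ∷ rs))
          uq′ : Unique ((ls ++ q ∷ []) ++ gs ++ p ∷ rs)
          uq′ = subst Unique regroup uq
          drop-middle : ∀ (as bs : List V) {cs} → Unique (as ++ bs ++ cs) → Unique (as ++ cs)
          drop-middle []       bs u = drop-left bs u
            where
            drop-left : ∀ (bs : List V) {cs} → Unique (bs ++ cs) → Unique cs
            drop-left []       u       = u
            drop-left (b ∷ bs) (_ ∷ u) = drop-left bs u
          drop-middle (a ∷ as) bs {cs} (x ∷ u) = Allₚ.++⁺ (Allₚ.++⁻ˡ as x) (Allₚ.++⁻ʳ bs (Allₚ.++⁻ʳ as x)) ∷ drop-middle as bs u
          back : ∀ {x} → x ∈ ls ++ q ∷ [] ⊎ x ∈ reverse (p ∷ rs) → x ∈ ls ++ q ∷ gs ++ p ∷ rs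
          back {x} (inj₁ i) = subst (x ∈_) (sym regroup) (∈-++⁺ˡ i)
          back {x} (inj₂ i) = subst (x ∈_) (sym regroup) (∈-++⁺ʳ (ls ++ q ∷ []) (∈-++⁺ʳ gs (∈-resp-↭ (↭-reverse (p ∷ rs)) i)))
          len : length (ls ++ q ∷ gs ++ p ∷ rs) ≡ length new + length gs
          len = trans (cong length regroup) (trans (length-++ (ls ++ q ∷ [])) (trans (cong (length (ls ++ q ∷ []) +_) (trans (length-++ gs) (+-comm (length gs) _)))
            (trans (sym (+-assoc (length (ls ++ q ∷ [])) (length (p ∷ rs)) (length gs)))
              (cong (_+ length gs) (trans (cong (length (ls ++ q ∷ []) +_) (sym (length-reverse (p ∷ rs)))) (sym (length-++ (ls ++ q ∷ []))))))))

        around-pair : ∀ as {zs bs} → Pair zs → xs ≡ as ++ zs ++ bs → LongCycle xs 200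
        around-pair as {bs = bs} (ls , q , p , rs , refl , tq , tp) e =
          around {as ++ ls} {q} {[]} {p} {rs ++ bs} (trans e (trans (cong (as ++_) (++-assoc ls (q ∷ p ∷ rs) bs)) (sym (++-assoc as ls (q ∷ p ∷ rs ++ bs))))) tq tp z≤n

        -- X …a p… a₁ b₁ …q b… Y with p ∼ X, q ∼ Y and a ∼ b closes up as X…a b…Y q…b₁ a₁…p.
        across : ∀ {a₁ b₁ ls rs} → Walk (Adj G) X a₁ ls → Adj G a₁ b₁ → Walk (Adj G) b₁ Y rs → xs ≡ ls ++ rs →
                 m ≤ count (adj G X) (reverse ls) + 70 → m ≤ count (adj G Y) rs + 70 → LongCycle xs 200
        across {a₁} {b₁} {ls} {rs} hl e hr refl big big′ = go (Dense.edge dense ⟨ ss ⟩ ⟨ tt′ ⟩ (λ _ _ → tt) (λ _ _ → tt)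
            (size (adj G X) (reverse ls) (Unique-resp-↭ (↭-sym (↭-reverse ls)) uql) big) (size (adj G Y) rs uqr big′))
          where
          ss = succs (adj G X) (reverse ls)
          tt′ = succs (adj G Y) rs
          parts : ∀ (as : List V) {cs} → Unique (as ++ cs) → Unique as × Unique cs
          parts []       u       = [] , u
          parts (a ∷ as) (x ∷ u) = (Allₚ.++⁻ˡ as x ∷ proj₁ (parts as u)) , proj₂ (parts as u)
          uql = proj₁ (parts ls uq)
          uqr = proj₂ (parts ls uq)
          size : ∀ p ys → Unique ys → m ≤ count p ys + 70 → d ≤ # ⟨ succs p ys ⟩
          size p ys u b = ≤-trans (lin (m ∷ d ∷ count p ys ∷ length (succs p ys) ∷ []) ((x₁ :+ con 300 ≲ x₀) ∷ (x₀ ≲ x₂ :+ con 70) ∷ (x₂ ≲ con 1 :+ x₃) ∷ [])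
            (x₁ ≲ x₃) d≤ b (succs-length {R = Adj G} p ys)) (≤-reflexive (sym (#-⟨⟩ (succs-unique {R = Adj G} p u))))
          go : (∃ λ a → ∃ λ b → T (⟨ ss ⟩ a) × T (⟨ tt′ ⟩ b) × Adj G a b) → LongCycle (ls ++ rs) 200
          go (a , b , ta , tb , ab) = build (cut {p = adj G X} (rev Adj-sym hl) (⟨⟩∈ ta)) (cut {p = adj G Y} hr (⟨⟩∈ tb))
            where
            build : Cut {R = Adj G} (adj G X) a₁ X (reverse ls) a → Cut {R = Adj G} (adj G Y) b₁ Y rs b → LongCycle (ls ++ rs) 200
            build (mkCut {p} {ls = L} {R′} eq l _ r t) (mkCut {q} {ls = L₂} {R₂} eq₂ l₂ _ r₂ t₂) = longCycle
              (join (rev Adj-sym r) ab (join r₂ t₂ (join (rev Adj-sym l₂) (Adj-sym e) l))) (Adj-sym t)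
              (Unique-resp-↭ (↭-sym perm) uq) (∈-resp-↭ perm) (≤-trans (≤-reflexive (↭-length (↭-sym perm))) (m≤m+n _ 200))
              where
              perm : reverse R′ ++ R₂ ++ reverse L₂ ++ L ↭ ls ++ rs
              perm = ↭-trans (++⁺ (↭-reverse R′) (↭-trans (++-comm R₂ (reverse L₂ ++ L))
                (↭-trans (++⁺ʳ R₂ (↭-trans (++⁺ʳ L (↭-reverse L₂)) (++-comm L₂ L))) (↭-reflexive (++-assoc L L₂ R₂)))))
                (↭-trans (↭-reflexive (sym (++-assoc R′ L (L₂ ++ R₂)))) (++⁺ (↭-trans (++-comm R′ L) (↭-trans (↭-reflexive (sym eq)) (↭-reverse ls))) (↭-reflexive (sym eq₂))))

        -- Up to b and D, the neighbours of X lie before b and those of Y from b on. Each half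
        -- therefore has at least d successors to offer, and an edge joins the two successor sets.
        -- An empty first half would leave X with b and D as its only neighbours.
        halves : ∀ ls b rs → xs ≡ ls ++ b ∷ rs → All (λ x → ¬ T (adj G Y x)) ls → All (λ x → ¬ T (adj G X x)) rs → LongCycle xs 200
        halves []       b rs e nq np = ⊥-elim (<⇒≱ small (≤-trans (deg X) (≤-trans (#-≤-length (b ∷ D) sub) (s≤s |D|≤60))))
          where
          sub : ∀ x → T (adj G X x) → x ∈ b ∷ D
          sub x t = by (x ∈? D)
            where
            by : Dec (x ∈ D) → x ∈ b ∷ D
            by (yes i) = there i
            by (no ¬i) with subst (x ∈_) e (complete ¬i)
            ... | here eq = here eq
            ... | there j = contradiction t (All.lookup np j)
          small : 61 < m
          small = lin (d ∷ m ∷ []) ((x₀ :+ con 300 ≲ x₁) ∷ []) (con 62 ≲ x₁) d≤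
        halves (l ∷ ls) b rs refl nq np = build (before l ls h)
          where
          build : ∃ (λ x → Walk (Adj G) X x (l ∷ ls) × Adj G x b) → LongCycle (l ∷ ls ++ b ∷ rs) 200
          build (x , hl , e) = across hl e (suffix (l ∷ ls) h) refl
            (≤-trans (deg X) (≤-trans (#-≤-cnt+ (adj G X) (reverse (l ∷ ls))) (+-monoʳ-≤ _ (≤-trans (#-≤-length (b ∷ D) restX) (≤-trans (s≤s |D|≤60) (le 61 70))))))
            (≤-trans (deg Y) (≤-trans (#-≤-cnt+ (adj G Y) (b ∷ rs)) (+-monoʳ-≤ _ (≤-trans (#-≤-length D restY) (≤-trans |D|≤60 (le 60 70))))))
            where
            restX : ∀ x → T ((adj G X ∖ ⟨ reverse (l ∷ ls) ⟩) x) → x ∈ b ∷ D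
            restX x t = by (x ∈? D)
              where
              by : Dec (x ∈ D) → x ∈ b ∷ D
              by (yes i) = there i
              by (no ¬i) with ∈-++⁻ (l ∷ ls) (complete ¬i)
              ... | inj₁ j = contradiction (∈⟨⟩ (∈-resp-↭ (↭-sym (↭-reverse (l ∷ ls))) j)) (not-T (proj₂ (∧-T {adj G X x} t)))
              ... | inj₂ (here eq) = here eq
              ... | inj₂ (there j) = contradiction (proj₁ (∧-T {adj G X x} t)) (All.lookup np j)
            restY : ∀ x → T ((adj G Y ∖ ⟨ b ∷ rs ⟩) x) → x ∈ D
            restY x t = by (x ∈? D)
              where
              by : Dec (x ∈ D) → x ∈ D
              by (yes i) = i
              by (no ¬i) with ∈-++⁻ (l ∷ ls) (complete ¬i)
              ... | inj₁ j = contradiction (proj₁ (∧-T {adj G Y x} t)) (All.lookup nq j)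
              ... | inj₂ j = contradiction (∈⟨⟩ j) (not-T (proj₂ (∧-T {adj G Y x} t)))

        whole : ∀ ls → xs ≡ ls → All (λ x → ¬ T (adj G Y x)) ls → ⊥
        whole ls refl nq = <⇒≱ small (≤-trans (deg Y) (≤-trans (#-≤-length D sub) |D|≤60))
          where
          sub : ∀ x → T (adj G Y x) → x ∈ D
          sub x t = by (x ∈? D)
            where
            by : Dec (x ∈ D) → x ∈ D
            by (yes i) = i
            by (no ¬i) = contradiction t (All.lookup nq (complete ¬i))
          small : 60 < m
          small = lin (d ∷ m ∷ []) ((x₀ :+ con 300 ≲ x₁) ∷ []) (con 61 ≲ x₁) d≤

        -- If no neighbour of Y directly precedes one of X, the two stretches around the gap hold at
        -- most two more adjacencies than vertices. Since X and Y lose at most 120 adjacencies to D,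
        -- at most 123 vertices are left for the gap.
        few-cycle : ∀ ls q gs p rs → xs ≡ ls ++ q ∷ gs ++ p ∷ rs → T (adj G Y q) → T (adj G X p) →
          All (λ x → ¬ T (adj G X x)) gs → All (λ x → ¬ T (adj G Y x)) gs → LongCycle xs 200
        few-cycle ls q gs p rs e tq tp a b = go (pair-or-few (ls ++ q ∷ [])) (pair-or-few (p ∷ rs))
          where
          regroup : xs ≡ (ls ++ q ∷ []) ++ gs ++ p ∷ rs
          regroup = trans e (sym (++-assoc ls (q ∷ []) (gs ++ p ∷ rs)))
          count-all : ∀ w → All (λ x → ¬ T (w x)) gs → count w xs ≡ count w (ls ++ q ∷ []) + count w (p ∷ rs)
          count-all w none = trans (cong (count w) regroup) (trans (count-++ w (ls ++ q ∷ []) _)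
            (cong (count w (ls ++ q ∷ []) +_) (trans (count-++ w gs (p ∷ rs)) (cong (_+ count w (p ∷ rs)) (count-none w gs none)))))
          go : Pair (ls ++ q ∷ []) ⊎ _ → Pair (p ∷ rs) ⊎ _ → LongCycle xs 200
          go (inj₁ pr) _ = around-pair [] pr regroup
          go (inj₂ _) (inj₁ pr) = around-pair ((ls ++ q ∷ []) ++ gs) {bs = []} pr
            (trans regroup (trans (sym (++-assoc (ls ++ q ∷ []) gs (p ∷ rs))) (cong (((ls ++ q ∷ []) ++ gs) ++_) (sym (++-identityʳ (p ∷ rs))))))
          go (inj₂ h₁) (inj₂ h₂) = around e tq tp (lin
            (m ∷ count (adj G X) (ls ++ q ∷ []) ∷ count (adj G Y) (ls ++ q ∷ []) ∷ count (adj G X) (p ∷ rs) ∷ count (adj G Y) (p ∷ rs)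
              ∷ length (ls ++ q ∷ []) ∷ length (p ∷ rs) ∷ length gs ∷ count (adj G X) xs ∷ count (adj G Y) xs ∷ length xs ∷ [])
            ((x₁ :+ x₂ ≲ x₅ :+ con 1) ∷ (x₃ :+ x₄ ≲ x₆ :+ con 1) ∷ (x₀ :+ x₀ ≲ x₈ :+ x₉ :+ con 120) ∷ (x₈ ≲ x₁ :+ x₃) ∷ (x₉ ≲ x₂ :+ x₄)
              ∷ (var 10 ≲ con 1 :+ (x₀ :+ x₀)) ∷ (x₅ :+ (x₇ :+ x₆) ≲ var 10) ∷ []) (x₇ ≲ con 200)
            h₁ h₂ total-count (≤-reflexive (count-all (adj G X) a)) (≤-reflexive (count-all (adj G Y) b)) |xs|≤
            (≤-reflexive (sym (trans (cong length regroup) (trans (length-++ (ls ++ q ∷ [])) (cong (length (ls ++ q ∷ []) +_) (length-++ gs)))))))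

        by-scan : ∀ {zs} → xs ≡ zs → Scan zs → LongCycle xs 200
        by-scan e (close ls q gs p rs tq tp a b)  = few-cycle ls q gs p rs e tq tp a b
        by-scan e (split ls [] nq _)              = ⊥-elim (whole (ls ++ []) e (Allₚ.++⁺ nq []))
        by-scan e (split ls (b ∷ rs) nq (_ ∷ np)) = halves ls b rs e nq np
        by-scan e (split₁ ls b rs nq np)          = halves ls b rs e nq np

      abstract
        long-cycle : LongCycle xs 200
        long-cycle = by-scan refl (scan xs)

-- The expanding case.

module Expanding {n : ℕ} (G : Graph n) where

  open Space G
  open Rooted G using (∉-head; ∉-tail; ∉-cons)
  open Denseness G
  open Absorption G
  open Robust G

  private
    V = Fin n

  abstract
    rep-even : ∀ j ε → Z (rep (j + j) ε ∷ [])
    rep-even zero    ε = Z-zero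
    rep-even (suc j) ε rewrite +-suc j j = comb (rep (2 + (j + j)) ε ∷ rep (j + j) ε ∷ []) ((0 ∷ 1 ∷ []) ∷ (1 ∷ []) ∷ []) (0 ∷ [])
      (rep-suc-suc (j + j) ε) (rep-even j ε)

    rep-odd : ∀ j ε → Z (rep (1 + (j + j)) ε ∷ ε ∷ [])
    rep-odd j ε = comb (rep (1 + (j + j)) ε ∷ ε ∷ rep (j + j) ε ∷ []) ((0 ∷ 1 ∷ 2 ∷ []) ∷ (2 ∷ []) ∷ []) (0 ∷ 1 ∷ [])
      (Z-⊕ ε (rep (j + j) ε)) (rep-even j ε)

  ham-path-in : HamiltonConnected G → ∀ {u v} → u ≢ v → HamPathIn Full [] u v
  ham-path-in hc {u} {v} ne with hc u v ne
  ... | mid , uq , l , len = hamPathIn (linked⇒walk mid l) uq (All.tabulate (λ _ → tt , λ ())) (λ {x} _ _ → full-length uq len x)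

  module _ (m d : ℕ) (n≡ : n ≡ 1 + (m + m)) (deg : ∀ v → m ≤ # (adj G v)) (d≤ : d + 300 ≤ m) (dense : Dense Full d 200) where

    abstract
      -- The cycle misses at most 200 vertices besides the at most 60 of D, so every vertex keeps at
      -- least m - 260 neighbours on it, more than the d + 1 that absorption asks for. This is paid
      -- from the slack of 300 between d and m.
      fill : ∀ D {xs} → length D ≤ 60 → (∀ {x} → x ∉ D → x ∈ xs) → All (_∉ D) xs → LongCycle xs 200 → HamCycleIn D
      fill D {xs} |D| complete sound (longCycle {u} {v} {ys} h c uq ins long) = hamCycleIn (absorb dense D ys h uq
          (All.tabulate (λ i → tt , All.lookup sound (ins i))) rich) c
        where
        rich : ∀ zs → (∀ {x} → x ∈ ys → x ∈ zs) → Unique zs → All (λ x → T true × x ∉ D) zs → ∃ (Outside Full D zs) →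
               ∃ λ w → Outside Full D zs w × d + 1 ≤ cnt (adj G w) zs
        rich zs sub uz _ (w , o) = w , o , lin
          (m ∷ d ∷ cnt (adj G w) zs ∷ # (adj G w ∖ ⟨ zs ⟩) ∷ # (Full ∖ ⟨ zs ⟩) ∷ # (Full ∩ ⟨ zs ⟩) ∷ length ys ∷ length xs ∷ n ∷ length D ∷ [])
          ((x₁ :+ con 300 ≲ x₀) ∷ (x₀ ≲ x₂ :+ x₃) ∷ (x₃ ≲ x₄) ∷ (x₅ :+ x₄ ≲ x₈) ∷ (x₆ ≲ x₅) ∷ (x₇ ≲ x₆ :+ con 200) ∷ (x₈ ≲ x₇ :+ x₉) ∷ (x₉ ≲ con 60) ∷ [])
          (x₁ :+ con 1 ≲ x₂)
          d≤ (≤-trans (deg w) (#-≤-cnt+ (adj G w) zs)) (∖-mono (adj G w) ⟨ zs ⟩ (λ _ _ → tt))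
          (≤-reflexive (trans (sym (#-split Full ⟨ zs ⟩)) #-Full))
          (length-≤-# uq (All.tabulate (λ i → ∈⟨⟩ (sub i)))) long
          (≤-trans (≤-reflexive (sym #-Full)) (≤-trans (#-≤-length (xs ++ D) (λ x _ → by x (x ∈? D))) (≤-reflexive (length-++ xs)))) |D|
          where
          by : ∀ x → Dec (x ∈ D) → x ∈ xs ++ D
          by x (yes i) = ∈-++⁺ʳ xs i
          by x (no ¬i) = ∈-++⁺ˡ (complete ¬i)

      -- Without w the Hamilton cycle is a path whose ends need not be adjacent. Closing it up costs
      -- some vertices, and `fill` puts them back.
      remove : ∀ {D w} → length D ≤ 59 → w ∉ D → HamCycleIn D → HamCycleIn (w ∷ D)
      remove {D} {w} |D| w∉D (hamCycleIn {u} {v} (hamPathIn {xs} h uq sound complete) c) = go (∈-∃++ (complete {w} tt w∉D))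
        where
        use : ∀ {X Y zs} → xs ↭ w ∷ zs → Walk (Adj G) X Y zs → HamCycleIn (w ∷ D)
        use {zs = zs} p k = fill (w ∷ D) (s≤s |D|) comp (All.tabulate snd) (Closing.long-cycle m d n≡ deg d≤ dense k uzs (w ∷ D) (s≤s |D|) comp)
          where
          split-head : Unique (w ∷ zs) → All (w ≢_) zs × Unique zs
          split-head (a ∷ b) = a , b
          w∉zs : All (w ≢_) zs
          w∉zs = proj₁ (split-head (Unique-resp-↭ p uq))
          uzs : Unique zs
          uzs = proj₂ (split-head (Unique-resp-↭ p uq))
          comp : ∀ {x} → x ∉ w ∷ D → x ∈ zs
          comp {x} x∉ = tail (∈-resp-↭ p (complete tt (∉-tail x∉)))
            where
            tail : x ∈ w ∷ zs → x ∈ zs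
            tail (here e)  = contradiction e (∉-head x∉)
            tail (there i) = i
          snd : ∀ {x} → x ∈ zs → x ∉ w ∷ D
          snd i = ∉-cons (≢-sym (All.lookup w∉zs i)) (proj₂ (All.lookup sound (∈-resp-↭ (↭-sym p) (there i))))
        go : (∃ λ ls → ∃ λ rs → xs ≡ ls ++ w ∷ rs) → HamCycleIn (w ∷ D)
        go (ls , rs , e) = parts ls rs e
          where
          after : ∀ {x} r rs → Walk (Adj G) w x (w ∷ r ∷ rs) → Walk (Adj G) r x (r ∷ rs)
          after r rs (step e k) with walk-∷ k
          ... | _ , refl = k
          parts : ∀ ls rs → xs ≡ ls ++ w ∷ rs → HamCycleIn (w ∷ D)
          parts []       []       e = ⊥-elim (<⇒≱ few (≤-trans (≤-reflexive (sym #-Full)) (≤-trans (#-≤-length (w ∷ D) (λ x _ → by x (x ∈? D))) (s≤s |D|))))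
            where
            by : ∀ x → Dec (x ∈ D) → x ∈ w ∷ D
            by x (yes i) = there i
            by x (no ¬i) = single (subst (x ∈_) e (complete tt ¬i))
              where
              single : x ∈ w ∷ [] → x ∈ w ∷ D
              single (here e′) = here e′
            few : 60 < n
            few = ≤-trans (lin (d ∷ m ∷ []) ((x₀ :+ con 300 ≲ x₁) ∷ []) (con 61 ≲ con 1 :+ (x₁ :+ x₁)) d≤) (≤-reflexive (sym n≡))
          parts []       (r ∷ rs) refl = use ↭-refl (after r rs (suffix [] h))
          parts (l ∷ ls) []       refl = use (↭-trans (shift w (l ∷ ls) []) (prep w (↭-reflexive (++-identityʳ (l ∷ ls))))) (proj₁ (proj₂ (before l ls h)))
          parts (l ∷ ls) (r ∷ rs) refl = use (↭-trans (shift w (l ∷ ls) (r ∷ rs)) (prep w (++-comm (l ∷ ls) (r ∷ rs))))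
            (join (after r rs (suffix (l ∷ ls) h)) c (proj₁ (proj₂ (before l ls h))))

      ham-cycle-in : HamCycleIn [] → ∀ D → length D ≤ 60 → HamCycleIn D
      ham-cycle-in base []      _ = base
      ham-cycle-in base (w ∷ D) h = by (w ∈? D) (ham-cycle-in base D (≤-trans (n≤1+n _) h))
        where
        by : Dec (w ∈ D) → HamCycleIn D → HamCycleIn (w ∷ D)
        by (no w∉) cyc = remove (≤-pred h) w∉ cyc
        by (yes i) (hamCycleIn (hamPathIn k uq sound complete) c) = hamCycleIn
          (hamPathIn k uq (All.map (λ (t , f) → t , λ { (here refl) → f i ; (there j) → f j }) sound) (λ t f → complete t (∉-tail f))) c

      -- A cycle through everything except u, v and D is rotated into a path from a neighbour of u
      -- to a neighbour of v.
      robust : HamCycleIn [] → ∀ D {u v} → length D ≤ 50 → u ≢ v → u ∉ D → v ∉ D → HamPathIn Full D u v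
      robust base D {u} {v} |D| u≢v u∉ v∉ = go (ham-cycle-in base (u ∷ v ∷ D) (≤-trans (s≤s (s≤s |D|)) (le 52 60)))
        where
        go : HamCycleIn (u ∷ v ∷ D) → HamPathIn Full D u v
        go (hamCycleIn {a} {b} (hamPathIn {xs} h uq sound complete) c) =
          build (Dense.edge dense ⟨ succs (adj G u) xs ⟩ ⟨ succs (adj G v) xs ⟩ (λ _ _ → tt) (λ _ _ → tt) (size u) (size v))
          where
          size : ∀ w → d ≤ # ⟨ succs (adj G w) xs ⟩
          size w = ≤-trans (lin (m ∷ d ∷ cnt (adj G w) xs ∷ length (succs (adj G w) xs) ∷ # (adj G w ∖ ⟨ xs ⟩) ∷ length D ∷ [])
            ((x₁ :+ con 300 ≲ x₀) ∷ (x₀ ≲ x₂ :+ x₄) ∷ (x₂ ≲ con 1 :+ x₃) ∷ (x₄ ≲ con 2 :+ x₅) ∷ (x₅ ≲ con 50) ∷ []) (x₁ ≲ x₃)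
            d≤ (≤-trans (deg w) (#-≤-cnt+ (adj G w) xs)) (succs-length {R = Adj G} (adj G w) xs) (#-≤-length (u ∷ v ∷ D) inD) |D|)
            (≤-reflexive (sym (#-⟨⟩ (succs-unique {R = Adj G} (adj G w) uq))))
            where
            inD : ∀ x → T ((adj G w ∖ ⟨ xs ⟩) x) → x ∈ u ∷ v ∷ D
            inD x t = by (x ∈? (u ∷ v ∷ D))
              where
              by : Dec (x ∈ u ∷ v ∷ D) → x ∈ u ∷ v ∷ D
              by (yes i) = i
              by (no ¬i) = contradiction (∈⟨⟩ (complete tt ¬i)) (not-T (proj₂ (∧-T {adj G w x} t)))
          build : (∃ λ x → ∃ λ y → T (⟨ succs (adj G u) xs ⟩ x) × T (⟨ succs (adj G v) xs ⟩ y) × Adj G x y) → HamPathIn Full D u v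
          build (x , y , tx , ty , xy) = finish (rotate Adj-sym {p = adj G u} {q = adj G v} h c (⟨⟩∈ tx) (⟨⟩∈ ty) (Adj-irr xy) xy)
            where
            finish : (∃ λ a → ∃ λ b → ∃ λ xs′ → T (adj G u a) × T (adj G v b) × Walk (Adj G) a b xs′ × xs′ ↭ xs) → HamPathIn Full D u v
            finish (a , b , ys , ua , vb , k , p) = hamPathIn (step ua (join k (Adj-sym vb) end))
              (Allₚ.++⁺ (All.tabulate (λ i → ≢-sym (∉-head (out i)))) (u≢v ∷ []) ∷
                Uniq.++⁺ (Unique-resp-↭ (↭-sym p) uq) ([] ∷ []) (λ { (i , here refl) → out i (there (here refl)) }))
              ((tt , u∉) ∷ Allₚ.++⁺ (All.tabulate (λ i → tt , ∉-tail (∉-tail (out i)))) ((tt , v∉) ∷ []))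
              (λ {z} _ z∉ → place z∉ (z ≟ u) (z ≟ v))
              where
              out : ∀ {z} → z ∈ ys → z ∉ u ∷ v ∷ D
              out i = proj₂ (All.lookup sound (∈-resp-↭ p i))
              place : ∀ {z} → z ∉ D → Dec (z ≡ u) → Dec (z ≡ v) → z ∈ u ∷ ys ++ v ∷ []
              place z∉ (yes e) _       = here e
              place z∉ (no _)  (yes e) = there (∈-++⁺ʳ ys (here e))
              place z∉ (no ne) (no ne′) = there (∈-++⁺ˡ (∈-resp-↭ (↭-sym p) (complete tt (∉-cons ne (∉-cons ne′ z∉)))))

    -- A Hamilton path between the ends of an edge closes up. All other cycles of this case arise
    -- from this one by deleting vertices.
    base-cycle : HamiltonConnected G → HamCycleIn []
    base-cycle hc = go (#-find {p = Full {n}} (≤-trans (≤-trans (s≤s z≤n) (≤-reflexive (sym n≡))) (≤-reflexive (sym #-Full))))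
      where
      go : ∃ (λ x → T (Full {n} x)) → HamCycleIn []
      go (x , _) = go′ (neighbour dense {x = x} [] tt (le 1 200))
        where
        go′ : (∃ λ y → T (Full {n} y) × Adj G x y × y ∉ []) → HamCycleIn []
        go′ (y , _ , xy , _) = hamCycleIn (ham-path-in hc (Adj-irr xy)) (Adj-sym xy)

    abstract
      expanding-generated : HamiltonConnected G → HamiltonGenerated G
      expanding-generated hc = use (base-cycle hc)
        where
        3≤n : 3 ≤ n
        3≤n = ≤-trans (lin (d ∷ m ∷ []) ((x₀ :+ con 300 ≲ x₁) ∷ []) (con 3 ≲ con 1 :+ (x₁ :+ x₁)) d≤) (≤-reflexive (sym n≡))
        use : HamCycleIn [] → HamiltonGenerated G
        use base@(hamCycleIn {u} {v} (hamPathIn {xs} h uq _ complete) c) = coboundary⇒generated g λ {x} {y} e → comb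
            (pairInd x y ∷ g x ∷ g y ∷ ε′ ∷ []) ((0 ∷ 1 ∷ 2 ∷ 3 ∷ []) ∷ (3 ∷ []) ∷ []) (0 ∷ 1 ∷ 2 ∷ []) (edge e) ε-zero
          where
          switch : ∀ {a z Λ Λ′} → T (Full {n} a) → a ∉ [] ⊎ z ∉ [] → Walk (Within Full) u z Λ → Walk (Within Full) u z Λ′ → Λ ↭ Λ′ → Unique Λ →
                   All (λ v → v ≡ a ⊎ v ≡ z ⊎ v ∉ []) Λ → length Λ ≤ 30 → Z (walkEdges Λ ∷ walkEdges Λ′ ∷ [])
          switch {z = z} {Λ} {Λ′} _ _ k k′ p uΛ _ |Λ| = go₁ (neighbour dense {x = z} Λ tt (≤-trans (s≤s |Λ|) (le 31 200)))
            where
            go₁ : (∃ λ y → T (Full {n} y) × Adj G z y × y ∉ Λ) → Z (walkEdges Λ ∷ walkEdges Λ′ ∷ [])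
            go₁ (y , _ , zy , y∉) = go₂ (neighbour dense {x = u} (y ∷ Λ) tt (≤-trans (s≤s (s≤s |Λ|)) (le 32 200)))
              where
              go₂ : (∃ λ w → T (Full {n} w) × Adj G u w × w ∉ y ∷ Λ) → Z (walkEdges Λ ∷ walkEdges Λ′ ∷ [])
              go₂ (w , _ , uw , w∉) = go₃ (robust base Λ (≤-trans |Λ| (le 30 50)) (≢-sym (∉-head w∉)) y∉ (∉-tail w∉))
                where
                go₃ : HamPathIn Full Λ y w → Z (walkEdges Λ ∷ walkEdges Λ′ ∷ [])
                go₃ (hamPathIn {ys} l ul sl cl) = ham-switch 3≤n (mapʷ proj₁ k) (mapʷ proj₁ k′) p l zy (Adj-sym uw)
                  (Uniq.++⁺ uΛ ul (λ (i , j) → proj₂ (All.lookup sl j) i)) (λ x → by x (x ∈? Λ))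
                  where
                  by : ∀ x → Dec (x ∈ Λ) → x ∈ Λ ++ ys
                  by x (yes i) = ∈-++⁺ˡ i
                  by x (no ¬i) = ∈-++⁺ʳ Λ (cl tt ¬i)
          module D = DenseRoot dense (le 200 200)
          g : V → EdgeVec n
          g = D.potential [] z≤n u tt (λ ()) switch
          ε′ : EdgeVec n
          ε′ = D.ε [] z≤n u tt (λ ()) switch
          edge : ∀ {x y} → Adj G x y → Z (pairInd x y ∷ g x ∷ g y ∷ ε′ ∷ [])
          edge e = D.potential-edge [] z≤n u tt (λ ()) switch (e , tt , tt) (inj₁ (λ ()))
          len : length xs ≡ 1 + (m + m)
          len = trans (covering-length uq (λ x → complete tt (λ ()))) n≡
          -- Around a Hamilton cycle the potential telescopes and leaves n copies of the error, with
          -- n odd.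
          ε-zero : Z (ε′ ∷ [])
          ε-zero = comb (walkEdges xs ∷ pairInd v u ∷ g u ∷ g v ∷ ε′ ∷ rep (length xs) ε′ ∷ [])
            ((0 ∷ 1 ∷ []) ∷ (0 ∷ 2 ∷ 3 ∷ 4 ∷ 5 ∷ []) ∷ (1 ∷ 3 ∷ 2 ∷ 4 ∷ []) ∷ (5 ∷ 4 ∷ []) ∷ []) (4 ∷ [])
            (ham-cycle 3≤n h c uq (λ x → complete tt (λ ()))) (walk-value g ε′ edge h) (edge c)
            (subst (λ l → Z (rep l ε′ ∷ ε′ ∷ [])) (sym len) (rep-odd m ε′))

-- Dense parts with a large core.

module Parts {n : ℕ} (G : Graph n) where

  open Rooted G using (∉-head; ∉-tail; ∉-left; ∉-right)
  open Denseness G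
  open Absorption G

  private
    V = Fin n

  Robustly : (V → Bool) → Set
  Robustly A = ∀ D {u v} → length D ≤ 50 → u ≢ v → T (A u) → T (A v) → u ∉ D → v ∉ D → HamPathIn A D u v

  module _ (m : ℕ) (n≡ : n ≡ 1 + (m + m)) (deg : ∀ v → m ≤ # (adj G v))
    (A X Y : V → Bool) (X⊑A : X ⊑ A) (A-Y : ∀ {x} → T (A x) → ¬ T (Y x)) (sep : ∀ {x y} → T (X x) → T (Y y) → ¬ Adj G x y)
    (Y-big : m ≤ # Y + 300) (A∖X-small : # (A ∖ X) ≤ 601) (rich : ∀ {x} → T (A x) → 2200 ≤ # (adj G x ∩ X)) where

    abstract
      -- Outside Y there are at most m + 301 vertices. They include all of A and all neighbours of
      -- x, at least m in number.
      misses : ∀ {x} → T (X x) → # (A ∖ adj G x) ≤ 301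
      misses {x} xx = lin (# (A ∖ adj G x) ∷ # (adj G x) ∷ # (Full ∖ Y) ∷ # (Full ∩ Y) ∷ # Y ∷ m ∷ n ∷ [])
        ((x₁ :+ x₀ ≲ x₂) ∷ (x₅ ≲ x₁) ∷ (x₅ ≲ x₄ :+ con 300) ∷ (x₄ ≲ x₃) ∷ (x₃ :+ x₂ ≲ x₆) ∷ (x₆ ≲ con 1 :+ (x₅ :+ x₅)) ∷ []) (x₀ ≲ con 301)
        (#-disjoint (Full ∖ Y) (adj G x) (A ∖ adj G x) (λ y t → not-intro (λ ty → sep xx ty t))
          (λ y t → not-intro (A-Y (proj₁ (∧-T {A y} t)))) (λ y t t′ → not-T (proj₂ (∧-T {A y} t′)) t))
        (deg x) Y-big (#-mono {p = Y} {q = Full ∩ Y} (λ _ t → t)) (≤-reflexive (trans (sym (#-split Full Y)) #-Full)) (≤-reflexive n≡)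

      -- A set of 700 vertices of A does not fit into the at most 601 outside the core X, and a core
      -- vertex in it misses at most 301 vertices of the other set. The 2200 core neighbours of a
      -- vertex split into 700 and the slack 1500.
      part-dense : Dense A 700 1500
      part-dense = record { edge = edge ; deg = λ {x} ax → ≤-trans (rich ax) (#-mono {p = adj G x ∩ X} {q = adj G x ∩ A}
          (λ y t → let (a , b) = ∧-T {adj G x y} t in ∧-intro a (X⊑A y b))) }
        where
        edge : ∀ p q → p ⊑ A → q ⊑ A → 700 ≤ # p → 700 ≤ # q → ∃ λ x → ∃ λ y → T (p x) × T (q y) × Adj G x y
        edge p q pA qA hp hq = go (#-find {p = p ∩ X} (lin (# p ∷ # (p ∩ X) ∷ # (p ∖ X) ∷ # (A ∖ X) ∷ [])
            ((con 700 ≲ x₀) ∷ (x₀ ≲ x₁ :+ x₂) ∷ (x₂ ≲ x₃) ∷ (x₃ ≲ con 601) ∷ []) (con 1 ≲ x₁)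
            hp (≤-reflexive (#-split p X)) (∖-mono p X pA) A∖X-small))
          where
          go : ∃ (λ x → T ((p ∩ X) x)) → ∃ λ x → ∃ λ y → T (p x) × T (q y) × Adj G x y
          go (x , t) = go′ (#-find {p = q ∩ adj G x} (lin (# q ∷ # (q ∩ adj G x) ∷ # (q ∖ adj G x) ∷ # (A ∖ adj G x) ∷ [])
              ((con 700 ≲ x₀) ∷ (x₀ ≲ x₁ :+ x₂) ∷ (x₂ ≲ x₃) ∷ (x₃ ≲ con 301) ∷ []) (con 1 ≲ x₁)
              hq (≤-reflexive (#-split q (adj G x))) (∖-mono q (adj G x) qA) (misses (proj₂ (∧-T {p x} t)))))
            where
            go′ : ∃ (λ y → T ((q ∩ adj G x) y)) → ∃ λ x → ∃ λ y → T (p x) × T (q y) × Adj G x y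
            go′ (y , t′) = x , y , proj₁ (∧-T {p x} t) , ∧-T {q y} t′

    private
      record Start (D : List V) (u v : V) (l : ℕ) : Set where
        constructor start
        field
          {list} : List V
          walk   : Walk (Adj G) u v list
          unique : Unique list
          sound  : All (λ x → T (A x) × x ∉ D) list
          len    : length list ≡ l

    abstract
      private
        begin-path : ∀ D {u v} → length D ≤ 50 → u ≢ v → T (A u) → T (A v) → u ∉ D → v ∉ D → Start D u v 4
        begin-path D {u} {v} |D| u≢v au av u∉ v∉ = build (connect part-dense (u ∷ v ∷ D) au av (≤-trans (s≤s (s≤s (s≤s |D|))) (le 53 1500)))
          where
          build : (∃ λ p → ∃ λ q → T (A p) × T (A q) × Adj G u p × Adj G p q × Adj G q v × p ∉ u ∷ v ∷ D × q ∉ u ∷ v ∷ D) → Start D u v 4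
          build (p , q , ap , aq , up , pq , qv , p∉ , q∉) = start (step up (step pq (step qv end)))
            ((Adj-irr up ∷ ≢-sym (∉-head q∉) ∷ u≢v ∷ []) ∷ (Adj-irr pq ∷ ∉-head (∉-tail p∉) ∷ []) ∷ (Adj-irr qv ∷ []) ∷ [] ∷ [])
            ((au , u∉) ∷ (ap , ∉-tail (∉-tail p∉)) ∷ (aq , ∉-tail (∉-tail q∉)) ∷ (av , v∉) ∷ []) refl

        lengthen : ∀ D {u v} l → length D ≤ 50 → l ≤ 1300 → Start D u v (2 + l) → Start D u v (4 + l)
        lengthen D {u} {v} l |D| l≤ (start {list = u ∷ xs} (step {y = w} e h) (u∉ ∷ uq) (su ∷ ss) len) =
          build (connect part-dense (u ∷ xs ++ D) (proj₁ su) (proj₁ (All.lookup ss (start-∈ h)))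
            (≤-trans (s≤s (s≤s (≤-reflexive (length-++ xs)))) (lin (length xs ∷ l ∷ length D ∷ []) ((con 1 :+ x₀ ≲ con 2 :+ x₁) ∷ (x₁ ≲ con 1300) ∷ (x₂ ≲ con 50) ∷ [])
              (con 2 :+ (x₀ :+ x₂) ≲ con 1500) (≤-reflexive len) l≤ |D|)))
          where
          build : (∃ λ p → ∃ λ q → T (A p) × T (A q) × Adj G u p × Adj G p q × Adj G q w × p ∉ u ∷ xs ++ D × q ∉ u ∷ xs ++ D) → Start D u v (4 + l)
          build (p , q , ap , aq , up , pq , qw , p∉ , q∉) = start (step up (step pq (step qw h)))
            ((Adj-irr up ∷ ≢-sym (∉-head q∉) ∷ u∉) ∷ (Adj-irr pq ∷ Allₚ.¬Any⇒All¬ xs (∉-left xs (∉-tail p∉))) ∷ Allₚ.¬Any⇒All¬ xs (∉-left xs (∉-tail q∉)) ∷ uq)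
            (su ∷ (ap , ∉-right xs (∉-tail p∉)) ∷ (aq , ∉-right xs (∉-tail q∉)) ∷ ss) (cong (2 +_) len)

        long-path : ∀ D {u v} j → length D ≤ 50 → j ≤ 600 → Start D u v 4 → Start D u v (4 + (j + j))
        long-path D zero    |D| h s = s
        long-path D (suc j) |D| h s = subst (Start D _ _) (cong (λ i → 5 + i) (sym (+-suc j j)))
          (lengthen D (2 + (j + j)) |D| (lin (j ∷ []) ((con 1 :+ x₀ ≲ con 600) ∷ (con 1 :+ x₀ ≲ con 600) ∷ []) (con 2 :+ (x₀ :+ x₀) ≲ con 1300) h h)
            (long-path D j |D| (≤-trans (n≤1+n j) h) s))

      -- The initial path has 1204 = 4 + 2 · 600 vertices. A core vertex misses at most 301 of them
      -- and so has the 701 neighbours needed for absorption from the start.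
      part-robust : Robustly A
      part-robust D {u} {v} |D| u≢v au av u∉ v∉ = use (long-path D 600 |D| ≤-refl (begin-path D |D| u≢v au av u∉ v∉))
        where
        use : Start D u v 1204 → HamPathIn A D u v
        use (start {list = xs₀} h uq ss len) = absorb part-dense D xs₀ h uq ss select
          where
          -- Vertices of X are inserted first; once they are all on the path, so are enough neighbours of the others.
          select : ∀ xs → (∀ {x} → x ∈ xs₀ → x ∈ xs) → Unique xs → All (λ x → T (A x) × x ∉ D) xs →
                   ∃ (Outside A D xs) → ∃ λ w → Outside A D xs w × 700 + 1 ≤ cnt (adj G w) xs
          select xs sub ux sx (w , o) = decide (outside? X D xs)
            where
            decide : ∃ (Outside X D xs) ⊎ (∀ {x} → T (X x) → x ∉ D → x ∈ xs) → ∃ λ w → Outside A D xs w × 700 + 1 ≤ cnt (adj G w) xs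
            decide (inj₁ (y , outside xy y∉D y∉)) = y , outside (X⊑A y xy) y∉D y∉ , lin
              (cnt (adj G y) xs ∷ # (adj G y ∩ ⟨ xs ⟩) ∷ # (⟨ xs ⟩ ∖ adj G y) ∷ # (⟨ xs ⟩ ∩ adj G y) ∷ # ⟨ xs ⟩ ∷ # (A ∖ adj G y) ∷ [])
              ((con 1204 ≲ x₄) ∷ (x₄ ≲ x₃ :+ x₂) ∷ (x₂ ≲ x₅) ∷ (x₅ ≲ con 301) ∷ (x₃ ≲ x₁) ∷ (x₁ ≲ x₀) ∷ []) (con 701 ≲ x₀)
              (≤-trans (≤-reflexive (sym len)) (length-≤-# uq (All.tabulate (λ i → ∈⟨⟩ (sub i)))))
              (≤-reflexive (#-split ⟨ xs ⟩ (adj G y))) (∖-mono ⟨ xs ⟩ (adj G y) (λ x t → proj₁ (All.lookup sx (⟨⟩∈ t))))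
              (misses xy) (#-mono {p = ⟨ xs ⟩ ∩ adj G y} {q = adj G y ∩ ⟨ xs ⟩} (λ x t → let (a , b) = ∧-T {⟨ xs ⟩ x} t in ∧-intro b a)) (#-≤-cnt (adj G y) xs)
            decide (inj₂ all-in) = w , o , lin (cnt (adj G w) xs ∷ # (adj G w ∩ ⟨ xs ⟩) ∷ # ((adj G w ∩ X) ∖ ⟨ D ⟩) ∷ [])
              ((con 2000 ≲ x₂) ∷ (x₂ ≲ x₁) ∷ (x₁ ≲ x₀) ∷ []) (con 701 ≲ x₀)
              (#-avoid (adj G w ∩ X) D (≤-trans (+-monoʳ-≤ 2000 |D|) (≤-trans (le 2050 2200) (rich (Outside.in-A o)))))
              (#-mono {p = (adj G w ∩ X) ∖ ⟨ D ⟩} {q = adj G w ∩ ⟨ xs ⟩} λ x t → let (t₁ , t₂) = ∧-T {adj G w x ∧ X x} t ; (t₃ , t₄) = ∧-T {adj G w x} t₁ in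
                ∧-intro t₃ (∈⟨⟩ (all-in t₄ (λ i → not-T t₂ (∈⟨⟩ i)))))
              (#-≤-cnt (adj G w) xs)

-- Two dense parts: the potential inside one of them.

module TwoParts {n : ℕ} (G : Graph n) (3≤n : 3 ≤ n) where

  open Space G
  open Ladder G
  open Rooted G using (∉-head; ∉-tail; ∉-cons)
  open Denseness G
  open Absorption G
  open Parts G

  private
    V = Fin n
    E = EdgeVec n

  record Cross (A B : V → Bool) (a b : V) : Set where
    constructor cross
    field
      edge : Adj G a b
      in-A : T (A a)
      in-B : T (B b)

  flip-cross : ∀ {A B a b} → Cross A B a b → Cross B A b a
  flip-cross (cross e a b) = cross (Adj-sym e) b a

  record Three (A B : V → Bool) : Set where
    constructor three
    field
      {a₁ a₂ a₃ b₁ b₂ b₃} : V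
      c₁ : Cross A B a₁ b₁
      c₂ : Cross A B a₂ b₂
      c₃ : Cross A B a₃ b₃
      a-distinct : Unique (a₁ ∷ a₂ ∷ a₃ ∷ [])
      b-distinct : Unique (b₁ ∷ b₂ ∷ b₃ ∷ [])

  flip-three : ∀ {A B} → Three A B → Three B A
  flip-three (three c₁ c₂ c₃ a b) = three (flip-cross c₁) (flip-cross c₂) (flip-cross c₃) b a

  record Valued (A : V → Bool) : Set where
    field
      g    : V → E
      ε    : E
      edge : ∀ {x y} → Within A x y → Z (pairInd x y ∷ g x ∷ g y ∷ ε ∷ [])

  record Parting (A B : V → Bool) : Set where
    field
      cover    : ∀ x → T (A x) ⊎ T (B x)
      disjoint : ∀ {x} → T (A x) → T (B x) → ⊥
      dense    : Dense A 700 1500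
      robust   : Robustly A
      robust′  : Robustly B

  module OneSide {A B : V → Bool} (parting : Parting A B) where

    open Parting parting

    abstract
      -- The third path spans the rest of A up to a₂, crosses to b₂, spans B and returns to the root
      -- over b₁a₁. So the root is the end of a cross edge, and a disjoint second cross edge must
      -- stay free.
      switch : ∀ {a₁ b₁ a₂ b₂} → Cross A B a₁ b₁ → Cross A B a₂ b₂ → b₂ ≢ b₁ → ∀ {z Λ Λ′} →
               Walk (Within A) a₁ z Λ → Walk (Within A) a₁ z Λ′ → Λ ↭ Λ′ → Unique Λ → a₂ ∉ Λ → length Λ ≤ 30 →
               Z (walkEdges Λ ∷ walkEdges Λ′ ∷ [])
      switch {a₁} {b₁} {a₂} {b₂} (cross e₁ aa₁ bb₁) (cross e₂ aa₂ bb₂) b₂≢b₁ {z} {Λ} {Λ′} h h′ p uq a₂∉ |Λ| =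
        go₁ (neighbour dense (a₂ ∷ Λ) (All.lookup inA (end-∈ h)) (≤-trans (s≤s (s≤s |Λ|)) (le 32 1500)))
        where
        inA : All (λ x → T (A x)) Λ
        inA = allʷ (λ (_ , x , y) → x , y) aa₁ h
        go₁ : (∃ λ y → T (A y) × Adj G z y × y ∉ a₂ ∷ Λ) → Z (walkEdges Λ ∷ walkEdges Λ′ ∷ [])
        go₁ (y , ay , zy , y∉) = go₂ (robust Λ (≤-trans |Λ| (le 30 50)) (∉-head y∉) ay aa₂ (∉-tail y∉) a₂∉)
                                     (robust′ [] z≤n b₂≢b₁ bb₂ bb₁ (λ ()) (λ ()))
          where
          go₂ : HamPathIn A Λ y a₂ → HamPathIn B [] b₂ b₁ → Z (walkEdges Λ ∷ walkEdges Λ′ ∷ [])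
          go₂ (hamPathIn {xs} k uk sk ck) (hamPathIn {ys} l ul sl cl) = ham-switch 3≤n (mapʷ proj₁ h) (mapʷ proj₁ h′) p
            (join k e₂ l) zy (Adj-sym e₁)
            (Uniq.++⁺ uq (Uniq.++⁺ uk ul (λ (i , j) → disjoint (proj₁ (All.lookup sk i)) (proj₁ (All.lookup sl j))))
              (λ (i , j) → apart i (∈-++⁻ xs j)))
            (λ x → place x (x ∈? Λ) (cover x))
            where
            apart : ∀ {x} → x ∈ Λ → x ∈ xs ⊎ x ∈ ys → ⊥
            apart i (inj₁ j) = proj₂ (All.lookup sk j) i
            apart i (inj₂ j) = disjoint (All.lookup inA i) (proj₁ (All.lookup sl j))
            place : ∀ x → Dec (x ∈ Λ) → T (A x) ⊎ T (B x) → x ∈ Λ ++ xs ++ ys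
            place x (yes i) _        = ∈-++⁺ˡ i
            place x (no ¬i) (inj₁ a) = ∈-++⁺ʳ Λ (∈-++⁺ˡ (ck a ¬i))
            place x (no ¬i) (inj₂ b) = ∈-++⁺ʳ Λ (∈-++⁺ʳ xs (cl b (λ ())))

    module _ (t : Three A B) where

      open Three t

      private
        S : List V
        S = a₂ ∷ a₃ ∷ []

        facts : Unique (a₁ ∷ a₂ ∷ a₃ ∷ []) → (a₁ ≢ a₂) × (a₁ ≢ a₃) × (a₂ ≢ a₃)
        facts ((x ∷ y ∷ []) ∷ (z ∷ []) ∷ _) = x , y , z
        bfacts : Unique (b₁ ∷ b₂ ∷ b₃ ∷ []) → (b₁ ≢ b₂) × (b₁ ≢ b₃) × (b₂ ≢ b₃)
        bfacts ((x ∷ y ∷ []) ∷ (z ∷ []) ∷ _) = x , y , z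

        a₁≢a₂ = proj₁ (facts a-distinct)
        a₁≢a₃ = proj₁ (proj₂ (facts a-distinct))
        a₂≢a₃ = proj₂ (proj₂ (facts a-distinct))

        -- If the walk uses one of a₂ and a₃, the cross edge at the other is the exit. The side
        -- condition excludes that it uses both.
        root-switch : ∀ {a z Λ Λ′} → T (A a) → a ∉ S ⊎ z ∉ S → Walk (Within A) a₁ z Λ → Walk (Within A) a₁ z Λ′ → Λ ↭ Λ′ → Unique Λ →
                      All (λ v → v ≡ a ⊎ v ≡ z ⊎ v ∉ S) Λ → length Λ ≤ 30 → Z (walkEdges Λ ∷ walkEdges Λ′ ∷ [])
        root-switch {a} {z} {Λ} {Λ′} _ ok h h′ p uq free |Λ| = decide (a₂ ∈? Λ) (a₃ ∈? Λ)
          where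
          ∈S₂ : a₂ ∈ S
          ∈S₂ = here refl
          ∈S₃ : a₃ ∈ S
          ∈S₃ = there (here refl)
          clash : a₂ ≡ a ⊎ a₂ ≡ z ⊎ a₂ ∉ S → a₃ ≡ a ⊎ a₃ ≡ z ⊎ a₃ ∉ S → a ∉ S ⊎ z ∉ S → ⊥
          clash (inj₂ (inj₂ f)) _ _ = f ∈S₂
          clash _ (inj₂ (inj₂ f)) _ = f ∈S₃
          clash (inj₁ e) (inj₁ e′) _ = a₂≢a₃ (trans e (sym e′))
          clash (inj₂ (inj₁ e)) (inj₂ (inj₁ e′)) _ = a₂≢a₃ (trans e (sym e′))
          clash (inj₁ e) (inj₂ (inj₁ e′)) (inj₁ f) = f (subst (_∈ S) e ∈S₂)
          clash (inj₁ e) (inj₂ (inj₁ e′)) (inj₂ f) = f (subst (_∈ S) e′ ∈S₃)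
          clash (inj₂ (inj₁ e)) (inj₁ e′) (inj₁ f) = f (subst (_∈ S) e′ ∈S₃)
          clash (inj₂ (inj₁ e)) (inj₁ e′) (inj₂ f) = f (subst (_∈ S) e ∈S₂)
          decide : Dec (a₂ ∈ Λ) → Dec (a₃ ∈ Λ) → Z (walkEdges Λ ∷ walkEdges Λ′ ∷ [])
          decide (no a₂∉) _        = switch c₁ c₂ (≢-sym (proj₁ (bfacts b-distinct))) h h′ p uq a₂∉ |Λ|
          decide (yes _)  (no a₃∉) = switch c₁ c₃ (≢-sym (proj₁ (proj₂ (bfacts b-distinct)))) h h′ p uq a₃∉ |Λ|
          decide (yes i)  (yes j)  = ⊥-elim (clash (All.lookup free i) (All.lookup free j) ok)

        a₁∉S : a₁ ∉ S
        a₁∉S = ∉-cons a₁≢a₂ (∉-cons a₁≢a₃ (λ ()))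

        module D = DenseRoot dense (le 200 1500)

        pot : V → E
        pot = D.potential S (le 2 10) a₁ (Cross.in-A c₁) a₁∉S root-switch
        eps : E
        eps = D.ε S (le 2 10) a₁ (Cross.in-A c₁) a₁∉S root-switch
        most : ∀ {x y} → Within A x y → x ∉ S ⊎ y ∉ S → Z (pairInd x y ∷ pot x ∷ pot y ∷ eps ∷ [])
        most = D.potential-edge S (le 2 10) a₁ (Cross.in-A c₁) a₁∉S root-switch

        module Rg (z : V) = Rungs (Within A) Within-sym a₂ z (_≢ a₁)
          (λ h h′ p uq ok |Λ| → switch c₂ c₁ (proj₁ (bfacts b-distinct)) h h′ p uq (λ i → All.lookup ok i refl) |Λ|)

        -- This is the edge with both ends in S. The four-cycle a₂ a₃ q p, switched with root a₂ and
        -- exit a₁b₁, reduces it to three edges of known value.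
        last-edge : Adj G a₂ a₃ → Z (pairInd a₂ a₃ ∷ pot a₂ ∷ pot a₃ ∷ eps ∷ [])
        last-edge e = build (connect dense (a₁ ∷ S) (Cross.in-A c₂) (Cross.in-A c₃) (le 4 1500))
          where
          build : (∃ λ p → ∃ λ q → T (A p) × T (A q) × Adj G a₂ p × Adj G p q × Adj G q a₃ × p ∉ a₁ ∷ S × q ∉ a₁ ∷ S) →
                  Z (pairInd a₂ a₃ ∷ pot a₂ ∷ pot a₃ ∷ eps ∷ [])
          build (p , q , ap , aq , a₂p , pq , qa₃ , p∉ , q∉) = comb
            (pairInd a₂ a₃ ∷ pot a₂ ∷ pot a₃ ∷ eps ∷ pairInd a₃ q ∷ pairInd a₂ p ∷ pairInd p q ∷ pot p ∷ pot q ∷ [])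
            ((0 ∷ 4 ∷ 5 ∷ 6 ∷ []) ∷ (4 ∷ 2 ∷ 8 ∷ 3 ∷ []) ∷ (5 ∷ 1 ∷ 7 ∷ 3 ∷ []) ∷ (6 ∷ 7 ∷ 8 ∷ 3 ∷ []) ∷ []) (0 ∷ 1 ∷ 2 ∷ 3 ∷ [])
            (Rg.even₄ q (e , aa₂ , aa₃) w₃ w₂ w₁ link ((a₂≢a₃ ∷ Adj-irr a₂p ∷ ≢-sym (∉-head (∉-tail q∉)) ∷ [])
                ∷ (≢-sym (∉-head (∉-tail (∉-tail p∉))) ∷ ≢-sym (Adj-irr qa₃) ∷ []) ∷ (Adj-irr pq ∷ []) ∷ [] ∷ [])
              (≢-sym a₁≢a₂) (≢-sym a₁≢a₃) (∉-head p∉) (∉-head q∉))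
            (most w₃ (inj₂ (∉-tail q∉))) (most w₂ (inj₂ (∉-tail p∉))) (most w₁ (inj₁ (∉-tail p∉)))
            where
            aa₂ = Cross.in-A c₂
            aa₃ = Cross.in-A c₃
            w₁ : Within A p q
            w₁ = pq , ap , aq
            w₂ : Within A a₂ p
            w₂ = a₂p , aa₂ , ap
            w₃ : Within A a₃ q
            w₃ = Adj-sym qa₃ , aa₃ , aq
            link : ∀ D → length D ≤ 40 → ∃ λ (b : Bridge (Within A) a₃ p D) → All (λ v → v ≡ a₃ ⊎ v ≡ p ⊎ v ≢ a₁) (Bridge.list b)
            link D |D| = conv (D.bridge (a₁ ∷ D) aa₃ ap (≢-sym (∉-head (∉-tail (∉-tail p∉)))) (≤-trans (s≤s |D|) (le 41 50)))
              where
              conv : Bridge (Within A) a₃ p (a₁ ∷ D) → ∃ λ (b : Bridge (Within A) a₃ p D) → All (λ v → v ≡ a₃ ⊎ v ≡ p ⊎ v ≢ a₁) (Bridge.list b)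
              conv br = record { walk = walk ; unique = unique ; fresh = All.map weaken fresh ; short = short } , All.map avoid fresh
                where
                open Bridge br
                weaken : ∀ {v} → v ≡ a₃ ⊎ v ≡ p ⊎ v ∉ a₁ ∷ D → v ≡ a₃ ⊎ v ≡ p ⊎ v ∉ D
                weaken (inj₁ x)        = inj₁ x
                weaken (inj₂ (inj₁ x)) = inj₂ (inj₁ x)
                weaken (inj₂ (inj₂ x)) = inj₂ (inj₂ (∉-tail x))
                avoid : ∀ {v} → v ≡ a₃ ⊎ v ≡ p ⊎ v ∉ a₁ ∷ D → v ≡ a₃ ⊎ v ≡ p ⊎ v ≢ a₁
                avoid (inj₁ x)        = inj₁ x
                avoid (inj₂ (inj₁ x)) = inj₂ (inj₁ x)
                avoid (inj₂ (inj₂ x)) = inj₂ (inj₂ (∉-head x))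

      abstract
        valued : Valued A
        valued = record { g = pot ; ε = eps ; edge = λ {x} {y} e → decide e (x ∈? S) (y ∈? S) }
          where
          decide : ∀ {x y} → Within A x y → Dec (x ∈ S) → Dec (y ∈ S) → Z (pairInd x y ∷ pot x ∷ pot y ∷ eps ∷ [])
          decide e (no x∉) _       = most e (inj₁ x∉)
          decide e (yes _) (no y∉) = most e (inj₂ y∉)
          decide (e , _) (yes (here refl)) (yes (here refl)) = contradiction refl (Adj-irr e)
          decide (e , _) (yes (here refl)) (yes (there (here refl))) = last-edge e
          decide (e , _) (yes (there (here refl))) (yes (here refl)) = comb
            (pairInd a₃ a₂ ∷ pot a₃ ∷ pot a₂ ∷ eps ∷ pairInd a₂ a₃ ∷ []) ((0 ∷ 4 ∷ []) ∷ (4 ∷ 2 ∷ 1 ∷ 3 ∷ []) ∷ []) (0 ∷ 1 ∷ 2 ∷ 3 ∷ [])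
            (Z-sym a₃ a₂) (last-edge (Adj-sym e))
          decide (e , _) (yes (there (here refl))) (yes (there (here refl))) = contradiction refl (Adj-irr e)

-- Relations from cycles with two and four cross edges.

module CrossEdges {n : ℕ} (G : Graph n) (3≤n : 3 ≤ n) where

  open Space G
  open Denseness G
  open Absorption G
  open TwoParts G 3≤n

  private
    V = Fin n
    E = EdgeVec n

  restrict : ∀ {A : V → Bool} {u v xs} → Walk (Adj G) u v xs → All (λ x → T (A x)) xs → Walk (Within A) u v xs
  restrict end        _        = end
  restrict (step e h) (a ∷ as) = step (e , a , All.lookup as (start-∈ h)) (restrict h as)

  abstract
    rep-+ : ∀ i j ε → Z (rep (i + j) ε ∷ rep i ε ∷ rep j ε ∷ [])
    rep-+ zero    j ε = comb (rep j ε ∷ zeroV ∷ []) ((1 ∷ []) ∷ []) (0 ∷ 1 ∷ 0 ∷ []) Z-zero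
    rep-+ (suc i) j ε = comb ((ε ⊕ rep (i + j) ε) ∷ (ε ⊕ rep i ε) ∷ rep j ε ∷ ε ∷ rep (i + j) ε ∷ rep i ε ∷ [])
      ((0 ∷ 3 ∷ 4 ∷ []) ∷ (1 ∷ 3 ∷ 5 ∷ []) ∷ (4 ∷ 5 ∷ 2 ∷ []) ∷ []) (0 ∷ 1 ∷ 2 ∷ [])
      (Z-⊕ ε (rep (i + j) ε)) (Z-⊕ ε (rep i ε)) (rep-+ i j ε)

    length-HamPathIn : ∀ {A D u v} (h : HamPathIn A D u v) → Unique D → All (λ x → T (A x)) D → length D + length (HamPathIn.list h) ≡ # A
    length-HamPathIn {A} {D} (hamPathIn {xs} _ uq sound complete) uD aD = trans (sym (length-++ D)) (≤-antisym
      (length-≤-# (Uniq.++⁺ uD uq (λ (i , j) → proj₂ (All.lookup sound j) i)) (Allₚ.++⁺ aD (All.map proj₁ sound)))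
      (#-≤-length (D ++ xs) (λ x t → by x t (x ∈? D))))
      where
      by : ∀ x → T (A x) → Dec (x ∈ D) → x ∈ D ++ xs
      by x t (yes i) = ∈-++⁺ˡ i
      by x t (no ¬i) = ∈-++⁺ʳ D (complete t ¬i)

  module Combine {A B : V → Bool} (pA : Parting A B) (pB : Parting B A) (vA : Valued A) (vB : Valued B) (t : Three A B) where

    open Three t
    open Valued vA renaming (g to gA; ε to εA; edge to edgeA)
    open Valued vB renaming (g to gB; ε to εB; edge to edgeB)

    private
      rA rB : E
      rA = rep (# A) εA
      rB = rep (# B) εB

    abstract
      -- A Hamilton cycle with just these cross edges runs through A and B by spanning paths. Their
      -- |A| - 1 and |B| - 1 inner edges account for the errors, written with |A| + 1 and |B| + 1
      -- copies.
      two-crossings : ∀ {a b a′ b′} → Cross A B a b → Cross A B a′ b′ → a ≢ a′ → b ≢ b′ →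
        Z (pairInd a b ∷ gA a ∷ gB b ∷ pairInd a′ b′ ∷ gA a′ ∷ gB b′ ∷ εA ∷ rA ∷ εB ∷ rB ∷ [])
      two-crossings {a} {b} {a′} {b′} (cross e aa bb) (cross e′ aa′ bb′) a≢ b≢ =
        go (Parting.robust pA [] z≤n a≢ aa aa′ (λ ()) (λ ())) (Parting.robust pB [] z≤n (≢-sym b≢) bb′ bb (λ ()) (λ ()))
        where
        go : HamPathIn A [] a a′ → HamPathIn B [] b′ b → Z (pairInd a b ∷ gA a ∷ gB b ∷ pairInd a′ b′ ∷ gA a′ ∷ gB b′ ∷ εA ∷ rA ∷ εB ∷ rB ∷ [])
        go p@(hamPathIn {xs} h uh sh ch) q@(hamPathIn {ys} k uk sk ck) = comb
          (pairInd a b ∷ gA a ∷ gB b ∷ pairInd a′ b′ ∷ gA a′ ∷ gB b′ ∷ εA ∷ rA ∷ εB ∷ rB ∷ walkEdges (xs ++ ys) ∷ walkEdges xs ∷ walkEdges ys ∷ pairInd b a ∷ [])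
          ((10 ∷ 13 ∷ []) ∷ (10 ∷ 11 ∷ 3 ∷ 12 ∷ []) ∷ (11 ∷ 1 ∷ 4 ∷ 6 ∷ 7 ∷ []) ∷ (12 ∷ 5 ∷ 2 ∷ 8 ∷ 9 ∷ []) ∷ (0 ∷ 13 ∷ []) ∷ [])
          (0 ∷ 1 ∷ 2 ∷ 3 ∷ 4 ∷ 5 ∷ 6 ∷ 7 ∷ 8 ∷ 9 ∷ [])
          (ham-cycle 3≤n (join h e′ k) (Adj-sym e) (Uniq.++⁺ uh uk (λ (i , j) → Parting.disjoint pA (proj₁ (All.lookup sh i)) (proj₁ (All.lookup sk j))))
            (λ x → place x (Parting.cover pA x)))
          (Z-join h k)
          (subst (λ l → Z (walkEdges xs ∷ gA a ∷ gA a′ ∷ εA ∷ rep l εA ∷ [])) (length-HamPathIn p [] []) (walk-value gA εA edgeA (restrict h (All.map proj₁ sh))))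
          (subst (λ l → Z (walkEdges ys ∷ gB b′ ∷ gB b ∷ εB ∷ rep l εB ∷ [])) (length-HamPathIn q [] []) (walk-value gB εB edgeB (restrict k (All.map proj₁ sk))))
          (Z-sym a b)
          where
          place : ∀ x → T (A x) ⊎ T (B x) → x ∈ xs ++ ys
          place x (inj₁ ax) = ∈-++⁺ˡ (ch ax (λ ()))
          place x (inj₂ bx) = ∈-++⁺ʳ xs (ck bx (λ ()))

      -- For any two of the three disjoint cross edges, the sum of their values relative to gA and
      -- gB is the same constant. Adding the three relations counts each value twice and the
      -- constant three times.
      κ-zero : Z (εA ∷ rA ∷ εB ∷ rB ∷ [])
      κ-zero = go a-distinct b-distinct
        where
        go : Unique (a₁ ∷ a₂ ∷ a₃ ∷ []) → Unique (b₁ ∷ b₂ ∷ b₃ ∷ []) → Z (εA ∷ rA ∷ εB ∷ rB ∷ [])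
        go ((a₁₂ ∷ a₁₃ ∷ []) ∷ (a₂₃ ∷ []) ∷ _) ((b₁₂ ∷ b₁₃ ∷ []) ∷ (b₂₃ ∷ []) ∷ _) = comb
          (pairInd a₁ b₁ ∷ gA a₁ ∷ gB b₁ ∷ pairInd a₂ b₂ ∷ gA a₂ ∷ gB b₂ ∷ pairInd a₃ b₃ ∷ gA a₃ ∷ gB b₃ ∷ εA ∷ rA ∷ εB ∷ rB ∷ [])
          ((0 ∷ 1 ∷ 2 ∷ 3 ∷ 4 ∷ 5 ∷ 9 ∷ 10 ∷ 11 ∷ 12 ∷ []) ∷ (0 ∷ 1 ∷ 2 ∷ 6 ∷ 7 ∷ 8 ∷ 9 ∷ 10 ∷ 11 ∷ 12 ∷ []) ∷ (3 ∷ 4 ∷ 5 ∷ 6 ∷ 7 ∷ 8 ∷ 9 ∷ 10 ∷ 11 ∷ 12 ∷ []) ∷ [])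
          (9 ∷ 10 ∷ 11 ∷ 12 ∷ [])
          (two-crossings c₁ c₂ a₁₂ b₁₂) (two-crossings c₁ c₃ a₁₃ b₁₃) (two-crossings c₂ c₃ a₂₃ b₂₃)

      same : ∀ {a b a′ b′} → Cross A B a b → Cross A B a′ b′ → a ≢ a′ → b ≢ b′ →
             Z (pairInd a b ∷ gA a ∷ gB b ∷ pairInd a′ b′ ∷ gA a′ ∷ gB b′ ∷ [])
      same {a} {b} {a′} {b′} c c′ na nb = comb (pairInd a b ∷ gA a ∷ gB b ∷ pairInd a′ b′ ∷ gA a′ ∷ gB b′ ∷ εA ∷ rA ∷ εB ∷ rB ∷ [])
        ((0 ∷ 1 ∷ 2 ∷ 3 ∷ 4 ∷ 5 ∷ 6 ∷ 7 ∷ 8 ∷ 9 ∷ []) ∷ (6 ∷ 7 ∷ 8 ∷ 9 ∷ []) ∷ []) (0 ∷ 1 ∷ 2 ∷ 3 ∷ 4 ∷ 5 ∷ [])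
        (two-crossings c c′ na nb) κ-zero

      -- A cross edge that meets a₁b₁ is compared with it through a₂b₂, or through a₃b₃ if it meets
      -- a₂b₂ as well.
      uniform : ∀ {a b} → Cross A B a b → Z (pairInd a b ∷ gA a ∷ gB b ∷ pairInd a₁ b₁ ∷ gA a₁ ∷ gB b₁ ∷ [])
      uniform {a} {b} c = go a-distinct b-distinct (a ≟ a₁) (b ≟ b₁) (a ≟ a₂) (b ≟ b₂)
        where
        via : ∀ {a′ b′} → Cross A B a′ b′ → a ≢ a′ → b ≢ b′ → a′ ≢ a₁ → b′ ≢ b₁ → Z (pairInd a b ∷ gA a ∷ gB b ∷ pairInd a₁ b₁ ∷ gA a₁ ∷ gB b₁ ∷ [])
        via {a′} {b′} c′ na nb na₁ nb₁ = comb (pairInd a b ∷ gA a ∷ gB b ∷ pairInd a₁ b₁ ∷ gA a₁ ∷ gB b₁ ∷ pairInd a′ b′ ∷ gA a′ ∷ gB b′ ∷ [])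
          ((0 ∷ 1 ∷ 2 ∷ 6 ∷ 7 ∷ 8 ∷ []) ∷ (6 ∷ 7 ∷ 8 ∷ 3 ∷ 4 ∷ 5 ∷ []) ∷ []) (0 ∷ 1 ∷ 2 ∷ 3 ∷ 4 ∷ 5 ∷ []) (same c c′ na nb) (same c′ c₁ na₁ nb₁)
        go : Unique (a₁ ∷ a₂ ∷ a₃ ∷ []) → Unique (b₁ ∷ b₂ ∷ b₃ ∷ []) → Dec (a ≡ a₁) → Dec (b ≡ b₁) → Dec (a ≡ a₂) → Dec (b ≡ b₂) →
             Z (pairInd a b ∷ gA a ∷ gB b ∷ pairInd a₁ b₁ ∷ gA a₁ ∷ gB b₁ ∷ [])
        go _ _ (no n₁) (no n₂) _ _ = same c c₁ n₁ n₂
        go ((a₁₂ ∷ _) ∷ _) ((b₁₂ ∷ _) ∷ _) _ _ (no n₁) (no n₂) = via c₂ n₁ n₂ (≢-sym a₁₂) (≢-sym b₁₂)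
        go ((a₁₂ ∷ a₁₃ ∷ []) ∷ (a₂₃ ∷ []) ∷ _) ((b₁₂ ∷ b₁₃ ∷ []) ∷ (b₂₃ ∷ []) ∷ _) (yes refl) (yes refl) _ _ =
          comb (pairInd a b ∷ gA a ∷ gB b ∷ []) [] (0 ∷ 1 ∷ 2 ∷ 0 ∷ 1 ∷ 2 ∷ [])
        go ((a₁₂ ∷ _) ∷ _) _ (yes refl) _ (yes e) _ = contradiction e a₁₂
        go ((a₁₂ ∷ a₁₃ ∷ []) ∷ (a₂₃ ∷ []) ∷ _) ((b₁₂ ∷ b₁₃ ∷ []) ∷ (b₂₃ ∷ []) ∷ _) (yes refl) (no _) (no _) (yes refl) = via c₃ a₁₃ b₂₃ (≢-sym a₁₃) (≢-sym b₁₃)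
        go ((a₁₂ ∷ a₁₃ ∷ []) ∷ (a₂₃ ∷ []) ∷ _) ((b₁₂ ∷ b₁₃ ∷ []) ∷ (b₂₃ ∷ []) ∷ _) (no _) (yes refl) (yes refl) _ = via c₃ a₂₃ b₁₃ (≢-sym a₁₃) (≢-sym b₁₃)
        go _ ((b₁₂ ∷ _) ∷ _) (no _) (yes refl) (no _) (yes e) = contradiction e b₁₂

      -- Now each part is covered by two paths, with |A| - 2 and |B| - 2 inner edges in all. The
      -- four cross edges have equal values, which cancel, and so do the two additional copies of
      -- each error.
      four-crossings : ∀ {p₁ p₂ p₃ p₄ q₁ q₂ q₃ q₄ L M} → Walk (Within A) p₁ p₂ L → Unique L → Walk (Within B) q₂ q₃ M → Unique M →
        Cross A B p₁ q₁ → Cross A B p₂ q₂ → Cross A B p₃ q₃ → Cross A B p₄ q₄ → p₃ ≢ p₄ → p₃ ∉ L → p₄ ∉ L → q₄ ≢ q₁ → q₄ ∉ M → q₁ ∉ M →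
        length L ≤ 50 → length M ≤ 50 → Z (rA ∷ rB ∷ [])
      four-crossings {p₁} {p₂} {p₃} {p₄} {q₁} {q₂} {q₃} {q₄} {L} {M} l uL k uM c₁′@(cross e₁ ap₁ bq₁) c₂′@(cross e₂ ap₂ bq₂) c₃′@(cross e₃ ap₃ bq₃) c₄′@(cross e₄ ap₄ bq₄)
        p₃≢p₄ p₃∉ p₄∉ q₄≢q₁ q₄∉ q₁∉ |L| |M| =
        go (Parting.robust pA L |L| p₃≢p₄ ap₃ ap₄ p₃∉ p₄∉) (Parting.robust pB M |M| q₄≢q₁ bq₄ bq₁ q₄∉ q₁∉)
        where
        inA : All (λ x → T (A x)) L
        inA = allʷ (λ (_ , x , y) → x , y) ap₁ l
        inB : All (λ x → T (B x)) M
        inB = allʷ (λ (_ , x , y) → x , y) bq₂ k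
        go : HamPathIn A L p₃ p₄ → HamPathIn B M q₄ q₁ → Z (rA ∷ rB ∷ [])
        go p@(hamPathIn {xs} h uh sh ch) q@(hamPathIn {ys} j uj sj cj) = final
          where
          W : List V
          W = L ++ M ++ xs ++ ys
          lwalk : Walk (Adj G) p₁ p₂ L
          lwalk = mapʷ proj₁ l
          kwalk : Walk (Adj G) q₂ q₃ M
          kwalk = mapʷ proj₁ k
          uW : Unique W
          uW = Uniq.++⁺ uL (Uniq.++⁺ uM (Uniq.++⁺ uh uj (λ (i , i′) → Parting.disjoint pA (proj₁ (All.lookup sh i)) (proj₁ (All.lookup sj i′))))
                 (λ (i , i′) → m-apart i (∈-++⁻ xs i′))) (λ (i , i′) → l-apart i (∈-++⁻ M i′))
            where
            m-apart : ∀ {x} → x ∈ M → x ∈ xs ⊎ x ∈ ys → ⊥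
            m-apart i (inj₁ i′) = Parting.disjoint pA (proj₁ (All.lookup sh i′)) (All.lookup inB i)
            m-apart i (inj₂ i′) = proj₂ (All.lookup sj i′) i
            l-apart : ∀ {x} → x ∈ L → x ∈ M ⊎ x ∈ xs ++ ys → ⊥
            l-apart i (inj₁ i′) = Parting.disjoint pA (All.lookup inA i) (All.lookup inB i′)
            l-apart {x} i (inj₂ i′) = tail (∈-++⁻ xs i′)
              where
              tail : x ∈ xs ⊎ x ∈ ys → ⊥
              tail (inj₁ i″) = proj₂ (All.lookup sh i″) i
              tail (inj₂ i″) = Parting.disjoint pA (All.lookup inA i) (proj₁ (All.lookup sj i″))
          place : ∀ x → T (A x) ⊎ T (B x) → Dec (x ∈ L) → Dec (x ∈ M) → x ∈ W
          place x _         (yes i) _       = ∈-++⁺ˡ i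
          place x _         (no _)  (yes i) = ∈-++⁺ʳ L (∈-++⁺ˡ i)
          place x (inj₁ ax) (no ¬i) _       = ∈-++⁺ʳ L (∈-++⁺ʳ M (∈-++⁺ˡ (ch ax ¬i)))
          place x (inj₂ bx) _       (no ¬i) = ∈-++⁺ʳ L (∈-++⁺ʳ M (∈-++⁺ʳ xs (cj bx ¬i)))
          cyc : Z (walkEdges W ∷ pairInd q₁ p₁ ∷ [])
          cyc = ham-cycle 3≤n (join lwalk e₂ (join kwalk (Adj-sym e₃) (join h e₄ j))) (Adj-sym e₁) uW (λ x → place x (Parting.cover pA x) (x ∈? L) (x ∈? M))
          joins : Z (walkEdges W ∷ walkEdges L ∷ pairInd p₂ q₂ ∷ walkEdges M ∷ pairInd q₃ p₃ ∷ walkEdges xs ∷ pairInd p₄ q₄ ∷ walkEdges ys ∷ [])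
          joins = comb (walkEdges W ∷ walkEdges L ∷ pairInd p₂ q₂ ∷ walkEdges M ∷ pairInd q₃ p₃ ∷ walkEdges xs ∷ pairInd p₄ q₄ ∷ walkEdges ys ∷ walkEdges (M ++ xs ++ ys) ∷ walkEdges (xs ++ ys) ∷ [])
            ((0 ∷ 1 ∷ 2 ∷ 8 ∷ []) ∷ (8 ∷ 3 ∷ 4 ∷ 9 ∷ []) ∷ (9 ∷ 5 ∷ 6 ∷ 7 ∷ []) ∷ []) (0 ∷ 1 ∷ 2 ∷ 3 ∷ 4 ∷ 5 ∷ 6 ∷ 7 ∷ [])
            (Z-join lwalk (join kwalk (Adj-sym e₃) (join h e₄ j))) (Z-join kwalk (join h e₄ j)) (Z-join h j)
          lenA : Z (rA ∷ rep (length L) εA ∷ rep (length xs) εA ∷ [])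
          lenA = subst (λ l → Z (rep l εA ∷ rep (length L) εA ∷ rep (length xs) εA ∷ [])) (length-HamPathIn p uL inA) (rep-+ (length L) (length xs) εA)
          lenB : Z (rB ∷ rep (length M) εB ∷ rep (length ys) εB ∷ [])
          lenB = subst (λ l → Z (rep l εB ∷ rep (length M) εB ∷ rep (length ys) εB ∷ [])) (length-HamPathIn q uM inB) (rep-+ (length M) (length ys) εB)
          sideA : Z (walkEdges L ∷ walkEdges xs ∷ gA p₁ ∷ gA p₂ ∷ gA p₃ ∷ gA p₄ ∷ rA ∷ [])
          sideA = comb (walkEdges L ∷ walkEdges xs ∷ gA p₁ ∷ gA p₂ ∷ gA p₃ ∷ gA p₄ ∷ rA ∷ rep (length L) εA ∷ rep (length xs) εA ∷ εA ∷ [])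
            ((6 ∷ 7 ∷ 8 ∷ []) ∷ (0 ∷ 2 ∷ 3 ∷ 9 ∷ 7 ∷ []) ∷ (1 ∷ 4 ∷ 5 ∷ 9 ∷ 8 ∷ []) ∷ []) (0 ∷ 1 ∷ 2 ∷ 3 ∷ 4 ∷ 5 ∷ 6 ∷ [])
            lenA (walk-value gA εA edgeA l) (walk-value gA εA edgeA (restrict h (All.map proj₁ sh)))
          sideB : Z (walkEdges M ∷ walkEdges ys ∷ gB q₁ ∷ gB q₂ ∷ gB q₃ ∷ gB q₄ ∷ rB ∷ [])
          sideB = comb (walkEdges M ∷ walkEdges ys ∷ gB q₁ ∷ gB q₂ ∷ gB q₃ ∷ gB q₄ ∷ rB ∷ rep (length M) εB ∷ rep (length ys) εB ∷ εB ∷ [])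
            ((6 ∷ 7 ∷ 8 ∷ []) ∷ (0 ∷ 3 ∷ 4 ∷ 9 ∷ 7 ∷ []) ∷ (1 ∷ 5 ∷ 2 ∷ 9 ∷ 8 ∷ []) ∷ []) (0 ∷ 1 ∷ 2 ∷ 3 ∷ 4 ∷ 5 ∷ 6 ∷ [])
            lenB (walk-value gB εB edgeB k) (walk-value gB εB edgeB (restrict j (All.map proj₁ sj)))
          crossings : Z (pairInd p₁ q₁ ∷ pairInd p₂ q₂ ∷ pairInd p₃ q₃ ∷ pairInd p₄ q₄ ∷ gA p₁ ∷ gA p₂ ∷ gA p₃ ∷ gA p₄ ∷ gB q₁ ∷ gB q₂ ∷ gB q₃ ∷ gB q₄ ∷ [])
          crossings = comb (pairInd p₁ q₁ ∷ pairInd p₂ q₂ ∷ pairInd p₃ q₃ ∷ pairInd p₄ q₄ ∷ gA p₁ ∷ gA p₂ ∷ gA p₃ ∷ gA p₄ ∷ gB q₁ ∷ gB q₂ ∷ gB q₃ ∷ gB q₄ ∷ pairInd a₁ b₁ ∷ gA a₁ ∷ gB b₁ ∷ [])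
            ((0 ∷ 4 ∷ 8 ∷ 12 ∷ 13 ∷ 14 ∷ []) ∷ (1 ∷ 5 ∷ 9 ∷ 12 ∷ 13 ∷ 14 ∷ []) ∷ (2 ∷ 6 ∷ 10 ∷ 12 ∷ 13 ∷ 14 ∷ []) ∷ (3 ∷ 7 ∷ 11 ∷ 12 ∷ 13 ∷ 14 ∷ []) ∷ [])
            (0 ∷ 1 ∷ 2 ∷ 3 ∷ 4 ∷ 5 ∷ 6 ∷ 7 ∷ 8 ∷ 9 ∷ 10 ∷ 11 ∷ [])
            (uniform c₁′) (uniform c₂′) (uniform c₃′) (uniform c₄′)
          final : Z (rA ∷ rB ∷ [])
          final = comb (rA ∷ rB ∷ walkEdges W ∷ pairInd q₁ p₁ ∷ walkEdges L ∷ pairInd p₂ q₂ ∷ walkEdges M ∷ pairInd q₃ p₃ ∷ walkEdges xs ∷ pairInd p₄ q₄ ∷ walkEdges ys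
              ∷ gA p₁ ∷ gA p₂ ∷ gA p₃ ∷ gA p₄ ∷ gB q₁ ∷ gB q₂ ∷ gB q₃ ∷ gB q₄ ∷ pairInd p₁ q₁ ∷ pairInd p₃ q₃ ∷ [])
            ((2 ∷ 3 ∷ []) ∷ (2 ∷ 4 ∷ 5 ∷ 6 ∷ 7 ∷ 8 ∷ 9 ∷ 10 ∷ []) ∷ (4 ∷ 8 ∷ 11 ∷ 12 ∷ 13 ∷ 14 ∷ 0 ∷ []) ∷ (6 ∷ 10 ∷ 15 ∷ 16 ∷ 17 ∷ 18 ∷ 1 ∷ [])
              ∷ (19 ∷ 5 ∷ 20 ∷ 9 ∷ 11 ∷ 12 ∷ 13 ∷ 14 ∷ 15 ∷ 16 ∷ 17 ∷ 18 ∷ []) ∷ (19 ∷ 3 ∷ []) ∷ (20 ∷ 7 ∷ []) ∷ []) (0 ∷ 1 ∷ [])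
            cyc joins sideA sideB crossings (Z-sym p₁ q₁) (Z-sym p₃ q₃)

-- Finding cross edges.

module Separated {n : ℕ} (G : Graph n) (3≤n : 3 ≤ n) where

  open Space G
  open Rooted G using (∉-head; ∉-tail; ∉-cons)
  open Denseness G
  open TwoParts G 3≤n
  open CrossEdges G 3≤n

  private
    V = Fin n

  Avoiding : (A B : V → Bool) → Set
  Avoiding A B = ∀ {c c′} → c ≢ c′ → ∃ λ a → ∃ λ b → Cross A B a b × a ∉ c ∷ c′ ∷ [] × b ∉ c ∷ c′ ∷ []

  abstract
    change : ∀ {A : V → Bool} {u v y xs} → Walk (Adj G) u v xs → y ∈ xs → T (A u) → ¬ T (A y) →
             ∃ λ a → ∃ λ b → a ∈ xs × b ∈ xs × Adj G a b × T (A a) × ¬ T (A b)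
    change end (here refl) au ¬ay = contradiction au ¬ay
    change (step e h) (here refl) au ¬ay = contradiction au ¬ay
    change {A} {u} (step {y = w} {xs = xs} e h) (there i) au ¬ay = by (T? (A w))
      where
      by : Dec (T (A w)) → ∃ λ a → ∃ λ b → a ∈ u ∷ xs × b ∈ u ∷ xs × Adj G a b × T (A a) × ¬ T (A b)
      by (no ¬aw) = u , w , here refl , there (start-∈ h) , e , au , ¬aw
      by (yes aw) = let (a , b , ia , ib , r) = change {A = A} h i aw ¬ay in a , b , there ia , there ib , r

    -- The interior of a Hamilton path from c to c′ consists of all other vertices. Three vertices
    -- in each part ensure that it meets both, so it changes parts somewhere.
    avoiding : ∀ {A B} → HamiltonConnected G → (∀ x → T (A x) ⊎ T (B x)) → (∀ {x} → T (A x) → T (B x) → ⊥) → 3 ≤ # A → 3 ≤ # B → Avoiding A B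
    avoiding {A} {B} hc cover disjoint bigA bigB {c} {c′} ne = go (hc c c′ ne) (pick A (c ∷ c′ ∷ []) bigA) (pick B (c ∷ c′ ∷ []) bigB)
      where
      Result : Set
      Result = ∃ λ a → ∃ λ b → Cross A B a b × a ∉ c ∷ c′ ∷ [] × b ∉ c ∷ c′ ∷ []
      go : HamPath G c c′ → (∃ λ x → T (A x) × x ∉ c ∷ c′ ∷ []) → (∃ λ x → T (B x) × x ∉ c ∷ c′ ∷ []) → Result
      go (mid , (c∉ ∷ uq) , l , len) (a , aa , a∉) (b , bb , b∉) = use mid refl
        where
        inner : ∀ {x} → x ∉ c ∷ c′ ∷ [] → x ∈ mid
        inner {x} x∉ = locate (full-length (c∉ ∷ uq) len x)
          where
          locate′ : x ∈ mid ⊎ x ∈ c′ ∷ [] → x ∈ mid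
          locate′ (inj₁ i)        = i
          locate′ (inj₂ (here e)) = contradiction e (∉-head (∉-tail x∉))
          locate : x ∈ c ∷ mid ++ c′ ∷ [] → x ∈ mid
          locate (here e)  = contradiction e (∉-head x∉)
          locate (there i) = locate′ (∈-++⁻ mid i)
        outer : ∀ {x} → x ∈ mid → x ∉ c ∷ c′ ∷ []
        outer {x} i = ∉-cons (λ e → All.lookup (Allₚ.++⁻ˡ mid c∉) i (sym e)) (∉-cons (λ e → last mid uq i e) (λ ()))
          where
          last : ∀ ms → Unique (ms ++ c′ ∷ []) → x ∈ ms → x ≢ c′
          last (y ∷ ms) (p ∷ _) (here refl) = All.lookup p (∈-++⁺ʳ ms (here refl))
          last (y ∷ ms) (_ ∷ u) (there i)   = last ms u i
        use : ∀ ms → mid ≡ ms → Result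
        use []       e with () ← subst (a ∈_) e (inner a∉)
        use (k ∷ ks) refl = walk-in (before c (k ∷ ks) (linked⇒walk mid l))
          where
          drop-first : ∀ {x} → Walk (Adj G) c x (c ∷ k ∷ ks) → Walk (Adj G) k x (k ∷ ks)
          drop-first (step e h) with walk-∷ h
          ... | _ , refl = h
          finish : (∃ λ a → ∃ λ b → a ∈ mid × b ∈ mid × Adj G a b × T (A a) × ¬ T (A b)) → Result
          finish (a , b , ia , ib , e , ta , ¬tb) = a , b , cross e ta ([ (λ t → contradiction t ¬tb) , id ]′ (cover b)) , outer ia , outer ib
          finish′ : (∃ λ a → ∃ λ b → a ∈ mid × b ∈ mid × Adj G a b × T (B a) × ¬ T (B b)) → Result
          finish′ (a , b , ia , ib , e , ta , ¬tb) = b , a , cross (Adj-sym e) ([ id , (λ t → contradiction t ¬tb) ]′ (cover b)) ta , outer ib , outer ia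
          walk-in : (∃ λ x → Walk (Adj G) c x (c ∷ k ∷ ks) × Adj G x c′) → Result
          walk-in (x , h , _) = side (cover k)
            where
            side : T (A k) ⊎ T (B k) → Result
            side (inj₁ ak) = finish (change {A = A} (drop-first h) (inner b∉) ak (λ t → disjoint t bb))
            side (inj₂ bk) = finish′ (change {A = B} (drop-first h) (inner a∉) bk (λ t → disjoint aa t))

    -- No two vertices cover all cross edges, so König's theorem promises a matching of three. It is
    -- built here by explicit augmentation, each further edge being requested so that it avoids two
    -- chosen vertices.
    find-three : ∀ {A B} → Avoiding A B → (∀ {x} → T (A x) → T (B x) → ⊥) → ∀ {x y : V} → x ≢ y → Three A B
    find-three {A} {B} av disjoint x≢y = s₁ (av x≢y)
      where
      Edge : V → V → Set
      Edge c c′ = ∃ λ a → ∃ λ b → Cross A B a b × a ∉ c ∷ c′ ∷ [] × b ∉ c ∷ c′ ∷ []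
      apart : ∀ {a b} → T (A a) → T (B b) → a ≢ b
      apart ta tb refl = disjoint ta tb
      mk : ∀ {a₁ a₂ a₃ b₁ b₂ b₃} → Cross A B a₁ b₁ → Cross A B a₂ b₂ → Cross A B a₃ b₃ → a₁ ≢ a₂ → a₁ ≢ a₃ → a₂ ≢ a₃ → b₁ ≢ b₂ → b₁ ≢ b₃ → b₂ ≢ b₃ → Three A B
      mk c₁ c₂ c₃ p q r s t u = three c₁ c₂ c₃ ((p ∷ q ∷ []) ∷ (r ∷ []) ∷ [] ∷ []) ((s ∷ t ∷ []) ∷ (u ∷ []) ∷ [] ∷ [])
      -- a₁b₁ and a₂b₂ are disjoint and b₁ has a second neighbour x outside a₁, a₂.
      s₃ : ∀ {a₁ b₁ a₂ b₂ x} → Cross A B a₁ b₁ → Cross A B a₂ b₂ → a₁ ≢ a₂ → b₁ ≢ b₂ → Cross A B x b₁ → x ≢ a₁ → x ≢ a₂ → Three A B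
      s₃ {a₁} {b₁} {a₂} {b₂} {x} c₁ c₂ a₁≢a₂ b₁≢b₂ cx x≢a₁ x≢a₂ = go (av (≢-sym (apart (Cross.in-A c₂) (Cross.in-B c₁))))
        where
        go : Edge b₁ a₂ → Three A B
        go (x′ , y′ , c′ , x′∉ , y′∉) = case₁ (y′ ≟ b₂) (x′ ≟ a₁)
          where
          x′≢a₂ : x′ ≢ a₂
          x′≢a₂ = ∉-head (∉-tail x′∉)
          y′≢b₁ : y′ ≢ b₁
          y′≢b₁ = ∉-head y′∉
          case₂ : y′ ≡ b₂ → Edge b₁ b₂ → Three A B
          case₂ refl (x″ , y″ , c″ , _ , y″∉) = case₃ (x″ ≟ a₁) (x″ ≟ a₂) (x′ ≟ a₁)
            where
            y₁ : b₁ ≢ y″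
            y₁ = ≢-sym (∉-head y″∉)
            y₂ : b₂ ≢ y″
            y₂ = ≢-sym (∉-head (∉-tail y″∉))
            case₃ : Dec (x″ ≡ a₁) → Dec (x″ ≡ a₂) → Dec (x′ ≡ a₁) → Three A B
            case₃ (no n₁) (no n₂) _ = mk c₁ c₂ c″ a₁≢a₂ (≢-sym n₁) (≢-sym n₂) b₁≢b₂ y₁ y₂
            case₃ (yes refl) _ _ = mk cx c₂ c″ x≢a₂ x≢a₁ (≢-sym a₁≢a₂) b₁≢b₂ y₁ y₂
            case₃ (no _) (yes refl) (no n₃) = mk c₁ c′ c″ (≢-sym n₃) a₁≢a₂ x′≢a₂ b₁≢b₂ y₁ y₂
            case₃ (no _) (yes refl) (yes refl) = mk cx c′ c″ x≢a₁ x≢a₂ a₁≢a₂ b₁≢b₂ y₁ y₂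
          case₁ : Dec (y′ ≡ b₂) → Dec (x′ ≡ a₁) → Three A B
          case₁ (yes e) _ = case₂ e (av b₁≢b₂)
          case₁ (no n₁) (no n₂) = mk c₁ c₂ c′ a₁≢a₂ (≢-sym n₂) (≢-sym x′≢a₂) b₁≢b₂ (≢-sym y′≢b₁) (≢-sym n₁)
          case₁ (no n₁) (yes refl) = mk cx c₂ c′ x≢a₂ x≢a₁ (≢-sym a₁≢a₂) b₁≢b₂ (≢-sym y′≢b₁) (≢-sym n₁)
      s₂ : ∀ {a₁ b₁} → Cross A B a₁ b₁ → Edge a₁ b₁ → Three A B
      s₂ {a₁} {b₁} c₁ (a₂ , b₂ , c₂ , a₂∉ , b₂∉) = go (av a₁≢a₂)
        where
        a₁≢a₂ : a₁ ≢ a₂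
        a₁≢a₂ = ≢-sym (∉-head a₂∉)
        b₁≢b₂ : b₁ ≢ b₂
        b₁≢b₂ = ≢-sym (∉-head (∉-tail b₂∉))
        go : Edge a₁ a₂ → Three A B
        go (x , y , c , x∉ , _) = by (y ≟ b₁) (y ≟ b₂)
          where
          by : Dec (y ≡ b₁) → Dec (y ≡ b₂) → Three A B
          by (no n₁) (no n₂) = mk c₁ c₂ c a₁≢a₂ (≢-sym (∉-head x∉)) (≢-sym (∉-head (∉-tail x∉))) b₁≢b₂ (≢-sym n₁) (≢-sym n₂)
          by (yes refl) _    = s₃ c₁ c₂ a₁≢a₂ b₁≢b₂ c (∉-head x∉) (∉-head (∉-tail x∉))
          by (no _) (yes refl) = s₃ c₂ c₁ (≢-sym a₁≢a₂) (≢-sym b₁≢b₂) c (∉-head (∉-tail x∉)) (∉-head x∉)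
      s₁ : ∀ {c c′} → Edge c c′ → Three A B
      s₁ (a , b , c , _) = s₂ c (av (apart (Cross.in-A c) (Cross.in-B c)))

  -- Hamilton cycles with four cross edges.

  module Fourfold {A B : V → Bool} (pA : Parting A B) (pB : Parting B A) (vA : Valued A) (vB : Valued B) (t : Three A B)
    (outward : ∀ {a} → T (A a) → ∃ λ b → Cross A B a b) where

    open Three t
    open Combine pA pB vA vB t
    open Valued vA using () renaming (ε to εA)
    open Valued vB using () renaming (ε to εB)

    private
      Goal : Set
      Goal = Z (rep (# A) εA ∷ rep (# B) εB ∷ [])

      dA = Parting.dense pA
      dB = Parting.dense pB

      A-big : 2000 ≤ # A
      A-big = ≤-trans (≤-trans (le 2000 2200) (Dense.deg dA (Cross.in-A c₁))) (#-mono {p = adj G a₁ ∩ A} {q = A} (λ x t → proj₂ (∧-T {adj G a₁ x} t)))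

      segment : ∀ {P d x y} → Dense P d 1500 → T (P x) → T (P y) → x ≢ y → ∀ D → length D ≤ 20 →
                ∃ λ L → Walk (Within P) x y L × Unique L × length L ≤ 50 × All (λ v → v ≡ x ⊎ v ≡ y ⊎ v ∉ D) L
      segment {P} {x = x} {y} dP px py x≢y D |D| = build (connect dP (x ∷ y ∷ D) px py (≤-trans (s≤s (s≤s (s≤s |D|))) (le 23 1500)))
        where
        build : (∃ λ p → ∃ λ q → T (P p) × T (P q) × Adj G x p × Adj G p q × Adj G q y × p ∉ x ∷ y ∷ D × q ∉ x ∷ y ∷ D) →
                ∃ λ L → Walk (Within P) x y L × Unique L × length L ≤ 50 × All (λ v → v ≡ x ⊎ v ≡ y ⊎ v ∉ D) L
        build (p , q , pp , pq , e₁ , e₂ , e₃ , p∉ , q∉) = _ , step (e₁ , px , pp) (step (e₂ , pp , pq) (step (e₃ , pq , py) end)) ,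
          (Adj-irr e₁ ∷ ≢-sym (∉-head q∉) ∷ x≢y ∷ []) ∷ (Adj-irr e₂ ∷ ∉-head (∉-tail p∉) ∷ []) ∷ (Adj-irr e₃ ∷ []) ∷ [] ∷ [] ,
          le 4 50 , inj₁ refl ∷ inj₂ (inj₂ (∉-tail (∉-tail p∉))) ∷ inj₂ (inj₂ (∉-tail (∉-tail q∉))) ∷ inj₂ (inj₁ refl) ∷ []

      off : ∀ {x y w : V} {D L : List V} → All (λ v → v ≡ x ⊎ v ≡ y ⊎ v ∉ D) L → w ≢ x → w ≢ y → w ∈ D → w ∉ L
      off {x} {y} {w} {D} fresh nx ny i j = go (All.lookup fresh j)
        where
        go : w ≡ x ⊎ w ≡ y ⊎ w ∉ D → ⊥
        go (inj₁ e)        = nx e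
        go (inj₂ (inj₁ e)) = ny e
        go (inj₂ (inj₂ f)) = f i

      -- The cycle visits s directly between two of its neighbours in A, so the middle path inside B
      -- is the single vertex s.
      star-with : ∀ {s a′ b′ a″ b″} → T (B s) → 10 ≤ # (adj G s ∩ A) → Cross A B a′ b′ → Cross A B a″ b″ → a′ ≢ a″ → b′ ≢ b″ → b′ ≢ s → b″ ≢ s → Goal
      star-with {s} {a′} {b′} {a″} {b″} bs many c′ c″ a≢ b≢ b′≢s b″≢s = go₁ (pick (adj G s ∩ A) (a′ ∷ a″ ∷ []) (≤-trans (le 3 10) many))
        where
        go₁ : (∃ λ d → T ((adj G s ∩ A) d) × d ∉ a′ ∷ a″ ∷ []) → Goal
        go₁ (d , td , d∉) = go₂ (pick (adj G s ∩ A) (d ∷ a′ ∷ a″ ∷ []) (≤-trans (le 4 10) many))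
          where
          go₂ : (∃ λ d′ → T ((adj G s ∩ A) d′) × d′ ∉ d ∷ a′ ∷ a″ ∷ []) → Goal
          go₂ (d′ , td′ , d′∉) = go₃ (segment dA (Cross.in-A c′) (proj₂ (∧-T {adj G s d} td)) (≢-sym (∉-head d∉)) (d′ ∷ a″ ∷ []) (le 2 20))
            where
            go₃ : (∃ λ L → Walk (Within A) a′ d L × Unique L × length L ≤ 50 × All (λ v → v ≡ a′ ⊎ v ≡ d ⊎ v ∉ d′ ∷ a″ ∷ []) L) → Goal
            go₃ (L , h , u , len , fresh) = four-crossings h u (end {x = s}) ([] ∷ []) c′
              (cross (Adj-sym (proj₁ (∧-T {adj G s d} td))) (proj₂ (∧-T {adj G s d} td)) bs)
              (cross (Adj-sym (proj₁ (∧-T {adj G s d′} td′))) (proj₂ (∧-T {adj G s d′} td′)) bs) c″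
              (∉-head (∉-tail (∉-tail d′∉)))
              (off fresh (∉-head (∉-tail d′∉)) (∉-head d′∉) (here refl))
              (off fresh (≢-sym a≢) (≢-sym (∉-head (∉-tail d∉))) (there (here refl)))
              (≢-sym b≢) (∉-cons b″≢s (λ ())) (∉-cons b′≢s (λ ())) len (le 1 50)

      star : ∀ {s} → T (B s) → 10 ≤ # (adj G s ∩ A) → Goal
      star {s} bs many = go a-distinct b-distinct (s ≟ b₁) (s ≟ b₂)
        where
        go : Unique (a₁ ∷ a₂ ∷ a₃ ∷ []) → Unique (b₁ ∷ b₂ ∷ b₃ ∷ []) → Dec (s ≡ b₁) → Dec (s ≡ b₂) → Goal
        go (_ ∷ (a₂₃ ∷ []) ∷ _) ((b₁₂ ∷ b₁₃ ∷ []) ∷ (b₂₃ ∷ []) ∷ _) (yes refl) _ = star-with bs many c₂ c₃ a₂₃ b₂₃ (≢-sym b₁₂) (≢-sym b₁₃)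
        go ((a₁₂ ∷ a₁₃ ∷ []) ∷ _) ((b₁₂ ∷ b₁₃ ∷ []) ∷ (b₂₃ ∷ []) ∷ _) (no _) (yes refl) = star-with bs many c₁ c₃ a₁₃ b₁₃ b₁₂ (≢-sym b₂₃)
        go ((a₁₂ ∷ a₁₃ ∷ []) ∷ _) ((b₁₂ ∷ b₁₃ ∷ []) ∷ _) (no n₁) (no n₂) = star-with bs many c₁ c₂ a₁₂ b₁₂ (≢-sym n₁) (≢-sym n₂)

      matching : ∀ {p₁ p₂ p₃ p₄ q₁ q₂ q₃ q₄} → Cross A B p₁ q₁ → Cross A B p₂ q₂ → Cross A B p₃ q₃ → Cross A B p₄ q₄ →
                 Unique (p₁ ∷ p₂ ∷ p₃ ∷ p₄ ∷ []) → Unique (q₁ ∷ q₂ ∷ q₃ ∷ q₄ ∷ []) → Goal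
      matching {p₁} {p₂} {p₃} {p₄} {q₁} {q₂} {q₃} {q₄} k₁ k₂ k₃ k₄ ((p₁₂ ∷ p₁₃ ∷ p₁₄ ∷ []) ∷ (p₂₃ ∷ p₂₄ ∷ []) ∷ (p₃₄ ∷ []) ∷ _)
        ((q₁₂ ∷ q₁₃ ∷ q₁₄ ∷ []) ∷ (q₂₃ ∷ q₂₄ ∷ []) ∷ (q₃₄ ∷ []) ∷ _) =
        go (segment dA (Cross.in-A k₁) (Cross.in-A k₂) p₁₂ (p₃ ∷ p₄ ∷ []) (le 2 20)) (segment dB (Cross.in-B k₂) (Cross.in-B k₃) q₂₃ (q₄ ∷ q₁ ∷ []) (le 2 20))
        where
        go : (∃ λ L → Walk (Within A) p₁ p₂ L × Unique L × length L ≤ 50 × All (λ v → v ≡ p₁ ⊎ v ≡ p₂ ⊎ v ∉ p₃ ∷ p₄ ∷ []) L) →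
             (∃ λ M → Walk (Within B) q₂ q₃ M × Unique M × length M ≤ 50 × All (λ v → v ≡ q₂ ⊎ v ≡ q₃ ⊎ v ∉ q₄ ∷ q₁ ∷ []) M) → Goal
        go (L , h , u , len , fr) (M , h′ , u′ , len′ , fr′) = four-crossings h u h′ u′ k₁ k₂ k₃ k₄ p₃₄
          (off fr (≢-sym p₁₃) (≢-sym p₂₃) (here refl)) (off fr (≢-sym p₁₄) (≢-sym p₂₄) (there (here refl)))
          (≢-sym q₁₄) (off fr′ (≢-sym q₂₄) (≢-sym q₃₄) (here refl)) (off fr′ q₁₂ q₁₃ (there (here refl))) len len′

      -- Either some vertex of B has many neighbours in A, or the edges leaving A contain a matching of size four.
      next : ∀ (qs ps : List V) → length qs + length ps ≤ 6 → All (λ q → # (adj G q ∩ A) < 10) qs →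
             ∃ λ p → ∃ λ q → Cross A B p q × p ∉ ps × All (λ q′ → ¬ Adj G p q′) qs
      next qs ps small few = go (pick (A ∖ (λ x → ⌊ anyAdj x ⌋)) ps (≤-trans (≤-trans (s≤s (≤-trans (m≤n+m _ _) small)) (le 7 100)) room))
        where
        anyAdj : ∀ x → Dec (Any (λ q → Adj G q x) qs)
        anyAdj x = any? (λ q → T? (adj G q x)) qs
        bad : ∀ qs → All (λ q → # (adj G q ∩ A) < 10) qs → # (A ∩ (λ x → ⌊ any? (λ q → T? (adj G q x)) qs ⌋)) ≤ 10 * length qs
        bad []       []       = #-empty _ (λ x t → proj₂ (∧-T {A x} t))
        bad (q ∷ qs) (f ∷ fs) = ≤-trans (#-subadd _ (adj G q ∩ A) (A ∩ (λ x → ⌊ any? (λ q → T? (adj G q x)) qs ⌋)) cases)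
          (≤-trans (≤-trans (n≤1+n _) f ⊹ bad qs fs) (≤-reflexive (sym (*-suc 10 (length qs)))))
          where
          cases : ∀ x → T ((A ∩ (λ x → ⌊ any? (λ q → T? (adj G q x)) (q ∷ qs) ⌋)) x) → T ((adj G q ∩ A) x) ⊎ T ((A ∩ (λ x → ⌊ any? (λ q → T? (adj G q x)) qs ⌋)) x)
          cases x t = split (∧-T {A x} t)
            where
            sub : T (A x) → Any (λ q → Adj G q x) (q ∷ qs) → T ((adj G q ∩ A) x) ⊎ T ((A ∩ (λ x → ⌊ any? (λ q → T? (adj G q x)) qs ⌋)) x)
            sub a (here e)  = inj₁ (∧-intro e a)
            sub a (there i) = inj₂ (∧-intro a (fromWitness i))
            split : T (A x) × T ⌊ any? (λ q → T? (adj G q x)) (q ∷ qs) ⌋ → T ((adj G q ∩ A) x) ⊎ T ((A ∩ (λ x → ⌊ any? (λ q → T? (adj G q x)) qs ⌋)) x)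
            split (a , w) = sub a (toWitness w)
        room : 100 ≤ # (A ∖ (λ x → ⌊ anyAdj x ⌋))
        room = lin (# A ∷ # (A ∩ (λ x → ⌊ anyAdj x ⌋)) ∷ # (A ∖ (λ x → ⌊ anyAdj x ⌋)) ∷ length qs ∷ length ps ∷ [])
          ((con 2000 ≲ x₀) ∷ (x₀ ≲ x₁ :+ x₂) ∷ (x₁ ≲ 10 :* x₃) ∷ (10 :* (x₃ :+ x₄) ≲ con 60) ∷ []) (con 100 ≲ x₂)
          A-big (≤-reflexive (#-split A (λ x → ⌊ anyAdj x ⌋))) (bad qs few) (*-monoʳ-≤ 10 small)
        go : (∃ λ p → T ((A ∖ (λ x → ⌊ anyAdj x ⌋)) p) × p ∉ ps) → ∃ λ p → ∃ λ q → Cross A B p q × p ∉ ps × All (λ q′ → ¬ Adj G p q′) qs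
        go (p , tp , p∉) = p , proj₁ (outward ap) , proj₂ (outward ap) , p∉ , Allₚ.¬Any⇒All¬ qs (λ i → not-T (proj₂ (∧-T {A p} tp)) (fromWitness (flip i)))
          where
          ap : T (A p)
          ap = proj₁ (∧-T {A p} tp)
          flip : ∀ {qs} → Any (λ q → Adj G p q) qs → Any (λ q → Adj G q p) qs
          flip (here e)  = here (Adj-sym e)
          flip (there i) = there (flip i)

      differ : ∀ {p q q′} → Adj G p q → ¬ Adj G p q′ → q ≢ q′
      differ e ¬e refl = ¬e e

    abstract
      -- Each new p has no neighbour among the earlier q's, so whichever neighbour in B it is given
      -- is new. Such a p exists as long as every earlier q has fewer than ten neighbours in A;
      -- otherwise `star` finishes.
      fourfold : Z (rep (# A) εA ∷ rep (# B) εB ∷ [])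
      fourfold = g₁ (next [] [] z≤n [])
        where
        Next : List V → List V → Set
        Next qs ps = ∃ λ p → ∃ λ q → Cross A B p q × p ∉ ps × All (λ q′ → ¬ Adj G p q′) qs
        heavy? : ∀ q → Dec (10 ≤ # (adj G q ∩ A))
        heavy? q = 10 ≤? # (adj G q ∩ A)
        g₁ : Next [] [] → Goal
        g₁ (p₁ , q₁ , k₁ , _ , _) = h₁ (heavy? q₁)
          where
          h₁ : Dec (10 ≤ # (adj G q₁ ∩ A)) → Goal
          h₁ (yes many) = star (Cross.in-B k₁) many
          h₁ (no few₁) = g₂ (next (q₁ ∷ []) (p₁ ∷ []) (le 2 6) (≰⇒> few₁ ∷ []))
            where
            g₂ : Next (q₁ ∷ []) (p₁ ∷ []) → Goal
            g₂ (p₂ , q₂ , k₂ , p₂∉ , (n₂₁ ∷ [])) = h₂ (heavy? q₂)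
              where
              h₂ : Dec (10 ≤ # (adj G q₂ ∩ A)) → Goal
              h₂ (yes many) = star (Cross.in-B k₂) many
              h₂ (no few₂) = g₃ (next (q₁ ∷ q₂ ∷ []) (p₁ ∷ p₂ ∷ []) (le 4 6) (≰⇒> few₁ ∷ ≰⇒> few₂ ∷ []))
                where
                g₃ : Next (q₁ ∷ q₂ ∷ []) (p₁ ∷ p₂ ∷ []) → Goal
                g₃ (p₃ , q₃ , k₃ , p₃∉ , (n₃₁ ∷ n₃₂ ∷ [])) = h₃ (heavy? q₃)
                  where
                  h₃ : Dec (10 ≤ # (adj G q₃ ∩ A)) → Goal
                  h₃ (yes many) = star (Cross.in-B k₃) many
                  h₃ (no few₃) = g₄ (next (q₁ ∷ q₂ ∷ q₃ ∷ []) (p₁ ∷ p₂ ∷ p₃ ∷ []) (le 6 6) (≰⇒> few₁ ∷ ≰⇒> few₂ ∷ ≰⇒> few₃ ∷ []))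
                    where
                    g₄ : Next (q₁ ∷ q₂ ∷ q₃ ∷ []) (p₁ ∷ p₂ ∷ p₃ ∷ []) → Goal
                    g₄ (p₄ , q₄ , k₄ , p₄∉ , (n₄₁ ∷ n₄₂ ∷ n₄₃ ∷ [])) = matching k₁ k₂ k₃ k₄
                      ((≢-sym (∉-head p₂∉) ∷ ≢-sym (∉-head p₃∉) ∷ ≢-sym (∉-head p₄∉) ∷ []) ∷ (≢-sym (∉-head (∉-tail p₃∉)) ∷ ≢-sym (∉-head (∉-tail p₄∉)) ∷ [])
                        ∷ (≢-sym (∉-head (∉-tail (∉-tail p₄∉))) ∷ []) ∷ [] ∷ [])
                      ((≢-sym (differ (Cross.edge k₂) n₂₁) ∷ ≢-sym (differ (Cross.edge k₃) n₃₁) ∷ ≢-sym (differ (Cross.edge k₄) n₄₁) ∷ [])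
                        ∷ (≢-sym (differ (Cross.edge k₃) n₃₂) ∷ ≢-sym (differ (Cross.edge k₄) n₄₂) ∷ []) ∷ (≢-sym (differ (Cross.edge k₄) n₄₃) ∷ []) ∷ [] ∷ [])

-- The separated case.

module SeparatedCase {n : ℕ} (G : Graph n) where

  open Space G
  open Denseness G
  open Parts G
  open Expanding G using (rep-even; rep-odd)

  private
    V = Fin n
    E = EdgeVec n

  data Parity : ℕ → Set where
    even : ∀ j → Parity (j + j)
    odd  : ∀ j → Parity (1 + (j + j))

  parity-of : ∀ i → Parity i
  parity-of zero    = even 0
  parity-of (suc i) with parity-of i
  ... | even j = odd j
  ... | odd j  = subst Parity (cong suc (+-suc j j)) (even (suc j))

  double≢odd : ∀ i j → i + i ≢ 1 + (j + j)
  double≢odd zero    j       ()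
  double≢odd (suc i) zero    e with () ← trans (sym (+-suc i i)) (cong pred e)
  double≢odd (suc i) (suc j) e = double≢odd i j (cong pred (trans (sym (+-suc i i)) (trans (cong pred e) (cong suc (+-suc j j)))))

  module _ (m : ℕ) (n≡ : n ≡ 1 + (m + m)) (deg : ∀ v → m ≤ # (adj G v)) (m-large : 10000 ≤ m) (hc : HamiltonConnected G)
    (X Y : V → Bool) (X-Y : ∀ {x} → T (X x) → ¬ T (Y x)) (sep : ∀ {x y} → T (X x) → T (Y y) → ¬ Adj G x y)
    (X-big : m ≤ # X + 300) (Y-big : m ≤ # Y + 300) where

    private
      3≤n : 3 ≤ n
      3≤n = ≤-trans (lin (m ∷ []) ((con 10000 ≲ x₀) ∷ []) (con 3 ≲ con 1 :+ (x₀ :+ x₀)) m-large) (≤-reflexive (sym n≡))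

      open TwoParts G 3≤n
      open CrossEdges G 3≤n
      open Separated G 3≤n

      degX degY : V → ℕ
      degX v = # (adj G v ∩ X)
      degY v = # (adj G v ∩ Y)

      -- A vertex outside X and Y joins the core in which it has more neighbours, with ties going to
      -- A. As it has at most 601 neighbours outside both cores, the larger share is at least 2200.
      A B : V → Bool
      A v = X v ∨ (not (Y v) ∧ (degY v ≤ᵇ degX v))
      B v = not (A v)

      A-case : ∀ {v} → T (A v) → T (X v) ⊎ (¬ T (Y v) × degY v ≤ degX v)
      A-case {v} t = go (∨-T {X v} t)
        where
        go : T (X v) ⊎ T (not (Y v) ∧ (degY v ≤ᵇ degX v)) → T (X v) ⊎ (¬ T (Y v) × degY v ≤ degX v)
        go (inj₁ x) = inj₁ x
        go (inj₂ t) = let (a , b) = ∧-T {not (Y v)} t in inj₂ (not-T a , ≤ᵇ⇒≤ _ _ b)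

      B-case : ∀ {v} → T (B v) → ¬ T (X v) × (T (Y v) ⊎ degX v ≤ degY v)
      B-case {v} t = (λ x → not-T t (Equivalence.from T-∨ (inj₁ x))) , go (T? (Y v))
        where
        go : Dec (T (Y v)) → T (Y v) ⊎ degX v ≤ degY v
        go (yes y) = inj₁ y
        go (no ¬y) = inj₂ (<⇒≤ (≰⇒> (λ h → not-T t (Equivalence.from (T-∨ {X v}) (inj₂ (∧-intro (not-intro ¬y) (≤⇒≤ᵇ h)))))))

      X⊑A : X ⊑ A
      X⊑A x t = Equivalence.from T-∨ (inj₁ t)

      A-Y : ∀ {x} → T (A x) → ¬ T (Y x)
      A-Y {x} t = go (A-case {x} t)
        where
        go : T (X x) ⊎ (¬ T (Y x) × degY x ≤ degX x) → ¬ T (Y x)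
        go (inj₁ a)       = X-Y a
        go (inj₂ (f , _)) = f

      B-X : ∀ {x} → T (B x) → ¬ T (X x)
      B-X {x} t = proj₁ (B-case {x} t)

      Y⊑B : Y ⊑ B
      Y⊑B y t = not-intro (λ a → A-Y {y} a t)

      -- X and Y are disjoint and contain at least 2m - 600 of the 2m + 1 vertices.
      rest-small : ∀ p → (∀ x → T (p x) → ¬ T (X x) × ¬ T (Y x)) → # p ≤ 601
      rest-small p f = lin (# p ∷ # X ∷ # Y ∷ # (X ∪ Y) ∷ n ∷ m ∷ # (X ∩ Y) ∷ [])
        ((x₀ :+ x₃ ≲ x₄) ∷ (x₁ :+ x₂ ≲ x₃ :+ x₆) ∷ (x₆ ≲ con 0) ∷ (x₄ ≲ con 1 :+ (x₅ :+ x₅)) ∷ (x₅ ≲ x₁ :+ con 300) ∷ (x₅ ≲ x₂ :+ con 300) ∷ []) (x₀ ≲ con 601)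
        (≤-trans (#-disjoint Full p (X ∪ Y) (λ _ _ → tt) (λ _ _ → tt) (λ x t u → [ proj₁ (f x t) , proj₂ (f x t) ]′ (∨-T {X x} u))) (≤-reflexive #-Full))
        (≤-reflexive (sym (#-∪ X Y))) (#-empty (X ∩ Y) (λ x t → X-Y (proj₁ (∧-T {X x} t)) (proj₂ (∧-T {X x} t))))
        (≤-reflexive n≡) X-big Y-big

      degree-sum : ∀ v → m ≤ degX v + degY v + 601
      degree-sum v = lin (m ∷ # (adj G v) ∷ degX v ∷ degY v ∷ # (adj G v ∖ X) ∷ # ((adj G v ∖ X) ∩ Y) ∷ # ((adj G v ∖ X) ∖ Y) ∷ [])
        ((x₀ ≲ x₁) ∷ (x₁ ≲ x₂ :+ x₄) ∷ (x₄ ≲ x₅ :+ x₆) ∷ (x₅ ≲ x₃) ∷ (x₆ ≲ con 601) ∷ []) (x₀ ≲ x₂ :+ x₃ :+ con 601)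
        (deg v) (≤-reflexive (#-split (adj G v) X)) (≤-reflexive (#-split (adj G v ∖ X) Y))
        (#-mono {p = (adj G v ∖ X) ∩ Y} {q = adj G v ∩ Y} (λ x t → let (a , b) = ∧-T {adj G v x ∧ not (X x)} t in ∧-intro (proj₁ (∧-T {adj G v x} a)) b))
        (rest-small ((adj G v ∖ X) ∖ Y) (λ x t → let (a , b) = ∧-T {adj G v x ∧ not (X x)} t in not-T (proj₂ (∧-T {adj G v x} a)) , not-T b))

      richA : ∀ {v} → T (A v) → 2200 ≤ degX v
      richA {v} t = go (A-case {v} t)
        where
        go : T (X v) ⊎ (¬ T (Y v) × degY v ≤ degX v) → 2200 ≤ degX v
        go (inj₁ x) = lin (m ∷ degX v ∷ degY v ∷ []) ((x₀ ≲ x₁ :+ x₂ :+ con 601) ∷ (x₂ ≲ con 0) ∷ (con 10000 ≲ x₀) ∷ []) (con 2200 ≲ x₁)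
          (degree-sum v) (#-empty (adj G v ∩ Y) (λ y t → let (a , b) = ∧-T {adj G v y} t in sep x b a)) m-large
        go (inj₂ (_ , h)) = *-cancelˡ-≤ 2 (lin (m ∷ degX v ∷ degY v ∷ []) ((x₀ ≲ x₁ :+ x₂ :+ con 601) ∷ (x₂ ≲ x₁) ∷ (con 10000 ≲ x₀) ∷ []) (con 4400 ≲ 2 :* x₁)
          (degree-sum v) h m-large)

      richB : ∀ {v} → T (B v) → 2200 ≤ degY v
      richB {v} t = go (proj₂ (B-case {v} t))
        where
        go : T (Y v) ⊎ degX v ≤ degY v → 2200 ≤ degY v
        go (inj₁ y) = lin (m ∷ degX v ∷ degY v ∷ []) ((x₀ ≲ x₁ :+ x₂ :+ con 601) ∷ (x₁ ≲ con 0) ∷ (con 10000 ≲ x₀) ∷ []) (con 2200 ≲ x₂)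
          (degree-sum v) (#-empty (adj G v ∩ X) (λ x t → let (a , b) = ∧-T {adj G v x} t in sep b y (Adj-sym a))) m-large
        go (inj₂ h) = *-cancelˡ-≤ 2 (lin (m ∷ degX v ∷ degY v ∷ []) ((x₀ ≲ x₁ :+ x₂ :+ con 601) ∷ (x₁ ≲ x₂) ∷ (con 10000 ≲ x₀) ∷ []) (con 4400 ≲ 2 :* x₂)
          (degree-sum v) h m-large)

      A∖X-small : # (A ∖ X) ≤ 601
      A∖X-small = rest-small (A ∖ X) (λ x t → let (a , b) = ∧-T {A x} t in not-T b , A-Y {x} a)

      B∖Y-small : # (B ∖ Y) ≤ 601
      B∖Y-small = rest-small (B ∖ Y) (λ x t → let (a , b) = ∧-T {B x} t in B-X {x} a , not-T b)

      sep′ : ∀ {x y} → T (Y x) → T (X y) → ¬ Adj G x y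
      sep′ y x e = sep x y (Adj-sym e)

      denseA : Dense A 700 1500
      denseA = part-dense m n≡ deg A X Y X⊑A (λ {x} → A-Y {x}) sep Y-big A∖X-small (λ {x} → richA {x})
      denseB : Dense B 700 1500
      denseB = part-dense m n≡ deg B Y X Y⊑B (λ {x} → B-X {x}) sep′ X-big B∖Y-small (λ {x} → richB {x})
      robustA : Robustly A
      robustA = part-robust m n≡ deg A X Y X⊑A (λ {x} → A-Y {x}) sep Y-big A∖X-small (λ {x} → richA {x})
      robustB : Robustly B
      robustB = part-robust m n≡ deg B Y X Y⊑B (λ {x} → B-X {x}) sep′ X-big B∖Y-small (λ {x} → richB {x})

      cover : ∀ x → T (A x) ⊎ T (B x)
      cover x = go (T? (A x))
        where
        go : Dec (T (A x)) → T (A x) ⊎ T (B x)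
        go (yes a) = inj₁ a
        go (no ¬a) = inj₂ (not-intro ¬a)

      disjoint : ∀ {x} → T (A x) → T (B x) → ⊥
      disjoint a b = not-T b a

      pA : Parting A B
      pA = record { cover = cover ; disjoint = λ {x} → disjoint {x} ; dense = denseA ; robust = robustA ; robust′ = robustB }
      pB : Parting B A
      pB = record { cover = λ x → [ inj₂ , inj₁ ]′ (cover x) ; disjoint = λ {x} b a → disjoint {x} a b ; dense = denseB ; robust = robustB ; robust′ = robustA }

      bigA : 3 ≤ # A
      bigA = ≤-trans (lin (m ∷ # X ∷ []) ((con 10000 ≲ x₀) ∷ (x₀ ≲ x₁ :+ con 300) ∷ []) (con 3 ≲ x₁) m-large X-big) (#-mono {p = X} {q = A} X⊑A)
      bigB : 3 ≤ # B
      bigB = ≤-trans (lin (m ∷ # Y ∷ []) ((con 10000 ≲ x₀) ∷ (x₀ ≲ x₁ :+ con 300) ∷ []) (con 3 ≲ x₁) m-large Y-big) (#-mono {p = Y} {q = B} Y⊑B)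

      two : ∃ λ (x : V) → ∃ λ y → x ≢ y
      two = go (#-find {p = A} (≤-trans (le 1 3) bigA)) (#-find {p = B} (≤-trans (le 1 3) bigB))
        where
        go : ∃ (λ x → T (A x)) → ∃ (λ y → T (B y)) → ∃ λ (x : V) → ∃ λ y → x ≢ y
        go (x , a) (y , b) = x , y , λ e → disjoint {y} (subst (T ∘ A) e a) b

      t : Three A B
      t = find-three (avoiding {A} {B} hc cover (λ {x} → disjoint {x}) bigA bigB) (λ {x} → disjoint {x}) (proj₂ (proj₂ two))

      vA : Valued A
      vA = OneSide.valued pA t
      vB : Valued B
      vB = OneSide.valued pB (flip-three t)

      open Three t
      open Valued vA renaming (g to gA; ε to εA; edge to edgeA)
      open Valued vB renaming (g to gB; ε to εB; edge to edgeB)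
      open Combine pA pB vA vB t

      sum-parts : # A + # B ≡ 1 + (m + m)
      sum-parts = trans (sym (#-split Full A)) (trans #-Full n≡)

      -- Inside its part a vertex has at most |P| - 1 neighbours, fewer than its degree. One of the
      -- two parts has at most m vertices, because together they have 2m + 1.
      outward : ∀ {P Q : V → Bool} → # P ≤ m → (∀ x → T (P x) ⊎ T (Q x)) → ∀ {a} → T (P a) → ∃ λ b → Cross P Q a b
      outward {P} {Q} small cov {a} pa = go (#-find {p = adj G a ∖ P} (lin (m ∷ # P ∷ # (adj G a) ∷ # (adj G a ∩ P) ∷ # (adj G a ∖ P) ∷ # ⟨ a ∷ [] ⟩ ∷ [])
          ((x₁ ≲ x₀) ∷ (x₀ ≲ x₂) ∷ (x₂ ≲ x₃ :+ x₄) ∷ (x₅ :+ x₃ ≲ x₁) ∷ (con 1 ≲ x₅) ∷ []) (con 1 ≲ x₄)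
          small (deg a) (≤-reflexive (#-split (adj G a) P))
          (#-disjoint P ⟨ a ∷ [] ⟩ (adj G a ∩ P) (λ x t → single x (⟨⟩∈ t)) (λ x t → proj₂ (∧-T {adj G a x} t))
            (λ x t u → Adj-irr (proj₁ (∧-T {adj G a x} u)) (sym (single′ x (⟨⟩∈ t)))))
          (#-pos ⟨ a ∷ [] ⟩ {a} (∈⟨⟩ (here refl)))))
        where
        single′ : ∀ x → x ∈ a ∷ [] → x ≡ a
        single′ x (here e) = e
        single : ∀ x → x ∈ a ∷ [] → T (P x)
        single x (here e) = subst (T ∘ P) (sym e) pa
        go : ∃ (λ x → T ((adj G a ∖ P) x)) → ∃ λ b → Cross P Q a b
        go (x , u) = let (e , np) = ∧-T {adj G a x} u in x , cross e pa ([ (λ p → contradiction p (not-T np)) , id ]′ (cov x))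

      fourfold : Z (rep (# A) εA ∷ rep (# B) εB ∷ [])
      fourfold = go (# A ≤? m)
        where
        go : Dec (# A ≤ m) → Z (rep (# A) εA ∷ rep (# B) εB ∷ [])
        go (yes small) = Fourfold.fourfold pA pB vA vB t (outward small cover)
        go (no large)  = comb (rep (# A) εA ∷ rep (# B) εB ∷ []) ((1 ∷ 0 ∷ []) ∷ []) (0 ∷ 1 ∷ [])
          (Fourfold.fourfold pB pA vB vA (flip-three t) (outward (lin (# A ∷ # B ∷ m ∷ []) ((con 1 :+ x₂ ≲ x₀) ∷ (x₀ :+ x₁ ≲ con 1 :+ (x₂ :+ x₂)) ∷ []) (x₁ ≲ x₂)
            (≰⇒> large) (≤-reflexive sum-parts)) (Parting.cover pB)))

      -- Exactly one of |A| and |B| is even. Four crossings kill the error of the odd part, and then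
      -- two crossings kill that of the even part.
      ε-zero : Z (εA ∷ []) × Z (εB ∷ [])
      ε-zero = go (# A) (# B) sum-parts (parity-of (# A)) (parity-of (# B)) fourfold κ-zero
        where
        go : ∀ a b → a + b ≡ 1 + (m + m) → Parity a → Parity b → Z (rep a εA ∷ rep b εB ∷ []) → Z (εA ∷ rep a εA ∷ εB ∷ rep b εB ∷ []) → Z (εA ∷ []) × Z (εB ∷ [])
        go _ _ e (even i) (odd j) f k =
          comb (rep (i + i) εA ∷ rep (1 + (j + j)) εB ∷ εA ∷ εB ∷ []) ((0 ∷ []) ∷ (0 ∷ 1 ∷ []) ∷ (1 ∷ 3 ∷ []) ∷ (0 ∷ 1 ∷ []) ∷ (2 ∷ 0 ∷ 3 ∷ 1 ∷ []) ∷ []) (2 ∷ [])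
            (rep-even i εA) f (rep-odd j εB) f k ,
          comb (rep (i + i) εA ∷ rep (1 + (j + j)) εB ∷ εA ∷ εB ∷ []) ((0 ∷ []) ∷ (0 ∷ 1 ∷ []) ∷ (1 ∷ 3 ∷ []) ∷ []) (3 ∷ [])
            (rep-even i εA) f (rep-odd j εB)
        go _ _ e (odd i) (even j) f k =
          comb (rep (1 + (i + i)) εA ∷ rep (j + j) εB ∷ εA ∷ εB ∷ []) ((1 ∷ []) ∷ (0 ∷ 1 ∷ []) ∷ (0 ∷ 2 ∷ []) ∷ []) (2 ∷ [])
            (rep-even j εB) f (rep-odd i εA) ,
          comb (rep (1 + (i + i)) εA ∷ rep (j + j) εB ∷ εA ∷ εB ∷ []) ((1 ∷ []) ∷ (0 ∷ 1 ∷ []) ∷ (0 ∷ 2 ∷ []) ∷ (0 ∷ 1 ∷ []) ∷ (2 ∷ 0 ∷ 3 ∷ 1 ∷ []) ∷ []) (3 ∷ [])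
            (rep-even j εB) f (rep-odd i εA) f k
        go _ _ e (even i) (even j) f k = contradiction (trans (sym (interchange i i j j)) e) (double≢odd (i + j) m)
        go _ _ e (odd i) (odd j) f k = contradiction (trans (sym (cong suc (trans (+-suc (i + i) (j + j)) (trans (cong suc (interchange i i j j)) (sym (+-suc (i + j) (i + j))))))) e)
          (double≢odd (suc (i + j)) m)

      -- The common value of the cross edges relative to gA and gB. Shifting gB by it repairs all
      -- cross edges and leaves the sums over edges inside B unchanged.
      φ : E
      φ = pairInd a₁ b₁ ⊕ (gA a₁ ⊕ gB b₁)

      φ-Z : Z (φ ∷ pairInd a₁ b₁ ∷ gA a₁ ∷ gB b₁ ∷ [])
      φ-Z = comb (φ ∷ pairInd a₁ b₁ ∷ gA a₁ ∷ gB b₁ ∷ (gA a₁ ⊕ gB b₁) ∷ []) ((0 ∷ 1 ∷ 4 ∷ []) ∷ (4 ∷ 2 ∷ 3 ∷ []) ∷ []) (0 ∷ 1 ∷ 2 ∷ 3 ∷ [])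
        (Z-⊕ (pairInd a₁ b₁) (gA a₁ ⊕ gB b₁)) (Z-⊕ (gA a₁) (gB b₁))

      g : V → E
      g v with T? (A v)
      ... | yes _ = gA v
      ... | no _  = gB v ⊕ φ

      g-A : ∀ v → T (A v) → g v ≡ gA v
      g-A v a with T? (A v)
      ... | yes _ = refl
      ... | no ¬a = contradiction a ¬a

      g-B : ∀ v → T (B v) → g v ≡ gB v ⊕ φ
      g-B v b with T? (A v)
      ... | yes a = contradiction a (not-T b)
      ... | no _  = refl

      crossing : ∀ {x y} → Adj G x y → T (A x) → T (B y) → Z (pairInd x y ∷ g x ∷ g y ∷ [])
      crossing {x} {y} e a b = subst₂ (λ P Q → Z (pairInd x y ∷ P ∷ Q ∷ [])) (sym (g-A x a)) (sym (g-B y b))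
        (comb (pairInd x y ∷ gA x ∷ (gB y ⊕ φ) ∷ gB y ∷ φ ∷ pairInd a₁ b₁ ∷ gA a₁ ∷ gB b₁ ∷ [])
          ((2 ∷ 3 ∷ 4 ∷ []) ∷ (4 ∷ 5 ∷ 6 ∷ 7 ∷ []) ∷ (0 ∷ 1 ∷ 3 ∷ 5 ∷ 6 ∷ 7 ∷ []) ∷ []) (0 ∷ 1 ∷ 2 ∷ [])
          (Z-⊕ (gB y) φ) φ-Z (uniform (cross e a b)))

      coboundary : Coboundary g
      coboundary {x} {y} e = go (cover x) (cover y)
        where
        go : T (A x) ⊎ T (B x) → T (A y) ⊎ T (B y) → Z (pairInd x y ∷ g x ∷ g y ∷ [])
        go (inj₁ a) (inj₂ b) = crossing e a b
        go (inj₂ b) (inj₁ a) = comb (pairInd x y ∷ g x ∷ g y ∷ pairInd y x ∷ []) ((3 ∷ 2 ∷ 1 ∷ []) ∷ (0 ∷ 3 ∷ []) ∷ []) (0 ∷ 1 ∷ 2 ∷ [])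
          (crossing (Adj-sym e) a b) (Z-sym x y)
        go (inj₁ a) (inj₁ a′) = subst₂ (λ P Q → Z (pairInd x y ∷ P ∷ Q ∷ [])) (sym (g-A x a)) (sym (g-A y a′))
          (comb (pairInd x y ∷ gA x ∷ gA y ∷ εA ∷ []) ((0 ∷ 1 ∷ 2 ∷ 3 ∷ []) ∷ (3 ∷ []) ∷ []) (0 ∷ 1 ∷ 2 ∷ []) (edgeA (e , a , a′)) (proj₁ ε-zero))
        go (inj₂ b) (inj₂ b′) = subst₂ (λ P Q → Z (pairInd x y ∷ P ∷ Q ∷ [])) (sym (g-B x b)) (sym (g-B y b′))
          (comb (pairInd x y ∷ (gB x ⊕ φ) ∷ (gB y ⊕ φ) ∷ εB ∷ gB x ∷ gB y ∷ φ ∷ [])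
            ((0 ∷ 4 ∷ 5 ∷ 3 ∷ []) ∷ (3 ∷ []) ∷ (1 ∷ 4 ∷ 6 ∷ []) ∷ (2 ∷ 5 ∷ 6 ∷ []) ∷ []) (0 ∷ 1 ∷ 2 ∷ [])
            (edgeB (e , b , b′)) (proj₂ ε-zero) (Z-⊕ (gB x) φ) (Z-⊕ (gB y) φ))

    separated-generated : HamiltonGenerated G
    separated-generated = coboundary⇒generated g coboundary

-- Nearly complete bipartite graphs: chains.

module Bipartite {n : ℕ} (G : Graph n) where

  open Space G
  open Rooted G using (∉-head; ∉-tail; ∉-left; ∉-right)
  open Denseness G

  private
    V = Fin n
    E = EdgeVec n

  -- I is the core of the side A; the vertices of A ∖ I are few and may have few neighbours in the core of the other side.
  record Bip (I A B : V → Bool) : Set where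
    field
      I⊑A      : I ⊑ A
      cover    : ∀ x → T (A x) ⊎ T (B x)
      disjoint : ∀ {x} → T (A x) → T (B x) → ⊥
      I-miss   : ∀ {x} → T (I x) → # (B ∖ adj G x) ≤ 602
      B-rich   : ∀ {x} → T (B x) → 1000000 ≤ # (adj G x ∩ I)
      A-rich   : ∀ {x} → T (A x) → 500000 ≤ # (adj G x ∩ B)
      A∖I-few  : # (A ∖ I) ≤ 1300

  Edges : Set
  Edges = List (V × V)

  ends : Edges → List V
  ends []             = []
  ends ((x , y) ∷ es) = x ∷ y ∷ ends es

  Inside : (V → Bool) → Edges → Set
  Inside P = All (λ (x , y) → Adj G x y × T (P x) × T (P y))

  -- How far g is from explaining the edge xy. For a coherent g only edges inside a side can have an
  -- excess.
  excess : (V → E) → V → V → E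
  excess g x y = pairInd x y ⊕ (g x ⊕ g y)

  total-excess : (V → E) → Edges → E
  total-excess g []             = zeroV
  total-excess g ((x , y) ∷ es) = excess g x y ⊕ total-excess g es

  length-ends : ∀ es → length (ends es) ≡ 2 * length es
  length-ends []       = refl
  length-ends (_ ∷ es) = trans (cong (2 +_) (length-ends es)) (sym (*-suc 2 (length es)))

  cnt-yes : ∀ (p : V → Bool) {x} xs → T (p x) → cnt p (x ∷ xs) ≡ suc (cnt p xs)
  cnt-yes p {x} xs t with p x
  ... | true = refl

  cnt-no : ∀ (p : V → Bool) {x} xs → ¬ T (p x) → cnt p (x ∷ xs) ≡ cnt p xs
  cnt-no p {x} xs f with p x
  ... | true  = contradiction tt f
  ... | false = refl

  cnt-++ : ∀ (p : V → Bool) xs ys → cnt p (xs ++ ys) ≡ cnt p xs + cnt p ys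
  cnt-++ p []       ys = refl
  cnt-++ p (x ∷ xs) ys with p x
  ... | true  = cong suc (cnt-++ p xs ys)
  ... | false = cnt-++ p xs ys

  ∉-++ : ∀ {v : V} xs {ys} → v ∉ xs → v ∉ ys → v ∉ xs ++ ys
  ∉-++ xs f g i = [ f , g ]′ (∈-++⁻ xs i)

  module _ {I A B : V → Bool} (bip : Bip I A B) where

    open Bip bip

    Coherent : (V → E) → Set
    Coherent g = ∀ {a b} → T (A a) → T (B b) → Adj G a b → Z (pairInd a b ∷ g a ∷ g b ∷ [])

    abstract
      B-not-A : ∀ {x} → T (B x) → ¬ T (A x)
      B-not-A b a = disjoint a b

      I-neighbour : ∀ {x} D → T (B x) → length D ≤ 100000 → ∃ λ i → T (I i) × Adj G x i × i ∉ D
      I-neighbour {x} D bx h = conv (pick (adj G x ∩ I) D (≤-trans (s≤s h) (≤-trans (le 100001 1000000) (B-rich bx))))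
        where
        conv : (∃ λ i → T ((adj G x ∩ I) i) × i ∉ D) → ∃ λ i → T (I i) × Adj G x i × i ∉ D
        conv (i , t , i∉) = let (a , b) = ∧-T {adj G x i} t in i , b , a , i∉

      B-neighbour : ∀ {x} D → T (A x) → length D ≤ 100000 → ∃ λ y → T (B y) × Adj G x y × y ∉ D
      B-neighbour {x} D ax h = conv (pick (adj G x ∩ B) D (≤-trans (s≤s h) (≤-trans (le 100001 500000) (A-rich ax))))
        where
        conv : (∃ λ i → T ((adj G x ∩ B) i) × i ∉ D) → ∃ λ y → T (B y) × Adj G x y × y ∉ D
        conv (i , t , i∉) = let (a , b) = ∧-T {adj G x i} t in i , b , a , i∉

      common : ∀ {a i} D → T (A a) → T (I i) → length D ≤ 100000 → ∃ λ y → T (B y) × Adj G a y × Adj G i y × y ∉ D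
      common {a} {i} D aa ii h = conv (pick ((adj G a ∩ B) ∩ adj G i) D (lin
          (length D ∷ # (adj G a ∩ B) ∷ # ((adj G a ∩ B) ∩ adj G i) ∷ # ((adj G a ∩ B) ∖ adj G i) ∷ # (B ∖ adj G i) ∷ [])
          ((x₀ ≲ con 100000) ∷ (con 500000 ≲ x₁) ∷ (x₁ ≲ x₂ :+ x₃) ∷ (x₃ ≲ x₄) ∷ (x₄ ≲ con 602) ∷ []) (con 1 :+ x₀ ≲ x₂)
          h (A-rich aa) (≤-reflexive (#-split (adj G a ∩ B) (adj G i))) (∖-mono (adj G a ∩ B) (adj G i) (λ y t → proj₂ (∧-T {adj G a y} t))) (I-miss ii)))
        where
        conv : (∃ λ y → T (((adj G a ∩ B) ∩ adj G i) y) × y ∉ D) → ∃ λ y → T (B y) × Adj G a y × Adj G i y × y ∉ D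
        conv (y , t , y∉) = let (t₁ , t₂) = ∧-T {adj G a y ∧ B y} t ; (t₃ , t₄) = ∧-T {adj G a y} t₁ in y , t₄ , t₃ , t₂ , y∉

    record Connector (x x′ : V) (D : List V) : Set where
      constructor connector
      field
        {i y i′}    : V
        in-I        : T (I i)
        in-B        : T (B y)
        in-I′       : T (I i′)
        x-i         : Adj G x i
        i-y         : Adj G i y
        y-i′        : Adj G y i′
        i′-x′       : Adj G i′ x′
        i≢i′        : i ≢ i′
        i∉          : i ∉ D
        y∉          : y ∉ D
        i′∉         : i′ ∉ D

    abstract
      connectB : ∀ {x x′} D → T (B x) → T (B x′) → length D ≤ 90000 → Connector x x′ D
      connectB {x} {x′} D bx bx′ h = go₁ (I-neighbour D bx (≤-trans h (le 90000 100000)))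
        where
        go₁ : (∃ λ i → T (I i) × Adj G x i × i ∉ D) → Connector x x′ D
        go₁ (i , ii , xi , i∉) = go₂ (I-neighbour (i ∷ D) bx′ (≤-trans (s≤s h) (le 90001 100000)))
          where
          go₂ : (∃ λ j → T (I j) × Adj G x′ j × j ∉ i ∷ D) → Connector x x′ D
          go₂ (j , ij , xj , j∉) = go₃ (common D (I⊑A i ii) ij (≤-trans h (le 90000 100000)))
            where
            go₃ : (∃ λ y → T (B y) × Adj G i y × Adj G j y × y ∉ D) → Connector x x′ D
            go₃ (y , by , iy , jy , y∉) = connector ii by ij xi iy (Adj-sym jy) (Adj-sym xj) (≢-sym (∉-head j∉)) i∉ y∉ (∉-tail j∉)

    -- A walk Λ from x to z prolonged by M to a vertex e of B, uniformly in Λ; p and q record the balance of M, w its value.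
    record Chain (x z : V) (Λ R : List V) (l p q : ℕ) (w : (V → E) → E) : Set where
      field
        {e}     : V
        {M}     : List V
        {c}     : E
        in-B    : T (B e)
        prolong : ∀ {Λ′} → Walk (Adj G) x z Λ′ → Walk (Adj G) x e (Λ′ ++ M)
        value   : ∀ {Λ′} → Walk (Adj G) x z Λ′ → Z (walkEdges (Λ′ ++ M) ∷ walkEdges Λ′ ∷ c ∷ [])
        cohere  : ∀ g → Coherent g → Z (c ∷ g z ∷ g e ∷ w g ∷ [])
        unique  : Unique (Λ ++ M)
        avoids  : All (_∉ R) (Λ ++ M)
        short   : length (Λ ++ M) ≤ l
        balance : cnt B M + q ≡ cnt A M + p

    trivial : ∀ {x z Λ R l} → T (B z) → Unique Λ → All (_∉ R) Λ → length Λ ≤ l → Chain x z Λ R l 0 0 (λ _ → zeroV)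
    trivial {x} {z} {Λ} bz uq av len = record { M = [] ; in-B = bz ; prolong = λ {Λ′} h → subst (Walk (Adj G) x z) (sym (++-identityʳ Λ′)) h
      ; c = zeroV
      ; value = λ {Λ′} h → subst (λ L → Z (walkEdges L ∷ walkEdges Λ′ ∷ zeroV ∷ [])) (sym (++-identityʳ Λ′))
          (comb (walkEdges Λ′ ∷ zeroV ∷ []) ((1 ∷ []) ∷ []) (0 ∷ 0 ∷ 1 ∷ []) Z-zero)
      ; cohere = λ g _ → comb (zeroV ∷ g z ∷ []) [] (0 ∷ 1 ∷ 1 ∷ 0 ∷ [])
      ; unique = subst Unique (sym (++-identityʳ Λ)) uq ; avoids = subst (All _) (sym (++-identityʳ Λ)) av
      ; short = subst (λ L → length L ≤ _) (sym (++-identityʳ Λ)) len ; balance = refl }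

    forget : ∀ {x z Λ R l p q w w′} → (∀ g → Z (w g ∷ w′ g ∷ [])) → Chain x z Λ R l p q w → Chain x z Λ R l p q w′
    forget {z = z} {w = w} {w′} f ch = record { e = e ; M = M ; c = c ; in-B = in-B ; prolong = prolong ; value = value ; unique = unique ; avoids = avoids ; short = short ; balance = balance
      ; cohere = λ g k → comb (c ∷ g z ∷ g e ∷ w g ∷ w′ g ∷ []) ((0 ∷ 1 ∷ 2 ∷ 3 ∷ []) ∷ (3 ∷ 4 ∷ []) ∷ []) (0 ∷ 1 ∷ 2 ∷ 4 ∷ []) (cohere g k) (f g) }
      where open Chain ch

    abstract
      -- The connector contributes two vertices of A and one of B. This offsets the one vertex by
      -- which N, starting and ending in B, favours B apart from its inside edges. R lists the
      -- vertices reserved for later segments and shrinks to R′; the seven new places are the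
      -- connector and at most four vertices of N.
      attach : ∀ {x z Λ R l p q w} (R′ : List V) {b b′ N p′ q′} {w′ : (V → E) → E} (ch : Chain x z Λ R l p q w) →
        Walk (Adj G) b b′ N → T (B b) → T (B b′) → Unique N → (∀ {v} → v ∈ Λ ++ Chain.M ch → v ∉ N) → All (_∉ R′) N → (∀ {v} → v ∈ R′ → v ∈ R) →
        (∀ g → Coherent g → Z (walkEdges N ∷ g b ∷ g b′ ∷ w′ g ∷ [])) → length N ≤ 4 → cnt B N + q′ ≡ cnt A N + p′ + 1 →
        l ≤ 60000 → length R′ ≤ 20000 →
        ∃ λ (ch′ : Chain x z Λ R′ (l + 7) (p + p′) (q + q′) (λ (g : V → E) → w g ⊕ w′ g)) → ∀ {v} → v ∈ Λ ++ Chain.M ch ⊎ v ∈ N → v ∈ Λ ++ Chain.M ch′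
      attach {x} {z} {Λ} {R} {l} {p} {q} {w} R′ {b} {b′} {N} {p′} {q′} {w′} ch h bb bb′ uN dN rN sub vN |N| bal l≤ |R′| =
        go (connectB ((Λ ++ M) ++ N ++ R′) in-B bb (≤-trans (≤-reflexive (trans (length-++ (Λ ++ M)) (cong (length (Λ ++ M) +_) (length-++ N))))
          (lin (length (Λ ++ M) ∷ length N ∷ length R′ ∷ l ∷ []) ((x₀ ≲ x₃) ∷ (x₁ ≲ con 4) ∷ (x₂ ≲ con 20000) ∷ (x₃ ≲ con 60000) ∷ []) (x₀ :+ (x₁ :+ x₂) ≲ con 90000)
            short |N| |R′| l≤)))
        where
        open Chain ch
        go : Connector e b ((Λ ++ M) ++ N ++ R′) → ∃ λ (ch′ : Chain x z Λ R′ (l + 7) (p + p′) (q + q′) (λ (g : V → E) → w g ⊕ w′ g)) → ∀ {v} → v ∈ Λ ++ M ⊎ v ∈ N → v ∈ Λ ++ Chain.M ch′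
        go (connector {i} {y} {i′} ii by ii′ ei iy yi′ i′b i≢i′ i∉ y∉ i′∉) = record
          { e = b′ ; M = M ++ S ; c = c ⊕ (pairInd e i ⊕ walkEdges S) ; in-B = bb′
          ; prolong = λ {Λ′} k → subst (Walk (Adj G) x b′) (++-assoc Λ′ M S) (join (prolong k) ei seg)
          ; value = val ; cohere = coh
          ; unique = subst Unique (++-assoc Λ M S) (Uniq.++⁺ unique uS disj)
          ; avoids = subst (All (_∉ R′)) (++-assoc Λ M S) (Allₚ.++⁺ (All.map (λ f j → f (sub j)) avoids)
              (outR i∉ ∷ outR y∉ ∷ outR i′∉ ∷ rN))
          ; short = ≤-trans (≤-reflexive (trans (cong length (sym (++-assoc Λ M S))) (length-++ (Λ ++ M)))) (short ⊹ s≤s (s≤s (s≤s |N|)))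
          ; balance = bal′ } , incl
          where
          S : List V
          S = i ∷ y ∷ i′ ∷ N
          incl : ∀ {v} → v ∈ Λ ++ M ⊎ v ∈ N → v ∈ Λ ++ M ++ S
          incl {v} (inj₁ j) = subst (v ∈_) (++-assoc Λ M S) (∈-++⁺ˡ j)
          incl (inj₂ j) = ∈-++⁺ʳ Λ (∈-++⁺ʳ M (there (there (there j))))
          seg : Walk (Adj G) i b′ S
          seg = step iy (step yi′ (step i′b h))
          outN : ∀ {v} → v ∉ (Λ ++ M) ++ N ++ R′ → v ∉ N
          outN f = ∉-left N (∉-right (Λ ++ M) f)
          outR : ∀ {v} → v ∉ (Λ ++ M) ++ N ++ R′ → v ∉ R′
          outR f = ∉-right N (∉-right (Λ ++ M) f)
          uS : Unique S
          uS = (Adj-irr iy ∷ i≢i′ ∷ Allₚ.¬Any⇒All¬ N (outN i∉)) ∷ (Adj-irr yi′ ∷ Allₚ.¬Any⇒All¬ N (outN y∉)) ∷ Allₚ.¬Any⇒All¬ N (outN i′∉) ∷ uN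
          disj : ∀ {v} → v ∈ Λ ++ M × v ∈ S → ⊥
          disj (j , here refl)                 = ∉-left (Λ ++ M) i∉ j
          disj (j , there (here refl))         = ∉-left (Λ ++ M) y∉ j
          disj (j , there (there (here refl))) = ∉-left (Λ ++ M) i′∉ j
          disj (j , there (there (there k)))   = dN j k
          val : ∀ {Λ′} → Walk (Adj G) x z Λ′ → Z (walkEdges (Λ′ ++ M ++ S) ∷ walkEdges Λ′ ∷ (c ⊕ (pairInd e i ⊕ walkEdges S)) ∷ [])
          val {Λ′} k = subst (λ L → Z (walkEdges L ∷ walkEdges Λ′ ∷ (c ⊕ (pairInd e i ⊕ walkEdges S)) ∷ [])) (++-assoc Λ′ M S)
            (comb (walkEdges ((Λ′ ++ M) ++ S) ∷ walkEdges Λ′ ∷ (c ⊕ (pairInd e i ⊕ walkEdges S)) ∷ walkEdges (Λ′ ++ M) ∷ c ∷ pairInd e i ∷ walkEdges S ∷ (pairInd e i ⊕ walkEdges S) ∷ [])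
              ((0 ∷ 3 ∷ 5 ∷ 6 ∷ []) ∷ (3 ∷ 1 ∷ 4 ∷ []) ∷ (2 ∷ 4 ∷ 7 ∷ []) ∷ (7 ∷ 5 ∷ 6 ∷ []) ∷ []) (0 ∷ 1 ∷ 2 ∷ [])
              (Z-join (prolong k) seg) (value k) (Z-⊕ c (pairInd e i ⊕ walkEdges S)) (Z-⊕ (pairInd e i) (walkEdges S)))
          coh : ∀ g → Coherent g → Z ((c ⊕ (pairInd e i ⊕ walkEdges S)) ∷ g z ∷ g b′ ∷ (w g ⊕ w′ g) ∷ [])
          coh g k = comb ((c ⊕ (pairInd e i ⊕ walkEdges S)) ∷ g z ∷ g b′ ∷ (w g ⊕ w′ g) ∷ c ∷ (pairInd e i ⊕ walkEdges S) ∷ pairInd e i ∷ walkEdges S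
              ∷ w g ∷ w′ g ∷ g e ∷ g i ∷ pairInd i e ∷ walkEdges N ∷ g b ∷ excessS ∷ [])
            ((0 ∷ 4 ∷ 5 ∷ []) ∷ (5 ∷ 6 ∷ 7 ∷ []) ∷ (3 ∷ 8 ∷ 9 ∷ []) ∷ (4 ∷ 1 ∷ 10 ∷ 8 ∷ []) ∷ (6 ∷ 12 ∷ []) ∷ (12 ∷ 11 ∷ 10 ∷ []) ∷ (7 ∷ 15 ∷ 13 ∷ []) ∷ (15 ∷ 11 ∷ 14 ∷ []) ∷ (13 ∷ 14 ∷ 2 ∷ 9 ∷ []) ∷ []) (0 ∷ 1 ∷ 2 ∷ 3 ∷ [])
            (Z-⊕ c (pairInd e i ⊕ walkEdges S)) (Z-⊕ (pairInd e i) (walkEdges S)) (Z-⊕ (w g) (w′ g)) (cohere g k) (Z-sym e i) (k (I⊑A i ii) in-B (Adj-sym ei))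
            split-S excess-S (vN g k)
            where
            excessS : E
            excessS = pairInd i y ⊕ (pairInd y i′ ⊕ pairInd i′ b)
            split-S : Z (walkEdges S ∷ excessS ∷ walkEdges N ∷ [])
            split-S = comb (walkEdges S ∷ excessS ∷ walkEdges N ∷ pairInd i y ∷ pairInd y i′ ∷ pairInd i′ b ∷ (pairInd y i′ ⊕ pairInd i′ b) ∷ walkEdges (y ∷ i′ ∷ N) ∷ walkEdges (i′ ∷ N) ∷ [])
              ((1 ∷ 3 ∷ 6 ∷ []) ∷ (6 ∷ 4 ∷ 5 ∷ []) ∷ (0 ∷ 3 ∷ 7 ∷ []) ∷ (7 ∷ 4 ∷ 8 ∷ []) ∷ (8 ∷ 5 ∷ 2 ∷ []) ∷ []) (0 ∷ 1 ∷ 2 ∷ [])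
              (Z-⊕ (pairInd i y) (pairInd y i′ ⊕ pairInd i′ b)) (Z-⊕ (pairInd y i′) (pairInd i′ b))
              (Z-step {u = i} (step {R = Adj G} yi′ (step i′b h))) (Z-step {u = y} (step {R = Adj G} i′b h)) (Z-step {u = i′} h)
            excess-S : Z (excessS ∷ g i ∷ g b ∷ [])
            excess-S = comb (excessS ∷ g i ∷ g b ∷ pairInd i y ∷ pairInd y i′ ∷ pairInd i′ b ∷ (pairInd y i′ ⊕ pairInd i′ b) ∷ g y ∷ g i′ ∷ pairInd i′ y ∷ [])
              ((0 ∷ 3 ∷ 6 ∷ []) ∷ (6 ∷ 4 ∷ 5 ∷ []) ∷ (3 ∷ 1 ∷ 7 ∷ []) ∷ (4 ∷ 9 ∷ []) ∷ (9 ∷ 8 ∷ 7 ∷ []) ∷ (5 ∷ 8 ∷ 2 ∷ []) ∷ []) (0 ∷ 1 ∷ 2 ∷ [])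
              (Z-⊕ (pairInd i y) (pairInd y i′ ⊕ pairInd i′ b)) (Z-⊕ (pairInd y i′) (pairInd i′ b)) (k (I⊑A i ii) by iy) (Z-sym y i′) (k (I⊑A i′ ii′) by (Adj-sym yi′)) (k (I⊑A i′ ii′) bb i′b)
          cntB : cnt B S ≡ 1 + cnt B N
          cntB = trans (cnt-no B _ (λ t → disjoint (I⊑A i ii) t)) (trans (cnt-yes B _ by) (cong suc (cnt-no B N (λ t → disjoint (I⊑A i′ ii′) t))))
          cntA : cnt A S ≡ 2 + cnt A N
          cntA = trans (cnt-yes A _ (I⊑A i ii)) (cong suc (trans (cnt-no A _ (λ t → disjoint t by)) (cnt-yes A N (I⊑A i′ ii′))))
          bal′ : cnt B (M ++ S) + (q + q′) ≡ cnt A (M ++ S) + (p + p′)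
          bal′ = trans (cong (_+ (q + q′)) (trans (cnt-++ B M S) (cong (cnt B M +_) cntB)))
            (trans (shuffle (cnt B M) (cnt B N) q q′ (cnt A M) (cnt A N) p p′ balance bal) (cong (_+ (p + p′)) (sym (trans (cnt-++ A M S) (cong (cnt A M +_) cntA)))))
            where
            shuffle : ∀ bM bN q q′ aM aN p p′ → bM + q ≡ aM + p → bN + q′ ≡ aN + p′ + 1 → (bM + (1 + bN)) + (q + q′) ≡ (aM + (2 + aN)) + (p + p′)
            shuffle bM bN q q′ aM aN p p′ e₁ e₂ = ≤-antisym
              (lin (bM ∷ bN ∷ q ∷ q′ ∷ aM ∷ aN ∷ p ∷ p′ ∷ []) ((x₀ :+ x₂ ≲ x₄ :+ x₆) ∷ (x₁ :+ x₃ ≲ x₅ :+ x₇ :+ con 1) ∷ [])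
                ((x₀ :+ (con 1 :+ x₁)) :+ (x₂ :+ x₃) ≲ (x₄ :+ (con 2 :+ x₅)) :+ (x₆ :+ x₇)) (≤-reflexive e₁) (≤-reflexive e₂))
              (lin (bM ∷ bN ∷ q ∷ q′ ∷ aM ∷ aN ∷ p ∷ p′ ∷ []) ((x₄ :+ x₆ ≲ x₀ :+ x₂) ∷ (x₅ :+ x₇ :+ con 1 ≲ x₁ :+ x₃) ∷ [])
                ((x₄ :+ (con 2 :+ x₅)) :+ (x₆ :+ x₇) ≲ (x₀ :+ (con 1 :+ x₁)) :+ (x₂ :+ x₃)) (≤-reflexive (sym e₁)) (≤-reflexive (sym e₂)))

-- Threading inside edges and exceptional vertices onto a chain.

module Chains {n : ℕ} (G : Graph n) where

  open Space G
  open Rooted G using (∉-head; ∉-tail; ∉-left; ∉-right)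
  open Denseness G
  open Bipartite G

  private
    V = Fin n
    E = EdgeVec n

  module _ {I A B : V → Bool} (bip : Bip I A B) where

    open Bip bip

    private
      Ch : (x z : V) (Λ R : List V) (l p q : ℕ) (w : (V → E) → E) → Set
      Ch = Chain bip

    relax : ∀ {x z Λ R l l′ p p′ q q′ w} → l ≤ l′ → p ≡ p′ → q ≡ q′ → Ch x z Λ R l p q w → Ch x z Λ R l′ p′ q′ w
    relax le′ e₁ e₂ ch = record { e = e ; M = M ; c = c ; in-B = in-B ; prolong = prolong ; value = value ; cohere = cohere
      ; unique = unique ; avoids = avoids ; short = ≤-trans short le′
      ; balance = subst₂ (λ p q → cnt B M + q ≡ cnt A M + p) e₁ e₂ balance }
      where open Chain ch

    Grown : ∀ {x z Λ R l p q w} → Ch x z Λ R l p q w → (R′ : List V) (l′ p′ q′ : ℕ) (w′ : (V → E) → E) → List V → Set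
    Grown {x} {z} {Λ} ch R′ l′ p′ q′ w′ N = ∃ λ (ch′ : Ch x z Λ R′ l′ p′ q′ w′) → ∀ {v} → v ∈ Λ ++ Chain.M ch ⊎ v ∈ N → v ∈ Λ ++ Chain.M ch′

    private
      excess-Z : ∀ g x y → Z (excess g x y ∷ pairInd x y ∷ g x ∷ g y ∷ [])
      excess-Z g x y = comb (excess g x y ∷ pairInd x y ∷ g x ∷ g y ∷ (g x ⊕ g y) ∷ []) ((0 ∷ 1 ∷ 4 ∷ []) ∷ (4 ∷ 2 ∷ 3 ∷ []) ∷ []) (0 ∷ 1 ∷ 2 ∷ 3 ∷ [])
        (Z-⊕ (pairInd x y) (g x ⊕ g y)) (Z-⊕ (g x) (g y))

      reserved : ∀ {L R N : List V} → All (_∉ R) L → (∀ {v} → v ∈ N → v ∈ R) → ∀ {v} → v ∈ L → v ∉ N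
      reserved av sub i j = All.lookup av i (sub j)

      uniqueʳ : ∀ (xs : List V) {ys} → Unique (xs ++ ys) → Unique ys
      uniqueʳ []       u       = u
      uniqueʳ (x ∷ xs) (_ ∷ u) = uniqueʳ xs u

    abstract
      add-B : ∀ {x z Λ l p q w R b b′} (ch : Ch x z Λ (b ∷ b′ ∷ R) l p q w) → Adj G b b′ → T (B b) → T (B b′) → Unique (b ∷ b′ ∷ R) →
        l ≤ 60000 → length R ≤ 20000 → Grown ch R (l + 7) (p + 1) (q + 0) (λ g → w g ⊕ excess g b b′) (b ∷ b′ ∷ [])
      add-B {R = R} {b} {b′} ch e bb bb′ ((b≢b′ ∷ b∉) ∷ b′∉ ∷ _) l≤ |R| = attach bip R {p′ = 1} {q′ = 0} ch (step e end) bb bb′ ((b≢b′ ∷ []) ∷ [] ∷ [])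
        (reserved (Chain.avoids ch) sub) (Allₚ.All¬⇒¬Any b∉ ∷ Allₚ.All¬⇒¬Any b′∉ ∷ []) (there ∘ there)
        (λ g k → comb (walkEdges (b ∷ b′ ∷ []) ∷ g b ∷ g b′ ∷ excess g b b′ ∷ pairInd b b′ ∷ zeroV ∷ []) ((0 ∷ 4 ∷ 5 ∷ []) ∷ (5 ∷ []) ∷ (3 ∷ 4 ∷ 1 ∷ 2 ∷ []) ∷ []) (0 ∷ 1 ∷ 2 ∷ 3 ∷ [])
          (Z-⊕ (pairInd b b′) zeroV) Z-zero (excess-Z g b b′))
        (le 2 4) counts l≤ |R|
        where
        sub : ∀ {v} → v ∈ b ∷ b′ ∷ [] → v ∈ b ∷ b′ ∷ R
        sub (here e)         = here e
        sub (there (here e)) = there (here e)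
        counts : cnt B (b ∷ b′ ∷ []) + 0 ≡ cnt A (b ∷ b′ ∷ []) + 1 + 1
        counts = trans (cong (_+ 0) (trans (cnt-yes B _ bb) (cong suc (cnt-yes B [] bb′))))
          (sym (cong (λ j → j + 1 + 1) (trans (cnt-no A _ (B-not-A bip bb)) (cnt-no A [] (B-not-A bip bb′)))))

      -- Segments have to start and end in B, so the edge aa′ is flanked by a neighbour of each end.
      add-A : ∀ {x z Λ l p q w R a a′} (ch : Ch x z Λ (a ∷ a′ ∷ R) l p q w) → Adj G a a′ → T (A a) → T (A a′) → Unique (a ∷ a′ ∷ R) →
        l ≤ 60000 → length R ≤ 20000 → Grown ch R (l + 7) (p + 0) (q + 1) (λ g → w g ⊕ excess g a a′) (a ∷ a′ ∷ [])
      add-A {x} {z} {Λ} {l} {p} {q} {w} {R} {a} {a′} ch e aa aa′ ((a≢a′ ∷ a∉) ∷ a′∉ ∷ _) l≤ |R| = go₁ (B-neighbour bip D aa |D|)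
        where
        D : List V
        D = (Λ ++ Chain.M ch) ++ R
        |D|′ : length D ≤ 80000
        |D|′ = ≤-trans (≤-reflexive (length-++ (Λ ++ Chain.M ch))) (lin (length (Λ ++ Chain.M ch) ∷ length R ∷ l ∷ []) ((x₀ ≲ x₂) ∷ (x₂ ≲ con 60000) ∷ (x₁ ≲ con 20000) ∷ []) (x₀ :+ x₁ ≲ con 80000) (Chain.short ch) l≤ |R|)
        |D| : length D ≤ 100000
        |D| = ≤-trans |D|′ (le 80000 100000)
        go₁ : (∃ λ y → T (B y) × Adj G a y × y ∉ D) → Grown ch R (l + 7) (p + 0) (q + 1) (λ g → w g ⊕ excess g a a′) (a ∷ a′ ∷ [])
        go₁ (y , by , ay , y∉) = go₂ (B-neighbour bip (y ∷ D) aa′ (≤-trans (s≤s |D|′) (le 80001 100000)))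
          where
          go₂ : (∃ λ y′ → T (B y′) × Adj G a′ y′ × y′ ∉ y ∷ D) → Grown ch R (l + 7) (p + 0) (q + 1) (λ g → w g ⊕ excess g a a′) (a ∷ a′ ∷ [])
          go₂ (y′ , by′ , ay′ , y′∉) = shrink (attach bip R {p′ = 0} {q′ = 1} ch (step (Adj-sym ay) (step e (step ay′ end))) by by′
            ((apart aa by ∷ apart aa′ by ∷ ≢-sym (∉-head y′∉) ∷ []) ∷ (a≢a′ ∷ ≢-sym (apart aa by′) ∷ []) ∷ (≢-sym (apart aa′ by′) ∷ []) ∷ [] ∷ [])
            disj (∉-right (Λ ++ Chain.M ch) y∉ ∷ Allₚ.All¬⇒¬Any a∉ ∷ Allₚ.All¬⇒¬Any a′∉ ∷ ∉-right (Λ ++ Chain.M ch) (∉-tail y′∉) ∷ []) (there ∘ there)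
            val (le 4 4) counts l≤ |R|)
            where
            apart : ∀ {a b} → T (A a) → T (B b) → b ≢ a
            apart ta tb refl = disjoint ta tb
            N : List V
            N = y ∷ a ∷ a′ ∷ y′ ∷ []
            shrink : Grown ch R (l + 7) (p + 0) (q + 1) (λ g → w g ⊕ excess g a a′) N → Grown ch R (l + 7) (p + 0) (q + 1) (λ g → w g ⊕ excess g a a′) (a ∷ a′ ∷ [])
            shrink (ch′ , inc) = ch′ , λ { (inj₁ i) → inc (inj₁ i) ; (inj₂ (here e)) → inc (inj₂ (there (here e))) ; (inj₂ (there (here e))) → inc (inj₂ (there (there (here e)))) }
            disj : ∀ {v} → v ∈ Λ ++ Chain.M ch → v ∉ N
            disj i (here refl)                         = ∉-left (Λ ++ Chain.M ch) y∉ i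
            disj i (there (here refl))                 = All.lookup (Chain.avoids ch) i (here refl)
            disj i (there (there (here refl)))         = All.lookup (Chain.avoids ch) i (there (here refl))
            disj i (there (there (there (here refl)))) = ∉-left (Λ ++ Chain.M ch) (∉-tail y′∉) i
            val : ∀ g → Coherent bip g → Z (walkEdges N ∷ g y ∷ g y′ ∷ excess g a a′ ∷ [])
            val g k = comb (walkEdges N ∷ g y ∷ g y′ ∷ excess g a a′ ∷ pairInd y a ∷ pairInd a a′ ∷ pairInd a′ y′ ∷ pairInd a y ∷ g a ∷ g a′ ∷ [])
              ((0 ∷ 4 ∷ 5 ∷ 6 ∷ []) ∷ (3 ∷ 5 ∷ 8 ∷ 9 ∷ []) ∷ (4 ∷ 7 ∷ []) ∷ (7 ∷ 8 ∷ 1 ∷ []) ∷ (6 ∷ 9 ∷ 2 ∷ []) ∷ []) (0 ∷ 1 ∷ 2 ∷ 3 ∷ [])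
              (Rooted.Z₃ G y a a′ y′) (excess-Z g a a′) (Z-sym y a) (k aa by ay) (k aa′ by′ ay′)
            counts : cnt B N + 1 ≡ cnt A N + 0 + 1
            counts = trans (cong (_+ 1) (trans (cnt-yes B _ by) (cong suc (trans (cnt-no B _ (disjoint aa)) (trans (cnt-no B _ (disjoint aa′)) (cnt-yes B [] by′))))))
              (sym (cong (λ j → j + 0 + 1) (trans (cnt-no A _ (B-not-A bip by)) (trans (cnt-yes A _ aa) (cong suc (trans (cnt-yes A _ aa′) (cong suc (cnt-no A [] (B-not-A bip by′)))))))))

      -- For vertices of A outside the core: the alternating completion inserts core vertices only,
      -- so the others must already be on the chain.
      add-vertex : ∀ {x z Λ l p q w a} (ch : Ch x z Λ [] l p q w) → T (A a) → a ∉ Λ ++ Chain.M ch → l ≤ 60000 →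
        Grown ch [] (l + 7) (p + 0) (q + 0) (λ g → w g ⊕ zeroV) (a ∷ [])
      add-vertex {x} {z} {Λ} {l} {p} {q} {w} {a} ch aa a∉ l≤ = go₁ (B-neighbour bip D aa (≤-trans |D| (le 60000 100000)))
        where
        D : List V
        D = Λ ++ Chain.M ch
        |D| : length D ≤ 60000
        |D| = ≤-trans (Chain.short ch) l≤
        go₁ : (∃ λ y → T (B y) × Adj G a y × y ∉ D) → Grown ch [] (l + 7) (p + 0) (q + 0) (λ g → w g ⊕ zeroV) (a ∷ [])
        go₁ (y , by , ay , y∉) = go₂ (B-neighbour bip (y ∷ D) aa (≤-trans (s≤s |D|) (le 60001 100000)))
          where
          go₂ : (∃ λ y′ → T (B y′) × Adj G a y′ × y′ ∉ y ∷ D) → Grown ch [] (l + 7) (p + 0) (q + 0) (λ g → w g ⊕ zeroV) (a ∷ [])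
          go₂ (y′ , by′ , ay′ , y′∉) = shrink (attach bip [] {p′ = 0} {q′ = 0} ch (step (Adj-sym ay) (step ay′ end)) by by′
            ((apart aa by ∷ ≢-sym (∉-head y′∉) ∷ []) ∷ (≢-sym (apart aa by′) ∷ []) ∷ [] ∷ [])
            disj ((λ ()) ∷ (λ ()) ∷ (λ ()) ∷ []) id val (le 3 4) counts l≤ z≤n)
            where
            apart : ∀ {a b} → T (A a) → T (B b) → b ≢ a
            apart ta tb refl = disjoint ta tb
            N : List V
            N = y ∷ a ∷ y′ ∷ []
            shrink : Grown ch [] (l + 7) (p + 0) (q + 0) (λ g → w g ⊕ zeroV) N → Grown ch [] (l + 7) (p + 0) (q + 0) (λ g → w g ⊕ zeroV) (a ∷ [])
            shrink (ch′ , inc) = ch′ , λ { (inj₁ i) → inc (inj₁ i) ; (inj₂ (here e)) → inc (inj₂ (there (here e))) }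
            disj : ∀ {v} → v ∈ Λ ++ Chain.M ch → v ∉ N
            disj i (here refl)                 = y∉ i
            disj i (there (here refl))         = a∉ i
            disj i (there (there (here refl))) = ∉-tail y′∉ i
            val : ∀ g → Coherent bip g → Z (walkEdges N ∷ g y ∷ g y′ ∷ zeroV ∷ [])
            val g k = comb (walkEdges N ∷ g y ∷ g y′ ∷ zeroV ∷ pairInd y a ∷ pairInd a y′ ∷ pairInd a y ∷ g a ∷ walkEdges (a ∷ y′ ∷ []) ∷ [])
              ((0 ∷ 4 ∷ 8 ∷ []) ∷ (8 ∷ 5 ∷ 3 ∷ []) ∷ (4 ∷ 6 ∷ []) ∷ (6 ∷ 7 ∷ 1 ∷ []) ∷ (5 ∷ 7 ∷ 2 ∷ []) ∷ []) (0 ∷ 1 ∷ 2 ∷ 3 ∷ [])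
              (Z-⊕ (pairInd y a) (walkEdges (a ∷ y′ ∷ []))) (Z-⊕ (pairInd a y′) zeroV) (Z-sym y a) (k aa by ay) (k aa by′ ay′)
            counts : cnt B N + 0 ≡ cnt A N + 0 + 1
            counts = trans (cong (_+ 0) (trans (cnt-yes B _ by) (cong suc (trans (cnt-no B _ (disjoint aa)) (cnt-yes B [] by′)))))
              (sym (cong (λ j → j + 0 + 1) (trans (cnt-no A _ (B-not-A bip by)) (trans (cnt-yes A _ aa) (cong suc (cnt-no A [] (B-not-A bip by′)))))))

      private
        reassociate : ∀ (X Y W : E) → Z (((X ⊕ Y) ⊕ W) ∷ (X ⊕ (Y ⊕ W)) ∷ [])
        reassociate X Y W = comb (((X ⊕ Y) ⊕ W) ∷ (X ⊕ (Y ⊕ W)) ∷ (X ⊕ Y) ∷ (Y ⊕ W) ∷ X ∷ Y ∷ W ∷ [])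
          ((0 ∷ 2 ∷ 6 ∷ []) ∷ (1 ∷ 4 ∷ 3 ∷ []) ∷ (2 ∷ 4 ∷ 5 ∷ []) ∷ (3 ∷ 5 ∷ 6 ∷ []) ∷ []) (0 ∷ 1 ∷ [])
          (Z-⊕ (X ⊕ Y) W) (Z-⊕ X (Y ⊕ W)) (Z-⊕ X Y) (Z-⊕ Y W)

        drop-zero : ∀ (X : E) → Z ((X ⊕ zeroV) ∷ X ∷ [])
        drop-zero X = comb ((X ⊕ zeroV) ∷ X ∷ zeroV ∷ []) ((0 ∷ 1 ∷ 2 ∷ []) ∷ (2 ∷ []) ∷ []) (0 ∷ 1 ∷ []) (Z-⊕ X zeroV) Z-zero

        add-zero : ∀ (X : E) → Z (X ∷ (X ⊕ zeroV) ∷ [])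
        add-zero X = comb ((X ⊕ zeroV) ∷ X ∷ []) ((0 ∷ 1 ∷ []) ∷ []) (1 ∷ 0 ∷ []) (drop-zero X)

        seven : ∀ l j → l + 7 + 7 * j ≤ l + 7 * suc j
        seven l j = lin (l ∷ j ∷ 7 * suc j ∷ []) ((con 7 :+ 7 :* x₁ ≲ x₂) ∷ []) (x₀ :+ con 7 :+ 7 :* x₁ ≲ x₀ :+ x₂) (≤-reflexive (sym (*-suc 7 j)))

        bound : ∀ l j → l + 7 * suc j ≤ 60000 → (l + 7 + 7 * j ≤ 60000) × (l ≤ 60000)
        bound l j h = ≤-trans (seven l j) h , ≤-trans (m≤m+n l _) h

      add-Bs : ∀ es {x z Λ l p q w R} (ch : Ch x z Λ (ends es ++ R) l p q w) → Inside B es → Unique (ends es ++ R) →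
        l + 7 * length es ≤ 60000 → length (ends es ++ R) ≤ 20000 → Ch x z Λ R (l + 7 * length es) (p + length es) q (λ g → w g ⊕ total-excess g es)
      add-Bs [] {l = l} {p} ch _ _ _ _ = forget bip (λ g → add-zero _) (relax (m≤m+n l 0) (sym (+-identityʳ p)) refl ch)
      add-Bs ((b , b′) ∷ es) {x} {z} {Λ} {l} {p} {q} {w} {R} ch ((e , bb , bb′) ∷ ins) uq hl hR =
        go (add-B ch e bb bb′ uq (proj₂ (bound l (length es) hl)) (≤-trans (≤-trans (n≤1+n _) (n≤1+n _)) hR))
        where
        go : Grown ch (ends es ++ R) (l + 7) (p + 1) (q + 0) (λ g → w g ⊕ excess g b b′) (b ∷ b′ ∷ []) →
             Ch x z Λ R (l + 7 * suc (length es)) (p + suc (length es)) q (λ g → w g ⊕ (excess g b b′ ⊕ total-excess g es))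
        go (ch′ , _) = forget bip (λ g → reassociate (w g) (excess g b b′) (total-excess g es))
          (relax (seven l (length es)) (trans (+-assoc p 1 (length es)) refl) (+-identityʳ q)
            (add-Bs es ch′ ins (uniqueʳ (b ∷ b′ ∷ []) uq) (proj₁ (bound l (length es) hl)) (≤-trans (≤-trans (n≤1+n _) (n≤1+n _)) hR)))

      add-As : ∀ es {x z Λ l p q w R} (ch : Ch x z Λ (ends es ++ R) l p q w) → Inside A es → Unique (ends es ++ R) →
        l + 7 * length es ≤ 60000 → length (ends es ++ R) ≤ 20000 → Ch x z Λ R (l + 7 * length es) p (q + length es) (λ g → w g ⊕ total-excess g es)
      add-As [] {l = l} {q = q} ch _ _ _ _ = forget bip (λ g → add-zero _) (relax (m≤m+n l 0) refl (sym (+-identityʳ q)) ch)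
      add-As ((a , a′) ∷ es) {x} {z} {Λ} {l} {p} {q} {w} {R} ch ((e , aa , aa′) ∷ ins) uq hl hR =
        go (add-A ch e aa aa′ uq (proj₂ (bound l (length es) hl)) (≤-trans (≤-trans (n≤1+n _) (n≤1+n _)) hR))
        where
        go : Grown ch (ends es ++ R) (l + 7) (p + 0) (q + 1) (λ g → w g ⊕ excess g a a′) (a ∷ a′ ∷ []) →
             Ch x z Λ R (l + 7 * suc (length es)) p (q + suc (length es)) (λ g → w g ⊕ (excess g a a′ ⊕ total-excess g es))
        go (ch′ , _) = forget bip (λ g → reassociate (w g) (excess g a a′) (total-excess g es))
          (relax (seven l (length es)) (+-identityʳ p) (+-assoc q 1 (length es))
            (add-As es ch′ ins (uniqueʳ (a ∷ a′ ∷ []) uq) (proj₁ (bound l (length es) hl)) (≤-trans (≤-trans (n≤1+n _) (n≤1+n _)) hR)))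

      -- Some of these vertices may be on the chain already, as ends of inside edges or on
      -- connectors and flanks; they are skipped.
      add-vertices : ∀ vs {x z Λ l p q w} (ch : Ch x z Λ [] l p q w) → All (λ a → T (A a)) vs → l + 7 * length vs ≤ 60000 →
        Grown ch [] (l + 7 * length vs) p q w vs
      add-vertices [] {l = l} ch _ _ = relax (m≤m+n l 0) refl refl ch , λ { (inj₁ i) → i }
      add-vertices (a ∷ vs) {x} {z} {Λ} {l} {p} {q} {w} ch (aa ∷ as) hl = by (a ∈? (Λ ++ Chain.M ch))
        where
        next : ∀ {l′} (ch′ : Ch x z Λ [] l′ p q w) → l′ ≤ l + 7 → (∀ {v} → v ∈ Λ ++ Chain.M ch ⊎ v ∈ a ∷ [] → v ∈ Λ ++ Chain.M ch′) → Grown ch [] (l + 7 * suc (length vs)) p q w (a ∷ vs)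
        next {l′} ch′ h inc = fin (add-vertices vs ch′ as (≤-trans (+-monoˡ-≤ _ h) (proj₁ (bound l (length vs) hl))))
          where
          fin : Grown ch′ [] (l′ + 7 * length vs) p q w vs → Grown ch [] (l + 7 * suc (length vs)) p q w (a ∷ vs)
          fin (ch″ , inc′) = relax (≤-trans (+-monoˡ-≤ _ h) (seven l (length vs))) refl refl ch″ ,
            λ { (inj₁ i) → inc′ (inj₁ (inc (inj₁ i))) ; (inj₂ (here e)) → inc′ (inj₁ (inc (inj₂ (here e)))) ; (inj₂ (there i)) → inc′ (inj₂ i) }
        by : Dec (a ∈ Λ ++ Chain.M ch) → Grown ch [] (l + 7 * suc (length vs)) p q w (a ∷ vs)
        by (yes i) = next ch (m≤m+n l 7) λ { (inj₁ j) → j ; (inj₂ (here refl)) → i }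
        by (no a∉) = use (add-vertex ch aa a∉ (proj₂ (bound l (length vs) hl)))
          where
          use : Grown ch [] (l + 7) (p + 0) (q + 0) (λ g → w g ⊕ zeroV) (a ∷ []) → Grown ch [] (l + 7 * suc (length vs)) p q w (a ∷ vs)
          use (ch′ , inc) = next (forget bip (λ g → drop-zero (w g)) (relax ≤-refl (+-identityʳ p) (+-identityʳ q) ch′)) ≤-refl inc

-- Completing a chain by an alternating path.

module Alternating {n : ℕ} (G : Graph n) (3≤n : 3 ≤ n) where

  open Space G
  open Rooted G using (∉-head; ∉-tail; ∉-left; ∉-right)
  open Denseness G
  open Bipartite G

  private
    V = Fin n

  #-cnt : ∀ (p : V → Bool) {xs} → Unique xs → # p ≡ cnt p xs + # (p ∖ ⟨ xs ⟩)
  #-cnt p {xs} u = ≤-antisym (#-≤-cnt+ p xs) (≤-trans (+-monoˡ-≤ (# (p ∖ ⟨ xs ⟩)) (cnt-≤ {p = p} u (All.tabulate ∈⟨⟩))) (≤-reflexive (sym (#-split p ⟨ xs ⟩))))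

  module _ {I A B : V → Bool} (bip : Bip I A B) where

    open Bip bip

    BI : V → V → Set
    BI x y = Adj G x y × (T (I x) × T (B y) ⊎ T (B x) × T (I y))

    BI-sym : ∀ {x y} → BI x y → BI y x
    BI-sym (e , inj₁ (a , b)) = Adj-sym e , inj₂ (b , a)
    BI-sym (e , inj₂ (a , b)) = Adj-sym e , inj₁ (b , a)

    record Closing (L : List V) (e x : V) : Set where
      constructor closing
      field
        {w w′} : V
        {ys}   : List V
        walk   : Walk (Adj G) w w′ ys
        enter  : Adj G e w
        leave  : Adj G w′ x
        in-A   : T (A w)
        in-A′  : T (A w′)
        unique : Unique (L ++ ys)
        covers : ∀ v → v ∈ L ++ ys
        cohere : ∀ g → Coherent bip g → Z (walkEdges ys ∷ g w ∷ g w′ ∷ [])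

    module _ (L : List V) (e x : V) (be : T (B e)) (bx : T (B x)) (uL : Unique L) (|L| : length L ≤ 60000)
      -- The balance says that outside L there is one vertex of A more than of B, as for an
      -- alternating path with both ends in A.
      (L-full : ∀ {v} → T (A v) → ¬ T (I v) → v ∈ L) (L-bal : cnt B L + # A ≡ cnt A L + # B + 1) where

      private
        record Alt (u v : V) (xs : List V) : Set where
          constructor alt
          field
            walk   : Walk BI u v xs
            unique : Unique xs
            off    : All (_∉ L) xs
            bal    : cnt A xs ≡ cnt B xs + 1

        notB : ∀ {v} → T (I v) → ¬ T (B v)
        notB i b = disjoint (I⊑A _ i) b

        start-alt : ∃ λ u → ∃ λ v → ∃ λ xs → Adj G e u × Adj G v x × Alt u v xs × length xs ≡ 3 × T (I u) × T (I v)
        start-alt = go₁ (I-neighbour bip L be (≤-trans |L| (le 60000 100000)))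
          where
          Result : Set
          Result = ∃ λ u → ∃ λ v → ∃ λ xs → Adj G e u × Adj G v x × Alt u v xs × length xs ≡ 3 × T (I u) × T (I v)
          go₁ : (∃ λ i → T (I i) × Adj G e i × i ∉ L) → Result
          go₁ (i , ii , ei , i∉) = go₂ (I-neighbour bip (i ∷ L) bx (≤-trans (s≤s |L|) (le 60001 100000)))
            where
            go₂ : (∃ λ j → T (I j) × Adj G x j × j ∉ i ∷ L) → Result
            go₂ (j , ij , xj , j∉) = go₃ (common bip L (I⊑A i ii) ij (≤-trans |L| (le 60000 100000)))
              where
              go₃ : (∃ λ y → T (B y) × Adj G i y × Adj G j y × y ∉ L) → Result
              go₃ (y , by , iy , jy , y∉) = i , j , i ∷ y ∷ j ∷ [] , ei , Adj-sym xj ,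
                alt (step (iy , inj₁ (ii , by)) (step (Adj-sym jy , inj₂ (by , ij)) end))
                  ((Adj-irr iy ∷ ≢-sym (∉-head j∉) ∷ []) ∷ (≢-sym (Adj-irr jy) ∷ []) ∷ [] ∷ []) (i∉ ∷ y∉ ∷ ∉-tail j∉ ∷ [])
                  (trans (cnt-yes A _ (I⊑A i ii)) (trans (cong suc (trans (cnt-no A _ (B-not-A bip by)) (cnt-yes A [] (I⊑A j ij))))
                    (sym (cong (_+ 1) (trans (cnt-no B _ (notB ii)) (trans (cnt-yes B _ by) (cong suc (cnt-no B [] (notB ij))))))))) , refl , ii , ij

        lengthen : ∀ {u v} l → l ≤ 3000 → T (I u) → (∃ λ xs → Alt u v xs × length xs ≡ 2 + l) → ∃ λ xs → Alt u v xs × length xs ≡ 4 + l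
        lengthen {u} {v} l l≤ iu (.(_ ∷ _) , alt (step {xs = xs} (uy , inj₂ (bu , _)) h) uq off bal , len) = ⊥-elim (notB iu bu)
        lengthen {u} {v} l l≤ iu (.(_ ∷ _) , alt (step {y = y} {xs = xs} (uy , inj₁ (_ , by)) h) (u∉ ∷ uq) (ou ∷ off) bal , len) =
          go₁ (I-neighbour bip D by (≤-trans |D| (le 70000 100000)))
          where
          D : List V
          D = (u ∷ xs) ++ L
          |D| : length D ≤ 70000
          |D| = ≤-trans (≤-reflexive (length-++ (u ∷ xs))) (lin (length (u ∷ xs) ∷ length L ∷ l ∷ []) ((x₀ ≲ con 2 :+ x₂) ∷ (x₂ ≲ con 3000) ∷ (x₁ ≲ con 60000) ∷ [])
            (x₀ :+ x₁ ≲ con 70000) (≤-reflexive len) l≤ |L|)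
          go₁ : (∃ λ i → T (I i) × Adj G y i × i ∉ D) → ∃ λ xs → Alt u v xs × length xs ≡ 4 + l
          go₁ (i , ii , yi , i∉) = go₂ (common bip D (I⊑A u iu) ii (≤-trans |D| (le 70000 100000)))
            where
            go₂ : (∃ λ c → T (B c) × Adj G u c × Adj G i c × c ∉ D) → ∃ λ xs → Alt u v xs × length xs ≡ 4 + l
            go₂ (c , bc , uc , ic , c∉) = u ∷ c ∷ i ∷ xs ,
              alt (step (uc , inj₁ (iu , bc)) (step (Adj-sym ic , inj₂ (bc , ii)) (step (Adj-sym yi , inj₁ (ii , by)) h)))
                ((Adj-irr uc ∷ ≢-sym (∉-head (∉-left (u ∷ xs) i∉)) ∷ u∉) ∷ (≢-sym (Adj-irr ic) ∷ Allₚ.¬Any⇒All¬ xs (∉-tail (∉-left (u ∷ xs) c∉)))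
                  ∷ Allₚ.¬Any⇒All¬ xs (∉-tail (∉-left (u ∷ xs) i∉)) ∷ uq)
                (ou ∷ ∉-right (u ∷ xs) c∉ ∷ ∉-right (u ∷ xs) i∉ ∷ off) bal′ , cong (2 +_) len
              where
              bal′ : cnt A (u ∷ c ∷ i ∷ xs) ≡ cnt B (u ∷ c ∷ i ∷ xs) + 1
              bal′ = trans (cnt-yes A _ (I⊑A u iu)) (trans (cong suc (trans (cnt-no A _ (B-not-A bip bc)) (trans (cnt-yes A _ (I⊑A i ii))
                (trans (sym (cnt-yes A xs (I⊑A u iu))) (trans bal (cong (_+ 1) (cnt-no B xs (notB iu))))))))
                (sym (cong (_+ 1) (trans (cnt-no B _ (notB iu)) (trans (cnt-yes B _ bc) (cong suc (cnt-no B xs (notB ii))))))))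

        long : ∀ {u v} j → j ≤ 700 → T (I u) → (∃ λ xs → Alt u v xs × length xs ≡ 3) → ∃ λ xs → Alt u v xs × length xs ≡ 3 + (j + j)
        long zero    h iu s = s
        long {u} {v} (suc j) h iu s = subst (λ k → ∃ λ xs → Alt u v xs × length xs ≡ k) (cong (4 +_) (sym (+-suc j j)))
          (lengthen (1 + (j + j)) (lin (j ∷ []) ((con 1 :+ x₀ ≲ con 700) ∷ (con 1 :+ x₀ ≲ con 700) ∷ []) (con 1 :+ (x₀ :+ x₀) ≲ con 3000) h h) iu
            (long j (≤-trans (n≤1+n j) h) iu s))

        adjacent-to-all : List V → V → Bool
        adjacent-to-all []       y = true
        adjacent-to-all (i ∷ is) y = adj G i y ∧ adjacent-to-all is y

        adjacent-∈ : ∀ {is y i} → T (adjacent-to-all is y) → i ∈ is → Adj G i y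
        adjacent-∈ {j ∷ is} {y} t (here refl) = proj₁ (∧-T {adj G j y} t)
        adjacent-∈ {j ∷ is} {y} t (there k)   = adjacent-∈ {is} (proj₂ (∧-T {adj G j y} t)) k

        many-common : ∀ is (q : V → Bool) → q ⊑ B → All (λ i → T (I i)) is → # q ≤ # (q ∩ adjacent-to-all is) + 602 * length is
        many-common []       q qB []         = ≤-trans (#-mono {p = q} {q = q ∩ adjacent-to-all []} (λ x t → ∧-intro t tt)) (m≤m+n _ _)
        many-common (i ∷ is) q qB (ii ∷ iis) = lin
          (# q ∷ # (q ∩ adj G i) ∷ # (q ∖ adj G i) ∷ # (B ∖ adj G i) ∷ # ((q ∩ adj G i) ∩ adjacent-to-all is) ∷ # (q ∩ adjacent-to-all (i ∷ is)) ∷ 602 * length is ∷ 602 * length (i ∷ is) ∷ [])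
          ((x₀ ≲ x₁ :+ x₂) ∷ (x₂ ≲ x₃) ∷ (x₃ ≲ con 602) ∷ (x₁ ≲ x₄ :+ x₆) ∷ (x₄ ≲ x₅) ∷ (con 602 :+ x₆ ≲ x₇) ∷ []) (x₀ ≲ x₅ :+ x₇)
          (≤-reflexive (#-split q (adj G i))) (∖-mono q (adj G i) qB) (I-miss ii)
          (many-common is (q ∩ adj G i) (λ x t → qB x (proj₁ (∧-T {q x} t))) iis)
          (#-mono {p = (q ∩ adj G i) ∩ adjacent-to-all is} {q = q ∩ adjacent-to-all (i ∷ is)} (λ x t → let (t₁ , t₂) = ∧-T {q x ∧ adj G i x} t ; (t₃ , t₄) = ∧-T {q x} t₁ in ∧-intro t₃ (∧-intro t₄ t₂)))
          (≤-reflexive (sym (*-suc 602 (length is))))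

        after-I : ∀ {u v xs a} → Walk BI u v xs → ∀ {y} → y ∈ succs (adj G a ∩ I) xs → T (B y)
        after-I {a = a} h i = go (cut {p = adj G a ∩ I} h i)
          where
          go : ∀ {u v xs y} → Cut {R = BI} (adj G a ∩ I) u v xs y → T (B y)
          go (mkCut {m} _ _ (_ , inj₁ (_ , b)) _ t) = b
          go (mkCut {m} _ _ (_ , inj₂ (b , _)) _ t) = ⊥-elim (notB (proj₂ (∧-T {adj G a m} t)) b)

        -- The neighbours of a in the core have at least 604 successors on the walk, all in B, and b
        -- misses at most 602 of them. Two are left to take b between them.
        insert-pair : ∀ {u v xs a b} → Alt u v xs → T (B a) → a ∉ L → a ∉ xs → T (I b) → b ∉ L → b ∉ xs → 605 ≤ cnt (adj G a ∩ I) xs →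
                      ∃ λ xs′ → Alt u v xs′ × xs′ ↭ a ∷ b ∷ xs
        insert-pair {u} {v} {xs} {a} {b} (alt h uq off bal) ba a∉L a∉ ib b∉L b∉ rich = go₁ (#-find {p = ⟨ s ⟩ ∩ adj G b} (≤-trans (le 1 2) two))
          where
          s : List V
          s = succs (adj G a ∩ I) xs
          two : 2 ≤ # (⟨ s ⟩ ∩ adj G b)
          two = lin (cnt (adj G a ∩ I) xs ∷ length s ∷ # ⟨ s ⟩ ∷ # (⟨ s ⟩ ∩ adj G b) ∷ # (⟨ s ⟩ ∖ adj G b) ∷ # (B ∖ adj G b) ∷ [])
            ((con 605 ≲ x₀) ∷ (x₀ ≲ con 1 :+ x₁) ∷ (x₁ ≲ x₂) ∷ (x₂ ≲ x₃ :+ x₄) ∷ (x₄ ≲ x₅) ∷ (x₅ ≲ con 602) ∷ []) (con 2 ≲ x₃)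
            rich (succs-length {R = BI} (adj G a ∩ I) xs) (≤-reflexive (sym (#-⟨⟩ (succs-unique {R = BI} (adj G a ∩ I) uq))))
            (≤-reflexive (#-split ⟨ s ⟩ (adj G b))) (∖-mono ⟨ s ⟩ (adj G b) (λ y t → after-I h (⟨⟩∈ t))) (I-miss ib)
          apart : a ≢ b
          apart refl = notB ib ba
          Result : Set
          Result = ∃ λ xs′ → Alt u v xs′ × xs′ ↭ a ∷ b ∷ xs
          finish : (∃ λ xs′ → Walk BI u v xs′ × xs′ ↭ a ∷ b ∷ xs) → Result
          finish (xs′ , h′ , p) = xs′ , alt h′ (Unique-resp-↭ (↭-sym p) ((apart ∷ Allₚ.¬Any⇒All¬ xs a∉) ∷ Allₚ.¬Any⇒All¬ xs b∉ ∷ uq))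
            (All-resp-↭ (↭-sym p) (a∉L ∷ b∉L ∷ off)) (trans (count A p) (trans bal′ (sym (cong (_+ 1) (count B p))))) , p
            where
            count : ∀ (q : V → Bool) {xs ys} → xs ↭ ys → cnt q xs ≡ cnt q ys
            count q p = ↭-length (filter-↭ (λ x → T? (q x)) p)
            bal′ : cnt A (a ∷ b ∷ xs) ≡ cnt B (a ∷ b ∷ xs) + 1
            bal′ = trans (cnt-no A _ (B-not-A bip ba)) (trans (cnt-yes A xs (I⊑A b ib)) (trans (cong suc bal)
              (sym (cong (_+ 1) (trans (cnt-yes B _ ba) (cong suc (cnt-no B xs (notB ib))))))))
          go₁ : ∃ (λ y → T ((⟨ s ⟩ ∩ adj G b) y)) → Result
          go₁ (y , ty) = go₂ (pick (⟨ s ⟩ ∩ adj G b) (y ∷ []) two)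
            where
            go₂ : (∃ λ y′ → T ((⟨ s ⟩ ∩ adj G b) y′) × y′ ∉ y ∷ []) → Result
            go₂ (y′ , ty′ , y′∉) = finish (insert₂ BI-sym {p = adj G a ∩ I} h
              (λ x t → let (t₁ , t₂) = ∧-T {adj G a x} t in Adj-sym t₁ , inj₁ (t₂ , ba)) i j (≢-sym (∉-head y′∉))
              (Adj-sym (proj₂ (∧-T {⟨ s ⟩ y} ty)) , inj₂ (after-I h i , ib)) (Adj-sym (proj₂ (∧-T {⟨ s ⟩ y′} ty′)) , inj₂ (after-I h j , ib)))
              where
              i : y ∈ s
              i = ⟨⟩∈ (proj₁ (∧-T {⟨ s ⟩ y} ty))
              j : y′ ∈ s
              j = ⟨⟩∈ (proj₁ (∧-T {⟨ s ⟩ y′} ty′))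

        module Fill {u v : V} (eu : Adj G e u) (vx : Adj G v x) (iu : T (I u)) (iv : T (I v)) (is : List V) (I-is : All (λ i → T (I i)) is) (uis : Unique is)
          (few : length is ≤ 1403) (enough : 605 ≤ length is) where

          coherent-walk : ∀ {u v xs} g → Coherent bip g → Walk BI u v xs → Z (walkEdges xs ∷ g u ∷ g v ∷ [])
          coherent-walk {u} {v} {xs} g k h = comb (walkEdges xs ∷ g u ∷ g v ∷ zeroV ∷ rep (length xs) zeroV ∷ []) ((0 ∷ 1 ∷ 2 ∷ 3 ∷ 4 ∷ []) ∷ (3 ∷ []) ∷ (4 ∷ []) ∷ []) (0 ∷ 1 ∷ 2 ∷ [])
            (walk-value g zeroV edge h) Z-zero (rep-zero (length xs))
            where
            edge : ∀ {x y} → BI x y → Z (pairInd x y ∷ g x ∷ g y ∷ zeroV ∷ [])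
            edge {x} {y} (e , inj₁ (i , b)) = comb (pairInd x y ∷ g x ∷ g y ∷ zeroV ∷ []) ((0 ∷ 1 ∷ 2 ∷ []) ∷ (3 ∷ []) ∷ []) (0 ∷ 1 ∷ 2 ∷ 3 ∷ []) (k (I⊑A x i) b e) Z-zero
            edge {x} {y} (e , inj₂ (b , i)) = comb (pairInd x y ∷ g x ∷ g y ∷ zeroV ∷ pairInd y x ∷ []) ((4 ∷ 2 ∷ 1 ∷ []) ∷ (3 ∷ []) ∷ (0 ∷ 4 ∷ []) ∷ []) (0 ∷ 1 ∷ 2 ∷ 3 ∷ [])
              (k (I⊑A y i) b (Adj-sym e)) Z-zero (Z-sym x y)

          fill : ∀ j xs → # (B ∖ ⟨ L ++ xs ⟩) ≤ j → Alt u v xs → (∀ {i} → i ∈ is → i ∈ xs) → Closing L e x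
          fill j xs hj al@(alt h uq off bal) sub = decide j hj (1 ≤? # (B ∖ ⟨ L ++ xs ⟩))
            where
            uLx : Unique (L ++ xs)
            uLx = Uniq.++⁺ uL uq (λ (i , k) → All.lookup off k i)
            -- L compensates the surplus of one in the walk, so equally many vertices of A and of B
            -- are missing and can be inserted in pairs.
            same : # (A ∖ ⟨ L ++ xs ⟩) ≡ # (B ∖ ⟨ L ++ xs ⟩)
            same = balanced (# A) (# B) (cnt A L) (cnt B L) (cnt A xs) (cnt B xs) _ _ L-bal bal
              (trans (#-cnt A uLx) (cong (_+ # (A ∖ ⟨ L ++ xs ⟩)) (cnt-++ A L xs))) (trans (#-cnt B uLx) (cong (_+ # (B ∖ ⟨ L ++ xs ⟩)) (cnt-++ B L xs)))
              where
              balanced : ∀ a b aL bL ax bx r s → bL + a ≡ aL + b + 1 → ax ≡ bx + 1 → a ≡ (aL + ax) + r → b ≡ (bL + bx) + s → r ≡ s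
              balanced a b aL bL ax bx r s e₁ e₂ e₃ e₄ = ≤-antisym
                (lin (a ∷ b ∷ aL ∷ bL ∷ ax ∷ bx ∷ r ∷ s ∷ []) ((x₃ :+ x₀ ≲ x₂ :+ x₁ :+ con 1) ∷ (x₅ :+ con 1 ≲ x₄) ∷ ((x₂ :+ x₄) :+ x₆ ≲ x₀) ∷ (x₁ ≲ (x₃ :+ x₅) :+ x₇) ∷ []) (x₆ ≲ x₇)
                  (≤-reflexive e₁) (≤-reflexive (sym e₂)) (≤-reflexive (sym e₃)) (≤-reflexive e₄))
                (lin (a ∷ b ∷ aL ∷ bL ∷ ax ∷ bx ∷ r ∷ s ∷ []) ((x₂ :+ x₁ :+ con 1 ≲ x₃ :+ x₀) ∷ (x₄ ≲ x₅ :+ con 1) ∷ (x₀ ≲ (x₂ :+ x₄) :+ x₆) ∷ ((x₃ :+ x₅) :+ x₇ ≲ x₁) ∷ []) (x₇ ≲ x₆)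
                  (≤-reflexive (sym e₁)) (≤-reflexive e₂) (≤-reflexive e₃) (≤-reflexive (sym e₄)))
            member : ∀ (p : V → Bool) → # (p ∖ ⟨ L ++ xs ⟩) ≤ 0 → ∀ w → T (p w) → w ∈ L ++ xs
            member p z w t = by (w ∈? (L ++ xs))
              where
              by : Dec (w ∈ L ++ xs) → w ∈ L ++ xs
              by (yes i) = i
              by (no ¬i) = contradiction (≤-trans (#-pos (p ∖ ⟨ L ++ xs ⟩) {w} (∧-intro t (not-intro (λ s → ¬i (⟨⟩∈ s))))) z) λ ()
            done : # (B ∖ ⟨ L ++ xs ⟩) ≤ 0 → Closing L e x
            done z = closing (mapʷ proj₁ h) eu vx (I⊑A u iu) (I⊑A v iv) uLx (λ w → [ member A (≤-trans (≤-reflexive same) z) w , member B z w ]′ (cover w)) (λ g k → coherent-walk g k h)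
            Target : Set
            Target = ∃ λ a → T (B a) × a ∉ L ++ xs × 605 ≤ cnt (adj G a ∩ I) xs
            outB : ∀ {a} → T ((B ∖ ⟨ L ++ xs ⟩) a) → T (B a) × a ∉ L ++ xs
            outB {a} t = let (t₁ , t₂) = ∧-T {B a} t in t₁ , λ i → not-T t₂ (∈⟨⟩ i)
            -- While 850000 vertices of B are missing, one of them is adjacent to all of `is`, since
            -- 602 · 1403 = 844606 is less. Afterwards a missing vertex of B has 1000000 core
            -- neighbours, at most 60000 of them on L and fewer than 850000 missing themselves, so
            -- the rest lie on the walk.
            select : 1 ≤ # (B ∖ ⟨ L ++ xs ⟩) → Dec (850000 ≤ # (B ∖ ⟨ L ++ xs ⟩)) → Target
            select _ (yes big) = go (#-find {p = (B ∖ ⟨ L ++ xs ⟩) ∩ adjacent-to-all is} (lin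
                (# (B ∖ ⟨ L ++ xs ⟩) ∷ # ((B ∖ ⟨ L ++ xs ⟩) ∩ adjacent-to-all is) ∷ 602 * length is ∷ []) ((con 850000 ≲ x₀) ∷ (x₀ ≲ x₁ :+ x₂) ∷ (x₂ ≲ con 844606) ∷ []) (con 1 ≲ x₁)
                big (many-common is (B ∖ ⟨ L ++ xs ⟩) (λ w t → proj₁ (∧-T {B w} t)) I-is) (*-monoʳ-≤ 602 few)))
              where
              go : ∃ (λ a → T (((B ∖ ⟨ L ++ xs ⟩) ∩ adjacent-to-all is) a)) → Target
              go (a , t) = let (t₁ , t₂) = ∧-T {(B ∖ ⟨ L ++ xs ⟩) a} t in a , proj₁ (outB {a} t₁) , proj₂ (outB {a} t₁) ,
                ≤-trans enough (≤-trans (length-≤-# {p = (adj G a ∩ I) ∩ ⟨ xs ⟩} uis (All.tabulate (λ i → ∧-intro (∧-intro (Adj-sym (adjacent-∈ {is} t₂ i)) (All.lookup I-is i)) (∈⟨⟩ (sub i)))))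
                  (#-≤-cnt (adj G a ∩ I) xs))
            select h (no small) = go (#-find h)
              where
              go : ∃ (λ a → T ((B ∖ ⟨ L ++ xs ⟩) a)) → Target
              go (a , t) = a , proj₁ (outB {a} t) , proj₂ (outB {a} t) , lin
                (# (adj G a ∩ I) ∷ cnt (adj G a ∩ I) xs ∷ # ((adj G a ∩ I) ∖ ⟨ xs ⟩) ∷ # ⟨ L ⟩ ∷ # (A ∖ ⟨ L ++ xs ⟩) ∷ # (B ∖ ⟨ L ++ xs ⟩) ∷ length L ∷ [])
                ((con 1000000 ≲ x₀) ∷ (x₀ ≲ x₁ :+ x₂) ∷ (x₂ ≲ x₃ :+ x₄) ∷ (x₃ ≲ x₆) ∷ (x₆ ≲ con 60000) ∷ (x₄ ≲ x₅) ∷ (con 1 :+ x₅ ≲ con 850000) ∷ []) (con 605 ≲ x₁)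
                (B-rich (proj₁ (outB {a} t))) (#-≤-cnt+ (adj G a ∩ I) xs) (#-subadd ((adj G a ∩ I) ∖ ⟨ xs ⟩) ⟨ L ⟩ (A ∖ ⟨ L ++ xs ⟩) split)
                (#-⟨⟩≤ L) |L| (≤-reflexive same) (≰⇒> small)
                where
                split : ∀ w → T (((adj G a ∩ I) ∖ ⟨ xs ⟩) w) → T (⟨ L ⟩ w) ⊎ T ((A ∖ ⟨ L ++ xs ⟩) w)
                split w s = by (w ∈? L) (∧-T {adj G a w ∧ I w} s)
                  where
                  by : Dec (w ∈ L) → T (adj G a w ∧ I w) × T (not (⟨ xs ⟩ w)) → T (⟨ L ⟩ w) ⊎ T ((A ∖ ⟨ L ++ xs ⟩) w)
                  by (yes i) _ = inj₁ (∈⟨⟩ i)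
                  by (no ¬i) (s₁ , s₂) = inj₂ (∧-intro (I⊑A w (proj₂ (∧-T {adj G a w} s₁))) (not-intro (λ s₃ → ∉-++ L ¬i (λ k → not-T s₂ (∈⟨⟩ k)) (⟨⟩∈ s₃))))
            outside-I : 1 ≤ # (B ∖ ⟨ L ++ xs ⟩) → ∃ λ b → T (I b) × b ∉ L ++ xs
            outside-I h = go (#-find {p = A ∖ ⟨ L ++ xs ⟩} (≤-trans h (≤-reflexive (sym same))))
              where
              go : ∃ (λ b → T ((A ∖ ⟨ L ++ xs ⟩) b)) → ∃ λ b → T (I b) × b ∉ L ++ xs
              go (b , t) = b , core (T? (I b)) , b∉
                where
                b∉ : b ∉ L ++ xs
                b∉ i = not-T (proj₂ (∧-T {A b} t)) (∈⟨⟩ i)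
                core : Dec (T (I b)) → T (I b)
                core (yes i) = i
                core (no ¬i) = contradiction (∈-++⁺ˡ (L-full (proj₁ (∧-T {A b} t)) ¬i)) b∉
            decide : ∀ j → # (B ∖ ⟨ L ++ xs ⟩) ≤ j → Dec (1 ≤ # (B ∖ ⟨ L ++ xs ⟩)) → Closing L e x
            decide j       hj (no ¬h) = done (≤-pred (≰⇒> ¬h))
            decide zero    hj (yes _) = done hj
            decide (suc j) hj (yes h) = go (select h (850000 ≤? # (B ∖ ⟨ L ++ xs ⟩))) (outside-I h)
              where
              go : Target → (∃ λ b → T (I b) × b ∉ L ++ xs) → Closing L e x
              go (a , ba , a∉ , rich) (b , ib , b∉) = next (insert-pair al ba (∉-left L a∉) (∉-right L a∉) ib (∉-left L b∉) (∉-right L b∉) rich)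
                where
                next : (∃ λ xs′ → Alt u v xs′ × xs′ ↭ a ∷ b ∷ xs) → Closing L e x
                next (xs′ , al′ , p) = fill j xs′ (≤-pred (≤-trans smaller hj)) al′ (λ i → ∈-resp-↭ (↭-sym p) (there (there (sub i))))
                  where
                  smaller : 1 + # (B ∖ ⟨ L ++ xs′ ⟩) ≤ # (B ∖ ⟨ L ++ xs ⟩)
                  smaller = ≤-trans (+-monoˡ-≤ _ (#-pos ⟨ a ∷ [] ⟩ {a} (∈⟨⟩ (here refl))))
                    (#-disjoint (B ∖ ⟨ L ++ xs ⟩) ⟨ a ∷ [] ⟩ (B ∖ ⟨ L ++ xs′ ⟩) (λ w t → one (⟨⟩∈ t)) shrink (λ w t s → not-T (proj₂ (∧-T {B w} s)) (∈⟨⟩ (∈-++⁺ʳ L (∈-resp-↭ (↭-sym p) (hd (⟨⟩∈ t)))))))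
                    where
                    one : ∀ {w} → w ∈ a ∷ [] → T ((B ∖ ⟨ L ++ xs ⟩) w)
                    one (here refl) = ∧-intro ba (not-intro (λ s → a∉ (⟨⟩∈ s)))
                    hd : ∀ {w} → w ∈ a ∷ [] → w ∈ a ∷ b ∷ xs
                    hd (here e) = here e
                    shrink : (B ∖ ⟨ L ++ xs′ ⟩) ⊑ (B ∖ ⟨ L ++ xs ⟩)
                    shrink w t = let (t₁ , t₂) = ∧-T {B w} t in ∧-intro t₁ (not-intro (λ s → not-T t₂ (∈⟨⟩ (grow (∈-++⁻ L (⟨⟩∈ s))))))
                      where
                      grow : w ∈ L ⊎ w ∈ xs → w ∈ L ++ xs′
                      grow (inj₁ i) = ∈-++⁺ˡ i
                      grow (inj₂ i) = ∈-++⁺ʳ L (∈-resp-↭ (↭-sym p) (there (there i)))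

      abstract
        -- The starting walk has 1403 = 3 + 2 · 700 vertices. As it alternates and has its ends in
        -- the core, about half of them are core vertices, which exceeds the 605 needed for
        -- insertions.
        close-up : Closing L e x
        close-up = go start-alt
          where
          go : (∃ λ u → ∃ λ v → ∃ λ xs → Adj G e u × Adj G v x × Alt u v xs × length xs ≡ 3 × T (I u) × T (I v)) → Closing L e x
          go (u , v , xs , eu , vx , al , len , iu , iv) = go′ (long 700 ≤-refl iu (xs , al , len))
            where
            go′ : (∃ λ xs → Alt u v xs × length xs ≡ 1403) → Closing L e x
            go′ (xs , al@(alt h uq off bal) , len) = Fill.fill eu vx iu iv (filter (λ y → T? (I y)) xs)
              (All.tabulate (λ i → proj₂ (∈-filter⁻ (λ y → T? (I y)) {xs = xs} i))) (Uniq.filter⁺ (λ y → T? (I y)) uq)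
              (≤-trans (length-filter (λ y → T? (I y)) xs) (≤-reflexive len)) enough (# (B ∖ ⟨ L ++ xs ⟩)) xs ≤-refl al (λ i → proj₁ (∈-filter⁻ (λ y → T? (I y)) {xs = xs} i))
              where
              sides : ∀ {u v xs} → Walk BI u v xs → T (I u) ⊎ T (B u) → length xs ≤ cnt I xs + cnt B xs
              sides {u} end s = one s
                where
                one : ∀ {u} → T (I u) ⊎ T (B u) → 1 + 0 ≤ cnt I (u ∷ []) + cnt B (u ∷ [])
                one {u} (inj₁ i) = ≤-trans (≤-reflexive (sym (cnt-yes I {u} [] i))) (m≤m+n _ _)
                one {u} (inj₂ b) = ≤-trans (≤-reflexive (sym (cnt-yes B {u} [] b))) (m≤n+m _ _)
              sides {u} (step {xs = xs} (_ , t) h) s = ≤-trans (s≤s (sides h (nxt t))) (more s)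
                where
                nxt : ∀ {x y} → T (I x) × T (B y) ⊎ T (B x) × T (I y) → T (I y) ⊎ T (B y)
                nxt (inj₁ (_ , b)) = inj₂ b
                nxt (inj₂ (_ , i)) = inj₁ i
                more : T (I u) ⊎ T (B u) → 1 + (cnt I xs + cnt B xs) ≤ cnt I (u ∷ xs) + cnt B (u ∷ xs)
                more (inj₁ i) = ≤-reflexive (sym (cong₂ _+_ (cnt-yes I xs i) (cnt-no B xs (notB i))))
                more (inj₂ b) = ≤-reflexive (sym (trans (cong₂ _+_ (cnt-no I xs (λ i → notB i b)) (cnt-yes B xs b)) (+-suc _ _)))
              A≤I : cnt B xs + 1 ≤ cnt A xs
              A≤I = ≤-reflexive (sym bal)
              AB : cnt A xs + cnt B xs ≤ length xs
              AB = both xs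
                where
                both : ∀ ys → cnt A ys + cnt B ys ≤ length ys
                both []       = z≤n
                both (y ∷ ys) = by (cover y)
                  where
                  by : T (A y) ⊎ T (B y) → cnt A (y ∷ ys) + cnt B (y ∷ ys) ≤ suc (length ys)
                  by (inj₁ a) = ≤-trans (≤-reflexive (cong₂ _+_ (cnt-yes A ys a) (cnt-no B ys (disjoint a)))) (s≤s (both ys))
                  by (inj₂ b) = ≤-trans (≤-reflexive (trans (cong₂ _+_ (cnt-no A ys (B-not-A bip b)) (cnt-yes B ys b)) (+-suc _ _))) (s≤s (both ys))
              enough : 605 ≤ cnt I xs
              enough = *-cancelˡ-≤ 2 (lin (cnt I xs ∷ cnt A xs ∷ cnt B xs ∷ length xs ∷ [])
                ((con 1403 ≲ x₃) ∷ (x₃ ≲ x₀ :+ x₂) ∷ (x₃ ≲ x₀ :+ x₂) ∷ (x₁ :+ x₂ ≲ x₃) ∷ (x₂ :+ con 1 ≲ x₁) ∷ []) (con 1210 ≲ 2 :* x₀)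
                (≤-reflexive (sym len)) (sides h (inj₁ iu)) (sides h (inj₁ iu)) AB A≤I)

-- Hamilton cycles through prescribed edges.

module Routing {n : ℕ} (G : Graph n) (3≤n : 3 ≤ n) where

  open Space G
  open Denseness G
  open Bipartite G
  open Chains G
  open Alternating G 3≤n

  private
    V = Fin n
    E = EdgeVec n

  module _ {I A B : V → Bool} (bip : Bip I A B) where

    open Bip bip

    -- Λ and the given inside edges lie on a common Hamilton cycle all of whose other edges run between A and B.
    record Routed (x z : V) (Λ : List V) (esB esA : Edges) : Set where
      constructor routed
      field
        rest   : E
        closed : ∀ {Λ′} → Walk (Adj G) x z Λ′ → Λ ↭ Λ′ → Z (walkEdges Λ′ ∷ rest ∷ [])
        cohere : ∀ g → Coherent bip g → Z (rest ∷ g z ∷ g x ∷ total-excess g esB ∷ total-excess g esA ∷ [])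

    abstract
      -- On a Hamilton cycle the sizes of the sides differ by the difference between the numbers of
      -- edges inside them; the balance condition is this count, with Λ taken into account. Each
      -- prescribed edge and each exceptional vertex takes at most seven places on the chain, so 50
      -- + 3 · 7 · 1300 places suffice, well below 60000.
      route : ∀ {x z Λ} esB esA → Walk (Adj G) x z Λ → T (B x) → T (B z) → Unique (Λ ++ ends esB ++ ends esA) → Inside B esB → Inside A esA →
              length Λ ≤ 50 → length esB ≤ 1300 → length esA ≤ 1300 → cnt B Λ + length esB + # A ≡ cnt A Λ + length esA + # B + 1 →
              Routed x z Λ esB esA
      route {x} {z} {Λ} esB esA h bx bz uq inB inA |Λ| |esB| |esA| bal = go (add-vertices bip vs ch₂ all-A bound₃)
        where
        vs : List V
        vs = elements (A ∖ I)
        all-A : All (λ a → T (A a)) vs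
        all-A = All.tabulate (λ {v} i → proj₁ (∧-T {A v} (elements-∈ {p = A ∖ I} i)))
        |vs| : length vs ≤ 1300
        |vs| = ≤-trans (≤-reflexive (#-elements (A ∖ I))) A∖I-few
        R₁ : List V
        R₁ = ends esA ++ []
        uq′ : Unique (Λ ++ ends esB ++ R₁)
        uq′ = subst (λ xs → Unique (Λ ++ ends esB ++ xs)) (sym (++-identityʳ (ends esA))) uq
        l₁ l₂ : ℕ
        l₁ = 50 + 7 * length esB
        l₂ = l₁ + 7 * length esA
        bound₁ : l₁ ≤ 60000
        bound₁ = lin (length esB ∷ []) ((7 :* x₀ ≲ con 9100) ∷ []) (con 50 :+ 7 :* x₀ ≲ con 60000) (*-monoʳ-≤ 7 |esB|)
        bound₂ : l₂ ≤ 60000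
        bound₂ = lin (length esB ∷ length esA ∷ []) ((7 :* x₀ ≲ con 9100) ∷ (7 :* x₁ ≲ con 9100) ∷ []) ((con 50 :+ 7 :* x₀) :+ 7 :* x₁ ≲ con 60000) (*-monoʳ-≤ 7 |esB|) (*-monoʳ-≤ 7 |esA|)
        bound₃ : l₂ + 7 * length vs ≤ 60000
        bound₃ = lin (length esB ∷ length esA ∷ length vs ∷ []) ((7 :* x₀ ≲ con 9100) ∷ (7 :* x₁ ≲ con 9100) ∷ (7 :* x₂ ≲ con 9100) ∷ []) (((con 50 :+ 7 :* x₀) :+ 7 :* x₁) :+ 7 :* x₂ ≲ con 60000)
          (*-monoʳ-≤ 7 |esB|) (*-monoʳ-≤ 7 |esA|) (*-monoʳ-≤ 7 |vs|)
        |R₁| : length R₁ ≤ 2600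
        |R₁| = ≤-trans (≤-reflexive (trans (cong length (++-identityʳ (ends esA))) (length-ends esA))) (*-monoʳ-≤ 2 |esA|)
        |R₀| : length (ends esB ++ R₁) ≤ 20000
        |R₀| = ≤-trans (≤-reflexive (length-++ (ends esB))) (lin (length (ends esB) ∷ length R₁ ∷ []) ((x₀ ≲ con 2600) ∷ (x₁ ≲ con 2600) ∷ []) (x₀ :+ x₁ ≲ con 20000)
          (≤-trans (≤-reflexive (length-ends esB)) (*-monoʳ-≤ 2 |esB|)) |R₁|)
        parts : ∀ (as : List V) {cs} → Unique (as ++ cs) → Unique as × Unique cs × All (_∉ cs) as
        parts []       u       = [] , u , []
        parts (a ∷ as) (p ∷ u) = (Allₚ.++⁻ˡ as p ∷ proj₁ (parts as u)) , proj₁ (proj₂ (parts as u)) , (Allₚ.All¬⇒¬Any (Allₚ.++⁻ʳ as p) ∷ proj₂ (proj₂ (parts as u)))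
        ch₀ : Chain bip x z Λ (ends esB ++ R₁) 50 0 0 (λ _ → zeroV)
        ch₀ = trivial bip bz (proj₁ (parts Λ uq′)) (proj₂ (proj₂ (parts Λ uq′))) |Λ|
        ch₁ : Chain bip x z Λ R₁ l₁ (length esB) 0 (λ g → zeroV ⊕ total-excess g esB)
        ch₁ = add-Bs bip esB ch₀ inB (proj₁ (proj₂ (parts Λ uq′))) bound₁ |R₀|
        ch₂ : Chain bip x z Λ [] l₂ (length esB) (length esA) (λ g → (zeroV ⊕ total-excess g esB) ⊕ total-excess g esA)
        ch₂ = add-As bip esA ch₁ inA (proj₁ (proj₂ (parts (ends esB) (proj₁ (proj₂ (parts Λ uq′)))))) bound₂ (≤-trans |R₁| (le 2600 20000))
        go : Grown bip ch₂ [] (l₂ + 7 * length vs) (length esB) (length esA) (λ g → (zeroV ⊕ total-excess g esB) ⊕ total-excess g esA) vs → Routed x z Λ esB esA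
        go (ch , inc) = finish (close-up bip (Λ ++ C.M) C.e x C.in-B bx C.unique (≤-trans C.short bound₃) full balanced)
          where
          module C = Chain ch
          full : ∀ {v} → T (A v) → ¬ T (I v) → v ∈ Λ ++ C.M
          full {v} a ¬i = inc (inj₂ (∈-elements {p = A ∖ I} (∧-intro a (not-intro ¬i))))
          balanced : cnt B (Λ ++ C.M) + # A ≡ cnt A (Λ ++ C.M) + # B + 1
          balanced = trans (cong (_+ # A) (cnt-++ B Λ C.M)) (trans (solve (cnt B Λ) (cnt B C.M) (cnt A Λ) (cnt A C.M) (length esB) (length esA) (# A) (# B) bal C.balance)
            (sym (cong (λ j → j + # B + 1) (cnt-++ A Λ C.M))))
            where
            solve : ∀ bΛ bM aΛ aM p q a b → bΛ + p + a ≡ aΛ + q + b + 1 → bM + q ≡ aM + p → (bΛ + bM) + a ≡ (aΛ + aM) + b + 1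
            solve bΛ bM aΛ aM p q a b e₁ e₂ = ≤-antisym
              (lin (bΛ ∷ bM ∷ aΛ ∷ aM ∷ p ∷ q ∷ a ∷ b ∷ []) ((x₀ :+ x₄ :+ x₆ ≲ x₂ :+ x₅ :+ x₇ :+ con 1) ∷ (x₁ :+ x₅ ≲ x₃ :+ x₄) ∷ []) ((x₀ :+ x₁) :+ x₆ ≲ (x₂ :+ x₃) :+ x₇ :+ con 1) (≤-reflexive e₁) (≤-reflexive e₂))
              (lin (bΛ ∷ bM ∷ aΛ ∷ aM ∷ p ∷ q ∷ a ∷ b ∷ []) ((x₂ :+ x₅ :+ x₇ :+ con 1 ≲ x₀ :+ x₄ :+ x₆) ∷ (x₃ :+ x₄ ≲ x₁ :+ x₅) ∷ []) ((x₂ :+ x₃) :+ x₇ :+ con 1 ≲ (x₀ :+ x₁) :+ x₆) (≤-reflexive (sym e₁)) (≤-reflexive (sym e₂)))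
          finish : Closing bip (Λ ++ C.M) C.e x → Routed x z Λ esB esA
          finish (closing {w} {w′} {ys} k enter leave aw aw′ uW cov coh) = routed K closed cohere
            where
            K₂ K₁ K : E
            K₂ = walkEdges ys ⊕ pairInd w′ x
            K₁ = pairInd C.e w ⊕ K₂
            K = C.c ⊕ K₁
            K-split : Z (K ∷ C.c ∷ pairInd C.e w ∷ walkEdges ys ∷ pairInd w′ x ∷ [])
            K-split = comb (K ∷ C.c ∷ pairInd C.e w ∷ walkEdges ys ∷ pairInd w′ x ∷ K₁ ∷ K₂ ∷ []) ((0 ∷ 1 ∷ 5 ∷ []) ∷ (5 ∷ 2 ∷ 6 ∷ []) ∷ (6 ∷ 3 ∷ 4 ∷ []) ∷ []) (0 ∷ 1 ∷ 2 ∷ 3 ∷ 4 ∷ [])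
              (Z-⊕ C.c K₁) (Z-⊕ (pairInd C.e w) K₂) (Z-⊕ (walkEdges ys) (pairInd w′ x))
            closed : ∀ {Λ′} → Walk (Adj G) x z Λ′ → Λ ↭ Λ′ → Z (walkEdges Λ′ ∷ K ∷ [])
            closed {Λ′} h′ p = comb (walkEdges Λ′ ∷ K ∷ C.c ∷ pairInd C.e w ∷ walkEdges ys ∷ pairInd w′ x ∷ walkEdges ((Λ′ ++ C.M) ++ ys) ∷ walkEdges (Λ′ ++ C.M) ∷ [])
              ((1 ∷ 2 ∷ 3 ∷ 4 ∷ 5 ∷ []) ∷ (6 ∷ 5 ∷ []) ∷ (6 ∷ 7 ∷ 3 ∷ 4 ∷ []) ∷ (7 ∷ 0 ∷ 2 ∷ []) ∷ []) (0 ∷ 1 ∷ [])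
              K-split (ham-cycle 3≤n (join (C.prolong h′) enter k) leave (Unique-resp-↭ q uW) (λ v → ∈-resp-↭ q (cov v))) (Z-join (C.prolong h′) k) (C.value h′)
              where
              q : (Λ ++ C.M) ++ ys ↭ (Λ′ ++ C.M) ++ ys
              q = ++⁺ʳ ys (++⁺ʳ C.M p)
            cohere : ∀ g → Coherent bip g → Z (K ∷ g z ∷ g x ∷ total-excess g esB ∷ total-excess g esA ∷ [])
            cohere g c = comb (K ∷ g z ∷ g x ∷ total-excess g esB ∷ total-excess g esA ∷ C.c ∷ pairInd C.e w ∷ walkEdges ys ∷ pairInd w′ x ∷ g C.e ∷ g w ∷ g w′ ∷ pairInd w C.e
                ∷ ((zeroV ⊕ total-excess g esB) ⊕ total-excess g esA) ∷ (zeroV ⊕ total-excess g esB) ∷ zeroV ∷ [])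
              ((0 ∷ 5 ∷ 6 ∷ 7 ∷ 8 ∷ []) ∷ (5 ∷ 1 ∷ 9 ∷ 13 ∷ []) ∷ (13 ∷ 14 ∷ 4 ∷ []) ∷ (14 ∷ 15 ∷ 3 ∷ []) ∷ (15 ∷ []) ∷ (6 ∷ 12 ∷ []) ∷ (12 ∷ 10 ∷ 9 ∷ []) ∷ (7 ∷ 10 ∷ 11 ∷ []) ∷ (8 ∷ 11 ∷ 2 ∷ []) ∷ []) (0 ∷ 1 ∷ 2 ∷ 3 ∷ 4 ∷ [])
              K-split (C.cohere g c) (Z-⊕ (zeroV ⊕ total-excess g esB) (total-excess g esA)) (Z-⊕ zeroV (total-excess g esB)) Z-zero (Z-sym C.e w) (c aw C.in-B (Adj-sym enter)) (coh g c) (c aw′ bx leave)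

      -- For a walk that ends in A, whereas `route` wants its ends in B: the added edge runs between
      -- the sides and is absorbed by coherence.
      cap-right : ∀ {x z y Λ esB esA} → Walk (Adj G) x z Λ → Adj G z y → T (A z) → T (B y) → Routed x y (Λ ++ y ∷ []) esB esA → Routed x z Λ esB esA
      cap-right {x} {z} {y} {Λ} {esB} {esA} h e az by (routed r closed cohere) = routed (pairInd z y ⊕ r)
        (λ {Λ′} h′ p → comb (walkEdges Λ′ ∷ (pairInd z y ⊕ r) ∷ pairInd z y ∷ r ∷ walkEdges (Λ′ ++ y ∷ []) ∷ zeroV ∷ []) ((4 ∷ 3 ∷ []) ∷ (4 ∷ 0 ∷ 2 ∷ 5 ∷ []) ∷ (5 ∷ []) ∷ (1 ∷ 2 ∷ 3 ∷ []) ∷ []) (0 ∷ 1 ∷ [])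
          (closed (join h′ e end) (++⁺ʳ _ p)) (Z-join h′ (end {R = Adj G})) Z-zero (Z-⊕ (pairInd z y) r))
        (λ g k → comb ((pairInd z y ⊕ r) ∷ g z ∷ g x ∷ total-excess g esB ∷ total-excess g esA ∷ pairInd z y ∷ r ∷ g y ∷ []) ((0 ∷ 5 ∷ 6 ∷ []) ∷ (6 ∷ 7 ∷ 2 ∷ 3 ∷ 4 ∷ []) ∷ (5 ∷ 1 ∷ 7 ∷ []) ∷ []) (0 ∷ 1 ∷ 2 ∷ 3 ∷ 4 ∷ [])
          (Z-⊕ (pairInd z y) r) (cohere g k) (k az by e))

      cap-left : ∀ {x z y Λ esB esA} → Walk (Adj G) x z Λ → Adj G y x → T (A x) → T (B y) → Routed y z (y ∷ Λ) esB esA → Routed x z Λ esB esA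
      cap-left {x} {z} {y} {Λ} {esB} {esA} h e ax by (routed r closed cohere) = routed (pairInd y x ⊕ r)
        (λ {Λ′} h′ p → comb (walkEdges Λ′ ∷ (pairInd y x ⊕ r) ∷ pairInd y x ∷ r ∷ walkEdges (y ∷ Λ′) ∷ []) ((4 ∷ 3 ∷ []) ∷ (4 ∷ 2 ∷ 0 ∷ []) ∷ (1 ∷ 2 ∷ 3 ∷ []) ∷ []) (0 ∷ 1 ∷ [])
          (closed (step e h′) (prep y p)) (Z-step h′) (Z-⊕ (pairInd y x) r))
        (λ g k → comb ((pairInd y x ⊕ r) ∷ g z ∷ g x ∷ total-excess g esB ∷ total-excess g esA ∷ pairInd y x ∷ r ∷ g y ∷ pairInd x y ∷ []) ((0 ∷ 5 ∷ 6 ∷ []) ∷ (6 ∷ 1 ∷ 7 ∷ 3 ∷ 4 ∷ []) ∷ (5 ∷ 8 ∷ []) ∷ (8 ∷ 2 ∷ 7 ∷ []) ∷ []) (0 ∷ 1 ∷ 2 ∷ 3 ∷ 4 ∷ [])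
          (Z-⊕ (pairInd y x) r) (cohere g k) (Z-sym y x) (k ax by (Adj-sym e)))

-- The larger and the smaller side.

module TwoSided {n : ℕ} (G : Graph n) (3≤n : 3 ≤ n) where

  open Space G
  open Ladder G
  open Rooted G
  open Denseness G
  open Bipartite G
  open Routing G 3≤n using (Routed; routed; cap-left; cap-right)

  private
    V = Fin n
    E = EdgeVec n

  record Route (Big Small : V → Bool) (x z : V) (Λ : List V) (es ss : Edges) : Set where
    constructor routeTo
    field
      rest   : E
      closed : ∀ {Λ′} → Walk (Adj G) x z Λ′ → Λ ↭ Λ′ → Z (walkEdges Λ′ ∷ rest ∷ [])
      cohere : ∀ g → (∀ {a b} → T (Small a) → T (Big b) → Adj G a b → Z (pairInd a b ∷ g a ∷ g b ∷ [])) →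
               Z (rest ∷ g z ∷ g x ∷ total-excess g es ∷ total-excess g ss ∷ [])

  Crossing : (Big Small : V → Bool) → V → V → Set
  Crossing Big Small x y = Adj G x y × (T (Big x) × T (Small y) ⊎ T (Small x) × T (Big y))

  -- The core always lies in A, but either side can be the larger one. This interface hides which,
  -- so that the later arguments are carried out once.
  record Sided (Big Small : V → Bool) : Set where
    field
      cover    : ∀ x → T (Big x) ⊎ T (Small x)
      disjoint : ∀ {x} → T (Big x) → T (Small x) → ⊥
      route    : ∀ {x z Λ} es ss → Walk (Adj G) x z Λ → T (Big x) → T (Big z) → Unique (Λ ++ ends es ++ ends ss) → Inside Big es → Inside Small ss →
                 length Λ ≤ 40 → length es ≤ 1300 → length ss ≤ 1300 → cnt Big Λ + length es + # Small ≡ cnt Small Λ + length ss + # Big + 1 →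
                 Route Big Small x z Λ es ss
      to-small : ∀ {x} D → T (Big x) → length D ≤ 5000 → ∃ λ y → T (Small y) × Adj G x y × y ∉ D
      to-big   : ∀ {x} D → T (Small x) → length D ≤ 5000 → ∃ λ y → T (Big y) × Adj G x y × y ∉ D
      bridge-big   : ∀ {x y} D → T (Big x) → T (Big y) → x ≢ y → length D ≤ 5000 → Bridge (Crossing Big Small) x y D
      bridge-small : ∀ {x y} D → T (Small x) → T (Small y) → x ≢ y → length D ≤ 5000 → Bridge (Crossing Big Small) x y D
      root     : ∀ D → length D ≤ 5000 → ∃ λ r → T (Big r) × r ∉ D × (∀ {a} D → T (Small a) → length D ≤ 5000 →
                 ∃ λ p → ∃ λ q → T (Small p) × T (Big q) × Adj G r p × Adj G p q × Adj G q a × p ∉ D × q ∉ D)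

  module _ {I A B : V → Bool} (bip : Bip I A B) where

    open Bip bip

    private
      small′ : ∀ {D : List V} → length D ≤ 5000 → length D ≤ 100000
      small′ h = ≤-trans h (le 5000 100000)

    private abstract
      bridge-B : ∀ {R : V → V → Set} → (∀ {x y} → Adj G x y → T (A x) → T (B y) → R x y) → (∀ {x y} → Adj G x y → T (B x) → T (A y) → R x y) →
                 ∀ {x y} D → T (B x) → T (B y) → x ≢ y → length D ≤ 5000 → Bridge R x y D
      bridge-B {R} ab ba {x} {y} D bx by x≢y h = go (connectB bip (x ∷ y ∷ D) bx by (≤-trans (s≤s (s≤s h)) (le 5002 90000)))
        where
        go : Connector bip x y (x ∷ y ∷ D) → Bridge R x y D
        go (connector {i} {c} {j} ii bc ij xi ic cj jy i≢j i∉ c∉ j∉) = record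
          { walk = step (ba xi bx (I⊑A i ii)) (step (ab ic (I⊑A i ii) bc) (step (ba cj bc (I⊑A j ij)) (step (ab jy (I⊑A j ij) by) end)))
          ; unique = (Adj-irr xi ∷ ≢-sym (∉-head c∉) ∷ ≢-sym (∉-head j∉) ∷ x≢y ∷ []) ∷ (Adj-irr ic ∷ i≢j ∷ ∉-head (∉-tail i∉) ∷ [])
              ∷ (Adj-irr cj ∷ ∉-head (∉-tail c∉) ∷ []) ∷ (Adj-irr jy ∷ []) ∷ [] ∷ []
          ; fresh = inj₁ refl ∷ inj₂ (inj₂ (∉-tail (∉-tail i∉))) ∷ inj₂ (inj₂ (∉-tail (∉-tail c∉))) ∷ inj₂ (inj₂ (∉-tail (∉-tail j∉))) ∷ inj₂ (inj₁ refl) ∷ []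
          ; short = le 5 7 }

      bridge-A : ∀ {R : V → V → Set} → (∀ {x y} → Adj G x y → T (A x) → T (B y) → R x y) → (∀ {x y} → Adj G x y → T (B x) → T (A y) → R x y) →
                 ∀ {x y} D → T (A x) → T (A y) → x ≢ y → length D ≤ 5000 → Bridge R x y D
      bridge-A {R} ab ba {x} {y} D ax ay x≢y h = go₁ (B-neighbour bip (x ∷ y ∷ D) ax (≤-trans (s≤s (s≤s h)) (le 5002 100000)))
        where
        go₁ : (∃ λ p → T (B p) × Adj G x p × p ∉ x ∷ y ∷ D) → Bridge R x y D
        go₁ (p , bp , xp , p∉) = go₂ (B-neighbour bip (p ∷ x ∷ y ∷ D) ay (≤-trans (s≤s (s≤s (s≤s h))) (le 5003 100000)))
          where
          go₂ : (∃ λ q → T (B q) × Adj G y q × q ∉ p ∷ x ∷ y ∷ D) → Bridge R x y D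
          go₂ (q , bq , yq , q∉) = go₃ (connectB bip (p ∷ q ∷ x ∷ y ∷ D) bp bq (≤-trans (s≤s (s≤s (s≤s (s≤s h)))) (le 5004 90000)))
            where
            go₃ : Connector bip p q (p ∷ q ∷ x ∷ y ∷ D) → Bridge R x y D
            go₃ (connector {i} {c} {j} ii bc ij pi ic cj jq i≢j i∉ c∉ j∉) = record
              { walk = step (ab xp ax bp) (step (ba pi bp (I⊑A i ii)) (step (ab ic (I⊑A i ii) bc) (step (ba cj bc (I⊑A j ij)) (step (ab jq (I⊑A j ij) bq) (step (ba (Adj-sym yq) bq ay) end)))))
              ; unique = (Adj-irr xp ∷ ≢-sym (∉-head (xy i∉)) ∷ ≢-sym (∉-head (xy c∉)) ∷ ≢-sym (∉-head (xy j∉)) ∷ ≢-sym (∉-head (∉-tail q∉)) ∷ x≢y ∷ [])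
                  ∷ (Adj-irr pi ∷ ≢-sym (∉-head c∉) ∷ ≢-sym (∉-head j∉) ∷ ≢-sym (∉-head q∉) ∷ ∉-head (∉-tail p∉) ∷ [])
                  ∷ (Adj-irr ic ∷ i≢j ∷ ∉-head (∉-tail i∉) ∷ ∉-head (∉-tail (xy i∉)) ∷ [])
                  ∷ (Adj-irr cj ∷ ∉-head (∉-tail c∉) ∷ ∉-head (∉-tail (xy c∉)) ∷ [])
                  ∷ (Adj-irr jq ∷ ∉-head (∉-tail (xy j∉)) ∷ []) ∷ (≢-sym (Adj-irr yq) ∷ []) ∷ [] ∷ []
              ; fresh = inj₁ refl ∷ inj₂ (inj₂ (∉-tail (∉-tail p∉))) ∷ inj₂ (inj₂ (∉-tail (∉-tail (xy i∉)))) ∷ inj₂ (inj₂ (∉-tail (∉-tail (xy c∉))))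
                  ∷ inj₂ (inj₂ (∉-tail (∉-tail (xy j∉)))) ∷ inj₂ (inj₂ (∉-tail (∉-tail (∉-tail q∉)))) ∷ inj₂ (inj₁ refl) ∷ []
              ; short = le 7 7 }
              where
              xy : ∀ {v} → v ∉ p ∷ q ∷ x ∷ y ∷ D → v ∉ x ∷ y ∷ D
              xy f = ∉-tail (∉-tail f)

    sided-B : (∀ D → length D ≤ 5000 → ∃ λ r → T (B r) × r ∉ D) → Sided B A
    sided-B some = record
      { cover = λ x → [ inj₂ , inj₁ ]′ (cover x) ; disjoint = λ b a → disjoint a b
      ; route = λ es ss h bx bz uq i j l m k bal → conv es ss (Routing.route G 3≤n bip es ss h bx bz uq i j (≤-trans l (le 40 50)) m k bal)
      ; to-small = λ D bx h → up (I-neighbour bip D bx (small′ {D} h))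
      ; to-big = λ D ax h → B-neighbour bip D ax (small′ {D} h)
      ; bridge-big = bridge-B (λ e a b → e , inj₂ (a , b)) (λ e b a → e , inj₁ (b , a))
      ; bridge-small = bridge-A (λ e a b → e , inj₂ (a , b)) (λ e b a → e , inj₁ (b , a))
      ; root = λ D h → pack (some D h) }
      where
      conv : ∀ {x z Λ} es ss → Routed bip x z Λ es ss → Route B A x z Λ es ss
      conv es ss (routed r c k) = routeTo r c k
      up : ∀ {x D} → (∃ λ i → T (I i) × Adj G x i × i ∉ D) → ∃ λ y → T (A y) × Adj G x y × y ∉ D
      up (i , ii , e , f) = i , I⊑A i ii , e , f
      Third : V → Set
      Third r = ∀ {a} D → T (A a) → length D ≤ 5000 → ∃ λ p → ∃ λ q → T (A p) × T (B q) × Adj G r p × Adj G p q × Adj G q a × p ∉ D × q ∉ D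
      pack : ∀ {D} → (∃ λ r → T (B r) × r ∉ D) → ∃ λ r → T (B r) × r ∉ D × Third r
      pack (r , br , r∉) = r , br , r∉ , third
        where
        third : Third r
        third {a} D aa h = go₁ (I-neighbour bip D br (small′ {D} h))
          where
          go₁ : (∃ λ i → T (I i) × Adj G r i × i ∉ D) → ∃ λ p → ∃ λ q → T (A p) × T (B q) × Adj G r p × Adj G p q × Adj G q a × p ∉ D × q ∉ D
          go₁ (i , ii , ri , i∉) = go₂ (common bip D aa ii (small′ {D} h))
            where
            go₂ : (∃ λ y → T (B y) × Adj G a y × Adj G i y × y ∉ D) → ∃ λ p → ∃ λ q → T (A p) × T (B q) × Adj G r p × Adj G p q × Adj G q a × p ∉ D × q ∉ D
            go₂ (y , by , ay , iy , y∉) = i , y , I⊑A i ii , by , ri , iy , Adj-sym ay , i∉ , y∉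

    -- The root is taken from the core, because the path of length three from it needs a common
    -- neighbour of the root and another vertex, and only a core vertex guarantees one.
    sided-A : (∀ D → length D ≤ 5000 → ∃ λ r → T (I r) × r ∉ D) → Sided A B
    sided-A some = record
      { cover = cover ; disjoint = disjoint
      ; route = λ es ss h ax az uq i j l m k bal → wrap es ss h ax az uq i j l m k bal
      ; to-small = λ D ax h → B-neighbour bip D ax (small′ {D} h)
      ; to-big = λ D bx h → up (I-neighbour bip D bx (small′ {D} h))
      ; bridge-big = bridge-A (λ e a b → e , inj₁ (a , b)) (λ e b a → e , inj₂ (b , a))
      ; bridge-small = bridge-B (λ e a b → e , inj₁ (a , b)) (λ e b a → e , inj₂ (b , a))
      ; root = λ D h → pack (some D h) }
      where
      up : ∀ {x D} → (∃ λ i → T (I i) × Adj G x i × i ∉ D) → ∃ λ y → T (A y) × Adj G x y × y ∉ D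
      up (i , ii , e , f) = i , I⊑A i ii , e , f
      Third : V → Set
      Third r = ∀ {a} D → T (B a) → length D ≤ 5000 → ∃ λ p → ∃ λ q → T (B p) × T (A q) × Adj G r p × Adj G p q × Adj G q a × p ∉ D × q ∉ D
      pack : ∀ {D} → (∃ λ r → T (I r) × r ∉ D) → ∃ λ r → T (A r) × r ∉ D × Third r
      pack (r , ir , r∉) = r , I⊑A r ir , r∉ , third
        where
        third : Third r
        third {a} D ba h = go₁ (I-neighbour bip D ba (small′ {D} h))
          where
          go₁ : (∃ λ i → T (I i) × Adj G a i × i ∉ D) → ∃ λ p → ∃ λ q → T (B p) × T (A q) × Adj G r p × Adj G p q × Adj G q a × p ∉ D × q ∉ D
          go₁ (i , ii , ai , i∉) = go₂ (common bip D (I⊑A r ir) ii (small′ {D} h))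
            where
            go₂ : (∃ λ y → T (B y) × Adj G r y × Adj G i y × y ∉ D) → ∃ λ p → ∃ λ q → T (B p) × T (A q) × Adj G r p × Adj G p q × Adj G q a × p ∉ D × q ∉ D
            go₂ (y , by , ry , iy , y∉) = y , i , by , I⊑A i ii , ry , Adj-sym iy , Adj-sym ai , y∉ , i∉
      -- Λ has its ends in A, so it is first prolonged by a vertex of B at either end.
      wrap : ∀ {x z Λ} es ss → Walk (Adj G) x z Λ → T (A x) → T (A z) → Unique (Λ ++ ends es ++ ends ss) → Inside A es → Inside B ss →
             length Λ ≤ 40 → length es ≤ 1300 → length ss ≤ 1300 → cnt A Λ + length es + # B ≡ cnt B Λ + length ss + # A + 1 → Route A B x z Λ es ss
      wrap {x} {z} {Λ} es ss h ax az uq ies iss |Λ| |es| |ss| bal = go₁ (B-neighbour bip D ax (≤-trans |D| (le 5240 100000)))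
        where
        D : List V
        D = Λ ++ ends es ++ ends ss
        |D| : length D ≤ 5240
        |D| = ≤-trans (≤-reflexive (trans (length-++ Λ) (cong (length Λ +_) (trans (length-++ (ends es)) (cong₂ _+_ (length-ends es) (length-ends ss))))))
          (lin (length Λ ∷ length es ∷ length ss ∷ []) ((x₀ ≲ con 40) ∷ (2 :* x₁ ≲ con 2600) ∷ (2 :* x₂ ≲ con 2600) ∷ []) (x₀ :+ (2 :* x₁ :+ 2 :* x₂) ≲ con 5240) |Λ| (*-monoʳ-≤ 2 |es|) (*-monoʳ-≤ 2 |ss|))
        go₁ : (∃ λ y → T (B y) × Adj G x y × y ∉ D) → Route A B x z Λ es ss
        go₁ (y , by , xy , y∉) = go₂ (B-neighbour bip (y ∷ D) az (≤-trans (s≤s |D|) (le 5241 100000)))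
          where
          go₂ : (∃ λ y′ → T (B y′) × Adj G z y′ × y′ ∉ y ∷ D) → Route A B x z Λ es ss
          go₂ (y′ , by′ , zy′ , y′∉) = conv (cap-left bip h (Adj-sym xy) ax by (cap-right bip (step (Adj-sym xy) h) zy′ az by′
            (Routing.route G 3≤n bip ss es (step (Adj-sym xy) (join h zy′ end)) by by′ uq′ iss ies len |ss| |es| bal′)))
            where
            Λ⁺ : List V
            Λ⁺ = y ∷ Λ ++ y′ ∷ []
            conv : Routed bip x z Λ ss es → Route A B x z Λ es ss
            conv (routed r c k) = routeTo r c (λ g f → comb (r ∷ g z ∷ g x ∷ total-excess g es ∷ total-excess g ss ∷ []) ((0 ∷ 1 ∷ 2 ∷ 4 ∷ 3 ∷ []) ∷ []) (0 ∷ 1 ∷ 2 ∷ 3 ∷ 4 ∷ [])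
              (k g (λ {a} {b} ta tb e → comb (pairInd a b ∷ g a ∷ g b ∷ pairInd b a ∷ []) ((3 ∷ 2 ∷ 1 ∷ []) ∷ (0 ∷ 3 ∷ []) ∷ []) (0 ∷ 1 ∷ 2 ∷ []) (f tb ta (Adj-sym e)) (Z-sym a b))))
            uq′ : Unique (Λ⁺ ++ ends ss ++ ends es)
            uq′ = Unique-resp-↭ perm (Allₚ.¬Any⇒All¬ (y′ ∷ D) (∉-cons (≢-sym (∉-head y′∉)) y∉) ∷ Allₚ.¬Any⇒All¬ D (∉-tail y′∉) ∷ uq)
              where
              perm : y ∷ y′ ∷ Λ ++ ends es ++ ends ss ↭ Λ⁺ ++ ends ss ++ ends es
              perm = prep y (↭-trans (↭-sym (shift y′ Λ _)) (↭-trans (++⁺ˡ Λ (prep y′ (++-comm (ends es) (ends ss)))) (↭-reflexive (sym (++-assoc Λ (y′ ∷ []) _)))))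
            len : length Λ⁺ ≤ 50
            len = ≤-trans (s≤s (≤-reflexive (length-++ Λ))) (lin (length Λ ∷ []) ((x₀ ≲ con 40) ∷ []) (con 1 :+ (x₀ :+ con 1) ≲ con 50) |Λ|)
            cntA : cnt A Λ⁺ ≡ cnt A Λ
            cntA = trans (cnt-no A _ (B-not-A bip by)) (trans (cnt-++ A Λ (y′ ∷ [])) (trans (cong (cnt A Λ +_) (cnt-no A [] (B-not-A bip by′))) (+-identityʳ _)))
            cntB : cnt B Λ⁺ ≡ 2 + cnt B Λ
            cntB = trans (cnt-yes B _ by) (cong suc (trans (cnt-++ B Λ (y′ ∷ [])) (trans (cong (cnt B Λ +_) (cnt-yes B [] by′)) (+-comm _ 1))))
            bal′ : cnt B Λ⁺ + length ss + # A ≡ cnt A Λ⁺ + length es + # B + 1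
            bal′ = trans (cong (λ j → j + length ss + # A) cntB) (trans (solve (cnt A Λ) (cnt B Λ) (length es) (length ss) (# A) (# B) bal) (sym (cong (λ j → j + length es + # B + 1) cntA)))
              where
              solve : ∀ aΛ bΛ p q a b → aΛ + p + b ≡ bΛ + q + a + 1 → 2 + bΛ + q + a ≡ aΛ + p + b + 1
              solve aΛ bΛ p q a b e = ≤-antisym
                (lin (aΛ ∷ bΛ ∷ p ∷ q ∷ a ∷ b ∷ []) ((x₁ :+ x₃ :+ x₄ :+ con 1 ≲ x₀ :+ x₂ :+ x₅) ∷ []) (con 2 :+ x₁ :+ x₃ :+ x₄ ≲ x₀ :+ x₂ :+ x₅ :+ con 1) (≤-reflexive (sym e)))
                (lin (aΛ ∷ bΛ ∷ p ∷ q ∷ a ∷ b ∷ []) ((x₀ :+ x₂ :+ x₅ ≲ x₁ :+ x₃ :+ x₄ :+ con 1) ∷ []) (x₀ :+ x₂ :+ x₅ :+ con 1 ≲ con 2 :+ x₁ :+ x₃ :+ x₄) (≤-reflexive e))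

-- The potential between sides of different size.

module Imbalance {n : ℕ} (G : Graph n) (3≤n : 3 ≤ n) where

  open Space G
  open Ladder G
  open Rooted G
  open Denseness G
  open Bipartite G
  open TwoSided G 3≤n

  private
    V = Fin n
    E = EdgeVec n

  ends-++ : ∀ es fs → ends (es ++ fs) ≡ ends es ++ ends fs
  ends-++ []             fs = refl
  ends-++ ((x , y) ∷ es) fs = cong (λ zs → x ∷ y ∷ zs) (ends-++ es fs)

  ends-All : ∀ {P : V → Bool} {es} → Inside P es → All (λ v → T (P v)) (ends es)
  ends-All []                 = []
  ends-All ((_ , a , b) ∷ is) = a ∷ b ∷ ends-All is

  record Partner (P : V → Bool) (es : Edges) (z : V) : Set where
    constructor partner
    field
      {mate}   : V
      {others} : Edges
      edge     : Adj G z mate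
      in-P     : T (P mate)
      inside   : Inside P others
      unique   : Unique (z ∷ mate ∷ ends others)
      size     : length es ≡ suc (length others)
      within   : ∀ {v} → v ∈ mate ∷ ends others → v ∈ ends es

  find-partner : ∀ {P es z} → Inside P es → Unique (ends es) → z ∈ ends es → Partner P es z
  find-partner {es = (a , b) ∷ es} ((e , pa , pb) ∷ is) u (here refl) = partner e pb is u refl there
  find-partner {es = (a , b) ∷ es} ((e , pa , pb) ∷ is) ((a≢b ∷ a∉) ∷ b∉ ∷ u) (there (here refl)) =
    partner (Adj-sym e) pa is ((≢-sym a≢b ∷ b∉) ∷ a∉ ∷ u) refl λ { (here refl) → here refl ; (there i) → there (there i) }
  find-partner {P} {(a , b) ∷ es} {z} ((e , pa , pb) ∷ is) ((a≢b ∷ a∉) ∷ b∉ ∷ u) (there (there i)) = go (find-partner is u i)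
    where
    go : Partner P es z → Partner P ((a , b) ∷ es) z
    go (partner {m} {os} e′ pm ios (z∉ ∷ m∉ ∷ uo) size within) = partner e′ pm ((e , pa , pb) ∷ ios)
      (((≢-sym (All.lookup a∉ i) , ≢-sym (All.lookup b∉ i)) ⟫ z∉) ∷ ((≢-sym (All.lookup a∉ (within (here refl))) ∷ ≢-sym (All.lookup b∉ (within (here refl))) ∷ m∉)
        ∷ (a≢b ∷ All.tabulate (λ j → All.lookup a∉ (within (there j)))) ∷ All.tabulate (λ j → All.lookup b∉ (within (there j))) ∷ uo)) (cong suc size) within′
      where
      _⟫_ : (z ≢ a) × (z ≢ b) → All (z ≢_) (m ∷ ends os) → All (z ≢_) (m ∷ a ∷ b ∷ ends os)
      (p , q) ⟫ (x ∷ xs) = x ∷ p ∷ q ∷ xs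
      within′ : ∀ {v} → v ∈ m ∷ a ∷ b ∷ ends os → v ∈ a ∷ b ∷ ends es
      within′ (here refl)                 = there (there (within (here refl)))
      within′ (there (here refl))         = here refl
      within′ (there (there (here refl))) = there (here refl)
      within′ (there (there (there j)))   = there (there (within (there j)))

  module _ {Big Small : V → Bool} (sd : Sided Big Small) (t : ℕ) (size : # Big ≡ # Small + t) (t≤ : t ≤ 1250) where

    open Sided sd

    private
      R : V → V → Set
      R = Crossing Big Small

      R-sym : ∀ {x y} → R x y → R y x
      R-sym (e , inj₁ (a , b)) = Adj-sym e , inj₂ (b , a)
      R-sym (e , inj₂ (a , b)) = Adj-sym e , inj₁ (b , a)

      -- A crossing walk alternates, so its ends determine the difference of the two counts.
      cross-count : ∀ {x z Λ} → Walk R x z Λ →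
        (T (Big x) → T (Big z) → cnt Big Λ ≡ cnt Small Λ + 1) × (T (Big x) → T (Small z) → cnt Big Λ ≡ cnt Small Λ) ×
        (T (Small x) → T (Big z) → cnt Big Λ ≡ cnt Small Λ) × (T (Small x) → T (Small z) → cnt Big Λ + 1 ≡ cnt Small Λ)
      cross-count end =
        (λ b _ → trans (cnt-yes Big [] b) (sym (cong (_+ 1) (cnt-no Small [] (disjoint b))))) , (λ b s → ⊥-elim (disjoint b s)) , (λ s b → ⊥-elim (disjoint b s)) ,
        (λ s _ → trans (cong (_+ 1) (cnt-no Big [] (λ b → disjoint b s))) (sym (cnt-yes Small [] s)))
      cross-count {x} {z} (step {y = y} {xs = xs} (_ , sides) h) = go sides (cross-count h)
        where
        Counts : V → List V → Set
        Counts x Λ = (T (Big x) → T (Big z) → cnt Big Λ ≡ cnt Small Λ + 1) × (T (Big x) → T (Small z) → cnt Big Λ ≡ cnt Small Λ) ×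
          (T (Small x) → T (Big z) → cnt Big Λ ≡ cnt Small Λ) × (T (Small x) → T (Small z) → cnt Big Λ + 1 ≡ cnt Small Λ)
        go : T (Big x) × T (Small y) ⊎ T (Small x) × T (Big y) → Counts y xs → Counts x (x ∷ xs)
        go (inj₁ (bx , sy)) (_ , _ , sb , ss) =
          (λ _ bz → trans (cnt-yes Big xs bx) (trans (cong suc (sb sy bz)) (trans (+-comm 1 _) (sym (cong (_+ 1) (cnt-no Small xs (disjoint bx))))))) ,
          (λ _ sz → trans (cnt-yes Big xs bx) (trans (+-comm 1 _) (trans (ss sy sz) (sym (cnt-no Small xs (disjoint bx)))))) ,
          (λ s _ → ⊥-elim (disjoint bx s)) , (λ s _ → ⊥-elim (disjoint bx s))
        go (inj₂ (sx , by)) (bb , bs , _ , _) =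
          (λ b _ → ⊥-elim (disjoint b sx)) , (λ b _ → ⊥-elim (disjoint b sx)) ,
          (λ _ bz → trans (cnt-no Big xs (λ b → disjoint b sx)) (trans (bb by bz) (trans (+-comm _ 1) (sym (cnt-yes Small xs sx))))) ,
          (λ _ sz → trans (cong (_+ 1) (cnt-no Big xs (λ b → disjoint b sx))) (trans (cong (_+ 1) (bs by sz)) (trans (+-comm _ 1) (sym (cnt-yes Small xs sx)))))

      balance : ∀ b s l → b + l ≡ s + t + 1 → b + l + # Small ≡ s + 0 + # Big + 1
      balance b s l e = trans (cong (_+ # Small) e) (trans (arith s t (# Small)) (cong (λ j → s + 0 + j + 1) (sym size)))
        where
        arith : ∀ s t c → s + t + 1 + c ≡ s + 0 + (c + t) + 1
        arith s t c = ≤-antisym (lin (s ∷ t ∷ c ∷ []) [] (x₀ :+ x₁ :+ con 1 :+ x₂ ≲ x₀ :+ con 0 :+ (x₂ :+ x₁) :+ con 1)) (lin (s ∷ t ∷ c ∷ []) [] (x₀ :+ con 0 :+ (x₂ :+ x₁) :+ con 1 ≲ x₀ :+ x₁ :+ con 1 :+ x₂))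

    Coherence : (V → E) → Set
    Coherence g = ∀ {a b} → T (Small a) → T (Big b) → Adj G a b → Z (pairInd a b ∷ g a ∷ g b ∷ [])

    module _ (M : Edges) (inM : Inside Big M) (uM : Unique (ends M)) (|M| : length M ≡ t) where

      private
        S : List V
        S = ends M

        |S| : length S ≤ 2500
        |S| = ≤-trans (≤-reflexive (trans (length-ends M) (cong (2 *_) |M|))) (*-monoʳ-≤ 2 t≤)

        S-Big : ∀ {v} → v ∈ S → T (Big v)
        S-Big = All.lookup (ends-All inM)

        module _ (r : V) (br : T (Big r)) where

          -- The completed cycle needs t edges inside `Big`, which M supplies. As a lies in `Small`,
          -- the walk can meet the ends of M only at z. In that case it is prolonged along the
          -- matching edge at z, which then counts among the t. A walk that ends in `Small` is first
          -- prolonged into `Big`.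
          switch : ∀ {a z Λ Λ′} → T (Small a) → a ∉ S ⊎ z ∉ S → Walk R r z Λ → Walk R r z Λ′ → Λ ↭ Λ′ → Unique Λ →
                   All (λ v → v ≡ a ⊎ v ≡ z ⊎ v ∉ S) Λ → length Λ ≤ 30 → Z (walkEdges Λ ∷ walkEdges Λ′ ∷ [])
          switch {a} {z} {Λ} {Λ′} sa _ h h′ p uq free |Λ| = decide (cover z) (z ∈? S)
            where
            k = mapʷ proj₁ h
            k′ = mapʷ proj₁ h′
            off-S : ∀ {v} → v ∈ Λ → v ≢ z → v ∉ S
            off-S {v} i v≢z = go (All.lookup free i)
              where
              go : v ≡ a ⊎ v ≡ z ⊎ v ∉ S → v ∉ S
              go (inj₁ refl)     = λ j → disjoint (S-Big j) sa
              go (inj₂ (inj₁ e)) = contradiction e v≢z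
              go (inj₂ (inj₂ f)) = f
            same : ∀ {X} → Z (walkEdges Λ ∷ X ∷ []) → Z (walkEdges Λ′ ∷ X ∷ []) → Z (walkEdges Λ ∷ walkEdges Λ′ ∷ [])
            same {X} = comb (walkEdges Λ ∷ walkEdges Λ′ ∷ X ∷ []) ((0 ∷ 2 ∷ []) ∷ (1 ∷ 2 ∷ []) ∷ []) (0 ∷ 1 ∷ [])
            plain : T (Big z) → z ∉ S → Z (walkEdges Λ ∷ walkEdges Λ′ ∷ [])
            plain bz z∉ = use (route M [] k br bz uq′ inM [] (≤-trans |Λ| (le 30 40)) (≤-trans (≤-reflexive |M|) (≤-trans t≤ (le 1250 1300))) z≤n
                (balance (cnt Big Λ) (cnt Small Λ) (length M) (trans (cong₂ _+_ (proj₁ (cross-count h) br bz) |M|) (assoc (cnt Small Λ) t))))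
              where
              assoc : ∀ s t → s + 1 + t ≡ s + t + 1
              assoc s t = trans (+-assoc s 1 t) (trans (cong (s +_) (+-comm 1 t)) (sym (+-assoc s t 1)))
              none : ∀ {v} → v ∈ Λ → v ∉ S
              none {v} i = by (v ≟ z)
                where
                by : Dec (v ≡ z) → v ∉ S
                by (yes refl) = z∉
                by (no ne)    = off-S i ne
              uq′ : Unique (Λ ++ ends M ++ [])
              uq′ = subst (λ zs → Unique (Λ ++ zs)) (sym (++-identityʳ (ends M))) (Uniq.++⁺ uq uM (λ (i , j) → none i j))
              use : Route Big Small r z Λ M [] → Z (walkEdges Λ ∷ walkEdges Λ′ ∷ [])
              use (routeTo _ closed _) = same (closed k ↭-refl) (closed k′ p)
            suffixed : ∀ {y es} → Adj G z y → T (Big y) → Unique ((Λ ++ y ∷ []) ++ ends es ++ []) → Inside Big es → length es ≤ 1300 →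
              cnt Big (Λ ++ y ∷ []) + length es ≡ cnt Small (Λ ++ y ∷ []) + t + 1 → Z (walkEdges Λ ∷ walkEdges Λ′ ∷ [])
            suffixed {y} {es} zy by u ies |es| eq = use (route es [] (join k zy end) br by u ies [] (≤-trans (≤-reflexive (length-++ Λ)) (lin (length Λ ∷ []) ((x₀ ≲ con 30) ∷ []) (x₀ :+ con 1 ≲ con 40) |Λ|)) |es| z≤n
                (balance _ _ (length es) eq))
              where
              use : Route Big Small r y (Λ ++ y ∷ []) es [] → Z (walkEdges Λ ∷ walkEdges Λ′ ∷ [])
              use (routeTo X closed _) = comb (walkEdges Λ ∷ walkEdges Λ′ ∷ walkEdges (Λ ++ y ∷ []) ∷ walkEdges (Λ′ ++ y ∷ []) ∷ X ∷ pairInd z y ∷ zeroV ∷ [])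
                ((2 ∷ 4 ∷ []) ∷ (3 ∷ 4 ∷ []) ∷ (2 ∷ 0 ∷ 5 ∷ 6 ∷ []) ∷ (3 ∷ 1 ∷ 5 ∷ 6 ∷ []) ∷ []) (0 ∷ 1 ∷ [])
                (closed (join k zy end) ↭-refl) (closed (join k′ zy end) (++⁺ʳ _ p)) (Z-join k (end {R = Adj G})) (Z-join k′ (end {R = Adj G}))
            appended : ∀ {y} zs → y ∉ Λ → y ∉ zs → (∀ {v} → v ∈ Λ → v ∉ zs) → Unique zs → Unique ((Λ ++ y ∷ []) ++ zs ++ [])
            appended {y} zs y∉Λ y∉zs d uz = subst Unique (sym (trans (++-assoc Λ (y ∷ []) (zs ++ [])) (cong (λ ws → Λ ++ y ∷ ws) (++-identityʳ zs))))
              (Uniq.++⁺ uq (Allₚ.¬Any⇒All¬ zs y∉zs ∷ uz) (λ { (i , here refl) → y∉Λ i ; (i , there j) → d i j }))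
            big-end : ∀ {y} → T (Big y) → cnt Big (Λ ++ y ∷ []) ≡ cnt Big Λ + 1
            big-end {y} by = trans (cnt-++ Big Λ (y ∷ [])) (cong (cnt Big Λ +_) (cnt-yes Big [] by))
            small-end : ∀ {y} → T (Big y) → cnt Small (Λ ++ y ∷ []) ≡ cnt Small Λ
            small-end {y} by = trans (cnt-++ Small Λ (y ∷ [])) (trans (cong (cnt Small Λ +_) (cnt-no Small [] (disjoint by))) (+-identityʳ _))
            from-small : T (Small z) → Z (walkEdges Λ ∷ walkEdges Λ′ ∷ [])
            from-small sz = go (to-big (Λ ++ S) sz (≤-trans (≤-reflexive (length-++ Λ)) (lin (length Λ ∷ length S ∷ []) ((x₀ ≲ con 30) ∷ (x₁ ≲ con 2500) ∷ []) (x₀ :+ x₁ ≲ con 5000) |Λ| |S|)))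
              where
              none : ∀ {v} → v ∈ Λ → v ∉ S
              none {v} i j = by (v ≟ z)
                where
                by : Dec (v ≡ z) → ⊥
                by (yes refl) = disjoint (S-Big j) sz
                by (no ne)    = off-S i ne j
              go : (∃ λ y → T (Big y) × Adj G z y × y ∉ Λ ++ S) → Z (walkEdges Λ ∷ walkEdges Λ′ ∷ [])
              go (y , by , zy , y∉) = suffixed {es = M} zy by (appended S (∉-left Λ y∉) (∉-right Λ y∉) none uM) inM (≤-trans (≤-reflexive |M|) (≤-trans t≤ (le 1250 1300)))
                (trans (cong₂ _+_ (trans (big-end by) (cong (_+ 1) (proj₁ (proj₂ (cross-count h)) br sz))) |M|) (trans (assoc (cnt Small Λ) t) (sym (cong (λ j → j + t + 1) (small-end by)))))
                where
                assoc : ∀ s t → s + 1 + t ≡ s + t + 1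
                assoc s t = trans (+-assoc s 1 t) (trans (cong (s +_) (+-comm 1 t)) (sym (+-assoc s t 1)))
            from-S : T (Big z) → z ∈ S → Z (walkEdges Λ ∷ walkEdges Λ′ ∷ [])
            from-S bz i = go (find-partner inM uM i)
              where
              go : Partner Big M z → Z (walkEdges Λ ∷ walkEdges Λ′ ∷ [])
              go (partner {y} {es} zy by ies ((z≢y ∷ z∉) ∷ y∉ ∷ u) sz within) = suffixed {es = es} zy by (appended (ends es) y∉Λ (Allₚ.All¬⇒¬Any y∉) none u) ies
                (≤-trans (≤-trans (n≤1+n _) (≤-reflexive (trans (sym sz) |M|))) (≤-trans t≤ (le 1250 1300)))
                (trans (cong (_+ length es) (trans (big-end by) (cong (_+ 1) (proj₁ (cross-count h) br bz)))) (trans (assoc (cnt Small Λ) (length es) t (trans (sym sz) |M|)) (sym (cong (λ j → j + t + 1) (small-end by)))))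
                where
                assoc : ∀ s l t → suc l ≡ t → s + 1 + 1 + l ≡ s + t + 1
                assoc s l _ refl = ≤-antisym (lin (s ∷ l ∷ []) [] (x₀ :+ con 1 :+ con 1 :+ x₁ ≲ x₀ :+ (con 1 :+ x₁) :+ con 1)) (lin (s ∷ l ∷ []) [] (x₀ :+ (con 1 :+ x₁) :+ con 1 ≲ x₀ :+ con 1 :+ con 1 :+ x₁))
                y∉Λ : y ∉ Λ
                y∉Λ j = off-S j (≢-sym z≢y) (within (here refl))
                none : ∀ {v} → v ∈ Λ → v ∉ ends es
                none {v} j l = by′ (v ≟ z)
                  where
                  by′ : Dec (v ≡ z) → ⊥
                  by′ (yes refl) = All.lookup z∉ l refl
                  by′ (no ne)    = off-S j ne (within (there l))
            decide : T (Big z) ⊎ T (Small z) → Dec (z ∈ S) → Z (walkEdges Λ ∷ walkEdges Λ′ ∷ [])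
            decide (inj₂ sz) _       = from-small sz
            decide (inj₁ bz) (no z∉) = plain bz z∉
            decide (inj₁ bz) (yes i) = from-S bz i

        side : Bool → V → Set
        side false v = T (Big v)
        side true  v = T (Small v)

        side-step : ∀ {b x y} → R x y → side b x → side (not b) y
        side-step {false} (_ , inj₁ (_ , s)) _ = s
        side-step {false} (_ , inj₂ (s , _)) b = ⊥-elim (disjoint b s)
        side-step {true}  (_ , inj₁ (b , _)) s = ⊥-elim (disjoint b s)
        side-step {true}  (_ , inj₂ (_ , b)) _ = b

        bridge : ∀ {b x y} D → side b x → side b y → x ≢ y → length D ≤ 40 + 2500 → Bridge R x y D
        bridge {false} D sx sy ne h = bridge-big D sx sy ne (≤-trans h (le 2540 5000))
        bridge {true}  D sx sy ne h = bridge-small D sx sy ne (≤-trans h (le 2540 5000))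

        Third : V → Set
        Third r = ∀ {a} D → T (Small a) → length D ≤ 5000 → ∃ λ p → ∃ λ q → T (Small p) × T (Big q) × Adj G r p × Adj G p q × Adj G q a × p ∉ D × q ∉ D

        apart : ∀ {b s} → T (Big b) → T (Small s) → b ≢ s
        apart tb ts refl = disjoint tb ts

        module Values (r : V) (br : T (Big r)) (r∉S : r ∉ S) (third₀ : Third r) where

          module At′ = At R R-sym (λ (e , _) → Adj-irr e) side (λ {b} {x} {y} → side-step {b} {x} {y}) S 2500 |S| r r∉S br (λ {b} {x} {y} → bridge {b} {x} {y}) (switch r br)

          third : ∀ {a} D → T (Small a) → length D ≤ 30 → Path₃ R S r a D
          third {a} D sa h = build (third₀ (r ∷ a ∷ D ++ S) sa (≤-trans (s≤s (s≤s (≤-reflexive (length-++ D)))) (lin (length D ∷ length S ∷ []) ((x₀ ≲ con 30) ∷ (x₁ ≲ con 2500) ∷ []) (con 2 :+ (x₀ :+ x₁) ≲ con 5000) h |S|)))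
            where
            build : (∃ λ p → ∃ λ q → T (Small p) × T (Big q) × Adj G r p × Adj G p q × Adj G q a × p ∉ r ∷ a ∷ D ++ S × q ∉ r ∷ a ∷ D ++ S) → Path₃ R S r a D
            build (p , q , sp , bq , rp , pq , qa , p∉ , q∉) = make₃ (rp , inj₁ (br , sp)) (pq , inj₂ (sp , bq)) (qa , inj₁ (bq , sa)) (apart br sa) (Adj-irr pq) p∉ q∉

          third′ : ∀ {a} D → T (Small a) → a ≢ r → length D ≤ 20 → Path₃ R S r a D
          third′ D sa _ h = third D sa (≤-trans h (le 20 30))

          fourth : ∀ {y} D → T (Big y) → y ≢ r → length D ≤ 20 → Path₄ R S r y D
          fourth {y} D by y≢r h = build (to-small (D ++ S) by (≤-trans (≤-reflexive (length-++ D)) (lin (length D ∷ length S ∷ []) ((x₀ ≲ con 20) ∷ (x₁ ≲ con 2500) ∷ []) (x₀ :+ x₁ ≲ con 5000) h |S|)))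
            where
            build : (∃ λ s → T (Small s) × Adj G y s × s ∉ D ++ S) → Path₄ R S r y D
            build (s , ss , ys , s∉) = extend₄ (Adj-sym ys , inj₂ (ss , by)) (≢-sym y≢r) (≢-sym (Adj-irr ys)) s∉ (third (y ∷ D) ss (≤-trans (s≤s h) (le 21 30)))

          abstract
            g : V → E
            g v with T? (Small v) | T? (Big v) | v ≟ r
            ... | yes s | _     | _     = Path₃.value (third {v} [] s z≤n)
            ... | no _  | yes b | no ne = Path₄.value (fourth {v} [] b ne z≤n)
            -- At the root the empty path counts. The case that follows it never occurs, as the two
            -- sides cover all vertices.
            ... | no _  | yes _ | yes _ = zeroV
            ... | no _  | no _  | _     = zeroV

            g-small : ∀ v → T (Small v) → ∃ λ (P : Path₃ R S r v []) → g v ≡ Path₃.value P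
            g-small v s with T? (Small v) | T? (Big v) | v ≟ r
            ... | yes s′ | _ | _ = third [] s′ z≤n , refl
            ... | no ¬s  | _ | _ = contradiction s ¬s

            g-big : ∀ v → T (Big v) → v ≢ r → ∃ λ (P : Path₄ R S r v []) → g v ≡ Path₄.value P
            g-big v b ne with T? (Small v) | T? (Big v) | v ≟ r
            ... | yes s | _      | _      = ⊥-elim (disjoint b s)
            ... | no _  | yes b′ | no ne′ = fourth [] b′ ne′ z≤n , refl
            ... | no _  | yes _  | yes e  = contradiction e ne
            ... | no _  | no ¬b  | _      = contradiction b ¬b

            g-root : g r ≡ zeroV
            g-root with T? (Small r) | T? (Big r) | r ≟ r
            ... | yes s | _     | _     = ⊥-elim (disjoint br s)
            ... | no _  | yes _ | yes _ = refl
            ... | no _  | yes _ | no ne = contradiction refl ne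
            ... | no _  | no ¬b | _     = contradiction br ¬b

          coherence : Coherence g
          coherence {a} {b} sa bb e = by (b ≟ r)
            where
            by : Dec (b ≡ r) → Z (pairInd a b ∷ g a ∷ g b ∷ [])
            by (yes refl) = go (g-small a sa)
              where
              go : (∃ λ (P : Path₃ R S r a []) → g a ≡ Path₃.value P) → Z (pairInd a r ∷ g a ∷ g r ∷ [])
              go (P , e₁) = subst₂ (λ X Y → Z (pairInd a r ∷ X ∷ Y ∷ [])) (sym e₁) (sym g-root)
                (comb (pairInd a r ∷ Path₃.value P ∷ zeroV ∷ pairInd r a ∷ []) ((3 ∷ 1 ∷ []) ∷ (0 ∷ 3 ∷ []) ∷ (2 ∷ []) ∷ []) (0 ∷ 1 ∷ 2 ∷ [])
                  (At′.root-value third′ fourth P sa (Adj-sym e , inj₁ (br , sa))) (Z-sym a r) Z-zero)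
            by (no b≢r) = go (g-small a sa) (g-big b bb b≢r)
              where
              go : (∃ λ (P : Path₃ R S r a []) → g a ≡ Path₃.value P) → (∃ λ (P : Path₄ R S r b []) → g b ≡ Path₄.value P) → Z (pairInd a b ∷ g a ∷ g b ∷ [])
              go (P , e₁) (Q , e₂) = subst₂ (λ X Y → Z (pairInd a b ∷ X ∷ Y ∷ [])) (sym e₁) (sym e₂)
                (At′.edge-value third′ fourth P Q sa bb (≢-sym (apart br sa)) b≢r (e , inj₂ (sa , bb)) (inj₁ (λ i → disjoint (S-Big i) sa)))

      abstract
        potential : ∃ Coherence
        potential = go (root S (≤-trans |S| (le 2500 5000)))
          where
          go : (∃ λ r → T (Big r) × r ∉ S × Third r) → ∃ Coherence
          go (r , br , r∉ , third) = Values.g r br r∉ third , Values.coherence r br r∉ third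

    -- With respect to a coherent potential only the inside edges of a Hamilton cycle contribute.
    module Endgame (g : V → E) (coh : Coherence g) where

      private
        excess-Z : ∀ x y → Z (excess g x y ∷ pairInd x y ∷ g x ∷ g y ∷ [])
        excess-Z x y = comb (excess g x y ∷ pairInd x y ∷ g x ∷ g y ∷ (g x ⊕ g y) ∷ []) ((0 ∷ 1 ∷ 4 ∷ []) ∷ (4 ∷ 2 ∷ 3 ∷ []) ∷ []) (0 ∷ 1 ∷ 2 ∷ 3 ∷ [])
          (Z-⊕ (pairInd x y) (g x ⊕ g y)) (Z-⊕ (g x) (g y))

      -- The edges xy and es outnumber ss by t, which is the surplus that a Hamilton cycle requires.
      -- So there is one with exactly these inside edges, and its other edges have no excess.
      edge-route : ∀ {x y} es ss → Adj G x y → T (Big x) → T (Big y) → Unique (x ∷ y ∷ ends es ++ ends ss) → Inside Big es → Inside Small ss →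
                   length es + 1 ≡ length ss + t → length ss ≤ 10 → Z (excess g x y ∷ total-excess g es ∷ total-excess g ss ∷ [])
      edge-route {x} {y} es ss e bx by uq ies iss len |ss| = use (route es ss (step e end) bx by uq ies iss (le 2 40) |es| (≤-trans |ss| (le 10 1300)) bal)
        where
        |es| : length es ≤ 1300
        |es| = lin (length es ∷ length ss ∷ t ∷ []) ((x₀ :+ con 1 ≲ x₁ :+ x₂) ∷ (x₁ ≲ con 10) ∷ (x₂ ≲ con 1250) ∷ []) (x₀ ≲ con 1300) (≤-reflexive len) |ss| t≤
        bal : cnt Big (x ∷ y ∷ []) + length es + # Small ≡ cnt Small (x ∷ y ∷ []) + length ss + # Big + 1
        bal = trans (cong (λ j → j + length es + # Small) (trans (cnt-yes Big _ bx) (cong suc (cnt-yes Big [] by))))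
          (trans (solve (length es) (length ss) t (# Small) (# Big) len size) (sym (cong (λ j → j + length ss + # Big + 1) (trans (cnt-no Small _ (disjoint bx)) (cnt-no Small [] (disjoint by))))))
          where
          solve : ∀ l s t a b → l + 1 ≡ s + t → b ≡ a + t → 2 + l + a ≡ 0 + s + b + 1
          solve l s t a b e₁ e₂ = ≤-antisym
            (lin (l ∷ s ∷ t ∷ a ∷ b ∷ []) ((x₀ :+ con 1 ≲ x₁ :+ x₂) ∷ (x₃ :+ x₂ ≲ x₄) ∷ []) (con 2 :+ x₀ :+ x₃ ≲ con 0 :+ x₁ :+ x₄ :+ con 1) (≤-reflexive e₁) (≤-reflexive (sym e₂)))
            (lin (l ∷ s ∷ t ∷ a ∷ b ∷ []) ((x₁ :+ x₂ ≲ x₀ :+ con 1) ∷ (x₄ ≲ x₃ :+ x₂) ∷ []) (con 0 :+ x₁ :+ x₄ :+ con 1 ≲ con 2 :+ x₀ :+ x₃) (≤-reflexive (sym e₁)) (≤-reflexive e₂))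
        use : Route Big Small x y (x ∷ y ∷ []) es ss → Z (excess g x y ∷ total-excess g es ∷ total-excess g ss ∷ [])
        use (routeTo r closed cohere) = comb (excess g x y ∷ total-excess g es ∷ total-excess g ss ∷ walkEdges (x ∷ y ∷ []) ∷ r ∷ g x ∷ g y ∷ pairInd x y ∷ zeroV ∷ [])
          ((3 ∷ 4 ∷ []) ∷ (4 ∷ 6 ∷ 5 ∷ 1 ∷ 2 ∷ []) ∷ (3 ∷ 7 ∷ 8 ∷ []) ∷ (8 ∷ []) ∷ (0 ∷ 7 ∷ 5 ∷ 6 ∷ []) ∷ []) (0 ∷ 1 ∷ 2 ∷ [])
          (closed (step e end) ↭-refl) (cohere g coh) (Z-⊕ (pairInd x y) zeroV) Z-zero (excess-Z x y)

      -- For two edges of `Big` that share the vertex y: disjoint edges can be prescribed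
      -- separately, these have to be routed as one path.
      path-route : ∀ {x y z s s′} → Adj G x y → Adj G y z → T (Big x) → T (Big y) → T (Big z) → x ≢ z → Adj G s s′ → T (Small s) → T (Small s′) → t ≡ 1 →
                   Z (excess g x y ∷ excess g y z ∷ excess g s s′ ∷ [])
      path-route {x} {y} {z} {s} {s′} e e′ bx by bz x≢z f ss ss′ t≡1 = use (route [] ((s , s′) ∷ []) (step e (step e′ end)) bx bz uq [] ((f , ss , ss′) ∷ []) (le 3 40) z≤n (le 1 1300) bal)
        where
        apart : ∀ {b s} → T (Big b) → T (Small s) → b ≢ s
        apart tb ts refl = disjoint tb ts
        uq : Unique (x ∷ y ∷ z ∷ s ∷ s′ ∷ [])
        uq = (Adj-irr e ∷ x≢z ∷ apart bx ss ∷ apart bx ss′ ∷ []) ∷ (Adj-irr e′ ∷ apart by ss ∷ apart by ss′ ∷ []) ∷ (apart bz ss ∷ apart bz ss′ ∷ []) ∷ (Adj-irr f ∷ []) ∷ [] ∷ []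
        bal : cnt Big (x ∷ y ∷ z ∷ []) + 0 + # Small ≡ cnt Small (x ∷ y ∷ z ∷ []) + 1 + # Big + 1
        bal = trans (cong (λ j → j + 0 + # Small) (trans (cnt-yes Big _ bx) (cong suc (trans (cnt-yes Big _ by) (cong suc (cnt-yes Big [] bz))))))
          (trans (solve (# Small) (# Big) (trans size (cong (# Small +_) t≡1))) (sym (cong (λ j → j + 1 + # Big + 1) (trans (cnt-no Small _ (disjoint bx)) (trans (cnt-no Small _ (disjoint by)) (cnt-no Small [] (disjoint bz)))))))
          where
          solve : ∀ a b → b ≡ a + 1 → 3 + 0 + a ≡ 0 + 1 + b + 1
          solve a _ refl = ≤-antisym (lin (a ∷ []) [] (con 3 :+ con 0 :+ x₀ ≲ con 0 :+ con 1 :+ (x₀ :+ con 1) :+ con 1)) (lin (a ∷ []) [] (con 0 :+ con 1 :+ (x₀ :+ con 1) :+ con 1 ≲ con 3 :+ con 0 :+ x₀))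
        use : Route Big Small x z (x ∷ y ∷ z ∷ []) [] ((s , s′) ∷ []) → Z (excess g x y ∷ excess g y z ∷ excess g s s′ ∷ [])
        use (routeTo r closed cohere) = comb
          (excess g x y ∷ excess g y z ∷ excess g s s′ ∷ walkEdges (x ∷ y ∷ z ∷ []) ∷ r ∷ g x ∷ g y ∷ g z ∷ pairInd x y ∷ pairInd y z ∷ zeroV ∷ walkEdges (y ∷ z ∷ []) ∷ (excess g s s′ ⊕ zeroV) ∷ [])
          ((3 ∷ 4 ∷ []) ∷ (4 ∷ 7 ∷ 5 ∷ 10 ∷ 12 ∷ []) ∷ (12 ∷ 2 ∷ 10 ∷ []) ∷ (3 ∷ 8 ∷ 11 ∷ []) ∷ (11 ∷ 9 ∷ 10 ∷ []) ∷ (10 ∷ []) ∷ (0 ∷ 8 ∷ 5 ∷ 6 ∷ []) ∷ (1 ∷ 9 ∷ 6 ∷ 7 ∷ []) ∷ []) (0 ∷ 1 ∷ 2 ∷ [])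
          (closed (step e (step e′ end)) ↭-refl) (cohere g coh) (Z-⊕ (excess g s s′) zeroV) (Z-⊕ (pairInd x y) (walkEdges (y ∷ z ∷ []))) (Z-⊕ (pairInd y z) zeroV) Z-zero (excess-Z x y) (excess-Z y z)

      all-zero⇒coboundary : (∀ {x y} → Adj G x y → T (Big x) → T (Big y) → Z (excess g x y ∷ [])) →
                            (∀ {x y} → Adj G x y → T (Small x) → T (Small y) → Z (excess g x y ∷ [])) → Coboundary g
      all-zero⇒coboundary bigs smalls {x} {y} e = go (cover x) (cover y)
        where
        plain : Z (excess g x y ∷ []) → Z (pairInd x y ∷ g x ∷ g y ∷ [])
        plain z = comb (pairInd x y ∷ g x ∷ g y ∷ excess g x y ∷ []) ((3 ∷ []) ∷ (3 ∷ 0 ∷ 1 ∷ 2 ∷ []) ∷ []) (0 ∷ 1 ∷ 2 ∷ []) z (excess-Z x y)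
        go : T (Big x) ⊎ T (Small x) → T (Big y) ⊎ T (Small y) → Z (pairInd x y ∷ g x ∷ g y ∷ [])
        go (inj₁ b) (inj₁ b′) = plain (bigs e b b′)
        go (inj₂ s) (inj₂ s′) = plain (smalls e s s′)
        go (inj₂ s) (inj₁ b)  = coh s b e
        go (inj₁ b) (inj₂ s)  = comb (pairInd x y ∷ g x ∷ g y ∷ pairInd y x ∷ []) ((3 ∷ 2 ∷ 1 ∷ []) ∷ (0 ∷ 3 ∷ []) ∷ []) (0 ∷ 1 ∷ 2 ∷ []) (coh s b (Adj-sym e)) (Z-sym x y)

-- Vanishing of the excesses.

module Endgames {n : ℕ} (G : Graph n) (3≤n : 3 ≤ n) where

  open Space G
  open Rooted G using (∉-cons)
  open Denseness G
  open Absorption G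
  open Expanding G using (rep-even)
  open Bipartite G
  open TwoSided G 3≤n
  open Imbalance G 3≤n

  private
    V = Fin n
    E = EdgeVec n

  data TwoEdges (P : V → Bool) : Set where
    adjacent : ∀ {x y z} → Adj G x y → Adj G y z → T (P x) → T (P y) → T (P z) → x ≢ z → TwoEdges P
    separate : ∀ {x y u w} → Adj G x y → Adj G u w → T (P x) → T (P y) → T (P u) → T (P w) → Unique (x ∷ y ∷ u ∷ w ∷ []) → TwoEdges P

  module _ {Big Small : V → Bool} (sd : Sided Big Small) where

    open Sided sd

    private
      bit : V → ℕ
      bit v = if Big v then 1 else 0

      -- An outcome for a walk from x whose last vertex is in Small: the number of Big–Big steps it makes bounds its excess of Big vertices.
      data Found (x : V) (xs : List V) : Set where
        no-edge  : cnt Big xs + 1 ≤ cnt Small xs + bit x → Found x xs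
        one-edge : ∀ {y y′} → y ∈ xs → y′ ∈ xs → y′ ≢ x → Adj G y y′ → T (Big y) → T (Big y′) → cnt Big xs ≤ cnt Small xs + bit x → Found x xs
        found    : TwoEdges Big → Found x xs

      bit-big : ∀ {x} → T (Big x) → bit x ≡ 1
      bit-big {x} t with Big x
      ... | true = refl

      bit-small : ∀ {x} → T (Small x) → bit x ≡ 0
      bit-small {x} s with Big x in e
      ... | true  = ⊥-elim (disjoint (subst T (sym e) tt) s)
      ... | false = refl

      bit≤1 : ∀ x → bit x ≤ 1
      bit≤1 x with Big x
      ... | true  = le 1 1
      ... | false = z≤n

      search : ∀ {x z xs} → Walk (Adj G) x z xs → Unique xs → T (Small z) → Found x xs
      search {x} end _ sz = no-edge (≤-trans (≤-reflexive (trans (cong (_+ 1) (cnt-no Big [] (λ b → disjoint b sz))) (sym (cnt-yes Small [] sz)))) (m≤m+n _ _))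
      search {x} (step {y = w} {xs = xs} e h) (x∉ ∷ u) sz = go (cover x) (cover w) (search h u sz)
        where
        cB = cnt Big xs
        cS = cnt Small xs
        both : ∀ {y y′} → T (Big x) → T (Big w) → y ∈ xs → y′ ∈ xs → y′ ≢ w → Adj G y y′ → T (Big y) → T (Big y′) → Dec (y ≡ w) → TwoEdges Big
        both bx bw i j ne e′ by by′ (yes refl) = adjacent e e′ bx bw by′ (All.lookup x∉ j)
        both bx bw i j ne e′ by by′ (no ne′)   = separate e e′ bx bw by by′
          ((Adj-irr e ∷ All.lookup x∉ i ∷ All.lookup x∉ j ∷ []) ∷ (≢-sym ne′ ∷ ≢-sym ne ∷ []) ∷ (Adj-irr e′ ∷ []) ∷ [] ∷ [])
        smallB : T (Small x) → cnt Big (x ∷ xs) ≡ cB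
        smallB s = cnt-no Big xs (λ b → disjoint b s)
        smallS : T (Small x) → cnt Small (x ∷ xs) ≡ suc cS
        smallS s = cnt-yes Small xs s
        bigB : T (Big x) → cnt Big (x ∷ xs) ≡ suc cB
        bigB b = cnt-yes Big xs b
        bigS : T (Big x) → cnt Small (x ∷ xs) ≡ cS
        bigS b = cnt-no Small xs (disjoint b)
        go : T (Big x) ⊎ T (Small x) → T (Big w) ⊎ T (Small w) → Found w xs → Found x (x ∷ xs)
        go _ _ (found t) = found t
        go (inj₂ sx) _ (no-edge h′) = no-edge (subst₂ _≤_ (cong (_+ 1) (sym (smallB sx))) (cong (_+ bit x) (sym (smallS sx)))
          (lin (cB ∷ cS ∷ bit w ∷ bit x ∷ []) ((x₀ :+ con 1 ≲ x₁ :+ x₂) ∷ (x₂ ≲ con 1) ∷ []) (x₀ :+ con 1 ≲ (con 1 :+ x₁) :+ x₃) h′ (bit≤1 w)))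
        go (inj₂ sx) _ (one-edge i j ne e′ by by′ h′) = one-edge (there i) (there j) (λ { refl → All.lookup x∉ j refl }) e′ by by′
          (subst₂ _≤_ (sym (smallB sx)) (cong (_+ bit x) (sym (smallS sx)))
            (lin (cB ∷ cS ∷ bit w ∷ bit x ∷ []) ((x₀ ≲ x₁ :+ x₂) ∷ (x₂ ≲ con 1) ∷ []) (x₀ ≲ (con 1 :+ x₁) :+ x₃) h′ (bit≤1 w)))
        go (inj₁ bx) (inj₂ sw) (no-edge h′) = no-edge (subst₂ _≤_ (cong (_+ 1) (sym (bigB bx))) (cong₂ _+_ (sym (bigS bx)) (sym (bit-big bx)))
          (lin (cB ∷ cS ∷ bit w ∷ []) ((x₀ :+ con 1 ≲ x₁ :+ x₂) ∷ (x₂ ≲ con 0) ∷ []) ((con 1 :+ x₀) :+ con 1 ≲ x₁ :+ con 1) h′ (≤-reflexive (bit-small sw))))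
        go (inj₁ bx) (inj₂ sw) (one-edge i j ne e′ by by′ h′) = one-edge (there i) (there j) (λ { refl → All.lookup x∉ j refl }) e′ by by′
          (subst₂ _≤_ (sym (bigB bx)) (cong₂ _+_ (sym (bigS bx)) (sym (bit-big bx)))
            (lin (cB ∷ cS ∷ bit w ∷ []) ((x₀ ≲ x₁ :+ x₂) ∷ (x₂ ≲ con 0) ∷ []) (con 1 :+ x₀ ≲ x₁ :+ con 1) h′ (≤-reflexive (bit-small sw))))
        go (inj₁ bx) (inj₁ bw) (no-edge h′) = one-edge (here refl) (there (start-∈ h)) (≢-sym (Adj-irr e)) e bx bw
          (subst₂ _≤_ (sym (bigB bx)) (cong₂ _+_ (sym (bigS bx)) (sym (bit-big bx)))
            (lin (cB ∷ cS ∷ bit w ∷ []) ((x₀ :+ con 1 ≲ x₁ :+ x₂) ∷ (x₂ ≲ con 1) ∷ []) (con 1 :+ x₀ ≲ x₁ :+ con 1) h′ (bit≤1 w)))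
        go (inj₁ bx) (inj₁ bw) (one-edge {y} i j ne e′ by by′ h′) = found (both bx bw i j ne e′ by by′ (y ≟ w))

    abstract
      -- A Hamilton path between two vertices of `Small` with at most one step inside `Big` would
      -- contain no more vertices of `Big` than of `Small`.
      two-edges : ∀ {s s′} → HamPathIn Full [] s s′ → T (Small s) → T (Small s′) → # Big ≡ # Small + 1 → TwoEdges Big
      two-edges {s} {s′} (hamPathIn {xs} h uq _ complete) ss ss′ size = go (search h uq ss′)
        where
        exact : ∀ p → cnt p xs ≡ # p
        exact p = ≤-antisym (≤-trans (cnt-≤ {q = Full} {p = p} uq (All.tabulate (λ _ → tt))) (#-mono {p = p ∩ Full} {q = p} (λ x t → proj₁ (∧-T {p x} t))))
          (≤-trans (#-mono {p = p} {q = p ∩ ⟨ xs ⟩} (λ x t → ∧-intro t (∈⟨⟩ (complete tt (λ ()))))) (#-≤-cnt p xs))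
        clash : cnt Big xs ≤ cnt Small xs + bit s → ⊥
        clash h′ = 1+n≰n (lin (# Big ∷ # Small ∷ bit s ∷ cnt Big xs ∷ cnt Small xs ∷ []) ((x₃ ≲ x₄ :+ x₂) ∷ (x₂ ≲ con 0) ∷ (x₀ ≲ x₃) ∷ (x₄ ≲ x₁) ∷ (x₁ :+ con 1 ≲ x₀) ∷ []) (con 1 :+ x₁ ≲ x₁)
          h′ (≤-reflexive (bit-small ss)) (≤-reflexive (sym (exact Big))) (≤-reflexive (exact Small)) (≤-reflexive (sym size)))
        go : Found s xs → TwoEdges Big
        go (found t) = t
        go (no-edge h′) = ⊥-elim (clash (≤-trans (m≤m+n _ 1) h′))
        go (one-edge _ _ _ _ _ _ h′) = ⊥-elim (clash h′)

      -- When the sides differ by one, a single edge inside `Big` can be the only inside edge of a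
      -- Hamilton cycle, so it has no excess. An edge inside `Small` must be offset by two edges
      -- inside `Big`, whether these are adjacent or not.
      generated-by-one : # Big ≡ # Small + 1 → TwoEdges Big → HamiltonGenerated G
      generated-by-one size two = finish two (potential sd 1 size (le 1 1250) (M two) (inM two) (uM two) (lenM two))
        where
        M : TwoEdges Big → Edges
        M (adjacent {x} {y} _ _ _ _ _ _)     = (x , y) ∷ []
        M (separate {x} {y} _ _ _ _ _ _ _) = (x , y) ∷ []
        inM : ∀ t → Inside Big (M t)
        inM (adjacent e _ bx by _ _)     = (e , bx , by) ∷ []
        inM (separate e _ bx by _ _ _) = (e , bx , by) ∷ []
        uM : ∀ t → Unique (ends (M t))
        uM (adjacent e _ _ _ _ _)     = (Adj-irr e ∷ []) ∷ [] ∷ []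
        uM (separate e _ _ _ _ _ _) = (Adj-irr e ∷ []) ∷ [] ∷ []
        lenM : ∀ t → length (M t) ≡ 1
        lenM (adjacent _ _ _ _ _ _)     = refl
        lenM (separate _ _ _ _ _ _ _) = refl
        finish : TwoEdges Big → ∃ (Coherence sd 1 size (le 1 1250)) → HamiltonGenerated G
        finish two (g , coh) = coboundary⇒generated g (all-zero⇒coboundary bigs (smalls two))
          where
          open Endgame sd 1 size (le 1 1250) g coh
          bigs : ∀ {x y} → Adj G x y → T (Big x) → T (Big y) → Z (excess g x y ∷ [])
          bigs {x} {y} e bx by = comb (excess g x y ∷ zeroV ∷ []) ((0 ∷ 1 ∷ 1 ∷ []) ∷ []) (0 ∷ [])
            (edge-route [] [] e bx by ((Adj-irr e ∷ []) ∷ [] ∷ []) [] [] refl z≤n)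
          apart : ∀ {b s} → T (Big b) → T (Small s) → b ≢ s
          apart tb ts refl = disjoint tb ts
          smalls : TwoEdges Big → ∀ {s s′} → Adj G s s′ → T (Small s) → T (Small s′) → Z (excess g s s′ ∷ [])
          smalls (adjacent {x} {y} {z} e e′ bx by bz ne) {s} {s′} f ss ss′ = comb (excess g x y ∷ excess g y z ∷ excess g s s′ ∷ []) ((0 ∷ 1 ∷ 2 ∷ []) ∷ (0 ∷ []) ∷ (1 ∷ []) ∷ []) (2 ∷ [])
            (path-route e e′ bx by bz ne f ss ss′ refl) (bigs e bx by) (bigs e′ by bz)
          smalls (separate {x} {y} {u} {w} e e′ bx by bu bw ((xy ∷ xu ∷ xw ∷ []) ∷ (yu ∷ yw ∷ []) ∷ (uw ∷ []) ∷ _)) {s} {s′} f ss ss′ = comb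
            (excess g x y ∷ excess g u w ∷ excess g s s′ ∷ (excess g u w ⊕ zeroV) ∷ (excess g s s′ ⊕ zeroV) ∷ zeroV ∷ [])
            ((0 ∷ 3 ∷ 4 ∷ []) ∷ (3 ∷ 1 ∷ 5 ∷ []) ∷ (4 ∷ 2 ∷ 5 ∷ []) ∷ (0 ∷ []) ∷ (1 ∷ []) ∷ []) (2 ∷ [])
            (edge-route ((u , w) ∷ []) ((s , s′) ∷ []) e bx by
              ((xy ∷ xu ∷ xw ∷ apart bx ss ∷ apart bx ss′ ∷ []) ∷ (yu ∷ yw ∷ apart by ss ∷ apart by ss′ ∷ []) ∷ (uw ∷ apart bu ss ∷ apart bu ss′ ∷ [])
                ∷ (apart bw ss ∷ apart bw ss′ ∷ []) ∷ (Adj-irr f ∷ []) ∷ [] ∷ [])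
              ((e′ , bu , bw) ∷ []) ((f , ss , ss′) ∷ []) refl (le 1 10))
            (Z-⊕ (excess g u w) zeroV) (Z-⊕ (excess g s s′) zeroV) (bigs e bx by) (bigs e′ bu bw)

    module _ (t : ℕ) (size : # Big ≡ # Small + t) (t≤ : t ≤ 1250) (x₁′ y₁ x₂′ y₂ : V) (N : Edges) (i : ℕ) (|N| : length N ≡ i + i) (t≡ : t ≡ length N + 1)
      (inM : Inside Big ((x₁′ , y₁) ∷ (x₂′ , y₂) ∷ N)) (uM : Unique (ends ((x₁′ , y₁) ∷ (x₂′ , y₂) ∷ N))) where

      private
        M⁺ : Edges
        M⁺ = (x₁′ , y₁) ∷ (x₂′ , y₂) ∷ N

        tails : Unique (ends M⁺) → Unique (x₂′ ∷ y₂ ∷ ends N)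
        tails (_ ∷ _ ∷ u) = u

        tail-in : ∀ {e es} → Inside Big (e ∷ es) → Inside Big es
        tail-in (_ ∷ is) = is

        module Final (g : V → E) (coh : Coherence sd t size t≤ g) where

          open Endgame sd t size t≤ g coh

          e₁ e₂ TN : E
          e₁ = excess g x₁′ y₁
          e₂ = excess g x₂′ y₂
          TN = total-excess g N

          one : ∀ {x y} es → Adj G x y → T (Big x) → T (Big y) → Unique (x ∷ y ∷ ends es) → Inside Big es → length es ≡ length N → Z (excess g x y ∷ total-excess g es ∷ [])
          one {x} {y} es e bx by u is len = comb (excess g x y ∷ total-excess g es ∷ zeroV ∷ []) ((0 ∷ 1 ∷ 2 ∷ []) ∷ (2 ∷ []) ∷ []) (0 ∷ 1 ∷ [])
            (edge-route es [] e bx by (subst (λ zs → Unique (x ∷ y ∷ zs)) (sym (++-identityʳ (ends es))) u) is [] (trans (cong (_+ 1) len) (sym t≡)) z≤n) Z-zero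

          hd : ∀ {x y es} → Inside Big ((x , y) ∷ es) → Adj G x y × T (Big x) × T (Big y)
          hd (p ∷ _) = p

          total-++ : ∀ es fs → Z (total-excess g (es ++ fs) ∷ total-excess g es ∷ total-excess g fs ∷ [])
          total-++ []             fs = comb (total-excess g fs ∷ zeroV ∷ []) ((1 ∷ []) ∷ []) (0 ∷ 1 ∷ 0 ∷ []) Z-zero
          total-++ ((x , y) ∷ es) fs = comb
            (total-excess g ((x , y) ∷ es ++ fs) ∷ total-excess g ((x , y) ∷ es) ∷ total-excess g fs ∷ excess g x y ∷ total-excess g (es ++ fs) ∷ total-excess g es ∷ [])
            ((0 ∷ 3 ∷ 4 ∷ []) ∷ (1 ∷ 3 ∷ 5 ∷ []) ∷ (4 ∷ 5 ∷ 2 ∷ []) ∷ []) (0 ∷ 1 ∷ 2 ∷ [])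
            (Z-⊕ (excess g x y) (total-excess g (es ++ fs))) (Z-⊕ (excess g x y) (total-excess g es)) (total-++ es fs)

          skip : ∀ {a b : V} (xs : List V) {ys} → Unique (xs ++ a ∷ b ∷ ys) → Unique (xs ++ ys)
          skip []       (_ ∷ _ ∷ u) = u
          skip (x ∷ xs) (p ∷ u) = Allₚ.++⁺ (Allₚ.++⁻ˡ xs p) (drop₂ (Allₚ.++⁻ʳ xs p)) ∷ skip xs u
            where
            drop₂ : ∀ {P : V → Set} {a b ys} → All P (a ∷ b ∷ ys) → All P ys
            drop₂ (_ ∷ _ ∷ ps) = ps

          e₂-N : Z (e₂ ∷ TN ∷ [])
          e₂-N = let (e , b , b′) = hd (tail-in inM) in one N e b b′ (tails uM) (tail-in (tail-in inM)) refl

          e₁-N : Z (e₁ ∷ TN ∷ [])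
          e₁-N = let (e , b , b′) = hd inM in one N e b b′ (skip (x₁′ ∷ y₁ ∷ []) uM) (tail-in (tail-in inM)) refl

          -- Two admissible sets of t edges are compared: N with the second edge, and the first two
          -- edges with N without xy. They differ only in xy and the first edge.
          each : ∀ {x y} → (x , y) ∈ N → Z (excess g x y ∷ e₁ ∷ [])
          each {x} {y} k = go (∈-∃++ k)
            where
            go : (∃ λ N₁ → ∃ λ N₂ → N ≡ N₁ ++ (x , y) ∷ N₂) → Z (excess g x y ∷ e₁ ∷ [])
            go (N₁ , N₂ , eq) = comb (excess g x y ∷ e₁ ∷ e₂ ∷ TN ∷ total-excess g N₁ ∷ total-excess g ((x , y) ∷ N₂) ∷ total-excess g N₂ ∷ total-excess g ((x₂′ , y₂) ∷ N₁ ++ N₂) ∷ total-excess g (N₁ ++ N₂) ∷ [])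
              ((2 ∷ 3 ∷ []) ∷ (3 ∷ 4 ∷ 5 ∷ []) ∷ (5 ∷ 0 ∷ 6 ∷ []) ∷ (1 ∷ 7 ∷ []) ∷ (7 ∷ 2 ∷ 8 ∷ []) ∷ (8 ∷ 4 ∷ 6 ∷ []) ∷ []) (0 ∷ 1 ∷ [])
              e₂-N (subst (λ es → Z (total-excess g es ∷ total-excess g N₁ ∷ total-excess g ((x , y) ∷ N₂) ∷ [])) (sym eq) (total-++ N₁ ((x , y) ∷ N₂)))
              (Z-⊕ (excess g x y) (total-excess g N₂))
              (let (e , b , b′) = hd inM in one ((x₂′ , y₂) ∷ N₁ ++ N₂) e b b′ u is len)
              (Z-⊕ e₂ (total-excess g (N₁ ++ N₂))) (total-++ N₁ N₂)
              where
              u : Unique (x₁′ ∷ y₁ ∷ x₂′ ∷ y₂ ∷ ends (N₁ ++ N₂))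
              u = subst (λ zs → Unique (x₁′ ∷ y₁ ∷ x₂′ ∷ y₂ ∷ zs)) (sym (ends-++ N₁ N₂)) (skip (x₁′ ∷ y₁ ∷ x₂′ ∷ y₂ ∷ ends N₁)
                (subst (λ zs → Unique (x₁′ ∷ y₁ ∷ x₂′ ∷ y₂ ∷ zs)) (trans (cong ends eq) (ends-++ N₁ ((x , y) ∷ N₂))) uM))
              split-in : ∀ {es fs} → Inside Big (es ++ (x , y) ∷ fs) → Inside Big (es ++ fs)
              split-in {es} is = Allₚ.++⁺ (Allₚ.++⁻ˡ es is) (tail-in (Allₚ.++⁻ʳ es is))
              is : Inside Big ((x₂′ , y₂) ∷ N₁ ++ N₂)
              is = hd (tail-in inM) ∷ split-in {N₁} (subst (Inside Big) eq (tail-in (tail-in inM)))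
              len : suc (length (N₁ ++ N₂)) ≡ length N
              len = trans (cong suc (length-++ N₁)) (trans (sym (+-suc (length N₁) (length N₂))) (trans (sym (length-++ N₁)) (cong length (sym eq))))

          repeated : ∀ es → (∀ {x y} → (x , y) ∈ es → Z (excess g x y ∷ e₁ ∷ [])) → Z (total-excess g es ∷ rep (length es) e₁ ∷ [])
          repeated []             f = comb (zeroV ∷ []) [] (0 ∷ 0 ∷ [])
          repeated ((x , y) ∷ es) f = comb (total-excess g ((x , y) ∷ es) ∷ rep (suc (length es)) e₁ ∷ excess g x y ∷ total-excess g es ∷ e₁ ∷ rep (length es) e₁ ∷ [])
            ((0 ∷ 2 ∷ 3 ∷ []) ∷ (1 ∷ 4 ∷ 5 ∷ []) ∷ (2 ∷ 4 ∷ []) ∷ (3 ∷ 5 ∷ []) ∷ []) (0 ∷ 1 ∷ [])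
            (Z-⊕ (excess g x y) (total-excess g es)) (Z-⊕ e₁ (rep (length es) e₁)) (f (here refl)) (repeated es (f ∘ there))

          TN-zero : Z (TN ∷ [])
          TN-zero = comb (TN ∷ rep (length N) e₁ ∷ []) ((0 ∷ 1 ∷ []) ∷ (1 ∷ []) ∷ []) (0 ∷ []) (repeated N each) (subst (λ l → Z (rep l e₁ ∷ [])) (sym |N|) (rep-even i e₁))

          e₁-zero : Z (e₁ ∷ [])
          e₁-zero = comb (e₁ ∷ TN ∷ []) ((0 ∷ 1 ∷ []) ∷ (1 ∷ []) ∷ []) (0 ∷ []) e₁-N TN-zero

          e₂-zero : Z (e₂ ∷ [])
          e₂-zero = comb (e₂ ∷ TN ∷ []) ((0 ∷ 1 ∷ []) ∷ (1 ∷ []) ∷ []) (0 ∷ []) e₂-N TN-zero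

          zero-M : All (λ (x , y) → Z (excess g x y ∷ [])) M⁺
          zero-M = e₁-zero ∷ e₂-zero ∷ All.tabulate (λ { {x , y} k → comb (excess g x y ∷ e₁ ∷ []) ((0 ∷ 1 ∷ []) ∷ (1 ∷ []) ∷ []) (0 ∷ []) (each k) e₁-zero })

          record Part (es : Edges) : Set where
            constructor part
            field
              inside : Inside Big es
              unique : Unique (ends es)
              zeros  : All (λ (x , y) → Z (excess g x y ∷ [])) es

          drop-vertex : ∀ v es → Part es → ∃ λ es′ → Part es′ × length es ≤ 1 + length es′ × v ∉ ends es′ × (∀ {u} → u ∈ ends es′ → u ∈ ends es)
          drop-vertex v [] p = [] , p , z≤n , (λ ()) , id
          drop-vertex v ((a , b) ∷ es) (part (p ∷ ps) ((a≢b ∷ a∉) ∷ b∉ ∷ u) (z ∷ zs)) = by (v ≟ a) (v ≟ b) (drop-vertex v es (part ps u zs))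
            where
            by : Dec (v ≡ a) → Dec (v ≡ b) → (∃ λ es′ → Part es′ × length es ≤ 1 + length es′ × v ∉ ends es′ × (∀ {u} → u ∈ ends es′ → u ∈ ends es)) →
                 ∃ λ es′ → Part es′ × suc (length es) ≤ 1 + length es′ × v ∉ ends es′ × (∀ {u} → u ∈ ends es′ → u ∈ a ∷ b ∷ ends es)
            by (yes refl) _ _ = es , part ps u zs , ≤-refl , Allₚ.All¬⇒¬Any a∉ , there ∘ there
            by (no _) (yes refl) _ = es , part ps u zs , ≤-refl , Allₚ.All¬⇒¬Any b∉ , there ∘ there
            by (no n₁) (no n₂) (es′ , part ps′ u′ zs′ , l , v∉ , sub) = (a , b) ∷ es′ ,
              part (p ∷ ps′) ((a≢b ∷ All.tabulate (λ k → All.lookup a∉ (sub k))) ∷ All.tabulate (λ k → All.lookup b∉ (sub k)) ∷ u′) (z ∷ zs′) , s≤s l , ∉-cons n₁ (∉-cons n₂ v∉) ,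
              λ { (here e) → here e ; (there (here e)) → there (here e) ; (there (there k)) → there (there (sub k)) }

          shorten : ∀ l es → l ≤ length es → Part es → ∃ λ es′ → Part es′ × length es′ ≡ l × (∀ {u} → u ∈ ends es′ → u ∈ ends es)
          shorten zero    es h p = [] , part [] [] [] , refl , λ ()
          shorten (suc l) ((a , b) ∷ es) (s≤s h) (part (p ∷ ps) ((a≢b ∷ a∉) ∷ b∉ ∷ u) (z ∷ zs)) = go (shorten l es h (part ps u zs))
            where
            go : (∃ λ es′ → Part es′ × length es′ ≡ l × (∀ {u} → u ∈ ends es′ → u ∈ ends es)) → ∃ λ es′ → Part es′ × length es′ ≡ suc l × (∀ {u} → u ∈ ends es′ → u ∈ a ∷ b ∷ ends es)
            go (es′ , part ps′ u′ zs′ , e , sub) = (a , b) ∷ es′ , part (p ∷ ps′) ((a≢b ∷ All.tabulate (λ k → All.lookup a∉ (sub k))) ∷ All.tabulate (λ k → All.lookup b∉ (sub k)) ∷ u′) (z ∷ zs′) , cong suc e ,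
              λ { (here e) → here e ; (there (here e)) → there (here e) ; (there (there k)) → there (there (sub k)) }

          zero-total : ∀ es → All (λ (x , y) → Z (excess g x y ∷ [])) es → Z (total-excess g es ∷ [])
          zero-total []             []       = Z-zero
          zero-total ((x , y) ∷ es) (z ∷ zs) = comb (total-excess g ((x , y) ∷ es) ∷ excess g x y ∷ total-excess g es ∷ []) ((0 ∷ 1 ∷ 2 ∷ []) ∷ (1 ∷ []) ∷ (2 ∷ []) ∷ []) (0 ∷ [])
            (Z-⊕ (excess g x y) (total-excess g es)) z (zero-total es zs)

          bigs : ∀ {x y} → Adj G x y → T (Big x) → T (Big y) → Z (excess g x y ∷ [])
          bigs {x} {y} e bx by = go₁ (drop-vertex x M⁺ (part inM uM zero-M))
            where
            go₁ : (∃ λ es′ → Part es′ × length M⁺ ≤ 1 + length es′ × x ∉ ends es′ × (∀ {u} → u ∈ ends es′ → u ∈ ends M⁺)) → Z (excess g x y ∷ [])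
            go₁ (es , p , l , x∉ , _) = go₂ (drop-vertex y es p)
              where
              go₂ : (∃ λ es′ → Part es′ × length es ≤ 1 + length es′ × y ∉ ends es′ × (∀ {u} → u ∈ ends es′ → u ∈ ends es)) → Z (excess g x y ∷ [])
              go₂ (es₂ , p₂ , l₂ , y∉ , sub₂) = go₃ (shorten (length N) es₂ (lin (length N ∷ length es ∷ length es₂ ∷ []) ((con 2 :+ x₀ ≲ con 1 :+ x₁) ∷ (x₁ ≲ con 1 :+ x₂) ∷ []) (x₀ ≲ x₂) l l₂) p₂)
                where
                go₃ : (∃ λ es′ → Part es′ × length es′ ≡ length N × (∀ {u} → u ∈ ends es′ → u ∈ ends es₂)) → Z (excess g x y ∷ [])
                go₃ (es₃ , part is u zs , len , sub₃) = comb (excess g x y ∷ total-excess g es₃ ∷ []) ((0 ∷ 1 ∷ []) ∷ (1 ∷ []) ∷ []) (0 ∷ [])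
                  (one es₃ e bx by ((Adj-irr e ∷ Allₚ.¬Any⇒All¬ _ (λ k → x∉ (sub₂ (sub₃ k)))) ∷ Allₚ.¬Any⇒All¬ _ (λ k → y∉ (sub₃ k)) ∷ u) is len) (zero-total es₃ zs)

          -- An edge inside `Small` is offset by using all t + 1 matching edges.
          smalls : ∀ {s s′} → Adj G s s′ → T (Small s) → T (Small s′) → Z (excess g s s′ ∷ [])
          smalls {s} {s′} f ss ss′ = comb (excess g s s′ ∷ e₁ ∷ total-excess g ((x₂′ , y₂) ∷ N) ∷ (excess g s s′ ⊕ zeroV) ∷ zeroV ∷ [])
            ((1 ∷ 2 ∷ 3 ∷ []) ∷ (1 ∷ []) ∷ (2 ∷ []) ∷ (3 ∷ 0 ∷ 4 ∷ []) ∷ (4 ∷ []) ∷ []) (0 ∷ [])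
            (let (e , b , b′) = hd inM in edge-route ((x₂′ , y₂) ∷ N) ((s , s′) ∷ []) e b b′ uq (tail-in inM) ((f , ss , ss′) ∷ []) (trans (cong suc (sym t≡)) refl) (le 1 10))
            e₁-zero (zero-total ((x₂′ , y₂) ∷ N) (tl zero-M)) (Z-⊕ (excess g s s′) zeroV) Z-zero
            where
            tl : ∀ {e es} {P : V × V → Set} → All P (e ∷ es) → All P es
            tl (_ ∷ ps) = ps
            uq : Unique (ends M⁺ ++ s ∷ s′ ∷ [])
            uq = Uniq.++⁺ uM ((Adj-irr f ∷ []) ∷ [] ∷ []) λ { (k , here refl) → disjoint (All.lookup (ends-All inM) k) ss ; (k , there (here refl)) → disjoint (All.lookup (ends-All inM) k) ss′ }

      abstract
        -- Any t of the t + 1 matching edges can be the inside edges of a Hamilton cycle. So all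
        -- have the same excess, and t copies of it vanish with t odd. Any other edge inside `Big`
        -- meets at most two matching edges, and t - 1 of the remaining ones complete it.
        generated-by-matching : HamiltonGenerated G
        generated-by-matching = finish (potential sd t size t≤ ((x₂′ , y₂) ∷ N) (tail-in inM) (tails uM) (trans (+-comm 1 (length N)) (sym t≡)))
          where
          finish : ∃ (Coherence sd t size t≤) → HamiltonGenerated G
          finish (g , coh) = coboundary⇒generated g (Endgame.all-zero⇒coboundary sd t size t≤ g coh (Final.bigs g coh) (Final.smalls g coh))

-- A large independent set and the balancing of the sides.

module Balancing {n : ℕ} (G : Graph n) (3≤n : 3 ≤ n) where

  open Denseness G
  open Absorption G
  open Expanding G using (ham-path-in)
  open Bipartite G
  open TwoSided G 3≤n
  open Endgames G 3≤n

  private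
    V = Fin n

  ∁ : (V → Bool) → V → Bool
  ∁ P x = not (P x)

  heavy : ℕ → (V → Bool) → V → Bool
  heavy c P x = c ≤ᵇ # (adj G x ∩ P)

  abstract
    #-∁ : ∀ P → # P + # (∁ P) ≡ n
    #-∁ P = trans (sym (#-split Full P)) #-Full

    heavy-≥ : ∀ c P {x} → T (heavy c P x) → c ≤ # (adj G x ∩ P)
    heavy-≥ c P {x} = ≤ᵇ⇒≤ c (# (adj G x ∩ P))

    light-≤ : ∀ c P {x} → ¬ T (heavy c P x) → # (adj G x ∩ P) ≤ c
    light-≤ c P {x} l = ≰⇒≥ (l ∘ ≤⇒≤ᵇ)

    find? : ∀ (P : V → Bool) → (∃ λ x → T (P x)) ⊎ (∀ x → ¬ T (P x))
    find? P with 1 ≤? # P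
    ... | yes h = inj₁ (#-find h)
    ... | no ¬h = inj₂ λ x t → ¬h (#-pos P t)

    -- Together the vertices of L reach at most c · l elements of P.
    unreached : ∀ P L c l → All (λ x → # (adj G x ∩ P) ≤ c) L → length L ≤ l → c * l < # P → ∃ λ i → T (P i) × All (λ x → ¬ Adj G x i) L
    unreached P []      c l       _        _         h = let (i , t) = #-find (≤-trans (s≤s z≤n) h) in i , t , []
    unreached P (x ∷ L) c (suc l) (p ∷ ps) (s≤s len) h =
      conv (unreached (P ∖ adj G x) L c l (All.map (λ {y} → ≤-trans (shrink y)) ps) len room)
      where
      shrink : ∀ y → # (adj G y ∩ (P ∖ adj G x)) ≤ # (adj G y ∩ P)
      shrink y = #-mono {p = adj G y ∩ (P ∖ adj G x)} {q = adj G y ∩ P} λ v t → let (a , b) = ∧-T {adj G y v} t in ∧-intro a (proj₁ (∧-T {P v} b))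
      room : c * l < # (P ∖ adj G x)
      room = lin (c ∷ c * l ∷ # P ∷ # (P ∩ adj G x) ∷ # (P ∖ adj G x) ∷ # (adj G x ∩ P) ∷ [])
        ((con 1 :+ (x₀ :+ x₁) ≲ x₂) ∷ (x₂ ≲ x₃ :+ x₄) ∷ (x₃ ≲ x₅) ∷ (x₅ ≲ x₀) ∷ []) (con 1 :+ x₁ ≲ x₄)
        (subst (_< # P) (*-suc c l) h) (≤-reflexive (#-split P (adj G x)))
        (#-mono {p = P ∩ adj G x} {q = adj G x ∩ P} λ v t → let (a , b) = ∧-T {P v} t in ∧-intro b a) p
      conv : (∃ λ i → T ((P ∖ adj G x) i) × All (λ y → ¬ Adj G y i) L) → ∃ λ i → T (P i) × All (λ y → ¬ Adj G y i) (x ∷ L)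
      conv (i , t , f) = let (a , b) = ∧-T {P i} t in i , a , not-T b ∷ f

  module _ (m : ℕ) (n≡ : n ≡ 1 + (m + m)) (deg : ∀ v → m ≤ # (adj G v)) (m-large : 10000000000 ≤ m) (hc : HamiltonConnected G)
           (I : V → Bool) (independent : ∀ {x y} → T (I x) → T (I y) → ¬ Adj G x y) (I-big : m ≤ # I + 601) where

    private
      J = ∁ I

    abstract
      |J| : # J ≤ m + 602
      |J| = lin (m ∷ # I ∷ # J ∷ []) ((x₁ :+ x₂ ≲ con 1 :+ (x₀ :+ x₀)) ∷ (x₀ ≲ x₁ :+ con 601) ∷ []) (x₂ ≲ x₀ :+ con 602)
        (≤-reflexive (trans (#-∁ I) n≡)) I-big

      -- By independence all neighbours of x, at least m, lie in J, which has at most m + 602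
      -- elements.
      J-miss : ∀ {x} → T (I x) → # (J ∖ adj G x) ≤ 602
      J-miss {x} ix = lin (m ∷ # J ∷ # (J ∩ adj G x) ∷ # (J ∖ adj G x) ∷ # (adj G x) ∷ [])
        ((x₁ ≲ x₀ :+ con 602) ∷ (x₂ :+ x₃ ≲ x₁) ∷ (x₀ ≲ x₄) ∷ (x₄ ≲ x₂) ∷ []) (x₃ ≲ con 602)
        |J| (≤-reflexive (sym (#-split J (adj G x)))) (deg x)
        (#-mono {p = adj G x} {q = J ∩ adj G x} λ y a → ∧-intro (not-intro λ iy → independent ix iy a) a)

      -- Since 603 · 1000000 is less than |I|, 603 such vertices would leave some vertex of I
      -- adjacent to none of them, although it misses at most 602 vertices of J.
      light-list : ∀ L → Unique L → All (λ x → T (J x) × # (adj G x ∩ I) ≤ 1000000) L → length L ≤ 603 → length L ≤ 602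
      light-list L uL ok len = go (unreached I L 1000000 603 (All.map proj₂ ok) len
          (lin (m ∷ # I ∷ []) ((con 10000000000 ≲ x₀) ∷ (x₀ ≲ x₁ :+ con 601) ∷ []) (con 603000001 ≲ x₁) m-large I-big))
        where
        go : (∃ λ i → T (I i) × All (λ x → ¬ Adj G x i) L) → length L ≤ 602
        go (i , ti , far) = ≤-trans (length-≤-# {p = J ∖ adj G i} uL
          (All.zipWith (λ ((j , _) , ¬a) → ∧-intro j (not-intro λ a → ¬a (Adj-sym a))) (ok , far))) (J-miss ti)

    -- The sides have m + 1 + s and m - s vertices. The summand s in `A-rich` and `A-few` is a
    -- reserve for s moves: each costs a vertex at most one neighbour in B and adds at most one
    -- vertex outside the core to the other side.
    record Balanced (B : V → Bool) (s : ℕ) : Set where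
      field
        B⊑J    : B ⊑ J
        size   : # B ≡ m + 1 + s
        B-rich : ∀ {x} → T (B x) → 1000000 ≤ # (adj G x ∩ I)
        A-rich : ∀ {x} → ¬ T (B x) → s + 500000 ≤ # (adj G x ∩ B)
        A-few  : # (∁ B ∖ I) + s ≤ 1300
        s≤     : s ≤ 602

    abstract
      bipartite : ∀ B → B ⊑ J → (∀ {x} → T (B x) → 1000000 ≤ # (adj G x ∩ I)) → (∀ {x} → ¬ T (B x) → 500000 ≤ # (adj G x ∩ B)) →
                  # (∁ B ∖ I) ≤ 1300 → Bip I (∁ B) B
      bipartite B B⊑J rich rich′ few = record
        { I⊑A      = λ x i → not-intro λ b → not-T (B⊑J x b) i
        ; cover    = λ x → side (B x) refl
        ; disjoint = λ a b → not-T a b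
        ; I-miss   = λ {x} i → ≤-trans (∖-mono B (adj G x) B⊑J) (J-miss i)
        ; B-rich   = rich
        ; A-rich   = λ a → rich′ (not-T a)
        ; A∖I-few  = few }
        where
        side : ∀ {x} b → B x ≡ b → T (∁ B x) ⊎ T (B x)
        side true  e = inj₂ (subst T (sym e) tt)
        side false e = inj₁ (subst (T ∘ not) (sym e) tt)

      two-in : ∀ (P : V → Bool) → 2 ≤ # P → ∃ λ s → ∃ λ s′ → T (P s) × T (P s′) × HamPathIn Full [] s s′
      two-in P h = go (pick P [] (≤-trans (le 1 2) h))
        where
        go : (∃ λ s → T (P s) × s ∉ []) → ∃ λ s → ∃ λ s′ → T (P s) × T (P s′) × HamPathIn Full [] s s′
        go (s , ts , _) = go′ (pick P (s ∷ []) h)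
          where
          go′ : (∃ λ s′ → T (P s′) × s′ ∉ s ∷ []) → ∃ λ s → ∃ λ s′ → T (P s) × T (P s′) × HamPathIn Full [] s s′
          go′ (s′ , ts′ , s′∉) = s , s′ , ts , ts′ , ham-path-in hc λ e → s′∉ (here (sym e))

      generated-±1 : ∀ {Big Small} → Sided Big Small → 2 ≤ # Small → # Big ≡ # Small + 1 → HamiltonGenerated G
      generated-±1 {Big} {Small} sd h size = go (two-in Small h)
        where
        go : (∃ λ s → ∃ λ s′ → T (Small s) × T (Small s′) × HamPathIn Full [] s s′) → HamiltonGenerated G
        go (s , s′ , ts , ts′ , path) = generated-by-one sd size (two-edges sd path ts ts′ size)

      some : ∀ (P : V → Bool) → 10000 ≤ # P → ∀ D → length D ≤ 5000 → ∃ λ r → T (P r) × r ∉ D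
      some P h D |D| = pick P D (lin (length D ∷ # P ∷ []) ((con 10000 ≲ x₁) ∷ (x₀ ≲ con 5000) ∷ []) (con 1 :+ x₀ ≲ x₁) h |D|)

      I-huge : 10000 ≤ # I
      I-huge = lin (m ∷ # I ∷ []) ((con 10000000000 ≲ x₀) ∷ (x₀ ≲ x₁ :+ con 601) ∷ []) (con 10000 ≲ x₁) m-large I-big

      -- An unmatched b adjacent to no matched vertex can be joined to any neighbour in B, which is
      -- then unmatched too. At most 2420 matched vertices with at most 600000 neighbours each
      -- exclude 1452000000 candidates, the largest demand made on m.
      greedy-matching : ∀ B → m ≤ # B → (∀ {x} → T (B x) → # (adj G x ∩ B) ≤ 600000) → (∀ {x} → T (B x) → ∃ λ y → T (B y) × Adj G x y) →
                        ∀ k → k ≤ 1210 → ∃ λ es → length es ≡ k × Inside B es × Unique (ends es)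
      greedy-matching B big light nbr zero    _  = [] , refl , [] , []
      greedy-matching B big light nbr (suc k) k≤ = extend (greedy-matching B big light nbr k (≤-trans (n≤1+n k) k≤))
        where
        Goal : Set
        Goal = ∃ λ es → length es ≡ suc k × Inside B es × Unique (ends es)
        extend : (∃ λ es → length es ≡ k × Inside B es × Unique (ends es)) → Goal
        extend (es , len , ins , uq) = found (unreached P (ends es) 600000 2420 lights |ends| room)
          where
          P : V → Bool
          P = B ∖ ⟨ ends es ⟩
          |ends| : length (ends es) ≤ 2420
          |ends| = ≤-trans (≤-reflexive (length-ends es)) (lin (length es ∷ k ∷ []) ((x₀ ≲ x₁) ∷ (x₀ ≲ x₁) ∷ (con 1 :+ x₁ ≲ con 1210) ∷ (con 1 :+ x₁ ≲ con 1210) ∷ [])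
            (2 :* x₀ ≲ con 2420) (≤-reflexive len) (≤-reflexive len) k≤ k≤)
          room : 1452000000 < # P
          room = lin (m ∷ # B ∷ # P ∷ # (⟨_⟩ {n} (ends es)) ∷ length (ends es) ∷ [])
            ((con 10000000000 ≲ x₀) ∷ (x₀ ≲ x₁) ∷ (x₁ ≲ x₂ :+ x₃) ∷ (x₃ ≲ x₄) ∷ (x₄ ≲ con 2420) ∷ []) (con 1452000001 ≲ x₂)
            m-large big (#-subadd B P ⟨ ends es ⟩ used) (#-⟨⟩≤ (ends es)) |ends|
            where
            used : ∀ x → T (B x) → T (P x) ⊎ T (⟨ ends es ⟩ x)
            used x t with x ∈? ends es
            ... | yes _ = inj₂ tt
            ... | no _  = inj₁ (∧-intro t tt)
          in-B : ∀ es → Inside B es → All (λ x → T (B x)) (ends es)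
          in-B []       []                  = []
          in-B (_ ∷ es) ((_ , a , b) ∷ i) = a ∷ b ∷ in-B es i
          lights : All (λ x → # (adj G x ∩ P) ≤ 600000) (ends es)
          lights = All.map (λ {x} b → ≤-trans (#-mono {p = adj G x ∩ P} {q = adj G x ∩ B}
            (λ v t → let (a , c) = ∧-T {adj G x v} t in ∧-intro a (proj₁ (∧-T {B v} c)))) (light b)) (in-B es ins)
          found : (∃ λ b → T (P b) × All (λ x → ¬ Adj G x b) (ends es)) → Goal
          found (b , tb , far) = finish (nbr bb)
            where
            bb : T (B b)
            bb = proj₁ (∧-T {B b} tb)
            finish : (∃ λ c → T (B c) × Adj G b c) → Goal
            finish (c , bc , a) = (b , c) ∷ es , cong suc len , (a , bb , bc) ∷ ins ,
              (Adj-irr a ∷ Allₚ.¬Any⇒All¬ (ends es) (λ i → not-T (proj₂ (∧-T {B b} tb)) (∈⟨⟩ i)))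
              ∷ Allₚ.¬Any⇒All¬ (ends es) (λ i → All.lookup far i (Adj-sym a)) ∷ uq

    module _ {B : V → Bool} {s : ℕ} (bal : Balanced B s) where

      open Balanced bal

      private abstract
        bip : Bip I (∁ B) B
        bip = bipartite B B⊑J B-rich (λ a → ≤-trans (m≤n+m 500000 s) (A-rich a)) (≤-trans (m≤m+n _ s) A-few)

        |A| : # (∁ B) + s ≡ m
        |A| = +-cancelˡ-≡ (m + 1) _ _ (trans (trans (cong (m + 1 +_) (+-comm (# (∁ B)) s)) (trans (sym (+-assoc (m + 1) s (# (∁ B))))
          (trans (cong (_+ # (∁ B)) (sym size)) (trans (#-∁ B) n≡)))) (trans (sym (+-assoc 1 m m)) (cong (_+ m) (+-comm 1 m))))

        m≤B : m ≤ # B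
        m≤B = lin (m ∷ s ∷ # B ∷ []) ((x₀ :+ con 1 :+ x₁ ≲ x₂) ∷ []) (x₀ ≲ x₂) (≤-reflexive (sym size))

        sided : Sided B (∁ B)
        sided = sided-B bip (some B (≤-trans (≤-trans (le 10000 10000000000) m-large) m≤B))

        imbalance : # B ≡ # (∁ B) + (1 + (s + s))
        imbalance = trans size (trans (cong (λ k → k + 1 + s) (sym |A|)) (trans (cong (_+ s) (+-assoc (# (∁ B)) s 1))
          (trans (+-assoc (# (∁ B)) (s + 1) s) (cong (# (∁ B) +_) (cong (_+ s) (+-comm s 1))))))

      abstract
        balanced-one : s ≡ 0 → HamiltonGenerated G
        balanced-one refl = generated-±1 sided
          (≤-trans (≤-trans (le 2 10000000000) m-large) (≤-reflexive (trans (sym |A|) (+-identityʳ _)))) imbalance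

        -- Only m - s vertices lie outside B, so a vertex of degree m has a neighbour inside B. The
        -- 2 + 2s edges taken are one more than the difference of the sides.
        light-generated : 1 ≤ s → (∀ {x} → T (B x) → # (adj G x ∩ B) ≤ 600000) → HamiltonGenerated G
        light-generated 1≤s light = use (greedy-matching B m≤B light nbr (2 + (s + s))
            (lin (s ∷ []) ((x₀ ≲ con 602) ∷ (x₀ ≲ con 602) ∷ []) (con 2 :+ (x₀ :+ x₀) ≲ con 1210) s≤ s≤))
          where
          nbr : ∀ {x} → T (B x) → ∃ λ y → T (B y) × Adj G x y
          nbr {x} _ = conv (#-find {p = adj G x ∩ B} (lin (m ∷ s ∷ # (∁ B) ∷ # (adj G x) ∷ # (adj G x ∩ B) ∷ # (adj G x ∖ B) ∷ [])
              ((x₀ ≲ x₃) ∷ (x₃ ≲ x₄ :+ x₅) ∷ (x₅ ≲ x₂) ∷ (x₂ :+ x₁ ≲ x₀) ∷ (con 1 ≲ x₁) ∷ []) (con 1 ≲ x₄)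
              (deg x) (≤-reflexive (#-split (adj G x) B)) (#-mono {p = adj G x ∖ B} {q = ∁ B} λ y t → proj₂ (∧-T {adj G x y} t)) (≤-reflexive |A|) 1≤s))
            where
            conv : (∃ λ y → T ((adj G x ∩ B) y)) → ∃ λ y → T (B y) × Adj G x y
            conv (y , t) = let (a , b) = ∧-T {adj G x y} t in y , b , a
          use : (∃ λ es → length es ≡ 2 + (s + s) × Inside B es × Unique (ends es)) → HamiltonGenerated G
          use ((x₁ , y₁) ∷ (x₂ , y₂) ∷ N , len , ins , uq) = generated-by-matching sided (1 + (s + s)) imbalance
              (lin (s ∷ []) ((x₀ ≲ con 602) ∷ (x₀ ≲ con 602) ∷ []) (con 1 :+ (x₀ :+ x₀) ≲ con 1250) s≤ s≤)
              x₁ y₁ x₂ y₂ N s |N| (trans (+-comm 1 (s + s)) (cong (_+ 1) (sym |N|))) ins uq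
            where
            |N| : length N ≡ s + s
            |N| = +-cancelˡ-≡ 2 (length N) (s + s) len

    abstract
      move : ∀ {B s} → Balanced B (suc s) → ∀ {b} → T (B b) → 600000 ≤ # (adj G b ∩ B) → Balanced (B ∖ ⟨ b ∷ [] ⟩) s
      move {B} {s} bal {b} tb h = record
        { B⊑J    = λ x t → B⊑J x (old t)
        ; size   = +-cancelˡ-≡ 1 _ _ (trans (cong (_+ # B′) (sym one)) (trans (sym (#-split B ⟨ b ∷ [] ⟩)) (trans size (+-suc (m + 1) s))))
        ; B-rich = λ t → B-rich (old t)
        ; A-rich = λ {x} f → rich x f (x ≟ b)
        ; A-few  = lin (# (∁ B ∖ I) ∷ # (∁ B′ ∖ I) ∷ s ∷ []) ((x₀ :+ (con 1 :+ x₂) ≲ con 1300) ∷ (x₁ ≲ x₀ :+ con 1 ) ∷ [])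
            (x₁ :+ x₂ ≲ con 1300) A-few few
        ; s≤     = ≤-trans (n≤1+n s) s≤ }
        where
        open Balanced bal
        B′ : V → Bool
        B′ = B ∖ ⟨ b ∷ [] ⟩
        old : ∀ {x} → T (B′ x) → T (B x)
        old {x} t = proj₁ (∧-T {B x} t)
        one : # (B ∩ ⟨ b ∷ [] ⟩) ≡ 1
        one = ≤-antisym (#-single B b) (#-pos (B ∩ ⟨ b ∷ [] ⟩) (∧-intro tb (∈⟨⟩ {xs = b ∷ []} (here refl))))
        lose : ∀ x → # (adj G x ∩ B) ≤ # (adj G x ∩ B′) + 1
        lose x = ≤-trans (#-subadd (adj G x ∩ B) (adj G x ∩ B′) ⟨ b ∷ [] ⟩ split) (+-monoʳ-≤ (# (adj G x ∩ B′)) (#-⟨⟩≤ (b ∷ [])))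
          where
          split : ∀ y → T ((adj G x ∩ B) y) → T ((adj G x ∩ B′) y) ⊎ T (⟨ b ∷ [] ⟩ y)
          split y t with ∧-T {adj G x y} t | y ∈? (b ∷ [])
          ... | _ , _ | yes i = inj₂ tt
          ... | a , c | no ¬i = inj₁ (∧-intro a (∧-intro c tt))
        few : # (∁ B′ ∖ I) ≤ # (∁ B ∖ I) + 1
        few = ≤-trans (#-subadd (∁ B′ ∖ I) (∁ B ∖ I) ⟨ b ∷ [] ⟩ split) (+-monoʳ-≤ (# (∁ B ∖ I)) (#-⟨⟩≤ (b ∷ [])))
          where
          split : ∀ y → T ((∁ B′ ∖ I) y) → T ((∁ B ∖ I) y) ⊎ T (⟨ b ∷ [] ⟩ y)
          split y t with ∧-T {∁ B′ y} t | y ∈? (b ∷ [])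
          ... | _ , _ | yes i = inj₂ tt
          ... | a , c | no ¬i = inj₁ (∧-intro (not-intro λ by → not-T a (∧-intro by (not-intro (λ i → ¬i (⟨⟩∈ {xs = b ∷ []} i))))) c)
        rich : ∀ x → ¬ T (B′ x) → Dec (x ≡ b) → s + 500000 ≤ # (adj G x ∩ B′)
        rich x f (yes refl) = lin (s ∷ # (adj G x ∩ B) ∷ # (adj G x ∩ B′) ∷ [])
          ((con 600000 ≲ x₁) ∷ (x₁ ≲ x₂ :+ con 1) ∷ (con 1 :+ x₀ ≲ con 602) ∷ []) (x₀ :+ con 500000 ≲ x₂) h (lose x) s≤
        rich x f (no x≢b) = lin (s ∷ # (adj G x ∩ B) ∷ # (adj G x ∩ B′) ∷ [])
          ((con 1 :+ x₀ :+ con 500000 ≲ x₁) ∷ (x₁ ≲ x₂ :+ con 1) ∷ []) (x₀ :+ con 500000 ≲ x₂)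
          (A-rich λ bx → f (∧-intro bx (not-intro λ i → only (⟨⟩∈ {xs = b ∷ []} i)))) (lose x)
          where
          only : x ∈ b ∷ [] → ⊥
          only (here e) = x≢b e

      balanced-generated : ∀ s {B} → Balanced B s → HamiltonGenerated G
      balanced-generated zero        bal = balanced-one bal refl
      balanced-generated (suc s) {B} bal = go (find? (B ∩ heavy 600000 B))
        where
        go : (∃ λ x → T ((B ∩ heavy 600000 B) x)) ⊎ (∀ x → ¬ T ((B ∩ heavy 600000 B) x)) → HamiltonGenerated G
        go (inj₁ (b , t)) = let (tb , h) = ∧-T {B b} t in balanced-generated s (move bal tb (heavy-≥ 600000 B h))
        go (inj₂ none)    = light-generated bal (s≤s z≤n) λ {x} tb → light-≤ 600000 B λ h → none x (∧-intro tb h)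

    private
      -- A low vertex lies outside I but sees little of it. It goes to the side of I, so that every
      -- vertex of `B₀` is rich in core neighbours.
      B₀ low : V → Bool
      B₀  = J ∩ heavy 1000000 I
      low = J ∖ heavy 1000000 I

    abstract
      low-light : ∀ {x} → T (low x) → T (J x) × # (adj G x ∩ I) ≤ 1000000
      low-light {x} t = let (j , l) = ∧-T {J x} t in j , light-≤ 1000000 I (not-T l)

      low-few : # low ≤ 602
      low-few = go (# low ≤? 602)
        where
        L : List V
        L = take 603 (elements low)
        go : Dec (# low ≤ 602) → # low ≤ 602
        go (yes h) = h
        go (no ¬h) = contradiction (≤-trans (≤-reflexive (sym |L|)) (light-list L (Uniq.take⁺ 603 (elements-unique low))
            (Allₚ.take⁺ 603 (All.tabulate λ i → low-light (elements-∈ {p = low} i))) (≤-reflexive |L|))) (<⇒≱ (le 603 603))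
          where
          |L| : length L ≡ 603
          |L| = trans (length-take 603 (elements low)) (m≤n⇒m⊓n≡m (≤-trans (≰⇒> ¬h) (≤-reflexive (sym (#-elements low)))))

      outside-B₀ : ∀ {x} → ¬ T (B₀ x) → # (adj G x ∩ I) ≤ 1000000
      outside-B₀ {x} f = go (I x) refl
        where
        go : ∀ b → I x ≡ b → # (adj G x ∩ I) ≤ 1000000
        go true  e = ≤-trans (#-empty (adj G x ∩ I) (λ y t → let (a , i) = ∧-T {adj G x y} t in independent (subst T (sym e) tt) i a)) z≤n
        go false e = light-≤ 1000000 I λ h → f (∧-intro (subst (T ∘ not) (sym e) tt) h)

      B₀-degree : ∀ x → m ≤ # (adj G x ∩ I) + # (adj G x ∩ B₀) + # low
      B₀-degree x = ≤-trans (deg x) (≤-trans (#-subadd (adj G x) ((adj G x ∩ I) ∪ (adj G x ∩ B₀)) low split)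
          (+-monoˡ-≤ (# low) (#-subadd _ (adj G x ∩ I) (adj G x ∩ B₀) (λ y t → ∨-T t))))
        where
        split : ∀ y → T (adj G x y) → T (((adj G x ∩ I) ∪ (adj G x ∩ B₀)) y) ⊎ T (low y)
        split y a with adj G x y | I y | heavy 1000000 I y
        split y a | true | true  | _     = inj₁ tt
        split y a | true | false | true  = inj₁ tt
        split y a | true | false | false = inj₂ tt

      B₀-rich : ∀ {x} → ¬ T (B₀ x) → 600000 ≤ # (adj G x ∩ B₀)
      B₀-rich {x} f = lin (m ∷ # (adj G x ∩ I) ∷ # (adj G x ∩ B₀) ∷ # low ∷ [])
        ((con 10000000000 ≲ x₀) ∷ (x₀ ≲ x₁ :+ x₂ :+ x₃) ∷ (x₁ ≲ con 1000000) ∷ (x₃ ≲ con 602) ∷ []) (con 600000 ≲ x₂)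
        m-large (B₀-degree x) (outside-B₀ f) low-few

      A₀-few : # (∁ B₀ ∖ I) ≤ 602
      A₀-few = ≤-trans (#-mono {p = ∁ B₀ ∖ I} {q = low} sub) low-few
        where
        sub : (∁ B₀ ∖ I) ⊑ low
        sub x t with I x | heavy 1000000 I x
        ... | false | false = tt

      -- Few vertices of I see a low vertex, and any other vertex of I has all its neighbours in B₀.
      m≤B₀ : m ≤ # B₀
      m≤B₀ = go (unreached I (elements low) 1000000 602 (All.tabulate λ i → proj₂ (low-light (elements-∈ {p = low} i)))
          (≤-trans (≤-reflexive (#-elements low)) low-few)
          (lin (m ∷ # I ∷ []) ((con 10000000000 ≲ x₀) ∷ (x₀ ≲ x₁ :+ con 601) ∷ []) (con 602000001 ≲ x₁) m-large I-big))
        where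
        go : (∃ λ i → T (I i) × All (λ x → ¬ Adj G x i) (elements low)) → m ≤ # B₀
        go (i , ti , far) = ≤-trans (deg i) (#-mono {p = adj G i} {q = B₀} λ y a → ∧-intro (J-of y a) (high y a (T? (heavy 1000000 I y))))
          where
          J-of : ∀ y → Adj G i y → T (J y)
          J-of y a = not-intro λ iy → independent ti iy a
          high : ∀ y → Adj G i y → Dec (T (heavy 1000000 I y)) → T (heavy 1000000 I y)
          high y a (yes h) = h
          high y a (no ¬h) = contradiction (Adj-sym a) (All.lookup far (∈-elements {p = low} (∧-intro (J-of y a) (not-intro ¬h))))

      independent-generated : HamiltonGenerated G
      independent-generated = go (# B₀ ∸ m) (sym (m+[n∸m]≡n m≤B₀))
        where
        B₀⊑J : B₀ ⊑ J
        B₀⊑J x t = proj₁ (∧-T {J x} t)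
        high : ∀ {x} → T (B₀ x) → 1000000 ≤ # (adj G x ∩ I)
        high {x} t = heavy-≥ 1000000 I (proj₂ (∧-T {J x} t))
        go : ∀ s → # B₀ ≡ m + s → HamiltonGenerated G
        -- If `B₀` has only m vertices, its complement with m + 1 is the larger side.
        go zero e = generated-±1 (sided-A (bipartite B₀ B₀⊑J high (λ f → ≤-trans (le 500000 600000) (B₀-rich f)) (≤-trans A₀-few (le 602 1300)))
            (some I I-huge)) (≤-trans (≤-trans (le 2 10000000000) m-large) m≤B₀)
            (+-cancelˡ-≡ m _ _ (trans (cong (_+ # (∁ B₀)) (sym e′)) (trans (trans (#-∁ B₀) n≡) (trans (+-comm 1 (m + m)) (trans (+-assoc m m 1)
              (cong (λ k → m + (k + 1)) (sym e′)))))))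
          where
          e′ : # B₀ ≡ m
          e′ = trans e (+-identityʳ m)
        go (suc s) e = balanced-generated s record
          { B⊑J = B₀⊑J ; size = trans e (sym (+-assoc m 1 s)) ; B-rich = high
          ; A-rich = λ {x} f → lin (s ∷ # (adj G x ∩ B₀) ∷ []) ((con 600000 ≲ x₁) ∷ (x₀ ≲ con 602) ∷ []) (x₀ :+ con 500000 ≲ x₁) (B₀-rich f) s≤
          ; A-few = lin (s ∷ # (∁ B₀ ∖ I) ∷ []) ((x₁ ≲ con 602) ∷ (x₀ ≲ con 602) ∷ []) (x₁ :+ x₀ ≲ con 1300) A₀-few s≤
          ; s≤ = s≤ }
          where
          s≤ : s ≤ 602
          s≤ = lin (m ∷ s ∷ # B₀ ∷ # J ∷ []) ((x₀ :+ (con 1 :+ x₁) ≲ x₂) ∷ (x₂ ≲ x₃) ∷ (x₃ ≲ x₀ :+ con 602) ∷ []) (x₁ ≲ con 602)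
            (≤-reflexive (sym e)) (#-mono {p = B₀} {q = J} B₀⊑J) |J|

-- The case distinction and the theorem.

module Trichotomy {n : ℕ} (G : Graph n) (3≤n : 3 ≤ n) where

  open Denseness G
  open Balancing G 3≤n

  private
    V = Fin n

  Apart : (V → Bool) → (V → Bool) → Set
  Apart X Y = ∀ {x y} → T (X x) → T (Y y) → ¬ Adj G x y

  FarPair : ℕ → (V → Bool) → (V → Bool) → Set
  FarPair d X Y = d ≤ # X × d ≤ # Y × Apart X Y

  abstract
    edge? : ∀ X Y → (∃ λ x → ∃ λ y → T (X x) × T (Y y) × Adj G x y) ⊎ Apart X Y
    edge? X Y = go (find? (X ∩ heavy 1 Y))
      where
      go : (∃ λ x → T ((X ∩ heavy 1 Y) x)) ⊎ (∀ x → ¬ T ((X ∩ heavy 1 Y) x)) → (∃ λ x → ∃ λ y → T (X x) × T (Y y) × Adj G x y) ⊎ Apart X Y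
      go (inj₁ (x , t)) = let (tx , h) = ∧-T {X x} t
                              (y , s) = #-find {p = adj G x ∩ Y} (heavy-≥ 1 Y h)
                              (a , ty) = ∧-T {adj G x y} s in inj₁ (x , y , tx , ty , a)
      go (inj₂ none)    = inj₂ λ {x} {y} tx ty a → none x (∧-intro tx (≤⇒≤ᵇ (#-pos (adj G x ∩ Y) {y} (∧-intro a ty))))

    far-pair? : ∀ d X Y → Dec (FarPair d X Y)
    far-pair? d X Y with d ≤? # X | d ≤? # Y | edge? X Y
    ... | no ¬h | _ | _ = no λ (h , _) → ¬h h
    ... | yes _ | no ¬h | _ = no λ (_ , h , _) → ¬h h
    ... | yes _ | yes _ | inj₁ (x , y , tx , ty , a) = no λ (_ , _ , apart) → apart tx ty a
    ... | yes h | yes k | inj₂ apart = yes (h , k , apart)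

    far-pair-cong : ∀ {d X X′ Y Y′} → (∀ x → X x ≡ X′ x) → (∀ x → Y x ≡ Y′ x) → FarPair d X Y → FarPair d X′ Y′
    far-pair-cong {d} {X} {X′} {Y} {Y′} e f (h , k , apart) =
      ≤-trans h (#-mono {p = X} {q = X′} (λ x → subst T (e x))) , ≤-trans k (#-mono {p = Y} {q = Y′} (λ x → subst T (f x))) ,
      λ {x} {y} tx ty → apart (subst T (sym (e x)) tx) (subst T (sym (f y)) ty)

    far-pairs? : ∀ d → Dec (∃ λ X → ∃ λ Y → FarPair d X Y)
    far-pairs? d = anySub (λ X → anySub (far-pair? d X) (far-pair-cong {X = X} (λ _ → refl)))
      λ {X} {X′} e (Y , h) → Y , far-pair-cong {Y = Y} e (λ _ → refl) h

  module _ (m d : ℕ) (m≡ : m ≡ d + 300) (n≡ : n ≡ 1 + (m + m)) (deg : ∀ v → m ≤ # (adj G v)) (m-large : 10000000000 ≤ m)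
           (hc : HamiltonConnected G) where

    private abstract
      expanding : ¬ (∃ λ X → ∃ λ Y → FarPair d X Y) → HamiltonGenerated G
      expanding none = Expanding.expanding-generated G m d n≡ deg (≤-reflexive (sym m≡)) dense hc
        where
        link : ∀ {X Y} → d ≤ # X → d ≤ # Y → (∃ λ x → ∃ λ y → T (X x) × T (Y y) × Adj G x y) ⊎ Apart X Y → ∃ λ x → ∃ λ y → T (X x) × T (Y y) × Adj G x y
        link h k (inj₁ e)             = e
        link {X} {Y} h k (inj₂ apart) = ⊥-elim (none (X , Y , h , k , apart))
        dense : Dense Full d 200
        dense = record { edge = λ p q _ _ h k → link h k (edge? p q)
                       ; deg = λ {x} _ → ≤-trans (lin (d ∷ m ∷ []) ((x₀ :+ con 300 ≲ x₁) ∷ []) (x₀ :+ con 200 ≲ x₁) (≤-reflexive (sym m≡)))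
                           (≤-trans (deg x) (#-mono {p = adj G x} {q = adj G x ∩ Full} (λ y a → ∧-intro a tt))) }

      -- A common vertex v of X and Y has no neighbour in X ∪ Y, so X ∪ Y is small and X ∩ Y is large.
      meeting : ∀ {X Y v} → FarPair d X Y → T ((X ∩ Y) v) → HamiltonGenerated G
      meeting {X} {Y} {v} (h , k , apart) tv = independent-generated m n≡ deg m-large hc (X ∩ Y)
          (λ {x} {y} tx ty → apart (proj₁ (∧-T {X x} tx)) (proj₂ (∧-T {X y} ty)))
          (lin (m ∷ d ∷ # X ∷ # Y ∷ # (X ∪ Y) ∷ # (X ∩ Y) ∷ # (adj G v) ∷ [])
            ((x₀ ≲ x₁ :+ con 300) ∷ (x₀ ≲ x₁ :+ con 300) ∷ (x₁ ≲ x₂) ∷ (x₁ ≲ x₃) ∷ (x₂ :+ x₃ ≲ x₄ :+ x₅) ∷ (x₄ :+ x₆ ≲ con 1 :+ (x₀ :+ x₀)) ∷ (x₀ ≲ x₆) ∷ [])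
            (x₀ ≲ x₅ :+ con 601)
            (≤-reflexive m≡) (≤-reflexive m≡) h k (≤-reflexive (sym (#-∪ X Y)))
            (≤-trans (#-disjoint Full (X ∪ Y) (adj G v) (λ _ _ → tt) (λ _ _ → tt) (λ x t → clash x (∨-T t))) (≤-reflexive (trans #-Full n≡))) (deg v))
        where
        clash : ∀ x → T (X x) ⊎ T (Y x) → Adj G v x → ⊥
        clash x (inj₁ tx) a = apart tx (proj₂ (∧-T {X v} tv)) (Adj-sym a)
        clash x (inj₂ ty) a = apart (proj₁ (∧-T {X v} tv)) ty a

      separated : ∀ {X Y} → FarPair d X Y → (∀ x → ¬ T ((X ∩ Y) x)) → HamiltonGenerated G
      separated {X} {Y} (h , k , apart) disj = SeparatedCase.separated-generated G m n≡ deg (≤-trans (le 10000 10000000000) m-large) hc X Y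
          (λ {x} tx ty → disj x (∧-intro tx ty)) apart (big h) (big k)
        where
        big : ∀ {c} → d ≤ c → m ≤ c + 300
        big {c} h = lin (m ∷ d ∷ c ∷ []) ((x₀ ≲ x₁ :+ con 300) ∷ (x₁ ≲ x₂) ∷ []) (x₀ ≲ x₂ :+ con 300) (≤-reflexive m≡) h

    abstract
      hamilton-generated : HamiltonGenerated G
      hamilton-generated = go (far-pairs? d)
        where
        go : Dec (∃ λ X → ∃ λ Y → FarPair d X Y) → HamiltonGenerated G
        go (no none)              = expanding none
        go (yes (X , Y , far)) = [ (λ (v , tv) → meeting {v = v} far tv) , separated far ]′ (find? (X ∩ Y))

theorem1p5 : Σ ℕ λ n₀ → 1 ≤ n₀ ×
    (∀ (n : ℕ) → n₀ < n → n % 2 ≡ 1 → (G : Graph n) →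
    MinDegreeAtLeastHalf G → HamiltonConnected G → HamiltonGenerated G)
-- For odd n beyond this value, m = (n - 1)/2 is at least 10000000000, a round number above what the
-- greedy matching demands. The sets to be joined have size m - 300.
theorem1p5 = 20000000001 , s≤s z≤n , λ n n₀<n odd G δ hc → main n n₀<n odd G δ hc
  where
  main : ∀ n → 20000000001 < n → n % 2 ≡ 1 → (G : Graph n) → MinDegreeAtLeastHalf G → HamiltonConnected G → HamiltonGenerated G
  main n n₀<n odd G δ hc = Trichotomy.hamilton-generated G (≤-trans (le 3 20000000002) n₀<n) m (m ∸ 300)
      (sym (m∸n+n≡m (≤-trans (le 300 10000000000) m-large))) n≡ deg m-large hc
    where
    m : ℕ
    m = n / 2
    double : 2 * m ≡ m + m
    double = cong (m +_) (+-identityʳ m)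
    n≡ : n ≡ 1 + (m + m)
    n≡ = trans (m≡m%n+[m/n]*n n 2) (cong₂ _+_ odd (trans (*-comm m 2) double))
    deg : ∀ v → m ≤ # (adj G v)
    deg v = *-cancelˡ-≤ 2 (≤-trans (≤-reflexive (trans double (cong pred (sym n≡)))) (≤-trans (δ v) (≤-reflexive (cong (2 *_) (#-elements (adj G v))))))
    m-large : 10000000000 ≤ m
    m-large = ≮⇒≥ λ m< → <⇒≱ (le 1 1) (lin (m ∷ n ∷ [])
      ((con 1 :+ x₀ ≲ con 10000000000) ∷ (con 1 :+ x₀ ≲ con 10000000000) ∷ (con 20000000002 ≲ x₁) ∷ (x₁ ≲ con 1 :+ (x₀ :+ x₀)) ∷ []) (con 1 ≲ con 0)
      m< m< n₀<n (≤-reflexive n≡))
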